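{- Let $D>1$ be a square-free integer and let $k$ be a negative integer relatively prime to $D$. Then the quartic equation $$X^2 - D Y^4 = k$$ has at most $$384 \cdot 2^{\omega(k)}\, \epsilon_{D}^{3/2} \sqrt{|k|/(2D)}$$ solutions in positive integers $X$ and $Y$.
   Context: For a positive non-square integer $D$, $\epsilon_D = T + U\sqrt{D}$ (with $T,U$ positive integers) denotes the minimal unit greater than $1$ in the ring $\mathbb{Z}[\sqrt{D}]$. For a nonzero integer $k$, $\omega(k)$ denotes the number of distinct prime factors of $k$. -}

module Defs where

open import Data.Nat as ℕ using (ℕ; zero; suc)
open import Data.Nat.Divisibility using (_∣_; _∣?_)
open import Data.Nat.Primality using (Prime; prime?)
open import Data.Integer as ℤ using (ℤ; +_; ∣_∣)
open import Data.List using (List; length; filter; upTo)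
open import Data.Product using (_×_; _,_)
open import Data.Sum using (_⊎_)
open import Relation.Binary.PropositionalEquality using (_≡_)
open import Relation.Nullary.Decidable using (_×-dec_)

SquareFree : ℕ → Set
SquareFree n = ∀ (p : ℕ) → p ℕ.* p ∣ n → p ≡ 1

ω : ℕ → ℕ
ω n = length (filter (λ p → prime? p ×-dec (p ∣? n)) (upTo (suc n)))

ωℤ : ℤ → ℕ
ωℤ k = ω ∣ k ∣

-- Real inequality  x ≤ y·√D  for integers x, y and D ≥ 0,
-- written out in integer arithmetic (case analysis on signs, then squaring).
LeSqrt : ℕ → ℤ → ℤ → Set
LeSqrt D x y =
  (x ℤ.≤ + 0 × (+ 0 ℤ.≤ y ⊎ (+ D) ℤ.* (y ℤ.* y) ℤ.≤ x ℤ.* x))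
  ⊎ (+ 0 ℤ.≤ y × x ℤ.* x ℤ.≤ (+ D) ℤ.* (y ℤ.* y))

-- Real inequality  a + b√D ≤ c + d√D  for integers a b c d.
LeQD : ℕ → ℤ → ℤ → ℤ → ℤ → Set
LeQD D a b c d = LeSqrt D (a ℤ.- c) (d ℤ.- b)

IsPosUnit : ℕ → ℕ → ℕ → Set
IsPosUnit D T U =
  0 ℕ.< T × 0 ℕ.< U ×
  ((+ T) ℤ.* (+ T) ℤ.- (+ D) ℤ.* ((+ U) ℤ.* (+ U)) ≡ + 1
   ⊎ (+ T) ℤ.* (+ T) ℤ.- (+ D) ℤ.* ((+ U) ℤ.* (+ U)) ≡ ℤ.- (+ 1))

-- ε_D = T + U√D is the minimal unit > 1 of ℤ[√D]
-- (for D > 1 non-square, the units > 1 are exactly those T' + U'√D with T', U' > 0).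
IsFundamentalUnit : ℕ → ℕ → ℕ → Set
IsFundamentalUnit D T U =
  IsPosUnit D T U ×
  (∀ T' U' → IsPosUnit D T' U' → LeQD D (+ T) (+ U) (+ T') (+ U'))

IsSol : ℕ → ℤ → ℕ × ℕ → Set
IsSol D k (X , Y) =
  0 ℕ.< X × 0 ℕ.< Y ×
  (+ X) ℤ.* (+ X) ℤ.- (+ D) ℤ.* ((+ Y) ℤ.^ 4) ≡ k

-- ε³ = A + B√D where ε = T + U√D.
cubeA : ℕ → ℕ → ℕ → ℕ
cubeA D T U = T ℕ.* T ℕ.* T ℕ.+ 3 ℕ.* T ℕ.* U ℕ.* U ℕ.* D

cubeB : ℕ → ℕ → ℕ → ℕ
cubeB D T U = 3 ℕ.* T ℕ.* T ℕ.* U ℕ.+ U ℕ.* U ℕ.* U ℕ.* D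

-- The bound  N ≤ 384·2^ω(k)·ε^{3/2}·√(|k|/(2D)),  with N, the bound ≥ 0,
-- is equivalent to  2D·N² ≤ C·ε³  where C = 384²·4^ω(k)·|k|,
-- i.e.  2D·N² − C·A ≤ C·B·√D  with ε³ = A + B√D.
BoundHolds : ℕ → ℤ → ℕ → ℕ → ℕ → Set
BoundHolds D k T U N =
  LeSqrt D (+ (2 ℕ.* D ℕ.* (N ℕ.* N)) ℤ.- + (C ℕ.* cubeA D T U)) (+ (C ℕ.* cubeB D T U))
  where
  C : ℕ
  C = 384 ℕ.* 384 ℕ.* (4 ℕ.^ ωℤ k) ℕ.* ∣ k ∣

{-# OPTIONS --safe #-}
module Submission where

-- Write k = −m. If two solutions have the same gcd(X, Y²) and X/Y² defines the same square root of D modulo m, then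
-- X₂ + Y₂²√D = (X₁ + Y₁²√D)·η for a unit η, and, up to one of two classes, η = (s + t√D)². Completing the square in
-- Y₂² = Y₁²(s² + Dt²) + 2X₁st gives γ = G + Q√(−m) of norm gY₁Y₂, g ∣ 2m, such that Dγ⁴ = g²(X₁ + √(−m))(X₂ ∓ √(−m)).
-- Hence γ⁴ is a nearly real multiple of X₁ + √(−m): the quartic form Φ(G, Q) = Im(γ⁴(X₁ − √(−m)))/√m is only g²Y₁⁴.
-- The Padé approximants of ((1+τ)/(1−τ))^(1/4) at τ = √(−m)/X₁ provide integers E, O with Φ(E, O) small as well, so
-- that QE − GO is small; but it is a multiple of r!/4^r and does not vanish for two consecutive r. For a suitable r
-- this is impossible once X₁ exceeds a fixed power of m and Y₂ ≥ Y₁⁴.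
-- The norm of γ also shows that the Y in one class grow at least geometrically, so a class has O(log m) members with
-- Y > 64√m. There are at most O(m^(1/4)) values of the gcd, as its square divides m, and O(2^ω(m)) square roots. The
-- total is at most 384·2^ω(m)·√m, and ε³ ≥ 2D.

open import Defs
open import Algebra.Bundles using (CommutativeRing)
open import Algebra.Solver.Ring.AlmostCommutativeRing using (fromCommutativeRing; _-Raw-AlmostCommutative⟶_)
open import Algebra.Structures using (IsCommutativeRing)
open import Data.Integer.Base as ℤ using (ℤ; +_)
import Data.Integer.Properties as ℤ
open import Data.Nat.Base using (ℕ)
open import Relation.Binary.PropositionalEquality using (_≡_)

-- The Padé denominators are kept integral by not normalising them, at the price of coefficients of
-- the size of 8^r·r!. With only 1 ≤ L for a nonzero integer L, the estimates would be lost to that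
-- factorial. This is why its divisibility is proved, by a generating function over ℤ[√(-m)] built
-- on a fourth root with integral coefficients. Smallness of Φ(E, O) is not obtained by comparison
-- with the fourth root: a first-order differential equation for Φ as a power series in w = m/X²
-- shows that its first r coefficients vanish. So no real or complex number enters. A solution with
-- least Y serves as base point of its class, since only then are the coordinates of the quotient
-- unit natural numbers. The logarithm of m in the size of a class is replaced by a multiple of q =
-- ⌊m^(1/4)⌋; this is affordable because the gcd takes at most 2q values and q² ≤ √m.

module Prelude where
  open import Data.Empty public using (⊥; ⊥-elim)
  open import Data.Integer.Base public using (+_; -_; -[1+_]) renaming (∣_∣ to abs)
  open import Data.Integer.Tactic.RingSolver public using () renaming (solve-∀ to solveℤ-∀)
  open import Data.Nat.Base public
  open import Data.Nat.Properties public
  open import Data.Nat.Tactic.RingSolver public using (solve-∀)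
  open import Data.Product.Base public using (_×_; _,_; proj₁; proj₂; ∃-syntax)
  open import Data.Sum.Base public using (_⊎_; inj₁; inj₂; [_,_]′)
  open import Relation.Binary.PropositionalEquality public
  open import Relation.Nullary public using (¬_; Dec; yes; no)

-- Powers, casts from ℕ to ℤ, and equations as vanishing differences.

module Arith where
  open Prelude

  *-^ : ∀ a b n → (a * b) ^ n ≡ a ^ n * b ^ n
  *-^ a b zero    = refl
  *-^ a b (suc n) = trans (cong (a * b *_) (*-^ a b n)) (interchange a b (a ^ n) (b ^ n))
    where
    interchange : ∀ a b c d → a * b * (c * d) ≡ a * c * (b * d)
    interchange = solve-∀

module Cast where
  open Prelude

  infixl 7 _:*_
  infixl 6 _:+_

  -- On variables, `+_` commutes with multiplication only propositionally. Reified expressions move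
  -- a whole equation between ℕ and ℤ at once, so that subtraction becomes available to the ring
  -- solver.
  data Expr : Set where
    `_        : ℕ → Expr
    _:+_ _:*_ : Expr → Expr → Expr

  ⟦_⟧ : Expr → ℕ
  ⟦ ` a ⟧    = a
  ⟦ a :+ b ⟧ = ⟦ a ⟧ + ⟦ b ⟧
  ⟦ a :* b ⟧ = ⟦ a ⟧ * ⟦ b ⟧

  ⟦_⟧ℤ : Expr → ℤ
  ⟦ ` a ⟧ℤ    = + a
  ⟦ a :+ b ⟧ℤ = ⟦ a ⟧ℤ ℤ.+ ⟦ b ⟧ℤ
  ⟦ a :* b ⟧ℤ = ⟦ a ⟧ℤ ℤ.* ⟦ b ⟧ℤ

  cast : ∀ e → + ⟦ e ⟧ ≡ ⟦ e ⟧ℤ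
  cast (` a)    = refl
  cast (a :+ b) = cong₂ ℤ._+_ (cast a) (cast b)
  cast (a :* b) = trans (ℤ.pos-* ⟦ a ⟧ ⟦ b ⟧) (cong₂ ℤ._*_ (cast a) (cast b))

  castEq : ∀ e f → ⟦ e ⟧ ≡ ⟦ f ⟧ → ⟦ e ⟧ℤ ≡ ⟦ f ⟧ℤ
  castEq e f eq = trans (sym (cast e)) (trans (cong +_ eq) (cast f))

  uncastEq : ∀ e f → ⟦ e ⟧ℤ ≡ ⟦ f ⟧ℤ → ⟦ e ⟧ ≡ ⟦ f ⟧
  uncastEq e f eq = ℤ.+-injective (trans (cast e) (trans eq (sym (cast f))))

module Differences {c ℓ} (R : CommutativeRing c ℓ) where
  open CommutativeRing R

  infixr 5 _⊹_

  -- An equality is derived from others by writing its difference as a combination of theirs.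
  vanish : ∀ a {f g} → f ≈ g → a * (f - g) ≈ 0#
  vanish a {f} {g} p = trans (*-congˡ (trans (+-congʳ p) (-‿inverseʳ g))) (zeroʳ a)

  _⊹_ : ∀ {f g} → f ≈ 0# → g ≈ 0# → f + g ≈ 0#
  p ⊹ q = trans (+-cong p q) (+-identityˡ 0#)

  fromDifference : ∀ {f g h} → f - g ≈ h → h ≈ 0# → f ≈ g
  fromDifference {f} {g} p q = trans (sym (+-identityʳ f)) (trans (+-congˡ (sym (-‿inverseˡ g)))
    (trans (sym (+-assoc f (- g) g)) (trans (+-congʳ (trans p q)) (+-identityˡ g))))

-- Formal power series over a commutative ring.

module Series {c ℓ} (R : CommutativeRing c ℓ) where
  open import Data.Nat.Base using (ℕ; zero; suc)
  open import Data.Product.Base using (_,_)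
  open CommutativeRing R
  open import Algebra.Properties.CommutativeSemigroup +-commutativeSemigroup
    using (interchange; x∙yz≈y∙xz; x∙yz≈xz∙y; xy∙z≈xz∙y)
  open import Algebra.Properties.CommutativeSemigroup *-commutativeSemigroup
    using () renaming (x∙yz≈y∙xz to x*yz≈y*xz)
  open import Algebra.Properties.Semiring.Mult semiring
    using (_×_; ×-congʳ; ×-homo-+; ×-assoc-*; ×-comm-*)
  open import Algebra.Properties.CommutativeMonoid.Mult +-commutativeMonoid using (×-distrib-+)
  import Relation.Binary.Reasoning.Setoid as SetoidReasoning
  open import Algebra.Structures using (IsCommutativeRing)
  open SetoidReasoning setoid

  Ser : Set c
  Ser = ℕ → Carrier

  infix 4 _≋_
  infixl 6 _⊞_
  infixl 7 _⊛_

  _≋_ : Ser → Ser → Set ℓ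
  f ≋ g = ∀ n → f n ≈ g n

  tl : Ser → Ser
  tl f n = f (suc n)

  _⊞_ : Ser → Ser → Ser
  (f ⊞ g) n = f n + g n

  ⊟_ : Ser → Ser
  (⊟ f) n = - f n

  -- The Cauchy product by recursion along the left factor: the ring laws follow by induction on the
  -- index, without finite sums.
  _⊛_ : Ser → Ser → Ser
  (f ⊛ g) zero    = f 0 * g 0
  (f ⊛ g) (suc n) = f 0 * g (suc n) + (tl f ⊛ g) n

  con : Carrier → Ser
  con a zero    = a
  con a (suc n) = 0#

  W : Ser
  W zero          = 0#
  W (suc zero)    = 1#
  W (suc (suc n)) = 0#

  -- The Euler operator w·d/dw. Unlike d/dw it acts on each coefficient separately and preserves the
  -- order of vanishing.
  θ : Ser → Ser
  θ f n = n × f n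

  ⊛-cong : ∀ {f f′ g g′} → f ≋ f′ → g ≋ g′ → f ⊛ g ≋ f′ ⊛ g′
  ⊛-cong p q zero    = *-cong (p 0) (q 0)
  ⊛-cong p q (suc n) = +-cong (*-cong (p 0) (q (suc n))) (⊛-cong (λ k → p (suc k)) q n)

  ⊛-distribʳ : ∀ h f g → (f ⊞ g) ⊛ h ≋ f ⊛ h ⊞ g ⊛ h
  ⊛-distribʳ h f g zero    = distribʳ _ _ _
  ⊛-distribʳ h f g (suc n) =
    trans (+-cong (distribʳ _ _ _) (⊛-distribʳ h (tl f) (tl g) n)) (interchange _ _ _ _)

  ⊛-scaleˡ : ∀ a f g → (λ k → a * f k) ⊛ g ≋ λ n → a * (f ⊛ g) n
  ⊛-scaleˡ a f g zero    = *-assoc _ _ _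
  ⊛-scaleˡ a f g (suc n) =
    trans (+-cong (*-assoc _ _ _) (⊛-scaleˡ a (tl f) g n)) (sym (distribˡ _ _ _))

  ⊛-zeroˡ : ∀ {f} g → (∀ n → f n ≈ 0#) → ∀ n → (f ⊛ g) n ≈ 0#
  ⊛-zeroˡ g p zero    = trans (*-congʳ (p 0)) (zeroˡ _)
  ⊛-zeroˡ g p (suc n) =
    trans (+-cong (trans (*-congʳ (p 0)) (zeroˡ _)) (⊛-zeroˡ g (λ k → p (suc k)) n)) (+-identityˡ _)

  con-⊛ : ∀ a g n → (con a ⊛ g) n ≈ a * g n
  con-⊛ a g zero    = refl
  con-⊛ a g (suc n) = trans (+-congˡ (⊛-zeroˡ g (λ _ → refl) n)) (+-identityʳ _)

  -- The same product unfolded along the right factor, which is what commutativity needs.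
  ⊛-suc : ∀ f g n → (f ⊛ g) (suc n) ≈ (f ⊛ tl g) n + f (suc n) * g 0
  ⊛-suc f g zero    = refl
  ⊛-suc f g (suc n) = trans (+-congˡ (⊛-suc (tl f) g n)) (sym (+-assoc _ _ _))

  ⊛-comm : ∀ f g → f ⊛ g ≋ g ⊛ f
  ⊛-comm f g zero    = *-comm _ _
  ⊛-comm f g (suc n) = begin
    f 0 * g (suc n) + (tl f ⊛ g) n ≈⟨ +-cong (*-comm _ _) (⊛-comm (tl f) g n) ⟩
    g (suc n) * f 0 + (g ⊛ tl f) n ≈⟨ +-comm _ _ ⟩
    (g ⊛ tl f) n + g (suc n) * f 0 ≈⟨ ⊛-suc g f n ⟨
    (g ⊛ f) (suc n) ∎

  ⊛-assoc : ∀ f g h → (f ⊛ g) ⊛ h ≋ f ⊛ (g ⊛ h)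
  ⊛-assoc f g h zero    = *-assoc _ _ _
  ⊛-assoc f g h (suc n) = begin
    (f 0 * g 0) * h (suc n) + (tl (f ⊛ g) ⊛ h) n
      ≈⟨ +-cong (*-assoc _ _ _) (⊛-distribʳ h (λ k → f 0 * g (suc k)) (tl f ⊛ g) n) ⟩
    f 0 * (g 0 * h (suc n)) + (((λ k → f 0 * tl g k) ⊛ h) n + ((tl f ⊛ g) ⊛ h) n)
      ≈⟨ +-congˡ (+-cong (⊛-scaleˡ (f 0) (tl g) h n) (⊛-assoc (tl f) g h n)) ⟩
    f 0 * (g 0 * h (suc n)) + (f 0 * (tl g ⊛ h) n + (tl f ⊛ (g ⊛ h)) n)
      ≈⟨ +-assoc _ _ _ ⟨
    f 0 * (g 0 * h (suc n)) + f 0 * (tl g ⊛ h) n + (tl f ⊛ (g ⊛ h)) n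
      ≈⟨ +-congʳ (distribˡ _ _ _) ⟨
    (f ⊛ (g ⊛ h)) (suc n) ∎

  W-⊛-suc : ∀ f n → (W ⊛ f) (suc n) ≈ f n
  W-⊛-suc f n = begin
    0# * f (suc n) + (tl W ⊛ f) n ≈⟨ +-cong (zeroˡ _) (⊛-cong {tl W} {con 1#} tlW (λ _ → refl) n) ⟩
    0# + (con 1# ⊛ f) n           ≈⟨ +-identityˡ _ ⟩
    (con 1# ⊛ f) n                ≈⟨ con-⊛ 1# f n ⟩
    1# * f n                      ≈⟨ *-identityˡ _ ⟩
    f n                           ∎
    where
    tlW : tl W ≋ con 1#
    tlW zero    = refl
    tlW (suc n) = refl

  θ-⊛ : ∀ f g → θ (f ⊛ g) ≋ θ f ⊛ g ⊞ f ⊛ θ g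
  θ-⊛ f g zero    = sym (trans (+-cong (zeroˡ _) (zeroʳ _)) (+-identityˡ _))
  θ-⊛ f g (suc n) = begin
    suc n × (f 0 * g (suc n) + (tl f ⊛ g) n)
      ≈⟨ ×-distrib-+ _ _ (suc n) ⟩
    suc n × (f 0 * g (suc n)) + suc n × (tl f ⊛ g) n
      ≈⟨ +-cong (sym (×-comm-* (suc n) _ _)) (+-congˡ (θ-⊛ (tl f) g n)) ⟩
    f 0 * θ g (suc n) + ((tl f ⊛ g) n + ((θ (tl f) ⊛ g) n + (tl f ⊛ θ g) n))
      ≈⟨ +-congˡ (sym (+-assoc _ _ _)) ⟩
    f 0 * θ g (suc n) + ((tl f ⊛ g) n + (θ (tl f) ⊛ g) n + (tl f ⊛ θ g) n)
      ≈⟨ x∙yz≈y∙xz _ _ _ ⟩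
    (tl f ⊛ g) n + (θ (tl f) ⊛ g) n + (f ⊛ θ g) (suc n)
      ≈⟨ +-congʳ (sym (⊛-distribʳ g (tl f) (θ (tl f)) n)) ⟩
    (tl (θ f) ⊛ g) n + (f ⊛ θ g) (suc n)
      ≈⟨ +-congʳ (trans (+-congʳ (zeroˡ _)) (+-identityˡ _)) ⟨
    (θ f ⊛ g) (suc n) + (f ⊛ θ g) (suc n) ∎

  θ-⊞ : ∀ f g → θ (f ⊞ g) ≋ θ f ⊞ θ g
  θ-⊞ f g n = ×-distrib-+ _ _ n

  θ-cong : ∀ {f g} → f ≋ g → θ f ≋ θ g
  θ-cong p n = ×-congʳ n (p n)

  n×0#≈0# : ∀ n → n × 0# ≈ 0#
  n×0#≈0# zero    = refl
  n×0#≈0# (suc n) = trans (+-identityˡ _) (n×0#≈0# n)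

  θ-con : ∀ a n → θ (con a) n ≈ 0#
  θ-con a zero    = refl
  θ-con a (suc n) = n×0#≈0# (suc n)

  θ-W : θ W ≋ W
  θ-W zero          = refl
  θ-W (suc zero)    = +-identityʳ _
  θ-W (suc (suc n)) = n×0#≈0# (suc (suc n))

  series-isCommutativeRing : IsCommutativeRing _≋_ _⊞_ _⊛_ ⊟_ (con 0#) (con 1#)
  series-isCommutativeRing = record
    { isRing = record
      { +-isAbelianGroup = record
        { isGroup = record
          { isMonoid = record
            { isSemigroup = record
              { isMagma = record
                { isEquivalence = record
                  { refl = λ _ → refl ; sym = λ p n → sym (p n) ; trans = λ p q n → trans (p n) (q n) }
                ; ∙-cong = λ p q n → +-cong (p n) (q n) }
              ; assoc = λ f g h n → +-assoc _ _ _ }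
            ; identity = (λ f n → trans (+-congʳ (con0 n)) (+-identityˡ _))
                       , (λ f n → trans (+-congˡ (con0 n)) (+-identityʳ _)) }
          ; inverse = (λ f n → trans (-‿inverseˡ _) (sym (con0 n)))
                    , (λ f n → trans (-‿inverseʳ _) (sym (con0 n)))
          ; ⁻¹-cong = λ p n → -‿cong (p n) }
        ; comm = λ f g n → +-comm _ _ }
      ; *-cong = ⊛-cong
      ; *-assoc = ⊛-assoc
      ; *-identity = idˡ , (λ f n → trans (⊛-comm f (con 1#) n) (idˡ f n))
      ; distrib = (λ h f g n → trans (⊛-comm h (f ⊞ g) n)
                     (trans (⊛-distribʳ h f g n) (+-cong (⊛-comm f h n) (⊛-comm g h n))))
                , ⊛-distribʳ }
    ; *-comm = ⊛-comm }
    where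
    con0 : ∀ n → con 0# n ≈ 0#
    con0 zero    = refl
    con0 (suc n) = refl
    idˡ : ∀ f → con 1# ⊛ f ≋ f
    idˡ f n = trans (con-⊛ 1# f n) (*-identityˡ _)

  series-commutativeRing : CommutativeRing c ℓ
  series-commutativeRing = record { isCommutativeRing = series-isCommutativeRing }

module SeriesZ where
  open import Data.Integer.Base as ℤ using (ℤ; +_)
  import Data.Integer.Properties as ℤ
  open import Data.Maybe.Base using (Maybe; map)
  open import Data.Nat.Base using (zero; suc)
  open import Relation.Binary.Consequences using (dec⇒weaklyDec)
  open import Relation.Binary.PropositionalEquality
  open import Algebra.Solver.Ring.AlmostCommutativeRing using (fromCommutativeRing; _-Raw-AlmostCommutative⟶_)
  import Algebra.Solver.Ring

  open Series ℤ.+-*-commutativeRing public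

  con-* : ∀ a b → con (a ℤ.* b) ≋ con a ⊛ con b
  con-* a b zero    = refl
  con-* a b (suc n) = sym (trans (con-⊛ a (con b) (suc n)) (ℤ.*-zeroʳ a))

  con-+ : ∀ a b → con (a ℤ.+ b) ≋ con a ⊞ con b
  con-+ a b zero    = refl
  con-+ a b (suc n) = refl

  con-morphism : ℤ.+-*-rawRing -Raw-AlmostCommutative⟶ fromCommutativeRing series-commutativeRing
  con-morphism = record
    { ⟦_⟧ = con ; +-homo = con-+ ; *-homo = con-*
    ; -‿homo = λ { a zero → refl ; a (suc n) → refl }
    ; 0-homo = λ _ → refl ; 1-homo = λ _ → refl }

  con-≟ : ∀ a b → Maybe (con a ≋ con b)
  con-≟ a b = map (λ { refl _ → refl }) (dec⇒weaklyDec ℤ._≟_ a b)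

  module Solver = Algebra.Solver.Ring ℤ.+-*-rawRing (fromCommutativeRing series-commutativeRing) con-morphism con-≟

-- The Padé recurrence and its differential equations.

module Form where
  open import Data.Integer.Base as ℤ using (ℤ; +_)
  import Data.Integer.Properties as ℤ
  open import Data.Nat.Base as ℕ using (ℕ; zero; suc)
  import Data.Nat.Properties as ℕ
  open import Relation.Binary.PropositionalEquality
  open import Data.Nat.Tactic.RingSolver using (solve-∀)
  open SeriesZ
  open Differences series-commutativeRing
  open Solver using (solve; _:=_; _:+_; _:*_; _:-_; :-_; Polynomial)
  open import Algebra.Bundles using (CommutativeRing)
  private module S = CommutativeRing series-commutativeRing

  K : ∀ {n} → ℕ → Polynomial n
  K a = Solver.con (+ a)

  k : ℕ → Ser
  k a = con (+ a)

  -- The partial denominators 2r + 1 and partial numerators (r + 1)² - 1/16 of the continued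
  -- fraction of tan(¼ arctan √w), each step being scaled by 4 to clear fractions.
  γ κ : ℕ → ℕ
  γ r = 4 ℕ.* (2 ℕ.* r ℕ.+ 1)
  κ r = (4 ℕ.* r ℕ.+ 3) ℕ.* (4 ℕ.* r ℕ.+ 5)

  recur : Ser → Ser → ℕ → Ser
  recur f g zero          = f
  recur f g (suc zero)    = g
  recur f g (suc (suc r)) = k (γ (suc r)) ⊛ recur f g (suc r) ⊞ k (κ r) ⊛ (W ⊛ recur f g r)

  -- e r and o r are the even and odd parts of the r-th Padé denominator of ((1+τ)/(1-τ))^(1/4), as series in w = -τ².
  e o : ℕ → Ser
  e = recur (k 1) (k 4)
  o = recur (k 0) (k 1)

  k-+ : ∀ a b → k (a ℕ.+ b) S.≈ k a ⊞ k b
  k-+ a b = con-+ (+ a) (+ b)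

  k-* : ∀ a b → k (a ℕ.* b) S.≈ k a ⊛ k b
  k-* a b = S.trans (λ n → cong (λ c → con c n) (ℤ.pos-* a b)) (con-* (+ a) (+ b))

  k-cong : ∀ {a b} → a ≡ b → k a S.≈ k b
  k-cong refl _ = refl

  γ-suc : ∀ r → k (γ (suc r)) S.≈ k (γ r) ⊞ k 8
  γ-suc r = S.trans (k-cong (identity r)) (k-+ (γ r) 8)
    where
    identity : ∀ r → 4 ℕ.* (2 ℕ.* suc r ℕ.+ 1) ≡ 4 ℕ.* (2 ℕ.* r ℕ.+ 1) ℕ.+ 8
    identity = solve-∀

  κ-suc : ∀ r → k (κ (suc r)) S.≈ k (κ r) ⊞ k 4 ⊛ k (γ (suc r))
  κ-suc r = S.trans (k-cong (identity r)) (S.trans (k-+ (κ r) (4 ℕ.* γ (suc r))) (S.+-congˡ {k (κ r)} (k-* 4 (γ (suc r)))))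
    where
    identity : ∀ r → (4 ℕ.* suc r ℕ.+ 3) ℕ.* (4 ℕ.* suc r ℕ.+ 5)
      ≡ (4 ℕ.* r ℕ.+ 3) ℕ.* (4 ℕ.* r ℕ.+ 5) ℕ.+ 4 ℕ.* (4 ℕ.* (2 ℕ.* suc r ℕ.+ 1))
    identity = solve-∀

  con0 : (λ _ → + 0) S.≈ k 0
  con0 zero    = refl
  con0 (suc n) = refl

  θ-k⊛ : ∀ a f → θ (k a ⊛ f) S.≈ k a ⊛ θ f
  θ-k⊛ a f n = trans (θ-⊛ (k a) f n)
    (trans (cong (ℤ._+ (k a ⊛ θ f) n) (⊛-zeroˡ f (θ-con (+ a)) n)) (ℤ.+-identityˡ _))

  θ-W⊛ : ∀ f → θ (W ⊛ f) S.≈ W ⊛ f ⊞ W ⊛ θ f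
  θ-W⊛ f n = trans (θ-⊛ W f n) (cong (ℤ._+ (W ⊛ θ f) n) (⊛-cong {θ W} {W} {f} θ-W (λ _ → refl) n))

  θ-recur : ∀ f g r → let h = recur f g in
    θ (h (suc (suc r))) S.≈ k (γ (suc r)) ⊛ θ (h (suc r)) ⊞ k (κ r) ⊛ (W ⊛ h r ⊞ W ⊛ θ (h r))
  θ-recur f g r = S.trans (θ-⊞ (k (γ (suc r)) ⊛ recur f g (suc r)) (k (κ r) ⊛ (W ⊛ recur f g r)))
    (S.+-cong (θ-k⊛ (γ (suc r)) _)
              (S.trans (θ-k⊛ (κ r) (W ⊛ recur f g r)) (S.*-congˡ {k (κ r)} (θ-W⊛ (recur f g r)))))

  -- (1 - τ²) p_r' in terms of p_r and p_{r+1}, split into even and odd parts.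
  lhsₑ rhsₑ lhsₒ rhsₒ : ℕ → Ser
  lhsₑ j = k 8 ⊛ ((k 1 ⊞ W) ⊛ θ (e j)) ⊞ W ⊛ o j ⊞ e (suc j)
  rhsₑ j = (k (γ j) ⊞ k 4 ⊛ (k j ⊛ W)) ⊛ e j
  lhsₒ j = k 4 ⊛ ((k 1 ⊞ W) ⊛ (o j ⊞ k 2 ⊛ θ (o j))) ⊞ o (suc j)
  rhsₒ j = (k (γ j) ⊞ k 4 ⊛ (k j ⊛ W)) ⊛ o j ⊞ e j

  -- The solver sees γ, κ and the index as independent variables. This collects multiples of the
  -- relations between their consecutive values, which have to be supplied by hand.
  remainder : ∀ {n} → (w J J₁ J₂ γ₀ γ₁ κ₁ κ₂ f₀ f₁ : Polynomial n) → Polynomial n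
  remainder w J J₁ J₂ γ₀ γ₁ κ₁ κ₂ f₀ f₁ =
    :- (f₀ :* κ₁ :* w) :* (γ₁ :- (γ₀ :+ K 8))
    :+ (:- (K 4 :* f₀ :* κ₁ :* w :* w) :* (J₁ :- (K 1 :+ J))
    :+ (:- (K 4 :* f₀ :* κ₁ :* w :* w :+ K 4 :* f₁ :* w :* γ₁) :* (J₂ :- (K 1 :+ J₁))
    :+ f₁ :* w :* (κ₂ :- (κ₁ :+ K 4 :* γ₁))))

  remainder≈0 : ∀ j f₀ f₁ →
    ⊟ (f₀ ⊛ k (κ j) ⊛ W) ⊛ (k (γ (suc j)) ⊞ ⊟ (k (γ j) ⊞ k 8))
    ⊞ (⊟ (k 4 ⊛ f₀ ⊛ k (κ j) ⊛ W ⊛ W) ⊛ (k (suc j) ⊞ ⊟ (k 1 ⊞ k j))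
    ⊞ (⊟ (k 4 ⊛ f₀ ⊛ k (κ j) ⊛ W ⊛ W ⊞ k 4 ⊛ f₁ ⊛ W ⊛ k (γ (suc j))) ⊛ (k (suc (suc j)) ⊞ ⊟ (k 1 ⊞ k (suc j)))
    ⊞ f₁ ⊛ W ⊛ (k (κ (suc j)) ⊞ ⊟ (k (κ j) ⊞ k 4 ⊛ k (γ (suc j)))))) S.≈ k 0
  remainder≈0 j f₀ f₁ =
    vanish (⊟ (f₀ ⊛ k (κ j) ⊛ W)) (γ-suc j)
    ⊹ vanish (⊟ (k 4 ⊛ f₀ ⊛ k (κ j) ⊛ W ⊛ W)) (k-+ 1 j)
    ⊹ vanish (⊟ (k 4 ⊛ f₀ ⊛ k (κ j) ⊛ W ⊛ W ⊞ k 4 ⊛ f₁ ⊛ W ⊛ k (γ (suc j)))) (k-+ 1 (suc j))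
    ⊹ vanish (f₁ ⊛ W) (κ-suc j)

  -- Induction over two steps: the identity at j + 2 is γ times the one at j + 1 plus κ·w times the
  -- one at j, up to the derivative of the recurrence and the index relations in `remainder`.
  derivativeₑ : ∀ j → lhsₑ j S.≈ rhsₑ j
  derivativeₑ zero = fromDifference
    (solve 2 (λ w t → (K 8 :* ((K 1 :+ w) :* t) :+ w :* K 0 :+ K 4) :- (K 4 :+ K 4 :* (K 0 :* w)) :* K 1
                    := K 8 :* (K 1 :+ w) :* (t :- K 0)) (λ _ → refl) W (θ (k 1)))
    (vanish (k 8 ⊛ (k 1 ⊞ W)) (S.trans (θ-con (+ 1)) con0))
  derivativeₑ (suc zero) = fromDifference
    (solve 2 (λ w t → (K 8 :* ((K 1 :+ w) :* t) :+ w :* K 1 :+ (K 12 :* K 4 :+ K 15 :* (w :* K 1))) :- (K 12 :+ K 4 :* (K 1 :* w)) :* K 4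
                    := K 8 :* (K 1 :+ w) :* (t :- K 0)) (λ _ → refl) W (θ (k 4)))
    (vanish (k 8 ⊛ (k 1 ⊞ W)) (S.trans (θ-con (+ 4)) con0))
  derivativeₑ (suc (suc j)) = fromDifference
    (solve 16 (λ w J J₁ J₂ γ₀ γ₁ γ₂ κ₁ κ₂ e₀ e₁ t₀ t₁ t₂ o₀ o₁ → let
         e₂ = γ₁ :* e₁ :+ κ₁ :* (w :* e₀)
         o₂ = γ₁ :* o₁ :+ κ₁ :* (w :* o₀)
         e₃ = γ₂ :* e₂ :+ κ₂ :* (w :* e₁)
         L = λ t o e → K 8 :* ((K 1 :+ w) :* t) :+ w :* o :+ e
         R = λ γ J e → (γ :+ K 4 :* (J :* w)) :* e
       in L t₂ o₂ e₃ :- R γ₂ J₂ e₂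
       := K 8 :* (K 1 :+ w) :* (t₂ :- (γ₁ :* t₁ :+ κ₁ :* (w :* e₀ :+ w :* t₀)))
       :+ (γ₁ :* (L t₁ o₁ e₂ :- R γ₁ J₁ e₁)
       :+ (κ₁ :* w :* (L t₀ o₀ e₁ :- R γ₀ J e₀)
       :+ remainder w J J₁ J₂ γ₀ γ₁ κ₁ κ₂ e₀ e₁)))
     (λ _ → refl) W (k j) (k (suc j)) (k (suc (suc j))) (k (γ j)) (k (γ (suc j))) (k (γ (suc (suc j)))) (k (κ j)) (k (κ (suc j)))
       (e j) (e (suc j)) (θ (e j)) (θ (e (suc j))) (θ (e (suc (suc j)))) (o j) (o (suc j)))
    (vanish (k 8 ⊛ (k 1 ⊞ W)) (θ-recur (k 1) (k 4) j)
     ⊹ vanish (k (γ (suc j))) (derivativeₑ (suc j))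
     ⊹ vanish (k (κ j) ⊛ W) (derivativeₑ j)
     ⊹ remainder≈0 j (e j) (e (suc j)))

  derivativeₒ : ∀ j → lhsₒ j S.≈ rhsₒ j
  derivativeₒ zero = fromDifference
    (solve 2 (λ w t → (K 4 :* ((K 1 :+ w) :* (K 0 :+ K 2 :* t)) :+ K 1) :- ((K 4 :+ K 4 :* (K 0 :* w)) :* K 0 :+ K 1)
                    := K 8 :* (K 1 :+ w) :* (t :- K 0)) (λ _ → refl) W (θ (k 0)))
    (vanish (k 8 ⊛ (k 1 ⊞ W)) (S.trans (θ-con (+ 0)) con0))
  derivativeₒ (suc zero) = fromDifference
    (solve 2 (λ w t → (K 4 :* ((K 1 :+ w) :* (K 1 :+ K 2 :* t)) :+ (K 12 :* K 1 :+ K 15 :* (w :* K 0))) :- ((K 12 :+ K 4 :* (K 1 :* w)) :* K 1 :+ K 4)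
                    := K 8 :* (K 1 :+ w) :* (t :- K 0)) (λ _ → refl) W (θ (k 1)))
    (vanish (k 8 ⊛ (k 1 ⊞ W)) (S.trans (θ-con (+ 1)) con0))
  derivativeₒ (suc (suc j)) = fromDifference
    (solve 16 (λ w J J₁ J₂ γ₀ γ₁ γ₂ κ₁ κ₂ e₀ e₁ t₀ t₁ t₂ o₀ o₁ → let
         e₂ = γ₁ :* e₁ :+ κ₁ :* (w :* e₀)
         o₂ = γ₁ :* o₁ :+ κ₁ :* (w :* o₀)
         o₃ = γ₂ :* o₂ :+ κ₂ :* (w :* o₁)
         L = λ o t o′ → K 4 :* ((K 1 :+ w) :* (o :+ K 2 :* t)) :+ o′
         R = λ γ J o e → (γ :+ K 4 :* (J :* w)) :* o :+ e
       in L o₂ t₂ o₃ :- R γ₂ J₂ o₂ e₂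
       := K 8 :* (K 1 :+ w) :* (t₂ :- (γ₁ :* t₁ :+ κ₁ :* (w :* o₀ :+ w :* t₀)))
       :+ (γ₁ :* (L o₁ t₁ o₂ :- R γ₁ J₁ o₁ e₁)
       :+ (κ₁ :* w :* (L o₀ t₀ o₁ :- R γ₀ J o₀ e₀)
       :+ remainder w J J₁ J₂ γ₀ γ₁ κ₁ κ₂ o₀ o₁)))
     (λ _ → refl) W (k j) (k (suc j)) (k (suc (suc j))) (k (γ j)) (k (γ (suc j))) (k (γ (suc (suc j)))) (k (κ j)) (k (κ (suc j)))
       (e j) (e (suc j)) (θ (o j)) (θ (o (suc j))) (θ (o (suc (suc j)))) (o j) (o (suc j)))
    (vanish (k 8 ⊛ (k 1 ⊞ W)) (θ-recur (k 0) (k 1) j)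
     ⊹ vanish (k (γ (suc j))) (derivativeₒ (suc j))
     ⊹ vanish (k (κ j) ⊛ W) (derivativeₒ j)
     ⊹ remainder≈0 j (o j) (o (suc j)))

  -- V is, up to a unit, the derivative of the argument of (e + o √(-w))⁴ (1 - √(-w)).
  V : Ser → Ser → Ser
  V e o = k 4 ⊛ ((k 1 ⊞ W) ⊛ (o ⊛ e ⊞ k 2 ⊛ (θ o ⊛ e ⊞ ⊟ (o ⊛ θ e)))) ⊞ ⊟ (e ⊛ e ⊞ W ⊛ (o ⊛ o))

  casorati : ℕ → Ser
  casorati j = e (suc j) ⊛ o j ⊞ ⊟ (e j ⊛ o (suc j))

  -- The even and odd derivative formulas share the factor γ j + 4jw; in e times the odd one minus o
  -- times the even one it cancels, and only the Casorati determinant is left.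
  V≈casorati : ∀ j → V (e j) (o j) S.≈ casorati j
  V≈casorati j = fromDifference
    (solve 9 (λ w J γ e e′ o o′ t u →
        K 4 :* ((K 1 :+ w) :* (o :* e :+ K 2 :* (u :* e :- o :* t))) :- (e :* e :+ w :* (o :* o)) :- (e′ :* o :- e :* o′)
      := e :* (K 4 :* ((K 1 :+ w) :* (o :+ K 2 :* u)) :+ o′ :- ((γ :+ K 4 :* (J :* w)) :* o :+ e))
      :+ :- o :* (K 8 :* ((K 1 :+ w) :* t) :+ w :* o :+ e′ :- (γ :+ K 4 :* (J :* w)) :* e))
      (λ _ → refl) W (k j) (k (γ j)) (e j) (e (suc j)) (o j) (o (suc j)) (θ (e j)) (θ (o j)))
    (vanish (e j) (derivativeₒ j) ⊹ vanish (⊟ o j) (derivativeₑ j))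

  -- Starting from -1 at j = 0, the determinant gains a factor -κ·w at each step, so it is a
  -- constant multiple of w^j.
  casorati-suc : ∀ j → casorati (suc j) S.≈ ⊟ k (κ j) ⊛ (W ⊛ casorati j)
  casorati-suc j = solve 7 (λ w γ κ e e′ o o′ →
      (γ :* e′ :+ κ :* (w :* e)) :* o′ :- e′ :* (γ :* o′ :+ κ :* (w :* o)) := :- κ :* (w :* (e′ :* o :- e :* o′)))
    (λ _ → refl) W (k (γ (suc j))) (k (κ j)) (e j) (e (suc j)) (o j) (o (suc j))

-- Order of vanishing of the quartic form at the Padé denominators.

module FormOrder where
  open import Data.Integer.Base as ℤ using (ℤ; +_)
  import Data.Integer.Properties as ℤ
  open import Data.Nat.Base as ℕ using (ℕ; zero; suc; _<_; _≤_; z≤n; s≤s)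
  import Data.Nat.Properties as ℕ
  open import Data.Sum.Base using (inj₁; inj₂; [_,_]′)
  open import Data.Empty using (⊥-elim)
  open import Relation.Binary.PropositionalEquality
  open import Algebra.Properties.Semiring.Mult ℤ.+-*-semiring using () renaming (_×_ to _·_)
  open import Algebra.Bundles using (CommutativeRing)
  open SeriesZ
  open Solver using (solve; _:=_; _:+_; _:*_; _:-_; :-_; Polynomial)
  open Form
  private module S = CommutativeRing series-commutativeRing

  Ord : ℕ → Ser → Set
  Ord r f = ∀ n → n < r → f n ≡ + 0

  ord-cong : ∀ {r f g} → f S.≈ g → Ord r f → Ord r g
  ord-cong p h n lt = trans (sym (p n)) (h n lt)

  ord-⊛ˡ : ∀ {r f} g → Ord r f → Ord r (f ⊛ g)
  ord-⊛ˡ {suc r} g h zero    lt       = cong (ℤ._* g 0) (h 0 lt)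
  ord-⊛ˡ {suc r} {f} g h (suc n) (s≤s lt) =
    cong₂ ℤ._+_ (cong (ℤ._* g (suc n)) (h 0 (s≤s z≤n))) (ord-⊛ˡ {r} {tl f} g (λ i p → h (suc i) (s≤s p)) n lt)

  ord-⊛ʳ : ∀ {r f} g → Ord r f → Ord r (g ⊛ f)
  ord-⊛ʳ {r} {f} g h = ord-cong (⊛-comm f g) (ord-⊛ˡ g h)

  ord-W⊛ : ∀ {r f} → Ord r f → Ord (suc r) (W ⊛ f)
  ord-W⊛ {f = f} h zero    lt       = refl
  ord-W⊛ {f = f} h (suc n) (s≤s lt) = trans (W-⊛-suc f n) (h n lt)

  ord-⊞ : ∀ {r f g} → Ord r f → Ord r g → Ord r (f ⊞ g)
  ord-⊞ p q n lt = cong₂ ℤ._+_ (p n lt) (q n lt)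

  lead-⊛ : ∀ n f g → Ord n f → (f ⊛ g) n ≡ f n ℤ.* g 0
  lead-⊛ zero    f g h = refl
  lead-⊛ (suc n) f g h = trans
    (cong₂ ℤ._+_ (cong (ℤ._* g (suc n)) (h 0 (s≤s z≤n))) (lead-⊛ n (tl f) g (λ i p → h (suc i) (s≤s p))))
    (ℤ.+-identityˡ _)

  ord-casorati : ∀ j → Ord j (casorati j)
  ord-casorati zero    n ()
  ord-casorati (suc j) = ord-cong (S.sym (casorati-suc j)) (ord-⊛ʳ (⊟ k (κ j)) (ord-W⊛ (ord-casorati j)))

  -- The coefficient of √(-w) in (e + o√(-w))⁴(1 - √(-w)), with (e + o√(-w))² = c + d√(-w).
  Φ : Ser → Ser → Ser
  Φ e o = k 2 ⊛ (c ⊛ d) ⊞ ⊟ (c ⊛ c ⊞ ⊟ (W ⊛ (d ⊛ d)))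
    where
    c d : Ser
    c = e ⊛ e ⊞ ⊟ (W ⊛ (o ⊛ o))
    d = k 2 ⊛ (e ⊛ o)

  θ-⊟ : ∀ f → θ (⊟ f) S.≈ ⊟ θ f
  θ-⊟ f zero    = refl
  θ-⊟ f (suc n) = trans (cong (λ z → ℤ.- f (suc n) ℤ.+ z) (θ-⊟ (λ _ → f (suc n)) n))
                        (sym (ℤ.neg-distrib-+ (f (suc n)) (n · f (suc n))))

  θ-square : ∀ f → θ (f ⊛ f) S.≈ k 2 ⊛ (f ⊛ θ f)
  θ-square f = S.trans (θ-⊛ f f)
    (solve 2 (λ f t → t :* f :+ f :* t := K 2 :* (f :* t)) (λ _ → refl) f (θ f))

  θ-c : ∀ e o → θ (e ⊛ e ⊞ ⊟ (W ⊛ (o ⊛ o)))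
                S.≈ k 2 ⊛ (e ⊛ θ e) ⊞ ⊟ (W ⊛ (o ⊛ o) ⊞ W ⊛ (k 2 ⊛ (o ⊛ θ o)))
  θ-c e o = S.trans (θ-⊞ (e ⊛ e) (⊟ (W ⊛ (o ⊛ o))))
    (S.+-cong (θ-square e) (S.trans (θ-⊟ (W ⊛ (o ⊛ o)))
      (S.-‿cong (S.trans (θ-W⊛ (o ⊛ o)) (S.+-congˡ {W ⊛ (o ⊛ o)} (S.*-congˡ {W} (θ-square o)))))))

  θ-d : ∀ e o → θ (k 2 ⊛ (e ⊛ o)) S.≈ k 2 ⊛ (θ e ⊛ o ⊞ e ⊛ θ o)
  θ-d e o = S.trans (θ-k⊛ 2 (e ⊛ o)) (S.*-congˡ {k 2} (θ-⊛ e o))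

  θ-Φ : ∀ c d c′ d′ → θ c S.≈ c′ → θ d S.≈ d′ →
    θ (k 2 ⊛ (c ⊛ d) ⊞ ⊟ (c ⊛ c ⊞ ⊟ (W ⊛ (d ⊛ d))))
    S.≈ k 2 ⊛ (c′ ⊛ d ⊞ c ⊛ d′) ⊞ ⊟ (k 2 ⊛ (c ⊛ c′) ⊞ ⊟ (W ⊛ (d ⊛ d) ⊞ W ⊛ (k 2 ⊛ (d ⊛ d′))))
  θ-Φ c d c′ d′ p q = S.trans (θ-⊞ (k 2 ⊛ (c ⊛ d)) (⊟ (c ⊛ c ⊞ ⊟ (W ⊛ (d ⊛ d)))))
    (S.+-cong
      (S.trans (θ-d c d) (S.*-congˡ {k 2} (S.+-cong (S.*-congʳ {d} p) (S.*-congˡ {c} q))))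
      (S.trans (θ-⊟ (c ⊛ c ⊞ ⊟ (W ⊛ (d ⊛ d)))) (S.-‿cong (S.trans (θ-c c d)
        (S.+-cong (S.*-congˡ {k 2} (S.*-congˡ {c} p))
          (S.-‿cong (S.+-congˡ {W ⊛ (d ⊛ d)} (S.*-congˡ {W} (S.*-congˡ {k 2} (S.*-congˡ {d} q))))))))))

  transport : Ser → Ser → Ser
  transport e o = k 8 ⊛ θ e ⊞ k 4 ⊛ (W ⊛ (o ⊞ k 2 ⊛ θ o)) ⊞ W ⊛ o

  -- A first-order linear equation for Φ with a multiple of V as inhomogeneity, so that a high order
  -- of V forces a high order of Φ. It mirrors Im P′ = (ρ′/ρ)·Im P + α′·Re P for P = ρ·exp(iα); the
  -- left factor Φ + 2θΦ is 2θ(√w·Φ)/√w.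
  Φ-equation : ∀ e o →
    (e ⊞ W ⊛ o) ⊛ (Φ e o ⊞ k 2 ⊛ θ (Φ e o))
    S.≈ transport e o ⊛ Φ e o ⊞ (e ⊛ (e ⊛ e) ⊞ ⊟ (k 3 ⊛ (W ⊛ (e ⊛ (o ⊛ o))))) ⊛ V e o
  Φ-equation e o = S.trans
    (S.*-congˡ {e ⊞ W ⊛ o} (S.+-congˡ {Φ e o} (S.*-congˡ {k 2} (θ-Φ _ _ _ _ (θ-c e o) (θ-d e o)))))
    (solve 5 (λ e o e' o' w →
      let c = e :* e :- (w :* (o :* o))
          d = K 2 :* (e :* o)
          c' = K 2 :* (e :* e') :- (w :* (o :* o) :+ w :* (K 2 :* (o :* o')))
          d' = K 2 :* (e' :* o :+ e :* o')
          Φ = K 2 :* (c :* d) :- (c :* c :- (w :* (d :* d)))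
          Φ' = K 2 :* (c' :* d :+ c :* d') :- (K 2 :* (c :* c') :- (w :* (d :* d) :+ w :* (K 2 :* (d :* d'))))
          V = K 4 :* ((K 1 :+ w) :* (o :* e :+ K 2 :* (o' :* e :- (o :* e')))) :- (e :* e :+ w :* (o :* o))
      in (e :+ w :* o) :* (Φ :+ K 2 :* Φ') :=
         (K 8 :* e' :+ K 4 :* (w :* (o :+ K 2 :* o')) :+ w :* o) :* Φ
         :+ (e :* (e :* e) :- (K 3 :* (w :* (e :* (o :* o))))) :* V) (λ _ → refl) e o (θ e) (θ o) W)

  ·≡* : ∀ n a → n · a ≡ + n ℤ.* a
  ·≡* zero    a = refl
  ·≡* (suc n) a = trans (cong (λ z → a ℤ.+ z) (·≡* n a)) (sym (ℤ.suc-* (+ n) a))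

  -- The constant term of `e r`, that is 4^r·1·3···(2r - 1). Being nonzero, it can be cancelled from
  -- the leading coefficient of the differential equation; it also measures the size of E.
  N : ℕ → ℕ
  N zero    = 1
  N (suc r) = γ r ℕ.* N r

  recur-0 : ∀ a b r → recur (k a) (k b) (suc (suc r)) 0 ≡ + γ (suc r) ℤ.* recur (k a) (k b) (suc r) 0
  recur-0 a b r = trans (cong (λ z → (+ γ (suc r) ℤ.* recur (k a) (k b) (suc r) 0) ℤ.+ z) (ℤ.*-zeroʳ (+ κ r))) (ℤ.+-identityʳ _)

  e-0 : ∀ r → e r 0 ≡ + N r
  e-0 zero          = refl
  e-0 (suc zero)    = refl
  e-0 (suc (suc r)) = trans (recur-0 1 4 r) (trans (cong (+ γ (suc r) ℤ.*_) (e-0 (suc r))) (sym (ℤ.pos-* (γ (suc r)) (N (suc r)))))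

  N>0 : ∀ r → 0 < N r
  N>0 zero    = s≤s z≤n
  N>0 (suc r) = ℕ.*-mono-≤ {1} {γ r} {1} (ℕ.≤-trans (s≤s z≤n) (ℕ.*-monoʳ-≤ 4 (ℕ.m≤n+m 1 (2 ℕ.* r)))) (N>0 r)

  -- In Φ-equation the V-term has order r > n, so the coefficient of wⁿ reads (2n + 1)·N r·Φₙ = 0.
  ord-Φ-step : ∀ r n → n < r → Ord n (Φ (e r) (o r)) → Φ (e r) (o r) n ≡ + 0
  ord-Φ-step r n n<r h = [ (λ ()) , (λ p → p) ]′ (ℤ.i*j≡0⇒i≡0∨j≡0 (+ suc (2 ℕ.* n)) odd*Φ)
    where
    E O F Ψ : Ser
    E = e r
    O = o r
    F = Φ E O
    Ψ = F ⊞ k 2 ⊛ θ F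
    ordΨ : Ord n Ψ
    ordΨ = ord-⊞ h (ord-⊛ʳ {f = θ F} (k 2) (λ i p → trans (cong (i ·_) (h i p)) (n×0#≈0# i)))
    Ψ-n : Ψ n ≡ + suc (2 ℕ.* n) ℤ.* F n
    Ψ-n = trans (cong (λ z → F n ℤ.+ z) (trans (con-⊛ (+ 2) (θ F) n)
            (trans (cong (+ 2 ℤ.*_) (·≡* n (F n)))
            (trans (sym (ℤ.*-assoc (+ 2) (+ n) (F n))) (cong (ℤ._* F n) (sym (ℤ.pos-* 2 n)))))))
          (sym (ℤ.suc-* (+ (2 ℕ.* n)) (F n)))
    V-n : ∀ g → (g ⊛ V E O) n ≡ + 0
    V-n g = ord-⊛ʳ {r} g (ord-cong (S.sym (V≈casorati r)) (ord-casorati r)) n n<r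
    vanishes : (Ψ ⊛ (E ⊞ W ⊛ O)) n ≡ + 0
    vanishes = trans (⊛-comm Ψ (E ⊞ W ⊛ O) n) (trans (Φ-equation E O n)
      (cong₂ ℤ._+_ (trans (⊛-comm (transport E O) F n)
                          (trans (lead-⊛ n F (transport E O) h) (ℤ.*-zeroʳ (F n))))
                   (V-n _)))
    product : Ψ n ℤ.* (+ N r) ≡ + 0
    product = trans (cong (Ψ n ℤ.*_) (sym (trans (ℤ.+-identityʳ (E 0)) (e-0 r))))
                    (trans (sym (lead-⊛ n Ψ (E ⊞ W ⊛ O) ordΨ)) vanishes)
    odd*Φ : + suc (2 ℕ.* n) ℤ.* F n ≡ + 0
    odd*Φ = trans (sym Ψ-n) ([ (λ p → p) , (λ p → ⊥-elim (ℕ.<⇒≢ (N>0 r) (sym (ℤ.+-injective p)))) ]′ (ℤ.i*j≡0⇒i≡0∨j≡0 (Ψ n) product))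

  ord-Φ : ∀ r → Ord r (Φ (e r) (o r))
  ord-Φ r = upto r ℕ.≤-refl
    where
    upto : ∀ n → n ≤ r → Ord n (Φ (e r) (o r))
    upto (suc n) n<r i (s≤s i≤n) with ℕ.m≤n⇒m<n∨m≡n i≤n
    ... | inj₁ i<n  = upto n (ℕ.<⇒≤ n<r) i i<n
    ... | inj₂ refl = ord-Φ-step r n n<r (upto n (ℕ.<⇒≤ n<r))

-- Evaluation of the approximants at w = m/X², and their size.

module Evaluation where
  open import Data.Integer.Base as ℤ using (ℤ; +_; ∣_∣)
  import Data.Integer.Properties as ℤ
  open import Data.Integer.Tactic.RingSolver using () renaming (solve-∀ to solveℤ-∀)
  open import Data.Nat.Base as ℕ using (ℕ; zero; suc; _*_; _^_; _<_; _≤_; z≤n; s≤s)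
  import Data.Nat.Properties as ℕ
  open import Data.Nat.Tactic.RingSolver using (solve-∀)
  open import Data.Product.Base using (_×_; _,_; proj₁; proj₂)
  open import Relation.Binary.PropositionalEquality
  open import Algebra.Bundles using (CommutativeRing)
  open SeriesZ
  open Form
  open FormOrder
  open Arith
  private module S = CommutativeRing series-commutativeRing

  norm : ℕ → Ser → ℕ
  norm zero    f = ∣ f 0 ∣
  norm (suc n) f = ∣ f 0 ∣ ℕ.+ norm n (tl f)

  norm-cong : ∀ n {f g} → f S.≈ g → norm n f ≡ norm n g
  norm-cong zero    p = cong ∣_∣ (p 0)
  norm-cong (suc n) p = cong₂ ℕ._+_ (cong ∣_∣ (p 0)) (norm-cong n (λ i → p (suc i)))

  norm-zero : ∀ n {f} → (∀ i → f i ≡ + 0) → norm n f ≡ 0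
  norm-zero zero    p = cong ∣_∣ (p 0)
  norm-zero (suc n) p = cong₂ ℕ._+_ (cong ∣_∣ (p 0)) (norm-zero n (λ i → p (suc i)))

  norm-suc : ∀ n f → norm n f ≤ norm (suc n) f
  norm-suc zero    f = ℕ.m≤m+n _ _
  norm-suc (suc n) f = ℕ.+-monoʳ-≤ ∣ f 0 ∣ (norm-suc n (tl f))

  norm-⊞ : ∀ n f g → norm n (f ⊞ g) ≤ norm n f ℕ.+ norm n g
  norm-⊞ zero    f g = ℤ.∣i+j∣≤∣i∣+∣j∣ (f 0) (g 0)
  norm-⊞ (suc n) f g = ℕ.≤-trans (ℕ.+-mono-≤ (ℤ.∣i+j∣≤∣i∣+∣j∣ (f 0) (g 0)) (norm-⊞ n (tl f) (tl g)))
    (ℕ.≤-reflexive (interchange ∣ f 0 ∣ ∣ g 0 ∣ (norm n (tl f)) (norm n (tl g))))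
    where
    interchange : ∀ a b c d → a ℕ.+ b ℕ.+ (c ℕ.+ d) ≡ a ℕ.+ c ℕ.+ (b ℕ.+ d)
    interchange = solve-∀

  norm-⊟ : ∀ n f → norm n (⊟ f) ≡ norm n f
  norm-⊟ zero    f = ℤ.∣-i∣≡∣i∣ (f 0)
  norm-⊟ (suc n) f = cong₂ ℕ._+_ (ℤ.∣-i∣≡∣i∣ (f 0)) (norm-⊟ n (tl f))

  norm-scale : ∀ n a f → norm n (λ i → a ℤ.* f i) ≡ ∣ a ∣ ℕ.* norm n f
  norm-scale zero    a f = ℤ.abs-* a (f 0)
  norm-scale (suc n) a f = trans (cong₂ ℕ._+_ (ℤ.abs-* a (f 0)) (norm-scale n a (tl f))) (sym (ℕ.*-distribˡ-+ ∣ a ∣ _ _))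

  norm-⊛ : ∀ n f g → norm n (f ⊛ g) ≤ norm n f ℕ.* norm n g
  norm-⊛ zero    f g = ℕ.≤-reflexive (ℤ.abs-* (f 0) (g 0))
  norm-⊛ (suc n) f g = begin
    ∣ f 0 ℤ.* g 0 ∣ ℕ.+ norm n (tl (f ⊛ g))
      ≤⟨ ℕ.+-mono-≤ (ℕ.≤-reflexive (ℤ.abs-* (f 0) (g 0))) (norm-⊞ n (λ i → f 0 ℤ.* g (suc i)) (tl f ⊛ g)) ⟩
    ∣ f 0 ∣ ℕ.* ∣ g 0 ∣ ℕ.+ (norm n (λ i → f 0 ℤ.* tl g i) ℕ.+ norm n (tl f ⊛ g))
      ≤⟨ ℕ.+-monoʳ-≤ (∣ f 0 ∣ ℕ.* ∣ g 0 ∣) (ℕ.+-mono-≤ (ℕ.≤-reflexive (norm-scale n (f 0) (tl g)))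
           (ℕ.≤-trans (norm-⊛ n (tl f) g) (ℕ.*-monoʳ-≤ (norm n (tl f)) (norm-suc n g)))) ⟩
    ∣ f 0 ∣ ℕ.* ∣ g 0 ∣ ℕ.+ (∣ f 0 ∣ ℕ.* norm n (tl g) ℕ.+ norm n (tl f) ℕ.* norm (suc n) g)
      ≡⟨ regroup ∣ f 0 ∣ ∣ g 0 ∣ (norm n (tl g)) (norm n (tl f)) ⟩
    norm (suc n) f ℕ.* norm (suc n) g ∎
    where
    open ℕ.≤-Reasoning
    regroup : ∀ a b c d → a ℕ.* b ℕ.+ (a ℕ.* c ℕ.+ d ℕ.* (b ℕ.+ c)) ≡ (a ℕ.+ d) ℕ.* (b ℕ.+ c)
    regroup = solve-∀

  norm-k⊛ : ∀ n a f → norm n (k a ⊛ f) ≡ a ℕ.* norm n f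
  norm-k⊛ n a f = trans (norm-cong n (con-⊛ (+ a) f)) (norm-scale n (+ a) f)

  norm-W⊛ : ∀ n f → norm n (W ⊛ f) ≤ norm n f
  norm-W⊛ zero    f = z≤n
  norm-W⊛ (suc n) f = ℕ.≤-trans (ℕ.≤-reflexive (norm-cong n (W-⊛-suc f))) (norm-suc n f)

  norm-Φ : ∀ n e o B → norm n e ≤ B → norm n o ≤ B → norm n (Φ e o) ≤ 16 ℕ.* (B ℕ.* B ℕ.* (B ℕ.* B))
  norm-Φ n e o B eB oB = ℕ.≤-trans
    (ℕ.≤-trans (norm-⊞ n _ _) (ℕ.+-mono-≤
      (ℕ.≤-trans (ℕ.≤-reflexive (norm-k⊛ n 2 (c ⊛ d))) (ℕ.*-monoʳ-≤ 2 (prod c≤ d≤)))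
      (minus (c ⊛ c) (W ⊛ (d ⊛ d)) (prod c≤ c≤) (ℕ.≤-trans (norm-W⊛ n (d ⊛ d)) (prod d≤ d≤)))))
    (ℕ.≤-reflexive (total (B ℕ.* B)))
    where
    c d : Ser
    c = e ⊛ e ⊞ ⊟ (W ⊛ (o ⊛ o))
    d = k 2 ⊛ (e ⊛ o)
    prod : ∀ {f g a b} → norm n f ≤ a → norm n g ≤ b → norm n (f ⊛ g) ≤ a ℕ.* b
    prod {f} {g} p q = ℕ.≤-trans (norm-⊛ n f g) (ℕ.*-mono-≤ p q)
    minus : ∀ f g {a b} → norm n f ≤ a → norm n g ≤ b → norm n (⊟ (f ⊞ ⊟ g)) ≤ a ℕ.+ b
    minus f g p q = ℕ.≤-trans (ℕ.≤-reflexive (norm-⊟ n (f ⊞ ⊟ g)))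
      (ℕ.≤-trans (norm-⊞ n f (⊟ g)) (ℕ.+-mono-≤ p (ℕ.≤-trans (ℕ.≤-reflexive (norm-⊟ n g)) q)))
    c≤ : norm n c ≤ B ℕ.* B ℕ.+ B ℕ.* B
    c≤ = ℕ.≤-trans (ℕ.≤-reflexive (sym (norm-⊟ n c)))
      (minus (e ⊛ e) (W ⊛ (o ⊛ o)) (prod eB eB) (ℕ.≤-trans (norm-W⊛ n (o ⊛ o)) (prod oB oB)))
    d≤ : norm n d ≤ B ℕ.* B ℕ.+ B ℕ.* B
    d≤ = ℕ.≤-trans (ℕ.≤-reflexive (norm-k⊛ n 2 (e ⊛ o)))
      (ℕ.≤-trans (ℕ.*-monoʳ-≤ 2 (prod eB oB)) (ℕ.≤-reflexive (cong (λ z → B ℕ.* B ℕ.+ z) (ℕ.+-identityʳ _))))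
    total : ∀ b → 2 ℕ.* ((b ℕ.+ b) ℕ.* (b ℕ.+ b)) ℕ.+ ((b ℕ.+ b) ℕ.* (b ℕ.+ b) ℕ.+ (b ℕ.+ b) ℕ.* (b ℕ.+ b)) ≡ 16 ℕ.* (b ℕ.* b)
    total = solve-∀

  κN≤ : ∀ r → κ r ℕ.* N r ≤ γ (suc r) ℕ.* (γ r ℕ.* N r)
  κN≤ r = ℕ.≤-trans (ℕ.*-monoˡ-≤ (N r) (ℕ.≤-trans (ℕ.m≤m+n (κ r) _) (ℕ.≤-reflexive (gap r))))
                    (ℕ.≤-reflexive (ℕ.*-assoc (γ (suc r)) (γ r) (N r)))
    where
    gap : ∀ r → (4 ℕ.* r ℕ.+ 3) ℕ.* (4 ℕ.* r ℕ.+ 5) ℕ.+ (48 ℕ.* (r ℕ.* r) ℕ.+ 96 ℕ.* r ℕ.+ 33)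
      ≡ (4 ℕ.* (2 ℕ.* suc r ℕ.+ 1)) ℕ.* (4 ℕ.* (2 ℕ.* r ℕ.+ 1))
    gap = solve-∀

  -- As κ r ≤ γ (r + 1)·γ r, the second term of the recurrence never exceeds the first, and each
  -- step costs only a factor 2 beyond N. The weights u ≤ v allow for coefficient norms (both 1) as
  -- well as for the integers E (powers of X).
  growth-step : ∀ r {a b u v} → b ≤ 2 ℕ.^ r ℕ.* N r ℕ.* u → a ≤ 2 ℕ.^ suc r ℕ.* N (suc r) ℕ.* v → u ≤ v →
    γ (suc r) ℕ.* a ℕ.+ κ r ℕ.* b ≤ 2 ℕ.^ suc (suc r) ℕ.* N (suc (suc r)) ℕ.* v
  growth-step r {a} {b} {u} {v} b≤ a≤ u≤v = begin
    γ (suc r) ℕ.* a ℕ.+ κ r ℕ.* b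
      ≤⟨ ℕ.+-mono-≤ (ℕ.*-monoʳ-≤ (γ (suc r)) a≤) (ℕ.*-monoʳ-≤ (κ r) (ℕ.≤-trans b≤ (ℕ.*-monoʳ-≤ (2 ℕ.^ r ℕ.* N r) u≤v))) ⟩
    γ (suc r) ℕ.* (2 ℕ.^ suc r ℕ.* N (suc r) ℕ.* v) ℕ.+ κ r ℕ.* (2 ℕ.^ r ℕ.* N r ℕ.* v)
      ≡⟨ cong₂ ℕ._+_ (swap₁ (γ (suc r)) (2 ℕ.^ suc r) (N (suc r)) v) (swap₂ (κ r) (2 ℕ.^ r) (N r) v) ⟩
    2 ℕ.^ suc r ℕ.* v ℕ.* N (suc (suc r)) ℕ.+ 2 ℕ.^ r ℕ.* v ℕ.* (κ r ℕ.* N r)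
      ≤⟨ ℕ.+-monoʳ-≤ (2 ℕ.^ suc r ℕ.* v ℕ.* N (suc (suc r))) (ℕ.*-mono-≤ (ℕ.*-monoˡ-≤ v (ℕ.^-monoʳ-≤ 2 (ℕ.n≤1+n r))) (κN≤ r)) ⟩
    2 ℕ.^ suc r ℕ.* v ℕ.* N (suc (suc r)) ℕ.+ 2 ℕ.^ suc r ℕ.* v ℕ.* N (suc (suc r))
      ≡⟨ double (2 ℕ.^ suc r) v (N (suc (suc r))) ⟩
    2 ℕ.^ suc (suc r) ℕ.* N (suc (suc r)) ℕ.* v ∎
    where
    open ℕ.≤-Reasoning
    swap₁ : ∀ g p n v → g ℕ.* (p ℕ.* n ℕ.* v) ≡ p ℕ.* v ℕ.* (g ℕ.* n)
    swap₁ = solve-∀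
    swap₂ : ∀ g p n v → g ℕ.* (p ℕ.* n ℕ.* v) ≡ p ℕ.* v ℕ.* (g ℕ.* n)
    swap₂ = solve-∀
    double : ∀ p v n → p ℕ.* v ℕ.* n ℕ.+ p ℕ.* v ℕ.* n ≡ 2 ℕ.* p ℕ.* n ℕ.* v
    double = solve-∀

  norm-k : ∀ n a → norm n (k a) ≡ a
  norm-k zero    a = refl
  norm-k (suc n) a = trans (cong (λ z → a ℕ.+ z) (norm-zero n (λ _ → refl))) (ℕ.+-identityʳ a)

  -- The limits 1 and 8 are the values of 2^r·N r at r = 0 and r = 1; the starting values of both e
  -- and o respect them.
  norm-recur : ∀ a b n r → a ≤ 1 → b ≤ 8 → norm n (recur (k a) (k b) r) ≤ 2 ℕ.^ r ℕ.* N r ℕ.* 1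
  norm-recur a b n zero a≤ b≤ = ℕ.≤-trans (ℕ.≤-reflexive (norm-k n a)) a≤
  norm-recur a b n (suc zero) a≤ b≤ = ℕ.≤-trans (ℕ.≤-reflexive (norm-k n b)) b≤
  norm-recur a b n (suc (suc r)) a≤ b≤ = begin
    norm n (k (γ (suc r)) ⊛ h (suc r) ⊞ k (κ r) ⊛ (W ⊛ h r))
      ≤⟨ norm-⊞ n _ _ ⟩
    norm n (k (γ (suc r)) ⊛ h (suc r)) ℕ.+ norm n (k (κ r) ⊛ (W ⊛ h r))
      ≡⟨ cong₂ ℕ._+_ (norm-k⊛ n (γ (suc r)) (h (suc r))) (norm-k⊛ n (κ r) (W ⊛ h r)) ⟩
    γ (suc r) ℕ.* norm n (h (suc r)) ℕ.+ κ r ℕ.* norm n (W ⊛ h r)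
      ≤⟨ growth-step r (ℕ.≤-trans (norm-W⊛ n (h r)) (norm-recur a b n r a≤ b≤)) (norm-recur a b n (suc r) a≤ b≤) ℕ.≤-refl ⟩
    2 ℕ.^ suc (suc r) ℕ.* N (suc (suc r)) ℕ.* 1 ∎
    where
    open ℕ.≤-Reasoning
    h : ℕ → Ser
    h = recur (k a) (k b)

  Deg : ℕ → Ser → Set
  Deg n f = ∀ i → n < i → f i ≡ + 0

  deg-⊛ : ∀ n l f g → Deg n f → Deg l g → Deg (n ℕ.+ l) (f ⊛ g)
  deg-⊛ zero    l f g p q (suc i) (s≤s lt) = cong₂ ℤ._+_
    (trans (cong (f 0 ℤ.*_) (q (suc i) (s≤s lt))) (ℤ.*-zeroʳ (f 0)))
    (⊛-zeroˡ g (λ j → p (suc j) (s≤s z≤n)) i)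
  deg-⊛ (suc n) l f g p q (suc i) (s≤s lt) = cong₂ ℤ._+_
    (trans (cong (f 0 ℤ.*_) (q (suc i) (s≤s (ℕ.≤-trans (ℕ.m≤n+m l (suc n)) lt)))) (ℤ.*-zeroʳ (f 0)))
    (deg-⊛ n l (tl f) g (λ j h → p (suc j) (s≤s h)) q i lt)

  module _ (Z m : ℤ) where

    -- The homogenised value Σ f i · mⁱ · Z^(n-i) of the degree-n truncation of f.
    eval : ℕ → Ser → ℤ
    eval zero    f = f 0
    eval (suc n) f = f 0 ℤ.* Z ℤ.^ suc n ℤ.+ m ℤ.* eval n (tl f)

    eval-cong : ∀ n {f g} → f S.≈ g → eval n f ≡ eval n g
    eval-cong zero    p = p 0
    eval-cong (suc n) p = cong₂ (λ a b → a ℤ.* Z ℤ.^ suc n ℤ.+ m ℤ.* b) (p 0) (eval-cong n (λ i → p (suc i)))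

    eval-zero : ∀ n {f} → (∀ i → f i ≡ + 0) → eval n f ≡ + 0
    eval-zero zero    p = p 0
    eval-zero (suc n) p = trans (cong₂ (λ a b → a ℤ.* Z ℤ.^ suc n ℤ.+ m ℤ.* b) (p 0) (eval-zero n (λ i → p (suc i))))
                                (trans (ℤ.+-identityˡ _) (ℤ.*-zeroʳ m))

    eval-⊞ : ∀ n f g → eval n (f ⊞ g) ≡ eval n f ℤ.+ eval n g
    eval-⊞ zero    f g = refl
    eval-⊞ (suc n) f g = trans (cong (λ b → (f 0 ℤ.+ g 0) ℤ.* Z ℤ.^ suc n ℤ.+ m ℤ.* b) (eval-⊞ n (tl f) (tl g)))
      (regroup (f 0) (g 0) (Z ℤ.^ suc n) m (eval n (tl f)) (eval n (tl g)))
      where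
      regroup : ∀ a b z m u v → (a ℤ.+ b) ℤ.* z ℤ.+ m ℤ.* (u ℤ.+ v) ≡ a ℤ.* z ℤ.+ m ℤ.* u ℤ.+ (b ℤ.* z ℤ.+ m ℤ.* v)
      regroup = solveℤ-∀

    eval-scale : ∀ n a f → eval n (λ i → a ℤ.* f i) ≡ a ℤ.* eval n f
    eval-scale zero    a f = refl
    eval-scale (suc n) a f = trans (cong (λ b → a ℤ.* f 0 ℤ.* Z ℤ.^ suc n ℤ.+ m ℤ.* b) (eval-scale n a (tl f)))
      (regroup a (f 0) (Z ℤ.^ suc n) m (eval n (tl f)))
      where
      regroup : ∀ a b z m u → a ℤ.* b ℤ.* z ℤ.+ m ℤ.* (a ℤ.* u) ≡ a ℤ.* (b ℤ.* z ℤ.+ m ℤ.* u)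
      regroup = solveℤ-∀

    eval-⊛ : ∀ n l f g → Deg n f → Deg l g → eval (n ℕ.+ l) (f ⊛ g) ≡ eval n f ℤ.* eval l g
    eval-⊛ zero    l f g p q = trans (eval-cong l f⊛g) (eval-scale l (f 0) g)
      where
      f⊛g : f ⊛ g S.≈ λ i → f 0 ℤ.* g i
      f⊛g zero    = refl
      f⊛g (suc i) = trans (cong (λ z → f 0 ℤ.* g (suc i) ℤ.+ z) (⊛-zeroˡ g (λ j → p (suc j) (s≤s z≤n)) i)) (ℤ.+-identityʳ _)
    eval-⊛ (suc n) l f g p q = trans
      (cong (λ b → f 0 ℤ.* g 0 ℤ.* Z ℤ.^ suc (n ℕ.+ l) ℤ.+ m ℤ.* b)
        (trans (eval-⊞ (n ℕ.+ l) (λ i → f 0 ℤ.* g (suc i)) (tl f ⊛ g))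
               (cong₂ ℤ._+_ (eval-scale (n ℕ.+ l) (f 0) (tl g)) (eval-⊛ n l (tl f) g (λ j h → p (suc j) (s≤s h)) q))))
      (trans (regroup (f 0) (g 0) (Z ℤ.^ suc (n ℕ.+ l)) m (eval (n ℕ.+ l) (tl g)) (eval n (tl f)) (eval l g))
        (trans (cong (λ b → f 0 ℤ.* b ℤ.+ m ℤ.* eval n (tl f) ℤ.* eval l g) (raise (suc n) l g q))
               (factor (f 0) (Z ℤ.^ suc n) (eval l g) (m ℤ.* eval n (tl f)))))
      where
      regroup : ∀ a b z m u v w → a ℤ.* b ℤ.* z ℤ.+ m ℤ.* (a ℤ.* u ℤ.+ v ℤ.* w) ≡ a ℤ.* (b ℤ.* z ℤ.+ m ℤ.* u) ℤ.+ m ℤ.* v ℤ.* w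
      regroup = solveℤ-∀
      factor : ∀ a z u v → a ℤ.* (z ℤ.* u) ℤ.+ v ℤ.* u ≡ (a ℤ.* z ℤ.+ v) ℤ.* u
      factor = solveℤ-∀
      raise : ∀ j l g → Deg l g → eval (j ℕ.+ l) g ≡ Z ℤ.^ j ℤ.* eval l g
      raise zero    l g q = sym (ℤ.*-identityˡ _)
      raise (suc j) zero g q = trans (cong (λ b → g 0 ℤ.* Z ℤ.^ suc (j ℕ.+ 0) ℤ.+ m ℤ.* b) (eval-zero (j ℕ.+ 0) (λ i → q (suc i) (s≤s z≤n))))
        (trans (cong (λ i → g 0 ℤ.* Z ℤ.^ suc i ℤ.+ m ℤ.* + 0) (ℕ.+-identityʳ j)) (simplify (g 0) (Z ℤ.^ suc j) m))
        where
        simplify : ∀ a z m → a ℤ.* z ℤ.+ m ℤ.* + 0 ≡ z ℤ.* a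
        simplify = solveℤ-∀
      raise (suc j) (suc l) g q = trans
        (cong₂ (λ z b → g 0 ℤ.* z ℤ.+ m ℤ.* b) (ℤ.^-distribˡ-+-* Z (suc j) (suc l))
          (trans (cong (λ i → eval i (tl g)) (ℕ.+-suc j l)) (raise (suc j) l (tl g) (λ i h → q (suc i) (s≤s h)))))
        (pull (g 0) (Z ℤ.^ suc j) (Z ℤ.^ suc l) m (eval l (tl g)))
        where
        pull : ∀ a y z m u → a ℤ.* (y ℤ.* z) ℤ.+ m ℤ.* (y ℤ.* u) ≡ y ℤ.* (a ℤ.* z ℤ.+ m ℤ.* u)
        pull = solveℤ-∀

    -- `eval` is multiplicative only when the degrees stay within the truncation, so the degree
    -- bound travels with the value.
    Value : ℕ → Ser → ℤ → Set
    Value n f v = Deg n f × eval n f ≡ v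

    value-⊛ : ∀ {n l f g u v} → Value n f u → Value l g v → Value (n ℕ.+ l) (f ⊛ g) (u ℤ.* v)
    value-⊛ {n} {l} {f} {g} (p , refl) (q , refl) = deg-⊛ n l f g p q , eval-⊛ n l f g p q

    value-⊞ : ∀ {n f g u v} → Value n f u → Value n g v → Value n (f ⊞ g) (u ℤ.+ v)
    value-⊞ {n} {f} {g} (p , refl) (q , refl) = (λ i h → cong₂ ℤ._+_ (p i h) (q i h)) , eval-⊞ n f g

    value-⊟ : ∀ {n f u} → Value n f u → Value n (⊟ f) (ℤ.- u)
    value-⊟ {n} {f} (p , refl) = (λ i h → cong ℤ.-_ (p i h)) ,
      trans (eval-cong n (λ i → sym (ℤ.-1*i≡-i (f i)))) (trans (eval-scale n (ℤ.- + 1) f) (ℤ.-1*i≡-i (eval n f)))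

    value-k : ∀ a → Value 0 (k a) (+ a)
    value-k a = (λ { (suc i) _ → refl }) , refl

    value-W : Value 1 W m
    value-W = (λ { (suc zero) (s≤s ()) ; (suc (suc i)) _ → refl }) , trans (ℤ.+-identityˡ _) (ℤ.*-identityʳ m)

    -- Counting f as one degree higher costs a factor Z; this brings summands of unequal degree
    -- together.
    value-raise : ∀ {n f u} → Value n f u → Value (suc n) f (Z ℤ.* u)
    value-raise {n} {f} {u} v = (λ i h → trans (sym (S.*-identityˡ f i)) (proj₁ product i h)) ,
      trans (eval-cong (suc n) (S.sym (S.*-identityˡ f))) (trans (proj₂ product) (cong (ℤ._* u) (simplify Z m)))
      where
      simplify : ∀ Z m → + 1 ℤ.* (Z ℤ.* + 1) ℤ.+ m ℤ.* + 0 ≡ Z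
      simplify = solveℤ-∀
      product : Value (suc n) (k 1 ⊛ f) ((+ 1 ℤ.* (Z ℤ.* + 1) ℤ.+ m ℤ.* + 0) ℤ.* u)
      product = value-⊛ {1} {n} {k 1} {f} ((λ { (suc zero) (s≤s ()) ; (suc (suc i)) _ → refl }) , refl) v

  ∣eval∣≤ : ∀ Z m n f → m ≤ Z → ∣ eval (+ Z) (+ m) n f ∣ ≤ Z ^ n * norm n f
  ∣eval∣≤ Z m zero    f m≤Z = ℕ.≤-reflexive (sym (ℕ.+-identityʳ _))
  ∣eval∣≤ Z m (suc n) f m≤Z = begin
    ∣ f 0 ℤ.* (+ Z) ℤ.^ suc n ℤ.+ + m ℤ.* eval (+ Z) (+ m) n (tl f) ∣
      ≤⟨ ℤ.∣i+j∣≤∣i∣+∣j∣ (f 0 ℤ.* (+ Z) ℤ.^ suc n) _ ⟩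
    ∣ f 0 ℤ.* (+ Z) ℤ.^ suc n ∣ ℕ.+ ∣ + m ℤ.* eval (+ Z) (+ m) n (tl f) ∣
      ≡⟨ cong₂ ℕ._+_ (trans (ℤ.abs-* (f 0) _) (cong (∣ f 0 ∣ *_) (abs-^ (suc n)))) (ℤ.abs-* (+ m) _) ⟩
    ∣ f 0 ∣ * Z ^ suc n ℕ.+ m * ∣ eval (+ Z) (+ m) n (tl f) ∣
      ≤⟨ ℕ.+-monoʳ-≤ (∣ f 0 ∣ * Z ^ suc n) (ℕ.*-mono-≤ m≤Z (∣eval∣≤ Z m n (tl f) m≤Z)) ⟩
    ∣ f 0 ∣ * Z ^ suc n ℕ.+ Z * (Z ^ n * norm n (tl f))
      ≡⟨ regroup ∣ f 0 ∣ Z (Z ^ n) (norm n (tl f)) ⟩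
    Z ^ suc n * norm (suc n) f ∎
    where
    open ℕ.≤-Reasoning
    abs-^ : ∀ i → ∣ (+ Z) ℤ.^ i ∣ ≡ Z ^ i
    abs-^ zero    = refl
    abs-^ (suc i) = trans (ℤ.abs-* (+ Z) _) (cong (Z *_) (abs-^ i))
    regroup : ∀ a z p u → a * (z * p) ℕ.+ z * (p * u) ≡ z * p * (a ℕ.+ u)
    regroup = solve-∀

  -- Here vanishing turns into smallness: the first r coefficients drop out, so r of the factors Z
  -- are replaced by m.
  ∣eval∣≤-ord : ∀ Z m r n f → m ≤ Z → Ord r f → ∣ eval (+ Z) (+ m) (r ℕ.+ n) f ∣ ≤ m ^ r * Z ^ n * norm (r ℕ.+ n) f
  ∣eval∣≤-ord Z m zero    n f m≤Z h = ℕ.≤-trans (∣eval∣≤ Z m n f m≤Z)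
    (ℕ.≤-reflexive (cong (_* norm n f) (sym (ℕ.*-identityˡ (Z ^ n)))))
  ∣eval∣≤-ord Z m (suc r) n f m≤Z h = begin
    ∣ f 0 ℤ.* (+ Z) ℤ.^ suc (r ℕ.+ n) ℤ.+ + m ℤ.* eval (+ Z) (+ m) (r ℕ.+ n) (tl f) ∣
      ≡⟨ cong ∣_∣ (trans (cong (λ a → a ℤ.* (+ Z) ℤ.^ suc (r ℕ.+ n) ℤ.+ + m ℤ.* eval (+ Z) (+ m) (r ℕ.+ n) (tl f)) (h 0 (s≤s z≤n)))
                         (ℤ.+-identityˡ (+ m ℤ.* eval (+ Z) (+ m) (r ℕ.+ n) (tl f)))) ⟩
    ∣ + m ℤ.* eval (+ Z) (+ m) (r ℕ.+ n) (tl f) ∣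
      ≡⟨ ℤ.abs-* (+ m) (eval (+ Z) (+ m) (r ℕ.+ n) (tl f)) ⟩
    m * ∣ eval (+ Z) (+ m) (r ℕ.+ n) (tl f) ∣
      ≤⟨ ℕ.*-monoʳ-≤ m (∣eval∣≤-ord Z m r n (tl f) m≤Z (λ i p → h (suc i) (s≤s p))) ⟩
    m * (m ^ r * Z ^ n * norm (r ℕ.+ n) (tl f))
      ≤⟨ ℕ.*-monoʳ-≤ m (ℕ.*-monoʳ-≤ (m ^ r * Z ^ n) (ℕ.m≤n+m (norm (r ℕ.+ n) (tl f)) ∣ f 0 ∣)) ⟩
    m * (m ^ r * Z ^ n * norm (suc r ℕ.+ n) f)
      ≡⟨ regroup m (m ^ r) (Z ^ n) (norm (suc r ℕ.+ n) f) ⟩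
    m ^ suc r * Z ^ n * norm (suc r ℕ.+ n) f ∎
    where
    open ℕ.≤-Reasoning
    regroup : ∀ m p z u → m * (p * z * u) ≡ m * p * z * u
    regroup = solve-∀

  -- The coefficient of √(-m) in (a + b√(-m))⁴(X - √(-m)), computed by squaring twice.
  quartic : (X m a b : ℤ) → ℤ
  quartic X m a b = + 2 ℤ.* X ℤ.* (c ℤ.* d) ℤ.- (c ℤ.* c ℤ.- m ℤ.* (d ℤ.* d))
    where
    c d : ℤ
    c = a ℤ.* a ℤ.- m ℤ.* (b ℤ.* b)
    d = + 2 ℤ.* (a ℤ.* b)

  padé : (X m a b : ℕ) → ℕ → ℕ
  padé X m a b zero          = a
  padé X m a b (suc zero)    = b
  padé X m a b (suc (suc r)) = γ (suc r) * X * padé X m a b (suc r) ℕ.+ κ r * m * padé X m a b r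

  -- E + O √(-m) is the r-th denominator at τ = √(-m)/X, cleared of denominators.
  E O : (X m : ℕ) → ℕ → ℕ
  E X m = padé X m 1 (4 * X)
  O X m = padé X m 0 1

  module _ (X m : ℕ) where

    Z : ℤ
    Z = + X ℤ.* + X

    pos-padé : ∀ a b r → + padé X m a b (suc (suc r)) ≡
      + γ (suc r) ℤ.* + X ℤ.* + padé X m a b (suc r) ℤ.+ + κ r ℤ.* + m ℤ.* + padé X m a b r
    pos-padé a b r = cong₂ ℤ._+_
      (trans (ℤ.pos-* (γ (suc r) * X) _) (cong (ℤ._* + padé X m a b (suc r)) (ℤ.pos-* (γ (suc r)) X)))
      (trans (ℤ.pos-* (κ r * m) _) (cong (ℤ._* + padé X m a b r) (ℤ.pos-* (κ r) m)))

    module _ (t : ℤ) (a b c d : ℕ) where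
      private
        h : ℕ → Ser
        h = recur (k a) (k b)
        Scaled : ℕ → Set
        Scaled r = Value Z (+ m) r (h r) ((+ X) ℤ.^ r ℤ.* (t ℤ.* + padé X m c d r))

      value-step : ∀ r → Scaled r → Scaled (suc r) → Scaled (suc (suc r))
      value-step r v₀ v₁ = proj₁ v , trans (proj₂ v)
        (trans (regroup (+ X) ((+ X) ℤ.^ r) t (+ γ (suc r)) (+ κ r) (+ m) (+ padé X m c d (suc r)) (+ padé X m c d r))
               (cong (λ z → (+ X) ℤ.^ suc (suc r) ℤ.* (t ℤ.* z)) (sym (pos-padé c d r))))
        where
        V₁ V₀ : ℤ
        V₁ = (+ X) ℤ.^ suc r ℤ.* (t ℤ.* + padé X m c d (suc r))
        V₀ = (+ X) ℤ.^ r ℤ.* (t ℤ.* + padé X m c d r)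
        v : Value Z (+ m) (suc (suc r)) (h (suc (suc r)))
              (Z ℤ.* (+ γ (suc r) ℤ.* V₁) ℤ.+ Z ℤ.* (+ κ r ℤ.* (+ m ℤ.* V₀)))
        v = value-⊞ Z (+ m)
          (value-raise Z (+ m) {suc r} {k (γ (suc r)) ⊛ h (suc r)}
            (value-⊛ Z (+ m) {0} {suc r} (value-k Z (+ m) (γ (suc r))) v₁))
          (value-raise Z (+ m) {suc r} {k (κ r) ⊛ (W ⊛ h r)}
            (value-⊛ Z (+ m) {0} {suc r} (value-k Z (+ m) (κ r))
              (value-⊛ Z (+ m) {1} {r} (value-W Z (+ m)) v₀)))
        regroup : ∀ X p t g l m u v →
          X ℤ.* X ℤ.* (g ℤ.* (X ℤ.* p ℤ.* (t ℤ.* u))) ℤ.+ X ℤ.* X ℤ.* (l ℤ.* (m ℤ.* (p ℤ.* (t ℤ.* v))))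
          ≡ X ℤ.* (X ℤ.* p) ℤ.* (t ℤ.* (g ℤ.* X ℤ.* u ℤ.+ l ℤ.* m ℤ.* v))
        regroup = solveℤ-∀

      -- In degree r, `eval` multiplies by X^(2r), whereas E and O absorb only X^r and X^(r-1). This
      -- explains the factor X^r, and t = 1 for e but t = X for o.
      value-recur : + a ≡ t ℤ.* + c → Z ℤ.* + b ≡ + X ℤ.* (t ℤ.* + d) → ∀ r → Scaled r
      value-recur p q zero = proj₁ (value-k Z (+ m) a) , trans p (sym (ℤ.*-identityˡ _))
      value-recur p q (suc zero) = proj₁ v ,
        trans (proj₂ v) (trans q (cong (ℤ._* (t ℤ.* + d)) (sym (ℤ.*-identityʳ (+ X)))))
        where
        v : Value Z (+ m) 1 (k b) (Z ℤ.* + b)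
        v = value-raise Z (+ m) {0} {k b} (value-k Z (+ m) b)
      value-recur p q (suc (suc r)) = value-step r (value-recur p q r) (value-recur p q (suc r))

    value-e : ∀ r → Value Z (+ m) r (e r) ((+ X) ℤ.^ r ℤ.* (+ 1 ℤ.* + E X m r))
    value-e = value-recur (+ 1) 1 4 1 (4 * X) refl (trans (regroup (+ X)) (cong (λ z → + X ℤ.* (+ 1 ℤ.* z)) (sym (ℤ.pos-* 4 X))))
      where
      regroup : ∀ X → X ℤ.* X ℤ.* + 4 ≡ X ℤ.* (+ 1 ℤ.* (+ 4 ℤ.* X))
      regroup = solveℤ-∀

    value-o : ∀ r → Value Z (+ m) r (o r) ((+ X) ℤ.^ r ℤ.* (+ X ℤ.* + O X m r))
    value-o = value-recur (+ X) 0 1 0 1 (sym (ℤ.*-zeroʳ (+ X))) (regroup (+ X))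
      where
      regroup : ∀ X → X ℤ.* X ℤ.* + 1 ≡ X ℤ.* (X ℤ.* + 1)
      regroup = solveℤ-∀

    value-Φ : ∀ n e o u v → Value Z (+ m) n e u → Value Z (+ m) n o v →
      Value Z (+ m) (suc (n ℕ.+ n) ℕ.+ suc (n ℕ.+ n)) (Φ e o)
        (Z ℤ.* (+ 2 ℤ.* ((Z ℤ.* (u ℤ.* u) ℤ.- + m ℤ.* (v ℤ.* v)) ℤ.* (+ 2 ℤ.* (u ℤ.* v))))
         ℤ.- ((Z ℤ.* (u ℤ.* u) ℤ.- + m ℤ.* (v ℤ.* v)) ℤ.* (Z ℤ.* (u ℤ.* u) ℤ.- + m ℤ.* (v ℤ.* v))
              ℤ.- Z ℤ.* (+ m ℤ.* ((+ 2 ℤ.* (u ℤ.* v)) ℤ.* (+ 2 ℤ.* (u ℤ.* v))))))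
    value-Φ n e o u v ve vo = plus
      (subst (λ i → Value Z (+ m) i (k 2 ⊛ (c ⊛ d)) (Z ℤ.* (+ 2 ℤ.* (C ℤ.* D)))) (sym (ℕ.+-suc (suc (n ℕ.+ n)) (n ℕ.+ n)))
        (raise {suc (n ℕ.+ n) ℕ.+ (n ℕ.+ n)} (times (const 2) (times vc vd))))
      (value-⊟ Z (+ m) (plus (times vc vc) (value-⊟ Z (+ m)
        (subst (λ i → Value Z (+ m) i (W ⊛ (d ⊛ d)) (Z ℤ.* (+ m ℤ.* (D ℤ.* D)))) (sym (ℕ.+-suc (suc (n ℕ.+ n)) (n ℕ.+ n)))
          (raise {1 ℕ.+ ((n ℕ.+ n) ℕ.+ (n ℕ.+ n))} (times (value-W Z (+ m)) (times vd vd)))))))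
      where
      plus = λ {n f g u v} → value-⊞ Z (+ m) {n} {f} {g} {u} {v}
      times = λ {n l f g u v} → value-⊛ Z (+ m) {n} {l} {f} {g} {u} {v}
      raise = λ {n f u} → value-raise Z (+ m) {n} {f} {u}
      const = value-k Z (+ m)
      C D : ℤ
      C = Z ℤ.* (u ℤ.* u) ℤ.- + m ℤ.* (v ℤ.* v)
      D = + 2 ℤ.* (u ℤ.* v)
      c d : Ser
      c = e ⊛ e ⊞ ⊟ (W ⊛ (o ⊛ o))
      d = k 2 ⊛ (e ⊛ o)
      vc : Value Z (+ m) (suc (n ℕ.+ n)) c (Z ℤ.* (u ℤ.* u) ℤ.- + m ℤ.* (v ℤ.* v))
      vc = plus (raise {n ℕ.+ n} (times ve ve)) (value-⊟ Z (+ m) (times (value-W Z (+ m)) (times vo vo)))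
      vd : Value Z (+ m) (n ℕ.+ n) d (+ 2 ℤ.* (u ℤ.* v))
      vd = times (const 2) (times ve vo)

    eval-Φ : ∀ r → eval Z (+ m) (suc (r ℕ.+ r) ℕ.+ suc (r ℕ.+ r)) (Φ (e r) (o r))
      ≡ ((+ X) ℤ.^ r ℤ.* + X) ℤ.* ((+ X) ℤ.^ r ℤ.* + X) ℤ.* (((+ X) ℤ.^ r ℤ.* + X) ℤ.* ((+ X) ℤ.^ r ℤ.* + X)) ℤ.* quartic (+ X) (+ m) (+ E X m r) (+ O X m r)
    eval-Φ r = trans (proj₂ (value-Φ r (e r) (o r) _ _ (value-e r) (value-o r)))
      (regroup (+ X) ((+ X) ℤ.^ r) (+ m) (+ E X m r) (+ O X m r))
      where
      regroup : ∀ X p m a b →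
        let u = p ℤ.* (+ 1 ℤ.* a)
            v = p ℤ.* (X ℤ.* b)
            Z = X ℤ.* X
            q = p ℤ.* X
            c = a ℤ.* a ℤ.- m ℤ.* (b ℤ.* b)
            d = + 2 ℤ.* (a ℤ.* b) in
        Z ℤ.* (+ 2 ℤ.* ((Z ℤ.* (u ℤ.* u) ℤ.- m ℤ.* (v ℤ.* v)) ℤ.* (+ 2 ℤ.* (u ℤ.* v))))
         ℤ.- ((Z ℤ.* (u ℤ.* u) ℤ.- m ℤ.* (v ℤ.* v)) ℤ.* (Z ℤ.* (u ℤ.* u) ℤ.- m ℤ.* (v ℤ.* v))
              ℤ.- Z ℤ.* (m ℤ.* ((+ 2 ℤ.* (u ℤ.* v)) ℤ.* (+ 2 ℤ.* (u ℤ.* v)))))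
        ≡ q ℤ.* q ℤ.* (q ℤ.* q) ℤ.* (+ 2 ℤ.* X ℤ.* (c ℤ.* d) ℤ.- (c ℤ.* c ℤ.- m ℤ.* (d ℤ.* d)))
      regroup = solveℤ-∀

  -- Homogenised in degree 4r + 2, Φ(e r, o r) has the value X^(4r+4)·Φ(E, O). Having order r, it is
  -- at most m^r·X^(6r+4) times its norm; the common power of X is divided out.
  quartic-padé : ∀ X m r → 0 < X → m ≤ X * X → let B = 2 ^ r * N r in
    ∣ quartic (+ X) (+ m) (+ E X m r) (+ O X m r) ∣ ≤ m ^ r * (X ^ r * X ^ r) * (16 * (B * B * (B * B)))
  quartic-padé X m r X>0 m≤XX = ℕ.*-cancelˡ-≤ (q * q * (q * q)) {{ℕ.>-nonZero (pos (pos q>0 q>0) (pos q>0 q>0))}} (begin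
    q * q * (q * q) * ∣ F ∣
      ≡⟨ trans (ℤ.abs-* qℤ⁴ F) (cong (_* ∣ F ∣) abs-q⁴) ⟨
    ∣ qℤ⁴ ℤ.* F ∣
      ≡⟨ cong ∣_∣ (trans (sym (eval-Φ X m r)) (cong₂ (λ z n → eval z (+ m) n (Φ (e r) (o r))) (sym (ℤ.pos-* X X)) (degree r))) ⟩
    ∣ eval (+ (X * X)) (+ m) (r ℕ.+ n) (Φ (e r) (o r)) ∣
      ≤⟨ ∣eval∣≤-ord (X * X) m r n (Φ (e r) (o r)) m≤XX (ord-Φ r) ⟩
    m ^ r * (X * X) ^ n * norm (r ℕ.+ n) (Φ (e r) (o r))
      ≤⟨ ℕ.*-monoʳ-≤ (m ^ r * (X * X) ^ n) (norm-Φ (r ℕ.+ n) (e r) (o r) B (bound 1 4 (s≤s z≤n) (ℕ.m≤m+n 4 4)) (bound 0 1 z≤n (s≤s z≤n))) ⟩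
    m ^ r * (X * X) ^ n * (16 * (B * B * (B * B)))
      ≡⟨ cong (λ z → m ^ r * z * (16 * (B * B * (B * B)))) power ⟩
    m ^ r * (q * q * (q * q) * (X ^ r * X ^ r)) * (16 * (B * B * (B * B)))
      ≡⟨ regroup (m ^ r) (q * q * (q * q)) (X ^ r * X ^ r) (16 * (B * B * (B * B))) ⟩
    q * q * (q * q) * (m ^ r * (X ^ r * X ^ r) * (16 * (B * B * (B * B)))) ∎)
    where
    open ℕ.≤-Reasoning
    B q n : ℕ
    B = 2 ^ r * N r
    q = X ^ r * X
    n = suc (suc (r ℕ.+ (r ℕ.+ r)))
    F qℤ⁴ : ℤ
    F = quartic (+ X) (+ m) (+ E X m r) (+ O X m r)
    qℤ⁴ = ((+ X) ℤ.^ r ℤ.* + X) ℤ.* ((+ X) ℤ.^ r ℤ.* + X) ℤ.* (((+ X) ℤ.^ r ℤ.* + X) ℤ.* ((+ X) ℤ.^ r ℤ.* + X))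
    pos : ∀ {a b} → 0 < a → 0 < b → 0 < a * b
    pos = ℕ.*-mono-≤
    q>0 : 0 < q
    q>0 = pos (ℕ.m^n>0 X {{ℕ.>-nonZero X>0}} r) X>0
    abs-q : ∣ (+ X) ℤ.^ r ℤ.* + X ∣ ≡ q
    abs-q = trans (ℤ.abs-* ((+ X) ℤ.^ r) (+ X)) (cong (_* X) (abs-^ r))
      where
      abs-^ : ∀ i → ∣ (+ X) ℤ.^ i ∣ ≡ X ^ i
      abs-^ zero    = refl
      abs-^ (suc i) = trans (ℤ.abs-* (+ X) _) (cong (X *_) (abs-^ i))
    abs-q² : ∣ ((+ X) ℤ.^ r ℤ.* + X) ℤ.* ((+ X) ℤ.^ r ℤ.* + X) ∣ ≡ q * q
    abs-q² = trans (ℤ.abs-* ((+ X) ℤ.^ r ℤ.* + X) _) (cong₂ _*_ abs-q abs-q)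
    abs-q⁴ : ∣ qℤ⁴ ∣ ≡ q * q * (q * q)
    abs-q⁴ = trans (ℤ.abs-* (((+ X) ℤ.^ r ℤ.* + X) ℤ.* ((+ X) ℤ.^ r ℤ.* + X)) _) (cong₂ _*_ abs-q² abs-q²)
    degree : ∀ r → suc (r ℕ.+ r) ℕ.+ suc (r ℕ.+ r) ≡ r ℕ.+ suc (suc (r ℕ.+ (r ℕ.+ r)))
    degree = solve-∀
    bound : ∀ a b → a ≤ 1 → b ≤ 8 → norm (r ℕ.+ n) (recur (k a) (k b) r) ≤ B
    bound a b p q = ℕ.≤-trans (norm-recur a b (r ℕ.+ n) r p q) (ℕ.≤-reflexive (ℕ.*-identityʳ B))
    power : (X * X) ^ n ≡ q * q * (q * q) * (X ^ r * X ^ r)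
    power = trans (*-^ X X n) (trans (cong (λ z → z * z) X^n) (expand X (X ^ r)))
      where
      X^n : X ^ n ≡ X * (X * (X ^ r * (X ^ r * X ^ r)))
      X^n = cong (λ z → X * (X * z)) (trans (ℕ.^-distribˡ-+-* X r (r ℕ.+ r)) (cong (X ^ r *_) (ℕ.^-distribˡ-+-* X r r)))
      expand : ∀ X p → X * (X * (p * (p * p))) * (X * (X * (p * (p * p)))) ≡ p * X * (p * X) * (p * X * (p * X)) * (p * p)
      expand = solve-∀
    regroup : ∀ a b c d → a * (b * c) * d ≡ b * (a * c * d)
    regroup = solve-∀

-- Fixed points of contractions on power series.

module FixedPoint {c ℓ} (R : CommutativeRing c ℓ) where
  open import Data.Nat.Base as ℕ using (ℕ; zero; suc; _<_; z≤n; s≤s)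
  import Data.Nat.Properties as ℕ
  open import Data.Product.Base using (Σ; _,_)
  open import Relation.Binary.PropositionalEquality using (subst)
  open CommutativeRing R
  open Series R
  private module S = CommutativeRing series-commutativeRing

  Agree : ℕ → Ser → Ser → Set ℓ
  Agree n f g = ∀ i → i < n → f i ≈ g i

  agree-⊛ : ∀ {n f f′ g g′} → Agree n f f′ → Agree n g g′ → Agree n (f ⊛ g) (f′ ⊛ g′)
  agree-⊛ {suc n} p q zero    lt       = *-cong (p 0 lt) (q 0 lt)
  agree-⊛ {suc n} {f} {f′} {g} {g′} p q (suc i) (s≤s lt) =
    +-cong (*-cong (p 0 (s≤s z≤n)) (q (suc i) (s≤s lt)))
           (agree-⊛ {n} {tl f} {tl f′} {g} {g′} (λ j h → p (suc j) (s≤s h)) (λ j h → q j (ℕ.m<n⇒m<1+n h)) i lt)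

  agree-W⊛ : ∀ {n f g} → Agree n f g → Agree (suc n) (W ⊛ f) (W ⊛ g)
  agree-W⊛ {f = f} {g} p zero    lt       = trans (zeroˡ _) (sym (zeroˡ _))
  agree-W⊛ {f = f} {g} p (suc i) (s≤s lt) = trans (W-⊛-suc f i) (trans (p i lt) (sym (W-⊛-suc g i)))

  agree-⊟ : ∀ {n f g} h → Agree n f g → Agree n (h ⊞ ⊟ f) (h ⊞ ⊟ g)
  agree-⊟ h p i lt = +-congˡ (-‿cong (p i lt))

  -- The iterates from 0 agree with each other in ever more coefficients, so coefficient n may be
  -- read off from iterate n + 1.
  fixedPoint : (step : Ser → Ser) → (∀ n f g → Agree n f g → Agree (suc n) (step f) (step g)) →
    Σ Ser λ f → f S.≈ step f
  fixedPoint step contract = fix , λ n →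
    trans (fix-agree (suc n) n ℕ.≤-refl) (sym (contract n fix (iter n) (fix-agree n) n ℕ.≤-refl))
    where
    iter : ℕ → Ser
    iter zero    = con 0#
    iter (suc n) = step (iter n)
    iter-suc : ∀ n → Agree n (iter n) (iter (suc n))
    iter-suc zero    i ()
    iter-suc (suc n) = contract n (iter n) (iter (suc n)) (iter-suc n)
    iter-+ : ∀ n j → Agree n (iter n) (iter (j ℕ.+ n))
    iter-+ n zero    i lt = refl
    iter-+ n (suc j) i lt = trans (iter-+ n j i lt) (iter-suc (j ℕ.+ n) i (ℕ.≤-trans lt (ℕ.m≤n+m n j)))
    fix : Ser
    fix n = iter (suc n) n
    fix-agree : ∀ n → Agree n fix (iter n)
    fix-agree n i lt = subst (λ z → iter (suc i) i ≈ iter z i) (ℕ.m∸n+n≡m lt)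
      (iter-+ (suc i) (n ℕ.∸ suc i) i ℕ.≤-refl)

  -- The equation f + a·w·f² = h says that 1 + 2a·w·f is a square root of 1 + 4a·w·h.
  solveQuadratic : ∀ a h → Σ Ser λ f → f S.≈ h ⊞ ⊟ (con a ⊛ (W ⊛ (f ⊛ f)))
  solveQuadratic a h = fixedPoint (λ f → h ⊞ ⊟ (con a ⊛ (W ⊛ (f ⊛ f)))) λ n f g p →
    agree-⊟ {suc n} h (agree-⊛ {suc n} {con a} {con a} (λ _ _ → refl)
      (agree-W⊛ {n} {f ⊛ f} {g ⊛ g} (agree-⊛ {n} {f} {g} {f} {g} p p)))

  solveLinear : ∀ a h → Σ Ser λ f → f S.≈ h ⊞ ⊟ (a ⊛ (W ⊛ f))
  solveLinear a h = fixedPoint (λ f → h ⊞ ⊟ (a ⊛ (W ⊛ f))) λ n f g p →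
    agree-⊟ {suc n} h (agree-⊛ {suc n} {a} {a} (λ _ _ → refl) (agree-W⊛ {n} {f} {g} p))

-- The factorial in the Padé denominators, by a generating function.

module PadéIntegrality {A : Set} {_+ᴿ_ _*ᴿ_ : A → A → A} { -ᴿ_ : A → A} {0ᴿ 1ᴿ : A}
  (isCR : IsCommutativeRing _≡_ _+ᴿ_ _*ᴿ_ -ᴿ_ 0ᴿ 1ᴿ)
  (ι : ℤ → A) (+-homo : ∀ a b → ι (a ℤ.+ b) ≡ ι a +ᴿ ι b) (*-homo : ∀ a b → ι (a ℤ.* b) ≡ ι a *ᴿ ι b)
  (-‿homo : ∀ a → ι (ℤ.- a) ≡ -ᴿ ι a) (0-homo : ι (+ 0) ≡ 0ᴿ) (1-homo : ι (+ 1) ≡ 1ᴿ)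
  (cancel-ι4 : ∀ f g → ι (+ 4) *ᴿ f ≡ ι (+ 4) *ᴿ g → f ≡ g)
  (X̂ m̂ v̂ : A) (v̂² : v̂ *ᴿ v̂ ≡ -ᴿ m̂) where
  open import Data.Nat.Base using (ℕ; zero; suc)
  open import Data.Maybe.Base using (Maybe; map)
  open import Data.Product.Base using (Σ; _,_; proj₁; proj₂)
  open import Relation.Binary.Consequences using (dec⇒weaklyDec)
  open import Relation.Binary.PropositionalEquality
  import Algebra.Solver.Ring

  R : CommutativeRing _ _
  R = record { isCommutativeRing = isCR }

  ι-morphism : ℤ.+-*-rawRing -Raw-AlmostCommutative⟶ fromCommutativeRing R
  ι-morphism = record
    { ⟦_⟧ = ι ; +-homo = +-homo ; *-homo = *-homo ; -‿homo = -‿homo ; 0-homo = 0-homo ; 1-homo = 1-homo }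

  private module R = CommutativeRing R
  open Series R
  open FixedPoint R
  open Differences R using () renaming (vanish to Rvanish; _⊹_ to _R⊹_; fromDifference to RfromDifference)
  open Differences series-commutativeRing
  private module S = CommutativeRing series-commutativeRing

  ι-≟ : ∀ a b → Maybe (ι a ≡ ι b)
  ι-≟ a b = map (cong ι) (dec⇒weaklyDec ℤ._≟_ a b)

  module RSolver = Algebra.Solver.Ring ℤ.+-*-rawRing (fromCommutativeRing R) ι-morphism ι-≟

  con-⊞ : ∀ a b → con (a R.+ b) ≋ con a ⊞ con b
  con-⊞ a b zero    = refl
  con-⊞ a b (suc n) = sym (R.+-identityˡ _)

  con-⊟ : ∀ a → con (R.- a) ≋ ⊟ con a
  con-⊟ a zero    = refl
  con-⊟ a (suc n) = sym -0#≈0#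
    where open import Algebra.Properties.Ring R.ring using (-0#≈0#)

  con-cong : ∀ {a b} → a ≡ b → con a ≋ con b
  con-cong refl _ = refl

  con-* : ∀ a b → con (a R.* b) ≋ con a ⊛ con b
  con-* a b zero    = refl
  con-* a b (suc n) = sym (trans (con-⊛ a (con b) (suc n)) (R.zeroʳ a))

  k : ℤ → Ser
  k a = con (ι a)

  k-morphism : ℤ.+-*-rawRing -Raw-AlmostCommutative⟶ fromCommutativeRing series-commutativeRing
  k-morphism = record
    { ⟦_⟧ = k
    ; +-homo = λ a b → S.trans (con-cong (+-homo a b)) (con-⊞ (ι a) (ι b))
    ; *-homo = λ a b → S.trans (con-cong (*-homo a b)) (con-* (ι a) (ι b))
    ; -‿homo = λ a → S.trans (con-cong (-‿homo a)) (con-⊟ (ι a))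
    ; 0-homo = con-cong 0-homo ; 1-homo = con-cong 1-homo }

  k-≟ : ∀ a b → Maybe (k a ≋ k b)
  k-≟ a b = map (λ { refl _ → refl }) (dec⇒weaklyDec ℤ._≟_ a b)

  module SSolver = Algebra.Solver.Ring ℤ.+-*-rawRing (fromCommutativeRing series-commutativeRing) k-morphism k-≟
  open SSolver using (solve; _:=_; _:+_; _:*_; _:-_; :-_; Polynomial)
  K : ∀ {n} → ℤ → Polynomial n
  K = SSolver.con

  Xₛ mₛ v x y φ : Ser
  Xₛ = con X̂
  mₛ = con m̂
  v  = con v̂
  x  = Xₛ ⊞ v
  y  = Xₛ ⊞ ⊟ v
  φ  = (k (+ 1) ⊞ k (+ 8) ⊛ (x ⊛ W)) ⊛ (k (+ 1) ⊞ k (+ 8) ⊛ (y ⊛ W))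

  -- Two square roots are extracted in turn, each of the form 1 + 2ck with k + ck² given.
  fourthRoot : Σ Ser λ F → F ⊛ F ⊛ (F ⊛ F) ⊛ (k (+ 1) ⊞ k (+ 8) ⊛ (y ⊛ W)) ≋ k (+ 1) ⊞ k (+ 8) ⊛ (x ⊛ W)
  fourthRoot = k (+ 1) ⊞ k (+ 4) ⊛ (W ⊛ f₂) , fromDifference
    (solve 6 (λ w X v g f₁ f₂ →
      let F = K (+ 1) :+ K (+ 4) :* (w :* f₂)
          yw = K (+ 1) :+ K (+ 8) :* ((X :- v) :* w)
          G = K (+ 1) :+ K (+ 8) :* (w :* f₁)
      in F :* F :* (F :* F) :* yw :- (K (+ 1) :+ K (+ 8) :* ((X :+ v) :* w))
      := (F :* F :+ G) :* yw :* K (+ 8) :* w :* (f₂ :- (f₁ :- K (+ 2) :* (w :* (f₂ :* f₂))))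
      :+ (K (+ 16) :* yw :* w :* (f₁ :- (v :* g :- K (+ 4) :* (w :* (f₁ :* f₁))))
      :+ K (+ 16) :* w :* v :* (g :- (K (+ 1) :- K (+ 8) :* (X :- v) :* (w :* g)))))
      (λ _ → refl) W Xₛ v g f₁ f₂)
    (vanish _ f₂-eq ⊹ vanish _ f₁-eq ⊹ vanish (k (+ 16) ⊛ W ⊛ v) g-eq)
    where
    -- g is 1/(1 + 8yw). Because x - y = 2v, the quotient to be rooted is 1 + 16vwg; its root is 1 +
    -- 8wf₁, and the root of that is 1 + 4wf₂. The scale 8 keeps both halvings integral.
    g f₁ f₂ : Ser
    g  = proj₁ (solveLinear (k (+ 8) ⊛ y) (k (+ 1)))
    f₁ = proj₁ (solveQuadratic (ι (+ 4)) (v ⊛ g))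
    f₂ = proj₁ (solveQuadratic (ι (+ 2)) f₁)
    g-eq  = proj₂ (solveLinear (k (+ 8) ⊛ y) (k (+ 1)))
    f₁-eq = proj₂ (solveQuadratic (ι (+ 4)) (v ⊛ g))
    f₂-eq = proj₂ (solveQuadratic (ι (+ 2)) f₁)

  F : Ser
  F = proj₁ fourthRoot

  θ-const : ∀ a → θ (con a) ≋ S.0#
  θ-const a n = trans (θ-con a n) (zero-con n)
    where
    zero-con : ∀ n → 0ᴿ ≡ S.0# n
    zero-con zero    = refl
    zero-con (suc n) = refl

  θ-con⊛ : ∀ a f → θ (con a ⊛ f) ≋ con a ⊛ θ f
  θ-con⊛ a f = S.trans (θ-⊛ (con a) f)
    (S.trans (S.+-congʳ {con a ⊛ θ f} (S.trans (S.*-congʳ {f} (θ-const a)) (S.zeroˡ f))) (S.+-identityˡ (con a ⊛ θ f)))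

  cancel-4 : ∀ f g → k (+ 4) ⊛ f ≋ k (+ 4) ⊛ g → f ≋ g
  cancel-4 f g p n = cancel-ι4 (f n) (g n) (trans (sym (con-⊛ (ι (+ 4)) f n)) (trans (p n) (con-⊛ (ι (+ 4)) g n)))

  θ-linear : ∀ a → θ a ≋ S.0# → θ (k (+ 1) ⊞ k (+ 8) ⊛ (a ⊛ W)) ≋ k (+ 8) ⊛ (a ⊛ W)
  θ-linear a θa = S.trans (θ-⊞ (k (+ 1)) (k (+ 8) ⊛ (a ⊛ W)))
    (S.trans (S.+-cong (θ-const (ι (+ 1))) (S.trans (θ-con⊛ (ι (+ 8)) (a ⊛ W)) (S.*-congˡ {k (+ 8)}
      (S.trans (θ-⊛ a W) (S.trans (S.+-cong (S.trans (S.*-congʳ {W} θa) (S.zeroˡ W)) (S.*-congˡ {a} θ-W)) (S.+-identityˡ (a ⊛ W)))))))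
      (S.+-identityˡ (k (+ 8) ⊛ (a ⊛ W))))

  open RSolver using () renaming (solve to solveR; _:=_ to _:≡_; _:+_ to _⊕_; _:*_ to _⊗_; _:-_ to _⊖_; Polynomial to RPolynomial)
  C : ∀ {n} → ℤ → RPolynomial n
  C = RSolver.con

  α β : A
  α = ι (+ 16) R.* X̂
  β = ι (+ 64) R.* (X̂ R.* X̂ R.+ m̂)

  ψ ψ′ : Ser
  ψ  = k (+ 1) ⊞ con α ⊛ W ⊞ con β ⊛ (W ⊛ W)
  ψ′ = con α ⊛ W ⊞ k (+ 2) ⊛ (con β ⊛ (W ⊛ W))

  α≋ : con α ≋ k (+ 16) ⊛ Xₛ
  α≋ = con-* (ι (+ 16)) (X̂)

  β≋ : con β ≋ k (+ 64) ⊛ (Xₛ ⊛ Xₛ ⊞ mₛ)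
  β≋ = S.trans (con-* (ι (+ 64)) (X̂ R.* X̂ R.+ m̂)) (S.*-congˡ {k (+ 64)}
    (S.trans (con-⊞ (X̂ R.* X̂) (m̂)) (S.+-congʳ {mₛ} (con-* (X̂) (X̂)))))

  v² : v ⊛ v ≋ ⊟ mₛ
  v² = S.trans (S.sym (con-* v̂ v̂)) (S.trans (con-cong v̂²) (con-⊟ m̂))

  θ-k⊞ : ∀ a b → θ (con a ⊞ con b) ≋ S.0#
  θ-k⊞ a b = S.trans (θ-cong (S.sym (con-⊞ a b))) (θ-const (a R.+ b))

  θ-square : ∀ f → θ (f ⊛ f) ≋ k (+ 2) ⊛ (f ⊛ θ f)
  θ-square f = S.trans (θ-⊛ f f)
    (solve 2 (λ f t → t :* f :+ f :* t := K (+ 2) :* (f :* t)) (λ _ → refl) f (θ f))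

  ψ≋φ : ψ ≋ φ
  ψ≋φ = fromDifference
    (solve 6 (λ w X m v a b → K (+ 1) :+ a :* w :+ b :* (w :* w)
                :- (K (+ 1) :+ K (+ 8) :* ((X :+ v) :* w)) :* (K (+ 1) :+ K (+ 8) :* ((X :- v) :* w))
      := w :* (a :- K (+ 16) :* X) :+ (w :* w :* (b :- K (+ 64) :* (X :* X :+ m)) :+ K (+ 64) :* (w :* w) :* (v :* v :- (:- m))))
      (λ _ → refl) W Xₛ mₛ v (con α) (con β))
    (vanish W α≋ ⊹ vanish (W ⊛ W) β≋ ⊹ vanish (k (+ 64) ⊛ (W ⊛ W)) v²)

  θψ : θ ψ ≋ ψ′
  θψ = S.trans (θ-⊞ (k (+ 1) ⊞ con α ⊛ W) (con β ⊛ (W ⊛ W))) (S.+-cong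
    (S.trans (θ-⊞ (k (+ 1)) (con α ⊛ W)) (S.trans (S.+-cong (θ-const (ι (+ 1)))
      (S.trans (θ-con⊛ α W) (S.*-congˡ {con α} θ-W))) (S.+-identityˡ (con α ⊛ W))))
    (S.trans (θ-con⊛ β (W ⊛ W)) (S.trans (S.*-congˡ {con β} (S.trans (θ-square W) (S.*-congˡ {k (+ 2)} (S.*-congˡ {W} θ-W))))
      (solve 2 (λ b w → b :* (K (+ 2) :* (w :* w)) := K (+ 2) :* (b :* (w :* w))) (λ _ → refl) (con β) W))))

  -- Logarithmic differentiation of F⁴(1 + 8yw) = 1 + 8xw. Only four times the identity comes out,
  -- hence the assumption that 4 can be cancelled.
  θF : ψ ⊛ θ F ≋ k (+ 4) ⊛ (v ⊛ W) ⊛ F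
  θF = S.trans (S.*-congʳ {θ F} ψ≋φ) (cancel-4 _ _ (fromDifference
    (solve 5 (λ w X v F t →
      let a = K (+ 1) :+ K (+ 8) :* ((X :+ v) :* w)
          b = K (+ 1) :+ K (+ 8) :* ((X :- v) :* w)
      in K (+ 4) :* (a :* b :* t) :- K (+ 4) :* (K (+ 4) :* (v :* w) :* F)
      := F :* b :* ((K (+ 2) :* (F :* F :* (K (+ 2) :* (F :* t)))) :* b :+ F :* F :* (F :* F) :* (K (+ 8) :* ((X :- v) :* w)) :- K (+ 8) :* ((X :+ v) :* w))
      :+ :- (K (+ 4) :* b :* t :+ K (+ 8) :* (X :- v) :* w :* F) :* (F :* F :* (F :* F) :* b :- a))
      (λ _ → refl) W Xₛ v F (θ F))
    (vanish _ differentiated ⊹ vanish _ (proj₂ fourthRoot))))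
    where
    a b : Ser
    a = k (+ 1) ⊞ k (+ 8) ⊛ (x ⊛ W)
    b = k (+ 1) ⊞ k (+ 8) ⊛ (y ⊛ W)
    θy : θ y ≋ S.0#
    θy = S.trans (θ-cong (S.+-congˡ {Xₛ} (S.sym (con-⊟ v̂)))) (θ-k⊞ X̂ (-ᴿ v̂))
    differentiated : k (+ 2) ⊛ (F ⊛ F ⊛ (k (+ 2) ⊛ (F ⊛ θ F))) ⊛ b ⊞ F ⊛ F ⊛ (F ⊛ F) ⊛ (k (+ 8) ⊛ (y ⊛ W)) ≋ k (+ 8) ⊛ (x ⊛ W)
    differentiated = S.trans (S.sym (S.trans (θ-⊛ (F ⊛ F ⊛ (F ⊛ F)) b) (S.+-cong
        (S.*-congʳ {b} (S.trans (θ-square (F ⊛ F)) (S.*-congˡ {k (+ 2)} (S.*-congˡ {F ⊛ F} (θ-square F)))))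
        (S.*-congˡ {F ⊛ F ⊛ (F ⊛ F)} (θ-linear y θy)))))
      (S.trans (θ-cong (proj₂ fourthRoot)) (θ-linear x (θ-k⊞ (X̂) v̂)))

  -- The numeral n in the ring, defined so that its successor unfolds to the sum in which the solver
  -- meets it.
  ν : ℕ → A
  ν zero    = ι (+ 0)
  ν (suc n) = ι (+ 1) R.+ ν n

  -- The coefficient of s^r in Fₛ r = (1 + 8xs)^(r + 1/4) (1 + 8ys)^(r - 1/4) is the r-th denominator times 4^r/r!.
  Fₛ : ℕ → Ser
  Fₛ zero    = F
  Fₛ (suc r) = ψ ⊛ Fₛ r

  θFₛ : ∀ r → ψ ⊛ θ (Fₛ r) ≋ (con (ν r) ⊛ ψ′ ⊞ k (+ 4) ⊛ (v ⊛ W)) ⊛ Fₛ r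
  θFₛ zero = S.trans θF (S.*-congʳ {F} (S.sym (S.trans (S.+-congʳ {k (+ 4) ⊛ (v ⊛ W)} (S.trans (S.*-congʳ {ψ′} (con-cong 0-homo)) (S.zeroˡ ψ′))) (S.+-identityˡ _))))
  θFₛ (suc r) = S.trans (S.*-congˡ {ψ} (S.trans (θ-⊛ ψ (Fₛ r)) (S.+-cong (S.*-congʳ {Fₛ r} θψ) (θFₛ r))))
    (S.trans (solve 5 (λ p q f r u → p :* (q :* f :+ (r :* q :+ u) :* f) := ((K (+ 1) :+ r) :* q :+ u) :* (p :* f)) (λ _ → refl)
        ψ ψ′ (Fₛ r) (con (ν r)) (k (+ 4) ⊛ (v ⊛ W)))
      (S.*-congʳ {ψ ⊛ Fₛ r} (S.+-congʳ {k (+ 4) ⊛ (v ⊛ W)} (S.*-congʳ {ψ′} (S.sym (con-⊞ (ι (+ 1)) (ν r)))))))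

  open import Algebra.Properties.Semiring.Mult R.semiring using () renaming (_×_ to _·_)

  ·≡ι* : ∀ n a → n · a ≡ ν n R.* a
  ·≡ι* zero    a = sym (trans (cong (R._* a) 0-homo) (R.zeroˡ a))
  ·≡ι* (suc n) a = trans (cong (a R.+_) (·≡ι* n a))
    (solveR 2 (λ n a → a ⊕ n ⊗ a :≡ (C (+ 1) ⊕ n) ⊗ a) refl (ν n) a)

  coefficient-ψ : ∀ f n → (ψ ⊛ f) n ≡ f n R.+ α R.* (W ⊛ f) n R.+ β R.* (W ⊛ (W ⊛ f)) n
  coefficient-ψ f n = trans
    (solve 4 (λ w a b f → (K (+ 1) :+ a :* w :+ b :* (w :* w)) :* f := f :+ a :* (w :* f) :+ b :* (w :* (w :* f)))
      (λ _ → refl) W (con α) (con β) f n)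
    (cong₂ R._+_ (cong (f n R.+_) (con-⊛ α (W ⊛ f) n)) (con-⊛ β (W ⊛ (W ⊛ f)) n))

  coefficient-rhs : ∀ r f n → ((con (ν r) ⊛ ψ′ ⊞ k (+ 4) ⊛ (v ⊛ W)) ⊛ f) n
    ≡ ν r R.* α R.* (W ⊛ f) n R.+ ν r R.* ι (+ 2) R.* β R.* (W ⊛ (W ⊛ f)) n R.+ ι (+ 4) R.* v̂ R.* (W ⊛ f) n
  coefficient-rhs r f n = trans (fromDifference
      (solve 9 (λ w v a b r f ra rb fv →
        (r :* (a :* w :+ K (+ 2) :* (b :* (w :* w))) :+ K (+ 4) :* (v :* w)) :* f
        :- (ra :* (w :* f) :+ rb :* (w :* (w :* f)) :+ fv :* (w :* f))
        := :- (w :* f) :* (ra :- r :* a) :+ (:- (w :* (w :* f)) :* (rb :- r :* K (+ 2) :* b) :+ :- (w :* f) :* (fv :- K (+ 4) :* v)))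
        (λ _ → refl) W v (con α) (con β) (con (ν r)) f (con (ν r R.* α)) (con (ν r R.* ι (+ 2) R.* β)) (con (ι (+ 4) R.* v̂)))
      (vanish _ (con-* (ν r) α)
       ⊹ vanish _ (S.trans (con-* (ν r R.* ι (+ 2)) β) (S.*-congʳ {con β} (con-* (ν r) (ι (+ 2)))))
       ⊹ vanish _ (con-* (ι (+ 4)) v̂)) n)
    (cong₂ R._+_ (cong₂ R._+_ (con-⊛ (ν r R.* α) (W ⊛ f) n) (con-⊛ (ν r R.* ι (+ 2) R.* β) (W ⊛ (W ⊛ f)) n))
      (con-⊛ (ι (+ 4) R.* v̂) (W ⊛ f) n))

  W⊛θ : ∀ f n → (W ⊛ θ f) n ≡ ν n R.* (W ⊛ f) n R.- (W ⊛ f) n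
  W⊛θ f n = trans (solveR 2 (λ p q → q :≡ (p ⊕ q) ⊖ p) refl ((W ⊛ f) n) ((W ⊛ θ f) n))
    (cong (R._- (W ⊛ f) n) (trans (sym (trans (θ-⊛ W f n) (cong (R._+ (W ⊛ θ f) n) (⊛-cong {θ W} {W} {f} θ-W (λ _ → refl) n))))
                                  (·≡ι* n ((W ⊛ f) n))))

  W⊛W⊛θ : ∀ f n → (W ⊛ (W ⊛ θ f)) n ≡ ν n R.* (W ⊛ (W ⊛ f)) n R.- ι (+ 2) R.* (W ⊛ (W ⊛ f)) n
  W⊛W⊛θ f n = trans
    (fromDifference (solve 4 (λ w f t T → w :* (w :* t) :- (w :* T :- w :* (w :* f)) := :- w :* (T :- (w :* f :+ w :* t)))
        (λ _ → refl) W f (θ f) (θ (W ⊛ f)))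
      (vanish (⊟ W) (S.trans (θ-⊛ W f) (S.+-congʳ {W ⊛ θ f} (S.*-congʳ {f} θ-W)))) n)
    (trans (cong (R._- (W ⊛ (W ⊛ f)) n) (W⊛θ (W ⊛ f) n))
      (solveR 2 (λ i c → i ⊗ c ⊖ c ⊖ c :≡ i ⊗ c ⊖ C (+ 2) ⊗ c) refl (ν n) ((W ⊛ (W ⊛ f)) n)))

  -- Besides the wanted coefficient of s^r, the one before it is carried along. Multiplication by ψ
  -- also brings in the coefficients of s^(r+1) and s^(r-2); these are eliminated by `θFₛ` at
  -- s^(r+1) and at s^r, so that a and b satisfy a closed recurrence.
  a b : ℕ → A
  a r = Fₛ r r
  b r = (W ⊛ Fₛ r) r

  next : ∀ r → ν (suc r) R.* Fₛ r (suc r) ≡ ι (+ 4) R.* v̂ R.* a r R.+ β R.* ν (suc r) R.* b r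
  next r = RfromDifference
    (solveR 7 (λ i α β v J J⁺ b →
      (C (+ 1) ⊕ i) ⊗ J⁺ ⊖ (C (+ 4) ⊗ v ⊗ J ⊕ β ⊗ (C (+ 1) ⊕ i) ⊗ b)
      :≡ C (+ 1) ⊗ (((C (+ 1) ⊕ i) ⊗ J⁺ ⊕ α ⊗ (i ⊗ J) ⊕ β ⊗ (i ⊗ b ⊖ b)) ⊖ (i ⊗ α ⊗ J ⊕ i ⊗ C (+ 2) ⊗ β ⊗ b ⊕ C (+ 4) ⊗ v ⊗ J)))
      refl (ν r) α β v̂ (a r) (Fₛ r (suc r)) (b r))
    (Rvanish (ι (+ 1)) (trans (sym lhs) (trans (θFₛ r (suc r)) rhs)))
    where
    f : Ser
    f = Fₛ r
    lhs : (ψ ⊛ θ f) (suc r) ≡ ν (suc r) R.* f (suc r) R.+ α R.* (ν r R.* f r) R.+ β R.* (ν r R.* b r R.- b r)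
    lhs = trans (coefficient-ψ (θ f) (suc r)) (cong₂ R._+_ (cong₂ R._+_ (·≡ι* (suc r) (f (suc r)))
      (cong (α R.*_) (trans (W-⊛-suc (θ f) r) (·≡ι* r (f r)))))
      (cong (β R.*_) (trans (W-⊛-suc (W ⊛ θ f) r) (W⊛θ f r))))
    rhs : ((con (ν r) ⊛ ψ′ ⊞ k (+ 4) ⊛ (v ⊛ W)) ⊛ f) (suc r)
      ≡ ν r R.* α R.* f r R.+ ν r R.* ι (+ 2) R.* β R.* b r R.+ ι (+ 4) R.* v̂ R.* f r
    rhs = trans (coefficient-rhs r f (suc r)) (cong₂ (λ p q → ν r R.* α R.* p R.+ ν r R.* ι (+ 2) R.* β R.* q R.+ ι (+ 4) R.* v̂ R.* p)
      (W-⊛-suc f r) (W-⊛-suc (W ⊛ f) r))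

  previous : ∀ r → let c = (W ⊛ (W ⊛ Fₛ r)) r in
    ν r R.* a r ≡ (α R.+ ι (+ 4) R.* v̂) R.* b r R.+ β R.* (ν r R.+ ι (+ 2)) R.* c
  previous r = RfromDifference
    (solveR 7 (λ i α β v J b c →
      i ⊗ J ⊖ ((α ⊕ C (+ 4) ⊗ v) ⊗ b ⊕ β ⊗ (i ⊕ C (+ 2)) ⊗ c)
      :≡ C (+ 1) ⊗ ((i ⊗ J ⊕ α ⊗ (i ⊗ b ⊖ b) ⊕ β ⊗ (i ⊗ c ⊖ C (+ 2) ⊗ c)) ⊖ (i ⊗ α ⊗ b ⊕ i ⊗ C (+ 2) ⊗ β ⊗ c ⊕ C (+ 4) ⊗ v ⊗ b)))
      refl (ν r) α β v̂ (a r) (b r) ((W ⊛ (W ⊛ f)) r))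
    (Rvanish (ι (+ 1)) (trans (sym lhs) (trans (θFₛ r r) (coefficient-rhs r f r))))
    where
    f : Ser
    f = Fₛ r
    lhs : (ψ ⊛ θ f) r ≡ ν r R.* f r R.+ α R.* (ν r R.* b r R.- b r) R.+ β R.* (ν r R.* (W ⊛ (W ⊛ f)) r R.- ι (+ 2) R.* (W ⊛ (W ⊛ f)) r)
    lhs = trans (coefficient-ψ (θ f) r) (cong₂ R._+_ (cong₂ R._+_ (·≡ι* r (f r))
      (cong (α R.*_) (W⊛θ f r))) (cong (β R.*_) (W⊛W⊛θ f r)))

  a-suc : ∀ r → a (suc r) ≡ Fₛ r (suc r) R.+ α R.* a r R.+ β R.* b r
  a-suc r = trans (coefficient-ψ (Fₛ r) (suc r))
    (cong₂ (λ p q → Fₛ r (suc r) R.+ α R.* p R.+ β R.* q) (W-⊛-suc (Fₛ r) r) (W-⊛-suc (W ⊛ Fₛ r) r))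

  b-suc : ∀ r → b (suc r) ≡ a r R.+ α R.* b r R.+ β R.* (W ⊛ (W ⊛ Fₛ r)) r
  b-suc r = trans (W-⊛-suc (ψ ⊛ Fₛ r) r) (coefficient-ψ (Fₛ r) r)

  recurrenceₐ : ∀ r → ν (suc r) R.* a (suc r)
    ≡ (ι (+ 4) R.* v̂ R.+ α R.* ν (suc r)) R.* a r R.+ ι (+ 2) R.* β R.* ν (suc r) R.* b r
  recurrenceₐ r = RfromDifference
    (solveR 8 (λ i α β v J b J⁺ a⁺ → let I = C (+ 1) ⊕ i in
      I ⊗ a⁺ ⊖ ((C (+ 4) ⊗ v ⊕ α ⊗ I) ⊗ J ⊕ C (+ 2) ⊗ β ⊗ I ⊗ b)
      :≡ I ⊗ (a⁺ ⊖ (J⁺ ⊕ α ⊗ J ⊕ β ⊗ b)) ⊕ C (+ 1) ⊗ (I ⊗ J⁺ ⊖ (C (+ 4) ⊗ v ⊗ J ⊕ β ⊗ I ⊗ b)))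
      refl (ν r) α β v̂ (a r) (b r) (Fₛ r (suc r)) (a (suc r)))
    (Rvanish (ν (suc r)) (a-suc r) R⊹ Rvanish (ι (+ 1)) (next r))

  recurrence_b : ∀ r → (ν r R.+ ι (+ 2)) R.* b (suc r)
    ≡ ι (+ 2) R.* ν (suc r) R.* a r R.+ (α R.* ν (suc r) R.- ι (+ 4) R.* v̂) R.* b r
  recurrence_b r = RfromDifference
    (solveR 8 (λ i α β v J b c b⁺ → let I = C (+ 1) ⊕ i in
      (i ⊕ C (+ 2)) ⊗ b⁺ ⊖ (C (+ 2) ⊗ I ⊗ J ⊕ (α ⊗ I ⊖ C (+ 4) ⊗ v) ⊗ b)
      :≡ (i ⊕ C (+ 2)) ⊗ (b⁺ ⊖ (J ⊕ α ⊗ b ⊕ β ⊗ c)) ⊕ C (ℤ.- + 1) ⊗ (i ⊗ J ⊖ ((α ⊕ C (+ 4) ⊗ v) ⊗ b ⊕ β ⊗ (i ⊕ C (+ 2)) ⊗ c)))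
      refl (ν r) α β v̂ (a r) (b r) ((W ⊛ (W ⊛ Fₛ r)) r) (b (suc r)))
    (Rvanish (ν r R.+ ι (+ 2)) (b-suc r) R⊹ Rvanish (ι (ℤ.- + 1)) (previous r))

  -- Elimination of b. With I = r + 1 the coefficient of a r becomes 4βI² - (αI)² + 16v², from which
  -- X² cancels; what remains is 16m(16I² - 1) = 16m(4r + 3)(4r + 5).
  threeTerm : ∀ r → let i = ν r ; X̂ = X̂ in
    ν (suc r) R.* (ν (suc (suc r)) R.* a (suc (suc r)))
    ≡ ι (+ 16) R.* (ι (+ 2) R.* i R.+ ι (+ 3)) R.* X̂ R.* (ν (suc r) R.* a (suc r))
      R.+ ι (+ 16) R.* m̂ R.* ((ι (+ 4) R.* i R.+ ι (+ 3)) R.* (ι (+ 4) R.* i R.+ ι (+ 5))) R.* a r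
  threeTerm r = RfromDifference
    (solveR 9 (λ i X m v a b a′ b′ a″ →
      let I = C (+ 1) ⊕ i
          I₂ = C (+ 1) ⊕ (C (+ 1) ⊕ i)
          α = C (+ 16) ⊗ X
          β = C (+ 64) ⊗ (X ⊗ X ⊕ m)
      in I ⊗ (I₂ ⊗ a″) ⊖ (C (+ 16) ⊗ (C (+ 2) ⊗ i ⊕ C (+ 3)) ⊗ X ⊗ (I ⊗ a′)
          ⊕ C (+ 16) ⊗ m ⊗ ((C (+ 4) ⊗ i ⊕ C (+ 3)) ⊗ (C (+ 4) ⊗ i ⊕ C (+ 5))) ⊗ a)
      :≡ I ⊗ (I₂ ⊗ a″ ⊖ ((C (+ 4) ⊗ v ⊕ α ⊗ I₂) ⊗ a′ ⊕ C (+ 2) ⊗ β ⊗ I₂ ⊗ b′))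
       ⊕ (C (+ 2) ⊗ β ⊗ I ⊗ ((i ⊕ C (+ 2)) ⊗ b′ ⊖ (C (+ 2) ⊗ I ⊗ a ⊕ (α ⊗ I ⊖ C (+ 4) ⊗ v) ⊗ b))
       ⊕ (C (ℤ.- + 1) ⊗ (α ⊗ I ⊖ C (+ 4) ⊗ v) ⊗ (I ⊗ a′ ⊖ ((C (+ 4) ⊗ v ⊕ α ⊗ I) ⊗ a ⊕ C (+ 2) ⊗ β ⊗ I ⊗ b))
       ⊕ C (+ 16) ⊗ a ⊗ (v ⊗ v ⊖ RSolver.:- m))))
      refl (ν r) (X̂) (m̂) v̂ (a r) (b r) (a (suc r)) (b (suc r)) (a (suc (suc r))))
    (Rvanish (ν (suc r)) (recurrenceₐ (suc r)) R⊹ Rvanish (ι (+ 2) R.* β R.* ν (suc r)) (recurrence_b r)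
     R⊹ Rvanish (ι (ℤ.- + 1) R.* (α R.* ν (suc r) R.- ι (+ 4) R.* v̂)) (recurrenceₐ r)
     R⊹ Rvanish (ι (+ 16) R.* a r) v̂²)

  a-0 : a 0 ≡ ι (+ 1)
  a-0 = trans (cong (ι (+ 1) R.+_) (trans (cong (ι (+ 4) R.*_) (R.zeroˡ _)) (R.zeroʳ _))) (R.+-identityʳ _)

  a-1 : a 1 ≡ ι (+ 4) R.* (ι (+ 4) R.* X̂ R.+ v̂)
  a-1 = RfromDifference
    (solveR 6 (λ a a′ b X v m →
        a′ ⊖ C (+ 4) ⊗ (C (+ 4) ⊗ X ⊕ v)
        :≡ C (+ 1) ⊗ ((C (+ 1) ⊕ C (+ 0)) ⊗ a′ ⊖ ((C (+ 4) ⊗ v ⊕ C (+ 16) ⊗ X ⊗ (C (+ 1) ⊕ C (+ 0))) ⊗ a ⊕ C (+ 2) ⊗ (C (+ 64) ⊗ (X ⊗ X ⊕ m)) ⊗ (C (+ 1) ⊕ C (+ 0)) ⊗ b))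
         ⊕ ((C (+ 4) ⊗ v ⊕ C (+ 16) ⊗ X) ⊗ (a ⊖ C (+ 1))
         ⊕ C (+ 128) ⊗ (X ⊗ X ⊕ m) ⊗ (b ⊖ C (+ 0))))
      refl (a 0) (a 1) (b 0) X̂ v̂ m̂)
    (Rvanish (ι (+ 1)) (recurrenceₐ 0)
     R⊹ Rvanish (ι (+ 4) R.* v̂ R.+ ι (+ 16) R.* X̂) a-0
     R⊹ Rvanish (ι (+ 128) R.* (X̂ R.* X̂ R.+ m̂)) (trans (R.zeroˡ _) (sym 0-homo)))

  denominator : ℕ → A
  denominator zero          = ι (+ 1)
  denominator (suc zero)    = ι (+ 4) R.* X̂ R.+ v̂
  denominator (suc (suc r)) = ι (+ 4) R.* (ι (+ 2) R.* ν (suc r) R.+ ι (+ 1)) R.* X̂ R.* denominator (suc r)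
    R.+ (ι (+ 4) R.* ν r R.+ ι (+ 3)) R.* (ι (+ 4) R.* ν r R.+ ι (+ 5)) R.* m̂ R.* denominator r

  factorial power : ℕ → A
  factorial zero    = ι (+ 1)
  factorial (suc r) = ν (suc r) R.* factorial r
  power zero    = ι (+ 1)
  power (suc r) = ι (+ 4) R.* power r

  -- Multiplied by r!, `threeTerm` is the Padé recurrence with each step scaled by 4, so both sides
  -- obey the same recurrence.
  factorial∣denominator : ∀ r → factorial r R.* a r ≡ power r R.* denominator r
  factorial∣denominator zero = cong (ι (+ 1) R.*_) a-0
  factorial∣denominator (suc zero) = trans (cong ((ι (+ 1) R.+ ι (+ 0)) R.* ι (+ 1) R.*_) a-1)
    (solveR 2 (λ X v → (C (+ 1) ⊕ C (+ 0)) ⊗ C (+ 1) ⊗ (C (+ 4) ⊗ (C (+ 4) ⊗ X ⊕ v)) :≡ C (+ 4) ⊗ C (+ 1) ⊗ (C (+ 4) ⊗ X ⊕ v)) refl X̂ v̂)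
  factorial∣denominator (suc (suc r)) = RfromDifference
    (solveR 10 (λ i X m f p a a′ a″ d d′ →
      let I = C (+ 1) ⊕ i
          I₂ = C (+ 1) ⊕ (C (+ 1) ⊕ i)
          κ = (C (+ 4) ⊗ i ⊕ C (+ 3)) ⊗ (C (+ 4) ⊗ i ⊕ C (+ 5))
      in I₂ ⊗ (I ⊗ f) ⊗ a″ ⊖ C (+ 4) ⊗ (C (+ 4) ⊗ p) ⊗ (C (+ 4) ⊗ (C (+ 2) ⊗ I ⊕ C (+ 1)) ⊗ X ⊗ d′ ⊕ κ ⊗ m ⊗ d)
      :≡ f ⊗ (I ⊗ (I₂ ⊗ a″) ⊖ (C (+ 16) ⊗ (C (+ 2) ⊗ i ⊕ C (+ 3)) ⊗ X ⊗ (I ⊗ a′) ⊕ C (+ 16) ⊗ m ⊗ κ ⊗ a))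
       ⊕ (C (+ 16) ⊗ (C (+ 2) ⊗ i ⊕ C (+ 3)) ⊗ X ⊗ (I ⊗ f ⊗ a′ ⊖ C (+ 4) ⊗ p ⊗ d′)
       ⊕ C (+ 16) ⊗ m ⊗ κ ⊗ (f ⊗ a ⊖ p ⊗ d)))
      refl (ν r) X̂ m̂ (factorial r) (power r) (a r) (a (suc r)) (a (suc (suc r))) (denominator r) (denominator (suc r)))
    (Rvanish (factorial r) (threeTerm r)
     R⊹ Rvanish (ι (+ 16) R.* (ι (+ 2) R.* ν r R.+ ι (+ 3)) R.* X̂) (factorial∣denominator (suc r))
     R⊹ Rvanish (ι (+ 16) R.* m̂ R.* ((ι (+ 4) R.* ν r R.+ ι (+ 3)) R.* (ι (+ 4) R.* ν r R.+ ι (+ 5)))) (factorial∣denominator r))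

-- The ring ℤ[√(-m)] and the resulting divisibility in ℕ.

module QuadraticRing (m : ℤ) where
  open import Data.Integer.Base as ℤ using (ℤ; +_)
  import Data.Integer.Properties as ℤ
  open import Data.Integer.Tactic.RingSolver using () renaming (solve-∀ to solveℤ-∀)
  open import Data.Product.Base using (_×_; _,_; proj₁; proj₂)
  open import Relation.Binary.PropositionalEquality

  _⊕_ _⊗_ : ℤ × ℤ → ℤ × ℤ → ℤ × ℤ
  (a , b) ⊕ (c , d) = a ℤ.+ c , b ℤ.+ d
  (a , b) ⊗ (c , d) = a ℤ.* c ℤ.- m ℤ.* (b ℤ.* d) , a ℤ.* d ℤ.+ b ℤ.* c
  ⊖_ : ℤ × ℤ → ℤ × ℤ
  ⊖ (a , b) = ℤ.- a , ℤ.- b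
  ⊗-comm : ∀ x y → x ⊗ y ≡ y ⊗ x
  ⊗-comm (a , b) (c , d) = cong₂ _,_ (re m a b c d) (im a b c d)
    where
    re : ∀ m a b c d → a ℤ.* c ℤ.- m ℤ.* (b ℤ.* d) ≡ c ℤ.* a ℤ.- m ℤ.* (d ℤ.* b)
    re = solveℤ-∀
    im : ∀ a b c d → a ℤ.* d ℤ.+ b ℤ.* c ≡ c ℤ.* b ℤ.+ d ℤ.* a
    im = solveℤ-∀
  ⊗-assoc : ∀ x y z → (x ⊗ y) ⊗ z ≡ x ⊗ (y ⊗ z)
  ⊗-assoc (a , b) (c , d) (e , f) = cong₂ _,_ (re m a b c d e f) (im m a b c d e f)
    where
    re : ∀ m a b c d e f →
      (a ℤ.* c ℤ.- m ℤ.* (b ℤ.* d)) ℤ.* e ℤ.- m ℤ.* ((a ℤ.* d ℤ.+ b ℤ.* c) ℤ.* f)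
      ≡ a ℤ.* (c ℤ.* e ℤ.- m ℤ.* (d ℤ.* f)) ℤ.- m ℤ.* (b ℤ.* (c ℤ.* f ℤ.+ d ℤ.* e))
    re = solveℤ-∀
    im : ∀ m a b c d e f →
      (a ℤ.* c ℤ.- m ℤ.* (b ℤ.* d)) ℤ.* f ℤ.+ (a ℤ.* d ℤ.+ b ℤ.* c) ℤ.* e
      ≡ a ℤ.* (c ℤ.* f ℤ.+ d ℤ.* e) ℤ.+ b ℤ.* (c ℤ.* e ℤ.- m ℤ.* (d ℤ.* f))
    im = solveℤ-∀
  ⊗-identityˡ : ∀ x → (+ 1 , + 0) ⊗ x ≡ x
  ⊗-identityˡ (a , b) = cong₂ _,_ (re m a b) (im a b)
    where
    re : ∀ m a b → + 1 ℤ.* a ℤ.- m ℤ.* (+ 0 ℤ.* b) ≡ a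
    re = solveℤ-∀
    im : ∀ a b → + 1 ℤ.* b ℤ.+ + 0 ℤ.* a ≡ b
    im = solveℤ-∀
  ⊗-distribˡ : ∀ x y z → x ⊗ (y ⊕ z) ≡ (x ⊗ y) ⊕ (x ⊗ z)
  ⊗-distribˡ (a , b) (c , d) (e , f) = cong₂ _,_ (re m a b c d e f) (im a b c d e f)
    where
    re : ∀ m a b c d e f → a ℤ.* (c ℤ.+ e) ℤ.- m ℤ.* (b ℤ.* (d ℤ.+ f))
      ≡ a ℤ.* c ℤ.- m ℤ.* (b ℤ.* d) ℤ.+ (a ℤ.* e ℤ.- m ℤ.* (b ℤ.* f))
    re = solveℤ-∀
    im : ∀ a b c d e f → a ℤ.* (d ℤ.+ f) ℤ.+ b ℤ.* (c ℤ.+ e) ≡ a ℤ.* d ℤ.+ b ℤ.* c ℤ.+ (a ℤ.* f ℤ.+ b ℤ.* e)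
    im = solveℤ-∀
  isCR : IsCommutativeRing _≡_ _⊕_ _⊗_ ⊖_ (+ 0 , + 0) (+ 1 , + 0)
  isCR = record
    { isRing = record
      { +-isAbelianGroup = record
        { isGroup = record
          { isMonoid = record
            { isSemigroup = record
              { isMagma = record { isEquivalence = isEquivalence ; ∙-cong = cong₂ _⊕_ }
              ; assoc = λ x y z → cong₂ _,_ (ℤ.+-assoc (proj₁ x) (proj₁ y) (proj₁ z)) (ℤ.+-assoc (proj₂ x) (proj₂ y) (proj₂ z)) }
            ; identity = (λ x → cong₂ _,_ (ℤ.+-identityˡ _) (ℤ.+-identityˡ _))
                       , (λ x → cong₂ _,_ (ℤ.+-identityʳ _) (ℤ.+-identityʳ _)) }
          ; inverse = (λ x → cong₂ _,_ (ℤ.+-inverseˡ (proj₁ x)) (ℤ.+-inverseˡ (proj₂ x)))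
                    , (λ x → cong₂ _,_ (ℤ.+-inverseʳ (proj₁ x)) (ℤ.+-inverseʳ (proj₂ x)))
          ; ⁻¹-cong = cong ⊖_ }
        ; comm = λ x y → cong₂ _,_ (ℤ.+-comm (proj₁ x) (proj₁ y)) (ℤ.+-comm (proj₂ x) (proj₂ y)) }
      ; *-cong = cong₂ _⊗_
      ; *-assoc = ⊗-assoc
      ; *-identity = ⊗-identityˡ , (λ x → trans (⊗-comm x _) (⊗-identityˡ x))
      ; distrib = ⊗-distribˡ , (λ x y z → trans (⊗-comm (y ⊕ z) x) (trans (⊗-distribˡ x y z) (cong₂ _⊕_ (⊗-comm x y) (⊗-comm x z)))) }
    ; *-comm = ⊗-comm }

  embed-* : ∀ a b → (a ℤ.* b , + 0) ≡ (a , + 0) ⊗ (b , + 0)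
  embed-* a b = cong₂ _,_
    (sym (trans (cong (λ z → a ℤ.* b ℤ.- z) (ℤ.*-zeroʳ m)) (ℤ.+-identityʳ _)))
    (sym (trans (ℤ.+-identityʳ _) (ℤ.*-zeroʳ a)))

  re-scale : ∀ a z → proj₁ ((a , + 0) ⊗ z) ≡ a ℤ.* proj₁ z
  re-scale a z = trans (cong (λ c → a ℤ.* proj₁ z ℤ.- c) (ℤ.*-zeroʳ m)) (ℤ.+-identityʳ _)

  im-scale : ∀ a z → proj₂ ((a , + 0) ⊗ z) ≡ a ℤ.* proj₂ z
  im-scale a z = trans (cong (λ c → a ℤ.* proj₂ z ℤ.+ c) (ℤ.*-zeroˡ (proj₁ z))) (ℤ.+-identityʳ _)

  cancel-4 : ∀ f g → (+ 4 , + 0) ⊗ f ≡ (+ 4 , + 0) ⊗ g → f ≡ g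
  cancel-4 f g p = cong₂ _,_
    (ℤ.*-cancelˡ-≡ (+ 4) _ _ (trans (sym (re-scale (+ 4) f)) (trans (cong proj₁ p) (re-scale (+ 4) g))))
    (ℤ.*-cancelˡ-≡ (+ 4) _ _ (trans (sym (im-scale (+ 4) f)) (trans (cong proj₂ p) (im-scale (+ 4) g))))

module FactorialDivides (X m : ℕ) where
  open import Data.Integer.Base as ℤ using (ℤ; +_; ∣_∣)
  import Data.Integer.Properties as ℤ
  open import Data.Nat.Base as ℕ using (ℕ; zero; suc; _*_; _^_; _!)
  import Data.Nat.Properties as ℕ
  open import Data.Nat.Divisibility using (_∣_; divides)
  open import Data.Product.Base using (_×_; _,_; proj₁; proj₂)
  open import Relation.Binary.PropositionalEquality
  open Form using (γ; κ)
  open Evaluation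
  open QuadraticRing (+ m) renaming (isCR to isCR-m)
  open PadéIntegrality isCR-m (λ a → a , + 0) (λ _ _ → refl) embed-* (λ _ → refl) refl refl cancel-4 (+ X , + 0) (+ m , + 0) (+ 0 , + 1)
    (cong₂ _,_ (trans (ℤ.+-identityˡ _) (cong ℤ.-_ (ℤ.*-identityʳ (+ m)))) refl)

  ν≡ : ∀ n → ν n ≡ (+ n , + 0)
  ν≡ zero    = refl
  ν≡ (suc n) = cong ((+ 1 , + 0) ⊕_) (ν≡ n)

  ⊗-nat : ∀ a b → (+ a , + 0) ⊗ (+ b , + 0) ≡ (+ (a * b) , + 0)
  ⊗-nat a b = cong₂ _,_ (trans (re-scale (+ a) (+ b , + 0)) (sym (ℤ.pos-* a b))) (trans (im-scale (+ a) (+ b , + 0)) (ℤ.*-zeroʳ (+ a)))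

  factorial≡ : ∀ r → factorial r ≡ (+ (r !) , + 0)
  factorial≡ zero    = refl
  factorial≡ (suc r) = trans (cong₂ _⊗_ (ν≡ (suc r)) (factorial≡ r)) (⊗-nat (suc r) (r !))

  power≡ : ∀ r → power r ≡ (+ (4 ^ r) , + 0)
  power≡ zero    = refl
  power≡ (suc r) = trans (cong ((+ 4 , + 0) ⊗_) (power≡ r)) (⊗-nat 4 (4 ^ r))

  ⊗-scale : ∀ a z w → (+ a , + 0) ⊗ (+ z , + w) ≡ (+ (a * z) , + (a * w))
  ⊗-scale a z w = cong₂ _,_ (trans (re-scale (+ a) (+ z , + w)) (sym (ℤ.pos-* a z))) (trans (im-scale (+ a) (+ z , + w)) (sym (ℤ.pos-* a w)))

  denominator≡ : ∀ r → denominator r ≡ (+ E X m r , + O X m r)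
  denominator≡ zero          = refl
  denominator≡ (suc zero)    = trans (cong (_⊕ (+ 0 , + 1)) (⊗-nat 4 X)) (cong (λ n → + n , + 1) (ℕ.+-identityʳ (4 * X)))
  denominator≡ (suc (suc r)) = trans
    (cong₂ _⊕_
      (trans (cong₂ _⊗_ coefficient₁ (denominator≡ (suc r))) (⊗-scale (γ (suc r) * X) _ _))
      (trans (cong₂ _⊗_ coefficient₀ (denominator≡ r)) (⊗-scale (κ r * m) _ _)))
    refl
    where
    coefficient₁ : _ ≡ (+ (γ (suc r) * X) , + 0)
    coefficient₁ = trans (cong (_⊗ (+ X , + 0)) (trans (cong (λ z → (+ 4 , + 0) ⊗ (((+ 2 , + 0) ⊗ z) ⊕ (+ 1 , + 0))) (ν≡ (suc r)))
      (trans (cong (λ z → (+ 4 , + 0) ⊗ (z ⊕ (+ 1 , + 0))) (⊗-nat 2 (suc r))) (⊗-nat 4 (2 * suc r ℕ.+ 1))))) (⊗-nat (γ (suc r)) X)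
    coefficient₀ : _ ≡ (+ (κ r * m) , + 0)
    coefficient₀ = trans (cong (_⊗ (+ m , + 0)) (trans (cong (λ z → (((+ 4 , + 0) ⊗ z) ⊕ (+ 3 , + 0)) ⊗ (((+ 4 , + 0) ⊗ z) ⊕ (+ 5 , + 0))) (ν≡ r))
      (trans (cong (λ z → (z ⊕ (+ 3 , + 0)) ⊗ (z ⊕ (+ 5 , + 0))) (⊗-nat 4 r)) (⊗-nat (4 * r ℕ.+ 3) (4 * r ℕ.+ 5))))) (⊗-nat (κ r) m)

  -- A natural number dividing an element of ℤ[√(-m)] divides each of its two coordinates.
  divisible : ∀ r → ((r !) ∣ (4 ^ r * E X m r)) × ((r !) ∣ (4 ^ r * O X m r))
  divisible r = part proj₁ re-scale , part proj₂ im-scale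
    where
    part : (π : ℤ × ℤ → ℤ) → (∀ a z → π ((a , + 0) ⊗ z) ≡ a ℤ.* π z) → (r !) ∣ (4 ^ r * ∣ π (+ E X m r , + O X m r) ∣)
    part π scale = divides ∣ π (a r) ∣ (begin
      4 ^ r * ∣ π (+ E X m r , + O X m r) ∣          ≡⟨ ℤ.abs-* (+ (4 ^ r)) _ ⟨
      ∣ + (4 ^ r) ℤ.* π (+ E X m r , + O X m r) ∣    ≡⟨ cong ∣_∣ (scale (+ (4 ^ r)) _) ⟨
      ∣ π ((+ (4 ^ r) , + 0) ⊗ (+ E X m r , + O X m r)) ∣
        ≡⟨ cong (λ z → ∣ π z ∣) (cong₂ _⊗_ (power≡ r) (denominator≡ r)) ⟨
      ∣ π (power r ⊗ denominator r) ∣                ≡⟨ cong (λ z → ∣ π z ∣) (factorial∣denominator r) ⟨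
      ∣ π (factorial r ⊗ a r) ∣                      ≡⟨ cong (λ z → ∣ π (z ⊗ a r) ∣) (factorial≡ r) ⟩
      ∣ π ((+ (r !) , + 0) ⊗ a r) ∣                  ≡⟨ cong ∣_∣ (scale (+ (r !)) (a r)) ⟩
      ∣ + (r !) ℤ.* π (a r) ∣                        ≡⟨ ℤ.abs-* (+ (r !)) (π (a r)) ⟩
      (r !) * ∣ π (a r) ∣                            ≡⟨ ℕ.*-comm (r !) _ ⟩
      ∣ π (a r) ∣ * (r !)                            ∎)
      where open ≡-Reasoning

-- Estimates for E and O, and for the distance between two approximations.

module PadéEstimates (X m : ℕ) where
  open Prelude
  import Data.Sum.Base as Sum
  open import Data.Nat.Divisibility using (divides)
  open Form using (γ; κ)
  open FormOrder using (N; N>0)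
  open Evaluation hiding (E; O)
  open Arith
  open Cast

  E O : ℕ → ℕ
  E = Evaluation.E X m
  O = Evaluation.O X m

  E-lower : ∀ r → N r * X ^ r ≤ E r
  E-lower zero       = ≤-refl
  E-lower (suc zero) = ≤-reflexive (cong (4 *_) (*-identityʳ X))
  E-lower (suc (suc r)) = ≤-trans
    (≤-trans (≤-reflexive (regroup (γ (suc r)) (N (suc r)) X (X ^ suc r))) (*-monoʳ-≤ (γ (suc r) * X) (E-lower (suc r))))
    (m≤m+n _ _)
    where
    regroup : ∀ g n x p → g * n * (x * p) ≡ g * x * (n * p)
    regroup = solve-∀

  E-upper : m ≤ X * X → ∀ r → E r ≤ 2 ^ r * N r * X ^ r
  E-upper m≤XX zero       = ≤-refl
  E-upper m≤XX (suc zero) = ≤-trans (≤-reflexive (cong (4 *_) (sym (*-identityʳ X)))) (*-monoˡ-≤ (X ^ 1) {4} {8} (m≤m+n 4 4))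
  E-upper m≤XX (suc (suc r)) = ≤-trans
    (≤-reflexive (cong₂ _+_ (*-assoc (γ (suc r)) X (E (suc r))) (*-assoc (κ r) m (E r))))
    (growth-step r {X * E (suc r)} {m * E r} {m * X ^ r} {X ^ suc (suc r)}
      (≤-trans (*-monoʳ-≤ m (E-upper m≤XX r)) (≤-reflexive (swap m (2 ^ r * N r) (X ^ r))))
      (≤-trans (*-monoʳ-≤ X (E-upper m≤XX (suc r))) (≤-reflexive (swap X (2 ^ suc r * N (suc r)) (X ^ suc r))))
      (≤-trans (*-monoˡ-≤ (X ^ r) m≤XX) (≤-reflexive (*-assoc X X (X ^ r)))))
    where
    swap : ∀ a b c → a * (b * c) ≡ b * (a * c)
    swap = solve-∀

  -- Both pairs compared by `separation` must have slope at most 1/X; this is the Padé one.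
  O-slope : ∀ r → X * O r ≤ E r
  O-slope zero       = ≤-trans (≤-reflexive (*-zeroʳ X)) z≤n
  O-slope (suc zero) = ≤-trans (≤-reflexive (*-identityʳ X)) (m≤m+n X _)
  O-slope (suc (suc r)) = ≤-trans
    (≤-reflexive (regroup X (γ (suc r) * X) (κ r * m) (O (suc r)) (O r)))
    (+-mono-≤ (*-monoʳ-≤ (γ (suc r) * X) (O-slope (suc r))) (*-monoʳ-≤ (κ r * m) (O-slope r)))
    where
    regroup : ∀ x a b u v → x * (a * u + b * v) ≡ a * (x * u) + b * (x * v)
    regroup = solve-∀

  -- Proportionality of two consecutive denominators would descend to r = 0.
  independent : 0 < m → ∀ r → ¬ (E (suc r) * O r ≡ E r * O (suc r))
  independent m>0 zero    eq = 0≢1+n (trans (sym (*-zeroʳ (4 * X))) eq)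
  independent m>0 (suc r) eq = independent m>0 r (sym (*-cancelˡ-≡ _ _ (κ r * m) {{>-nonZero (*-mono-≤ {1} {κ r} {1} (*-mono-≤ {1} {4 * r + 3} {1} (≤-trans (s≤s z≤n) (m≤n+m 3 (4 * r))) (≤-trans (s≤s z≤n) (m≤n+m 5 (4 * r)))) m>0)}}
    (+-cancelˡ-≡ (γ (suc r) * X * (E (suc r) * O (suc r))) _ _
      (trans (sym (expandʳ (γ (suc r) * X) (κ r * m) (E (suc r)) (E r) (O (suc r)))) (trans eq (expandˡ (γ (suc r) * X) (κ r * m) (E (suc r)) (O (suc r)) (O r)))))))
    where
    expandʳ : ∀ a b u v w → (a * u + b * v) * w ≡ a * (u * w) + b * (v * w)
    expandʳ = solve-∀
    expandˡ : ∀ a b u v w → u * (a * v + b * w) ≡ a * (u * v) + b * (u * w)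
    expandˡ = solve-∀

  -- Factor by factor, γ r ≤ 8(r + 1). The factorial is paid for by `r!≤4^rL`.
  N≤8^r*r! : ∀ r → N r ≤ 8 ^ r * r !
  N≤8^r*r! zero    = ≤-refl
  N≤8^r*r! (suc r) = ≤-trans (*-mono-≤ γ≤ (N≤8^r*r! r)) (≤-reflexive (regroup (suc r) (8 ^ r) (r !)))
    where
    γ≤ : γ r ≤ 8 * suc r
    γ≤ = ≤-trans (m≤m+n (γ r) 4) (≤-reflexive (identity r))
      where
      identity : ∀ r → 4 * (2 * r + 1) + 4 ≡ 8 * (1 + r)
      identity = solve-∀
    regroup : ∀ s p f → 8 * s * (p * f) ≡ 8 * p * (s * f)
    regroup = solve-∀

  module _ (16m≤XX : 16 * m ≤ X * X) where

    -- The left side collects the negative terms of (Φ(A, p) - Φ(A, q))/(p - q), whose main term is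
    -- 4XA³. Multiplied by 256 = 16², each m can use 16m ≤ X²; the terms then amount to at most
    -- 196·XA³ against the allowed 512·XA³.
    steepness : ∀ A p q → X * p ≤ A → X * q ≤ A →
      4 * X * m * A * (p * p + p * q + q * q) + m * m * (p + q) * (p * p + q * q) ≤ 2 * X * (A * A * A)
    steepness A p q Xp≤A Xq≤A = *-cancelˡ-≤ 256 (begin
      256 * (4 * X * m * A * (p * p + p * q + q * q) + m * m * (p + q) * (p * p + q * q))
        ≡⟨ regroup X m A p q ⟩
      64 * X * A * (16 * m * (p * p) + 16 * m * (p * q) + 16 * m * (q * q)) + (16 * m * p + 16 * m * q) * (16 * m * (p * p) + 16 * m * (q * q))
        ≤⟨ +-mono-≤ (*-monoʳ-≤ (64 * X * A) (+-mono-≤ (+-mono-≤ (quad Xp≤A Xp≤A) (quad Xp≤A Xq≤A)) (quad Xq≤A Xq≤A)))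
             (*-mono-≤ (+-mono-≤ (lin p Xp≤A) (lin q Xq≤A)) (+-mono-≤ (quad Xp≤A Xp≤A) (quad Xq≤A Xq≤A))) ⟩
      64 * X * A * (A * A + A * A + A * A) + (X * A + X * A) * (A * A + A * A)
        ≤⟨ m≤m+n _ (316 * (X * (A * A * A))) ⟩
      64 * X * A * (A * A + A * A + A * A) + (X * A + X * A) * (A * A + A * A) + 316 * (X * (A * A * A))
        ≡⟨ total X A ⟩
      256 * (2 * X * (A * A * A)) ∎)
      where
      open ≤-Reasoning
      quad : ∀ {p q} → X * p ≤ A → X * q ≤ A → 16 * m * (p * q) ≤ A * A
      quad {p} {q} hp hq = ≤-trans (*-monoˡ-≤ (p * q) 16m≤XX) (≤-trans (≤-reflexive (swap X p q)) (*-mono-≤ hp hq))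
        where
        swap : ∀ x p q → x * x * (p * q) ≡ x * p * (x * q)
        swap = solve-∀
      lin : ∀ p → X * p ≤ A → 16 * m * p ≤ X * A
      lin p hp = ≤-trans (*-monoˡ-≤ p 16m≤XX) (≤-trans (≤-reflexive (*-assoc X X p)) (*-monoʳ-≤ X hp))
      regroup : ∀ X m A p q →
        256 * (4 * X * m * A * (p * p + p * q + q * q) + m * m * (p + q) * (p * p + q * q))
        ≡ 64 * X * A * (16 * m * (p * p) + 16 * m * (p * q) + 16 * m * (q * q)) + (16 * m * p + 16 * m * q) * (16 * m * (p * p) + 16 * m * (q * q))
      regroup = solve-∀
      total : ∀ X A → 64 * X * A * (A * A + A * A + A * A) + (X * A + X * A) * (A * A + A * A) + 316 * (X * (A * A * A)) ≡ 256 * (2 * X * (A * A * A))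
      total = solve-∀

    -- Φ(A, p) − Φ(A, q) is divisible by p − q, with a quotient of at least 2XA³.
    separation : ∀ A p q → X * p ≤ A → X * q ≤ A →
      abs (+ p ℤ.- + q) * (2 * X * (A * A * A)) ≤ abs (quartic (+ X) (+ m) (+ A) (+ p)) + abs (quartic (+ X) (+ m) (+ A) (+ q))
    separation A p q Xp≤A Xq≤A = begin
      abs (+ p ℤ.- + q) * (2 * X * (A * A * A))
        ≤⟨ *-monoʳ-≤ (abs (+ p ℤ.- + q)) (m≤m+n (2 * X * (A * A * A)) rest) ⟩
      abs (+ p ℤ.- + q) * slope
        ≡⟨ ℤ.abs-* (+ p ℤ.- + q) (+ slope) ⟨
      abs ((+ p ℤ.- + q) ℤ.* + slope)
        ≡⟨ cong abs (trans (cong ((+ p ℤ.- + q) ℤ.*_) (cast (` 2 :* ` X :* (` A :* ` A :* ` A) :+ (` t :+ ` 6 :* ` m :* (` A :* ` A) :* (` p :+ ` q)))))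
             (factorisation (+ X) (+ m) (+ A) (+ p) (+ q) (+ t)
               (castEq (` 4 :* ` X :* ` m :* ` A :* (` p :* ` p :+ ` p :* ` q :+ ` q :* ` q) :+ ` m :* ` m :* (` p :+ ` q) :* (` p :* ` p :+ ` q :* ` q) :+ ` t)
                       (` 2 :* ` X :* (` A :* ` A :* ` A)) t-eq))) ⟩
      abs (quartic (+ X) (+ m) (+ A) (+ p) ℤ.- quartic (+ X) (+ m) (+ A) (+ q))
        ≤⟨ ℤ.∣i-j∣≤∣i∣+∣j∣ (quartic (+ X) (+ m) (+ A) (+ p)) (quartic (+ X) (+ m) (+ A) (+ q)) ⟩
      abs (quartic (+ X) (+ m) (+ A) (+ p)) + abs (quartic (+ X) (+ m) (+ A) (+ q)) ∎
      where
      open ≤-Reasoning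
      low t rest slope : ℕ
      low = 4 * X * m * A * (p * p + p * q + q * q) + m * m * (p + q) * (p * p + q * q)
      t = 2 * X * (A * A * A) ∸ low
      rest = t + 6 * m * (A * A) * (p + q)
      slope = 2 * X * (A * A * A) + rest
      t-eq : low + t ≡ 2 * X * (A * A * A)
      t-eq = m+[n∸m]≡n (steepness A p q Xp≤A Xq≤A)
      factorisation : ∀ X m A p q t →
        + 4 ℤ.* X ℤ.* m ℤ.* A ℤ.* (p ℤ.* p ℤ.+ p ℤ.* q ℤ.+ q ℤ.* q) ℤ.+ m ℤ.* m ℤ.* (p ℤ.+ q) ℤ.* (p ℤ.* p ℤ.+ q ℤ.* q) ℤ.+ t
          ≡ + 2 ℤ.* X ℤ.* (A ℤ.* A ℤ.* A) →
        (p ℤ.- q) ℤ.* (+ 2 ℤ.* X ℤ.* (A ℤ.* A ℤ.* A) ℤ.+ (t ℤ.+ + 6 ℤ.* m ℤ.* (A ℤ.* A) ℤ.* (p ℤ.+ q)))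
          ≡ quartic X m A p ℤ.- quartic X m A q
      factorisation X m A p q t eq = trans (identity X m A p q t)
        (trans (cong (λ z → quartic X m A p ℤ.- quartic X m A q ℤ.+ (p ℤ.- q) ℤ.* (z ℤ.- + 2 ℤ.* X ℤ.* (A ℤ.* A ℤ.* A))) eq)
               (collapse (quartic X m A p ℤ.- quartic X m A q) (p ℤ.- q) (+ 2 ℤ.* X ℤ.* (A ℤ.* A ℤ.* A))))
        where
        collapse : ∀ u v w → u ℤ.+ v ℤ.* (w ℤ.- w) ≡ u
        collapse = solveℤ-∀
        identity : ∀ X m A p q t →
          let F = λ p → + 2 ℤ.* X ℤ.* ((A ℤ.* A ℤ.- m ℤ.* (p ℤ.* p)) ℤ.* (+ 2 ℤ.* (A ℤ.* p))) ℤ.- ((A ℤ.* A ℤ.- m ℤ.* (p ℤ.* p)) ℤ.* (A ℤ.* A ℤ.- m ℤ.* (p ℤ.* p)) ℤ.- m ℤ.* ((+ 2 ℤ.* (A ℤ.* p)) ℤ.* (+ 2 ℤ.* (A ℤ.* p)))) in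
          (p ℤ.- q) ℤ.* (+ 2 ℤ.* X ℤ.* (A ℤ.* A ℤ.* A) ℤ.+ (t ℤ.+ + 6 ℤ.* m ℤ.* (A ℤ.* A) ℤ.* (p ℤ.+ q)))
          ≡ F p ℤ.- F q ℤ.+ (p ℤ.- q) ℤ.* (+ 4 ℤ.* X ℤ.* m ℤ.* A ℤ.* (p ℤ.* p ℤ.+ p ℤ.* q ℤ.+ q ℤ.* q) ℤ.+ m ℤ.* m ℤ.* (p ℤ.+ q) ℤ.* (p ℤ.* p ℤ.+ q ℤ.* q) ℤ.+ t ℤ.- + 2 ℤ.* X ℤ.* (A ℤ.* A ℤ.* A))
        identity = solveℤ-∀

  -- Allows (G, Q) and (E, O) to be brought to the common first coordinate GE.
  quartic-homogeneous : ∀ a b c →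
    abs (quartic (+ X) (+ m) (+ (c * a)) (+ (c * b))) ≡ c * c * (c * c) * abs (quartic (+ X) (+ m) (+ a) (+ b))
  quartic-homogeneous a b c = trans
    (cong₂ (λ u v → abs (quartic (+ X) (+ m) u v)) (ℤ.pos-* c a) (ℤ.pos-* c b))
    (trans (cong abs (identity (+ X) (+ m) (+ a) (+ b) (+ c)))
      (trans (ℤ.abs-* (+ c ℤ.* + c ℤ.* (+ c ℤ.* + c)) _)
        (cong (λ z → abs z * abs (quartic (+ X) (+ m) (+ a) (+ b))) (sym (cast (` c :* ` c :* (` c :* ` c)))))))
    where
    identity : ∀ X m a b c →
      let F = λ A p → + 2 ℤ.* X ℤ.* ((A ℤ.* A ℤ.- m ℤ.* (p ℤ.* p)) ℤ.* (+ 2 ℤ.* (A ℤ.* p))) ℤ.- ((A ℤ.* A ℤ.- m ℤ.* (p ℤ.* p)) ℤ.* (A ℤ.* A ℤ.- m ℤ.* (p ℤ.* p)) ℤ.- m ℤ.* ((+ 2 ℤ.* (A ℤ.* p)) ℤ.* (+ 2 ℤ.* (A ℤ.* p)))) in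
      F (c ℤ.* a) (c ℤ.* b) ≡ c ℤ.* c ℤ.* (c ℤ.* c) ℤ.* F a b
    identity = solveℤ-∀

  module _ (m>0 : 0 < m) (G Q : ℕ) where

    L : ℕ → ℕ
    L r = abs (+ (E r * Q) ℤ.- + (G * O r))

    -- 4^r·E and 4^r·O are multiples of r!, hence so is 4^r times their combination L; a nonzero
    -- multiple is at least r!.
    r!≤4^rL : ∀ r → 0 < L r → r ! ≤ 4 ^ r * L r
    r!≤4^rL r L>0 with FactorialDivides.divisible X m r
    ... | divides a a-eq , divides b b-eq = ≤-trans (m≤m*n (r !) (abs z) {{>-nonZero z>0}}) (≤-reflexive (sym eq))
      where
      z : ℤ
      z = + a ℤ.* + Q ℤ.- + b ℤ.* + G
      eqℤ : + (4 ^ r) ℤ.* (+ (E r * Q) ℤ.- + (G * O r)) ≡ + (r !) ℤ.* z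
      eqℤ = trans (cong₂ (λ u v → + (4 ^ r) ℤ.* (u ℤ.- v)) (ℤ.pos-* (E r) Q) (ℤ.pos-* G (O r)))
        (trans (expand (+ (4 ^ r)) (+ E r) (+ Q) (+ G) (+ O r))
        (trans (cong₂ (λ u v → u ℤ.* + Q ℤ.- v ℤ.* + G)
                 (castEq (` (4 ^ r) :* ` E r) (` a :* ` (r !)) a-eq)
                 (castEq (` (4 ^ r) :* ` O r) (` b :* ` (r !)) b-eq))
               (collect (+ a) (+ b) (+ (r !)) (+ Q) (+ G))))
        where
        expand : ∀ p e q g o → p ℤ.* (e ℤ.* q ℤ.- g ℤ.* o) ≡ p ℤ.* e ℤ.* q ℤ.- p ℤ.* o ℤ.* g
        expand = solveℤ-∀
        collect : ∀ a b f q g → a ℤ.* f ℤ.* q ℤ.- b ℤ.* f ℤ.* g ≡ f ℤ.* (a ℤ.* q ℤ.- b ℤ.* g)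
        collect = solveℤ-∀
      eq : 4 ^ r * L r ≡ r ! * abs z
      eq = trans (sym (ℤ.abs-* (+ (4 ^ r)) _)) (trans (cong abs eqℤ) (ℤ.abs-* (+ (r !)) z))
      z>0 : 0 < abs z
      z>0 = n≢0⇒n>0 λ z≡0 → <⇒≢ (*-mono-≤ {1} {4 ^ r} (m^n>0 4 r) L>0) (sym (trans eq (trans (cong (r ! *_) z≡0) (*-zeroʳ (r !)))))

    -- If both vanished, two consecutive denominators would be proportional to (G, Q) and so to each
    -- other.
    nonvanishing : 0 < G → 0 < Q → ∀ r → 0 < L r ⊎ 0 < L (suc r)
    nonvanishing G>0 Q>0 r with L r in eq₀ | L (suc r) in eq₁
    ... | suc _ | _     = inj₁ (s≤s z≤n)
    ... | zero  | suc _ = inj₂ (s≤s z≤n)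
    ... | zero  | zero  = ⊥-elim (independent m>0 r (*-cancelˡ-≡ _ _ (G * Q) {{>-nonZero (*-mono-≤ {1} {G} G>0 Q>0)}}
        (trans (regroup₁ G Q (E (suc r)) (O r)) (trans (cong₂ _*_ (zero-eq (suc r) eq₁) (sym (zero-eq r eq₀))) (regroup₂ G Q (E r) (O (suc r)))))))
      where
      zero-eq : ∀ i → L i ≡ 0 → E i * Q ≡ G * O i
      zero-eq i p = ℤ.+-injective (ℤ.i-j≡0⇒i≡j _ _ (ℤ.∣i∣≡0⇒i≡0 p))
      regroup₁ : ∀ g q e o → g * q * (e * o) ≡ e * q * (g * o)
      regroup₁ = solve-∀
      regroup₂ : ∀ g q e o → g * o * (e * q) ≡ g * q * (e * o)
      regroup₂ = solve-∀

    module _ (g Y : ℕ) (16m≤XX : 16 * m ≤ X * X) (m≤XX : m ≤ X * X) (X>0 : 0 < X) (G>0 : 0 < G) (XQ≤G : X * Q ≤ G)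
             (small : abs (quartic (+ X) (+ m) (+ G) (+ Q)) ≤ g * g * (Y * Y * (Y * Y))) where

      N-positive : ∀ r → 0 < E r
      N-positive r = ≤-trans (*-mono-≤ {1} {N r} (N>0 r) (m^n>0 X {{>-nonZero X>0}} r)) (E-lower r)

      -- Φ is homogeneous, so separation at A = GE bounds L r by Φ(G, Q) and Φ(E, O), against r! ≤ 4^r L r.
      gap-impossible : ∀ r → 0 < L r → 16 * (512 * m) ^ r * G ≤ X ^ suc r →
        (64 * X) ^ r * (g * g * (Y * Y * (Y * Y))) < X * (G * G * G) → ⊥
      gap-impossible r L>0 first second = <-irrefl refl (begin-strict
        -- The total is split into equal halves: one exceeds the term of Φ(G, Q) by `second`, the
        -- other dominates the term of Φ(E, O) by `first`.
        r ! * (X * (e * e * e * (G * G * G))) + r ! * (X * (e * e * e * (G * G * G)))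
          ≡⟨ double (r !) X e G ⟩
        r ! * (2 * X * (G * e * (G * e) * (G * e)))
          ≤⟨ *-monoˡ-≤ (2 * X * (G * e * (G * e) * (G * e))) (r!≤4^rL r L>0) ⟩
        4 ^ r * L r * (2 * X * (G * e * (G * e) * (G * e)))
          ≡⟨ *-assoc (4 ^ r) (L r) _ ⟩
        4 ^ r * (L r * (2 * X * (G * e * (G * e) * (G * e))))
          ≤⟨ *-monoʳ-≤ (4 ^ r) (separation 16m≤XX (G * e) (e * Q) (G * O r) slope₁ slope₂) ⟩
        4 ^ r * (abs (quartic (+ X) (+ m) (+ (G * e)) (+ (e * Q))) + abs (quartic (+ X) (+ m) (+ (G * e)) (+ (G * O r))))
          ≡⟨ cong (4 ^ r *_) (cong₂ _+_
               (trans (cong (λ z → abs (quartic (+ X) (+ m) (+ z) (+ (e * Q)))) (*-comm G e)) (quartic-homogeneous G Q e))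
               (quartic-homogeneous e (O r) G)) ⟩
        4 ^ r * (e * e * (e * e) * abs (quartic (+ X) (+ m) (+ G) (+ Q)) + G * G * (G * G) * abs (quartic (+ X) (+ m) (+ e) (+ O r)))
          ≡⟨ *-distribˡ-+ (4 ^ r) _ _ ⟩
        4 ^ r * (e * e * (e * e) * abs (quartic (+ X) (+ m) (+ G) (+ Q))) + 4 ^ r * (G * G * (G * G) * abs (quartic (+ X) (+ m) (+ e) (+ O r)))
          <⟨ +-mono-<-≤ γ-part padé-part ⟩
        r ! * (X * (e * e * e * (G * G * G))) + r ! * (X * (e * e * e * (G * G * G))) ∎)
        where
        open ≤-Reasoning
        e h : ℕ
        e = E r
        h = g * g * (Y * Y * (Y * Y))
        double : ∀ f X e G → f * (X * (e * e * e * (G * G * G))) + f * (X * (e * e * e * (G * G * G))) ≡ f * (2 * X * (G * e * (G * e) * (G * e)))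
        double = solve-∀
        swap : ∀ x a b → x * (a * b) ≡ a * (x * b)
        swap = solve-∀
        slope₁ : X * (e * Q) ≤ G * e
        slope₁ = ≤-trans (≤-reflexive (swap X e Q)) (≤-trans (*-monoʳ-≤ e XQ≤G) (≤-reflexive (*-comm e G)))
        slope₂ : X * (G * O r) ≤ G * e
        slope₂ = ≤-trans (≤-reflexive (swap X G (O r))) (*-monoʳ-≤ G (O-slope r))
        -- The 64 in `second`: 4 from `r!≤4^rL`, 2 from `E-upper`, 8 from `N≤8^r*r!`.
        4*2*8 : ∀ r → 4 ^ r * (2 ^ r * 8 ^ r) ≡ 64 ^ r
        4*2*8 r = trans (cong (4 ^ r *_) (sym (*-^ 2 8 r))) (sym (*-^ 4 16 r))
        γ-part : 4 ^ r * (e * e * (e * e) * abs (quartic (+ X) (+ m) (+ G) (+ Q))) < r ! * (X * (e * e * e * (G * G * G)))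
        γ-part = begin-strict
          4 ^ r * (e * e * (e * e) * abs (quartic (+ X) (+ m) (+ G) (+ Q)))
            ≤⟨ *-monoʳ-≤ (4 ^ r) (*-monoʳ-≤ (e * e * (e * e)) small) ⟩
          4 ^ r * (e * e * (e * e) * h)
            ≡⟨ regroup₁ (4 ^ r) e h ⟩
          e * e * e * (4 ^ r * e * h)
            ≤⟨ *-monoʳ-≤ (e * e * e) (*-monoˡ-≤ h (*-monoʳ-≤ (4 ^ r) (≤-trans (E-upper m≤XX r)
                 (*-monoˡ-≤ (X ^ r) (*-monoʳ-≤ (2 ^ r) (N≤8^r*r! r)))))) ⟩
          e * e * e * (4 ^ r * (2 ^ r * (8 ^ r * r !) * X ^ r) * h)
            ≡⟨ cong (e * e * e *_) (trans (regroup₂ (4 ^ r) (2 ^ r) (8 ^ r) (r !) (X ^ r) h)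
                 (cong (λ z → r ! * (z * h)) (trans (cong (_* X ^ r) (4*2*8 r)) (sym (*-^ 64 X r))))) ⟩
          e * e * e * (r ! * ((64 * X) ^ r * h))
            <⟨ *-monoʳ-< (e * e * e) {{>-nonZero (*-mono-≤ {1} {e * e} (*-mono-≤ {1} {e} (N-positive r) (N-positive r)) (N-positive r))}}
                 (*-monoʳ-< (r !) {{>-nonZero (1≤n! r)}} second) ⟩
          e * e * e * (r ! * (X * (G * G * G)))
            ≡⟨ regroup₃ e (r !) X (G * G * G) ⟩
          r ! * (X * (e * e * e * (G * G * G))) ∎
          where
          regroup₁ : ∀ p e h → p * (e * e * (e * e) * h) ≡ e * e * e * (p * e * h)
          regroup₁ = solve-∀
          regroup₂ : ∀ a b c f x h → a * (b * (c * f) * x) * h ≡ f * (a * (b * c) * x * h)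
          regroup₂ = solve-∀
          regroup₃ : ∀ e f x g → e * e * e * (f * (x * g)) ≡ f * (x * (e * e * e * g))
          regroup₃ = solve-∀
        padé-part : 4 ^ r * (G * G * (G * G) * abs (quartic (+ X) (+ m) (+ e) (+ O r))) ≤ r ! * (X * (e * e * e * (G * G * G)))
        padé-part = begin
          4 ^ r * (G * G * (G * G) * abs (quartic (+ X) (+ m) (+ e) (+ O r)))
            ≤⟨ *-monoʳ-≤ (4 ^ r) (*-monoʳ-≤ (G * G * (G * G)) (quartic-padé X m r X>0 m≤XX)) ⟩
          4 ^ r * (G * G * (G * G) * (m ^ r * (X ^ r * X ^ r) * (16 * (2 ^ r * n * (2 ^ r * n) * (2 ^ r * n * (2 ^ r * n))))))
            ≡⟨ regroup₁ (4 ^ r) G (m ^ r) (X ^ r) (2 ^ r) n ⟩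
          n * n * n * (X ^ r * X ^ r) * (G * G * G) * (16 * (4 ^ r * (2 ^ r * 2 ^ r * (2 ^ r * 2 ^ r))) * m ^ r * n * G)
            ≤⟨ *-monoʳ-≤ (n * n * n * (X ^ r * X ^ r) * (G * G * G)) (*-monoˡ-≤ G (*-monoʳ-≤ (16 * (4 ^ r * (2 ^ r * 2 ^ r * (2 ^ r * 2 ^ r))) * m ^ r) (N≤8^r*r! r))) ⟩
          n * n * n * (X ^ r * X ^ r) * (G * G * G) * (16 * (4 ^ r * (2 ^ r * 2 ^ r * (2 ^ r * 2 ^ r))) * m ^ r * (8 ^ r * r !) * G)
            ≡⟨ cong (n * n * n * (X ^ r * X ^ r) * (G * G * G) *_) (trans (regroup₂ (4 ^ r * (2 ^ r * 2 ^ r * (2 ^ r * 2 ^ r))) (m ^ r) (8 ^ r) (r !) G)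
                 (cong (λ z → r ! * (16 * z * G)) 512^)) ⟩
          n * n * n * (X ^ r * X ^ r) * (G * G * G) * (r ! * (16 * (512 * m) ^ r * G))
            ≤⟨ *-monoʳ-≤ (n * n * n * (X ^ r * X ^ r) * (G * G * G)) (*-monoʳ-≤ (r !) first) ⟩
          n * n * n * (X ^ r * X ^ r) * (G * G * G) * (r ! * (X * X ^ r))
            ≡⟨ regroup₃ n (X ^ r) (G * G * G) (r !) X ⟩
          r ! * (X * (n * X ^ r * (n * X ^ r) * (n * X ^ r) * (G * G * G)))
            ≤⟨ *-monoʳ-≤ (r !) (*-monoʳ-≤ X (*-monoˡ-≤ (G * G * G) (*-mono-≤ (*-mono-≤ (E-lower r) (E-lower r)) (E-lower r)))) ⟩
          r ! * (X * (e * e * e * (G * G * G))) ∎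
          where
          n : ℕ
          n = N r
          regroup₁ : ∀ p G m x t n → p * (G * G * (G * G) * (m * (x * x) * (16 * (t * n * (t * n) * (t * n * (t * n))))))
            ≡ n * n * n * (x * x) * (G * G * G) * (16 * (p * (t * t * (t * t))) * m * n * G)
          regroup₁ = solve-∀
          regroup₂ : ∀ a m b f G → 16 * a * m * (b * f) * G ≡ f * (16 * (a * b * m) * G)
          regroup₂ = solve-∀
          regroup₃ : ∀ n x g f X → n * n * n * (x * x) * g * (f * (X * x)) ≡ f * (X * (n * x * (n * x) * (n * x) * g))
          regroup₃ = solve-∀
          -- The 512 in `first`: 4 from `r!≤4^rL`, 2⁴ from the fourth power of 2^r·N r, and 8 from
          -- one of the four factors N r. The other three are kept and absorbed into E³ by
          -- `E-lower`.
          512^ : 4 ^ r * (2 ^ r * 2 ^ r * (2 ^ r * 2 ^ r)) * 8 ^ r * m ^ r ≡ (512 * m) ^ r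
          512^ = trans (cong (_* m ^ r) (trans (cong (λ z → 4 ^ r * (z * z) * 8 ^ r) (sym (*-^ 2 2 r)))
            (trans (cong (λ z → 4 ^ r * z * 8 ^ r) (sym (*-^ 4 4 r)))
            (trans (cong (_* 8 ^ r) (sym (*-^ 4 16 r))) (sym (*-^ 64 8 r)))))) (sym (*-^ 512 m r))

-- Choice of the approximant, and the contradiction for distant solutions.

module Thue where
  open Prelude
  import Data.Sum.Base as Sum
  open import Relation.Unary using (Decidable)
  open Evaluation using (quartic)
  open Arith

  switch : ∀ {P : ℕ → Set} → Decidable P → ¬ P 0 → ∀ n → P n → ∃[ r ] ¬ P r × P (suc r)
  switch P? ¬P0 zero    Pn = ⊥-elim (¬P0 Pn)
  switch P? ¬P0 (suc n) Pn with P? n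
  ... | yes p = switch P? ¬P0 n p
  ... | no ¬p = n , ¬p , Pn

  n<2^n : ∀ n → n < 2 ^ n
  n<2^n zero    = s≤s z≤n
  n<2^n (suc n) = ≤-trans (+-mono-≤ (m^n>0 2 n) (n<2^n n)) (≤-reflexive (cong (λ z → 2 ^ n + z) (sym (+-identityʳ (2 ^ n)))))

  -- Kept abstract because unfolding c * m would be unary.
  abstract
    c : ℕ
    c = 2 ^ 18

    c≡2^18 : c ≡ 2 ^ 18
    c≡2^18 = refl

    c-expand : ∀ y → 64 * (64 * (64 * y)) ≡ c * y
    c-expand y = trans (cube 64 y) (cong (_* y) {64 ^ 3} {2 ^ 18} refl)
      where
      cube : ∀ s y → s * (s * (s * y)) ≡ s ^ 3 * y
      cube s y = trans (sym (trans (*-assoc s (s * s) y) (cong (s *_) (*-assoc s s y)))) (cong (λ z → s * (s * z) * y) (sym (*-identityʳ s)))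

  2^≤c : ∀ i → i ≤ 18 → 2 ^ i ≤ c
  2^≤c i i≤18 = ≤-trans (^-monoʳ-≤ 2 i≤18) (≤-reflexive (sym c≡2^18))

  module _ (X m G Q g Y₁ Y₂ : ℕ) (m>0 : 0 < m) (Y₁>0 : 0 < Y₁) (g>0 : 0 < g) (Q>0 : 0 < Q)
           (normEq : G * G + m * (Q * Q) ≡ g * (Y₁ * Y₂)) (g≤2m : g ≤ 2 * m) (2XQ≤G : 2 * X * Q ≤ G)
           (small : abs (quartic (+ X) (+ m) (+ G) (+ Q)) ≤ g * g * (Y₁ * Y₁ * (Y₁ * Y₁)))
           (X-large : (c * m) ^ 4 ≤ X) (Y₂-large : Y₁ ^ 4 ≤ Y₂) where

    private
      k : ℕ
      k = c * m

      -- The first hypothesis of `gap-impossible`. The index wanted is where it starts to hold: its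
      -- failure just before bounds X^(r+1) from above, which yields the second hypothesis.
      P : ℕ → Set
      P r = 16 * (512 * m) ^ r * G ≤ X ^ suc r

    k>0 : 0 < k
    k>0 = *-mono-≤ {1} {c} (2^≤c 0 z≤n) m>0

    k≤X : k ≤ X
    k≤X = ≤-trans (≤-reflexive (sym (*-identityʳ k))) (≤-trans (*-monoʳ-≤ k (m^n>0 k {{>-nonZero k>0}} 3)) X-large)

    X>0 : 0 < X
    X>0 = ≤-trans k>0 k≤X

    G>0 : 0 < G
    G>0 = ≤-trans (*-mono-≤ {1} {2 * X} (*-mono-≤ {1} {2} (s≤s z≤n) X>0) Q>0) 2XQ≤G

    c*m≤X : ∀ a → a ≤ c → a * m ≤ X
    c*m≤X a c≤ = ≤-trans (*-monoˡ-≤ m c≤) k≤X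

    X≤XX : X ≤ X * X
    X≤XX = ≤-trans (≤-reflexive (sym (*-identityʳ X))) (*-monoʳ-≤ X X>0)

    16≤ : 16 ≤ c
    16≤ = 2^≤c 4 (m≤m+n 4 14)

    512≤ : 512 ≤ c
    512≤ = 2^≤c 9 (m≤m+n 9 9)

    1024≤ : 1024 ≤ c
    1024≤ = 2^≤c 10 (m≤m+n 10 8)

    P-suc : ∀ r → P r → P (suc r)
    P-suc r p = ≤-trans (≤-reflexive (regroup (512 * m) ((512 * m) ^ r) G)) (*-mono-≤ (c*m≤X 512 512≤) p)
      where
      regroup : ∀ c p G → 16 * (c * p) * G ≡ c * (16 * p * G)
      regroup = solve-∀

    ¬P0 : ¬ P 0
    ¬P0 p = <-irrefl refl (begin-strict
      X ^ 1          ≡⟨ *-identityʳ X ⟩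
      X              ≤⟨ ≤-trans (m≤m*n X (2 * Q) {{>-nonZero (*-mono-≤ {1} {2} (s≤s z≤n) Q>0)}}) (≤-reflexive (regroup X Q)) ⟩
      2 * X * Q      ≤⟨ 2XQ≤G ⟩
      G              <⟨ m<m*n G 16 {{>-nonZero G>0}} (s≤s (s≤s z≤n)) ⟩
      G * 16         ≡⟨ *-comm G 16 ⟩
      16 * 1 * G     ≤⟨ p ⟩
      X ^ 1 ∎)
      where
      open ≤-Reasoning
      regroup : ∀ X Q → X * (2 * Q) ≡ 2 * X * Q
      regroup = solve-∀

    -- With R = 16G the factor 16G is below 2^R, which is absorbed because X ≥ 2·512m.
    P-large : P (16 * G)
    P-large = begin
      16 * (512 * m) ^ R * G      ≡⟨ regroup ((512 * m) ^ R) G ⟩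
      16 * G * (512 * m) ^ R      ≤⟨ *-monoˡ-≤ ((512 * m) ^ R) (<⇒≤ (n<2^n R)) ⟩
      2 ^ R * (512 * m) ^ R       ≡⟨ *-^ 2 (512 * m) R ⟨
      (2 * (512 * m)) ^ R         ≤⟨ ^-monoˡ-≤ R (≤-trans (≤-reflexive (sym (*-assoc 2 512 m))) (c*m≤X 1024 1024≤)) ⟩
      X ^ R                       ≤⟨ m≤n*m (X ^ R) X {{>-nonZero X>0}} ⟩
      X ^ suc R ∎
      where
      open ≤-Reasoning
      R : ℕ
      R = 16 * G
      regroup : ∀ p G → 16 * p * G ≡ 16 * G * p
      regroup = solve-∀

    16m≤XX : 16 * m ≤ X * X
    16m≤XX = ≤-trans (c*m≤X 16 16≤) X≤XX

    m≤XX : m ≤ X * X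
    m≤XX = ≤-trans (m≤n*m m 16) 16m≤XX

    XQ≤G : X * Q ≤ G
    XQ≤G = ≤-trans (≤-trans (m≤n*m (X * Q) 2) (≤-reflexive (sym (*-assoc 2 X Q)))) 2XQ≤G

    GG≤ : G * G ≤ k * (Y₁ * Y₂)
    GG≤ = ≤-trans (m≤m+n (G * G) (m * (Q * Q))) (≤-trans (≤-reflexive normEq)
      (*-monoˡ-≤ (Y₁ * Y₂) (≤-trans g≤2m (*-monoˡ-≤ m (2^≤c 1 (s≤s z≤n))))))

    ≤2GG : g * (Y₁ * Y₂) ≤ 2 * (G * G)
    ≤2GG = ≤-trans (≤-reflexive (sym normEq)) (≤-trans (+-monoʳ-≤ (G * G) mQQ≤GG) (≤-reflexive (cong (λ z → G * G + z) (sym (+-identityʳ (G * G))))))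
      where
      regroup : ∀ X Q → X * X * (Q * Q) ≡ X * Q * (X * Q)
      regroup = solve-∀
      mQQ≤GG : m * (Q * Q) ≤ G * G
      mQQ≤GG = ≤-trans (*-monoˡ-≤ (Q * Q) m≤XX) (≤-trans (≤-reflexive (regroup X Q)) (*-mono-≤ XQ≤G XQ≤G))

    module _ (r : ℕ) (¬Pr : ¬ P r) where
      open ≤-Reasoning

      K : ℕ
      K = k ^ suc r

      K>0 : 0 < K
      K>0 = m^n>0 k {{>-nonZero k>0}} (suc r)

      X-upper : X ^ suc r < 16 * (512 * m) ^ r * G
      X-upper = ≰⇒> ¬Pr

      X≤KG : X ^ suc r ≤ K * G
      X≤KG = ≤-trans (<⇒≤ X-upper) (*-monoˡ-≤ G (*-mono-≤ (≤-trans 16≤ (m≤m*n (c) m {{>-nonZero m>0}})) (^-monoˡ-≤ r (*-monoˡ-≤ m 512≤))))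

      -- X ≥ k⁴ gives K⁸ ≤ X^(2r+2), while X^(r+1) ≤ KG and G² ≤ k·Y₁Y₂ spend three factors K.
      K⁵≤Y₁Y₂ : K ^ 5 ≤ Y₁ * Y₂
      K⁵≤Y₁Y₂ = *-cancelˡ-≤ (K * K * K) {{>-nonZero (*-mono-≤ {1} {K * K} (*-mono-≤ {1} {K} K>0 K>0) K>0)}} (begin
        K * K * K * K ^ 5                 ≡⟨ regroup₁ K ⟩
        K ^ 4 * K ^ 4                     ≡⟨ cong (λ z → z * z) (trans (^-*-assoc k (suc r) 4) (trans (cong (k ^_) (*-comm (suc r) 4)) (sym (^-*-assoc k 4 (suc r))))) ⟩
        (k ^ 4) ^ suc r * (k ^ 4) ^ suc r ≤⟨ *-mono-≤ (^-monoˡ-≤ (suc r) X-large) (^-monoˡ-≤ (suc r) X-large) ⟩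
        X ^ suc r * X ^ suc r             ≤⟨ *-mono-≤ X≤KG X≤KG ⟩
        K * G * (K * G)                   ≡⟨ regroup₂ K G ⟩
        K * K * (G * G)                   ≤⟨ *-monoʳ-≤ (K * K) GG≤ ⟩
        K * K * (k * (Y₁ * Y₂))           ≤⟨ *-monoʳ-≤ (K * K) (*-monoˡ-≤ (Y₁ * Y₂) (m≤m*n k (k ^ r) {{>-nonZero (m^n>0 k {{>-nonZero k>0}} r)}})) ⟩
        K * K * (K * (Y₁ * Y₂))           ≡⟨ regroup₃ K (Y₁ * Y₂) ⟩
        K * K * K * (Y₁ * Y₂) ∎)
        where
        regroup₁ : ∀ K → K * K * K * (K * (K * (K * (K * (K * 1))))) ≡ K * (K * (K * (K * 1))) * (K * (K * (K * (K * 1))))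
        regroup₁ = solve-∀
        regroup₂ : ∀ K G → K * G * (K * G) ≡ K * K * (G * G)
        regroup₂ = solve-∀
        regroup₃ : ∀ K y → K * K * (K * y) ≡ K * K * K * y
        regroup₃ = solve-∀

      -- Otherwise Y₂⁵ < K⁵·Y₁¹⁵ ≤ Y₂·Y₁¹⁶ ≤ Y₂⁵, the last step by Y₁⁴ ≤ Y₂. The exponents in the
      -- lower bounds for X and Y₂ are tuned to meet here.
      KY₁³≤Y₂ : K * (Y₁ * Y₁ * Y₁) ≤ Y₂
      KY₁³≤Y₂ with K * (Y₁ * Y₁ * Y₁) ≤? Y₂
      ... | yes p = p
      ... | no ¬p = ⊥-elim (<-irrefl refl (begin-strict
        Y₂ ^ 5                              <⟨ ^-monoˡ-< 5 (≰⇒> ¬p) ⟩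
        (K * (Y₁ * Y₁ * Y₁)) ^ 5            ≡⟨ *-^ K (Y₁ * Y₁ * Y₁) 5 ⟩
        K ^ 5 * (Y₁ * Y₁ * Y₁) ^ 5          ≤⟨ *-monoˡ-≤ ((Y₁ * Y₁ * Y₁) ^ 5) K⁵≤Y₁Y₂ ⟩
        Y₁ * Y₂ * (Y₁ * Y₁ * Y₁) ^ 5        ≡⟨ regroup Y₁ Y₂ ⟩
        Y₂ * (Y₁ ^ 4) ^ 4                   ≤⟨ *-monoʳ-≤ Y₂ (^-monoˡ-≤ 4 Y₂-large) ⟩
        Y₂ ^ 5 ∎))
        where
        regroup : ∀ a b → let c = a * a * a ; d = a * (a * (a * (a * 1))) in
          a * b * (c * (c * (c * (c * (c * 1))))) ≡ b * (d * (d * (d * (d * 1))))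
        regroup = solve-∀

      h : ℕ
      h = g * g * (Y₁ * Y₁ * (Y₁ * Y₁))

      h>0 : 0 < h
      h>0 = *-mono-≤ {1} {g * g} (*-mono-≤ {1} {g} g>0 g>0) (*-mono-≤ {1} {Y₁ * Y₁} (*-mono-≤ {1} {Y₁} Y₁>0 Y₁>0) (*-mono-≤ {1} {Y₁} Y₁>0 Y₁>0))

      -- Source of the constant 2^18: outside the r-th powers stands 2·64²·16·2 = 2^18, and inside
      -- them 64·512 = 2^15 is smaller.
      coefficient : 2 * (64 ^ suc (suc r) * (16 * (512 * m) ^ r)) * (2 * m) ≤ K
      coefficient = begin
        2 * (64 ^ suc (suc r) * (16 * (512 * m) ^ r)) * (2 * m)  ≡⟨ regroup 64 (64 ^ r) ((512 * m) ^ r) m ⟩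
        64 * (64 * (64 * (m * (64 ^ r * (512 * m) ^ r))))        ≡⟨ c-expand (m * (64 ^ r * (512 * m) ^ r)) ⟩
        c * (m * (64 ^ r * (512 * m) ^ r))                       ≡⟨ *-assoc c m _ ⟨
        k * (64 ^ r * (512 * m) ^ r)                             ≡⟨ cong (k *_) (*-^ 64 (512 * m) r) ⟨
        k * (64 * (512 * m)) ^ r                                 ≤⟨ *-monoʳ-≤ k (^-monoˡ-≤ r (≤-trans (≤-reflexive (sym (*-assoc 64 512 m))) (*-monoˡ-≤ m 64*512≤))) ⟩
        K ∎
        where
        regroup : ∀ s p q m → 2 * (s * (s * p) * (16 * q)) * (2 * m) ≡ s * (s * (64 * (m * (p * q))))
        regroup = solve-∀
        64*512≤ : 64 * 512 ≤ c
        64*512≤ = 2^≤c 15 (m≤m+n 15 3)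

      -- The exponent r + 2 is the larger of the two indices that `nonvanishing` may return. After
      -- X^(r+1) is replaced by its upper bound, the claim is d·h ≤ G², and 2G² ≥ g·Y₁Y₂ reduces
      -- this to a multiple of Y₁³ being at most Y₂.
      core : 64 ^ suc (suc r) * X ^ suc r * h < G * G * G
      core = begin-strict
        64 ^ suc (suc r) * X ^ suc r * h
          <⟨ *-monoˡ-< h {{>-nonZero h>0}} (*-monoʳ-< (64 ^ suc (suc r)) {{>-nonZero (m^n>0 64 (suc (suc r)))}} X-upper) ⟩
        64 ^ suc (suc r) * (16 * (512 * m) ^ r * G) * h
          ≡⟨ regroup₁ (64 ^ suc (suc r)) (16 * (512 * m) ^ r) G h ⟩
        d * h * G
          ≤⟨ *-monoˡ-≤ G (*-cancelˡ-≤ {d * h} {G * G} 2 (begin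
               2 * (d * h)                               ≡⟨ regroup₂ d g Y₁ ⟩
               g * (Y₁ * (2 * d * g * (Y₁ * Y₁ * Y₁)))   ≤⟨ *-monoʳ-≤ g (*-monoʳ-≤ Y₁ (≤-trans (*-monoˡ-≤ (Y₁ * Y₁ * Y₁) (≤-trans (*-monoʳ-≤ (2 * d) g≤2m) coefficient)) KY₁³≤Y₂)) ⟩
               g * (Y₁ * Y₂)                             ≤⟨ ≤2GG ⟩
               2 * (G * G) ∎)) ⟩
        G * G * G ∎
        where
        d : ℕ
        d = 64 ^ suc (suc r) * (16 * (512 * m) ^ r)
        regroup₁ : ∀ p q G h → p * (q * G) * h ≡ p * q * h * G
        regroup₁ = solve-∀
        regroup₂ : ∀ c g Y → 2 * (c * (g * g * (Y * Y * (Y * Y)))) ≡ g * (Y * (2 * c * g * (Y * Y * Y)))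
        regroup₂ = solve-∀

      second₁ : (64 * X) ^ suc r * h < X * (G * G * G)
      second₁ = begin-strict
        (64 * X) ^ suc r * h              ≡⟨ cong (_* h) (*-^ 64 X (suc r)) ⟩
        64 ^ suc r * X ^ suc r * h        ≤⟨ *-monoˡ-≤ h (*-monoˡ-≤ (X ^ suc r) (^-monoʳ-≤ 64 (n≤1+n (suc r)))) ⟩
        64 ^ suc (suc r) * X ^ suc r * h  <⟨ core ⟩
        G * G * G                         ≤⟨ m≤n*m (G * G * G) X {{>-nonZero X>0}} ⟩
        X * (G * G * G) ∎

      second₂ : (64 * X) ^ suc (suc r) * h < X * (G * G * G)
      second₂ = begin-strict
        (64 * X) ^ suc (suc r) * h              ≡⟨ trans (cong (_* h) (*-^ 64 X (suc (suc r)))) (regroup (64 ^ suc (suc r)) X (X ^ suc r) h) ⟩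
        X * (64 ^ suc (suc r) * X ^ suc r * h)  <⟨ *-monoʳ-< X {{>-nonZero X>0}} core ⟩
        X * (G * G * G) ∎
        where
        regroup : ∀ p X q h → p * (X * q) * h ≡ X * (p * q * h)
        regroup = solve-∀

    -- At the switch P fails at r and holds at r + 1, hence also at r + 2; L is nonzero at one of
    -- these two.
    thue : ⊥
    thue = conclude (switch (λ r → 16 * (512 * m) ^ r * G ≤? X ^ suc r) ¬P0 (16 * G) P-large)
      where
      open PadéEstimates X m using (L; nonvanishing; gap-impossible)
      conclude : (∃[ r ] ¬ P r × P (suc r)) → ⊥
      conclude (r , ¬Pr , Pr₁) = [
          (λ L>0 → gap-impossible m>0 G Q g Y₁ 16m≤XX m≤XX X>0 G>0 XQ≤G small (suc r) L>0 Pr₁ (second₁ r ¬Pr))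
        , (λ L>0 → gap-impossible m>0 G Q g Y₁ 16m≤XX m≤XX X>0 G>0 XQ≤G small (suc (suc r)) L>0 (P-suc (suc r) Pr₁) (second₂ r ¬Pr)) ]′
        (nonvanishing m>0 G Q G>0 Q>0 (suc r))

-- Units of ℤ[√D] modulo squares.

module Units where
  open Prelude
  import Data.Sum.Base as Sum
  open Cast

  square-<⁻¹ : ∀ {a b} → a * a < b * b → a < b
  square-<⁻¹ {a} {b} h = ≰⇒> λ b≤a → <-irrefl refl (<-≤-trans h (*-mono-≤ b≤a b≤a))

  square-≤⁻¹ : ∀ {a b} → a * a ≤ b * b → a ≤ b
  square-≤⁻¹ {a} {b} h = ≮⇒≥ λ b<a → <-irrefl refl (<-≤-trans (*-mono-< b<a b<a) h)

  norm : ℕ → ℤ → ℤ → ℤ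
  norm D a b = a ℤ.* a ℤ.- + D ℤ.* (b ℤ.* b)

  IsUnit : ℤ → Set
  IsUnit n = n ≡ + 1 ⊎ n ≡ - + 1

  unit-* : ∀ {m n} → IsUnit m → IsUnit n → IsUnit (m ℤ.* n)
  unit-* (inj₁ refl) (inj₁ refl) = inj₁ refl
  unit-* (inj₁ refl) (inj₂ refl) = inj₂ refl
  unit-* (inj₂ refl) (inj₁ refl) = inj₂ refl
  unit-* (inj₂ refl) (inj₂ refl) = inj₁ refl

  norm⇒≡ : ∀ {D a b} → norm D (+ a) (+ b) ≡ + 1 → a * a ≡ D * (b * b) + 1
  norm⇒≡ {D} {a} {b} p = uncastEq (` a :* ` a) (` D :* (` b :* ` b) :+ ` 1)
    (trans (add (+ a ℤ.* + a) (+ D ℤ.* (+ b ℤ.* + b))) (cong (λ n → + D ℤ.* (+ b ℤ.* + b) ℤ.+ n) p))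
    where
    add : ∀ x y → x ≡ y ℤ.+ (x ℤ.- y)
    add = solveℤ-∀

  norm⇒≡⁻ : ∀ {D a b} → norm D (+ a) (+ b) ≡ - + 1 → a * a + 1 ≡ D * (b * b)
  norm⇒≡⁻ {D} {a} {b} p = uncastEq (` a :* ` a :+ ` 1) (` D :* (` b :* ` b))
    (trans (cong (λ n → + a ℤ.* + a ℤ.- n) (sym p)) (add (+ a ℤ.* + a) (+ D ℤ.* (+ b ℤ.* + b))))
    where
    add : ∀ x y → x ℤ.- (x ℤ.- y) ≡ y
    add = solveℤ-∀

  upper : ∀ {D a b} → IsUnit (norm D (+ a) (+ b)) → a * a ≤ D * (b * b) + 1
  upper {D} {a} {b} (inj₁ p) = ≤-reflexive (norm⇒≡ {D} {a} {b} p)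
  upper {D} {a} {b} (inj₂ p) = ≤-trans (m≤m+n (a * a) 1) (≤-trans (≤-reflexive (norm⇒≡⁻ {D} {a} {b} p)) (m≤m+n (D * (b * b)) 1))

  lower : ∀ {D a b} → IsUnit (norm D (+ a) (+ b)) → D * (b * b) ≤ a * a + 1
  lower {D} {a} {b} (inj₁ p) = ≤-trans (m≤m+n (D * (b * b)) 1) (≤-trans (≤-reflexive (sym (norm⇒≡ {D} {a} {b} p))) (m≤m+n (a * a) 1))
  lower {D} {a} {b} (inj₂ p) = ≤-reflexive (sym (norm⇒≡⁻ {D} {a} {b} p))

  -- The margin 4 outweighs what two norms of unknown sign ±1 can take away when squares of first
  -- coordinates are compared.
  square-grows : ∀ {D a b} → 1 < D → 0 < a → a < b → D * (a * a) + 4 ≤ D * (b * b)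
  square-grows {D} {a} {b} 1<D 0<a a<b = ≤-trans
    (+-monoʳ-≤ (D * (a * a)) (≤-trans (*-mono-≤ {2} {D} 1<D (+-mono-≤ 0<a 0<a)) (m≤n+m (D * (a + a)) D)))
    (≤-trans (≤-reflexive (expand D a)) (*-monoʳ-≤ D (*-mono-≤ a<b a<b)))
    where
    expand : ∀ D a → D * (a * a) + (D + D * (a + a)) ≡ D * ((1 + a) * (1 + a))
    expand = solve-∀

  pos-∸ : ∀ {a b} → b ≤ a → + (a ∸ b) ≡ + a ℤ.- + b
  pos-∸ {a} {b} b≤a = trans (sym (ℤ.⊖-≥ b≤a)) (sym (ℤ.m-n≡m⊖n a b))

  module _ (D T U : ℕ) (1<D : 1 < D) (fundamental : IsFundamentalUnit D T U) where

    private
      T>0 : 0 < T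
      T>0 = proj₁ (proj₁ fundamental)
      U>0 : 0 < U
      U>0 = proj₁ (proj₂ (proj₁ fundamental))
      unitε : IsUnit (norm D (+ T) (+ U))
      unitε = proj₂ (proj₂ (proj₁ fundamental))

    -- A second coordinate below U forces a first coordinate below T, because a² is within 1 of
    -- D·b²; then either alternative of the comparison with ε fails.
    U≤b : ∀ a b → 0 < a → 0 < b → IsUnit (norm D (+ a) (+ b)) → U ≤ b
    U≤b a b a>0 b>0 unit = ≮⇒≥ λ b<U → contradiction b<U (proj₂ fundamental a b (a>0 , b>0 , unit))
      where
      contradiction : b < U → LeQD D (+ T) (+ U) (+ a) (+ b) → ⊥
      contradiction b<U (inj₁ (T-a≤0 , _)) = <-irrefl refl (<-≤-trans a<T (ℤ.drop‿+≤+ (ℤ.i-j≤0⇒i≤j T-a≤0)))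
        where
        a<T : a < T
        a<T = square-<⁻¹ (s≤s⁻¹ (begin
          2 + a * a               ≤⟨ +-monoʳ-≤ 2 (upper {D} {a} {b} unit) ⟩
          2 + (D * (b * b) + 1)   ≤⟨ ≤-trans (m≤m+n _ 1) (≤-reflexive (regroup (D * (b * b)))) ⟩
          D * (b * b) + 4         ≤⟨ square-grows 1<D b>0 b<U ⟩
          D * (U * U)             ≤⟨ lower {D} {T} {U} unitε ⟩
          T * T + 1               ≡⟨ +-comm (T * T) 1 ⟩
          suc (T * T)             ∎))
          where
          open ≤-Reasoning
          regroup : ∀ x → 2 + (x + 1) + 1 ≡ x + 4
          regroup = solve-∀
      contradiction b<U (inj₂ (0≤b-U , _)) = <-irrefl refl (<-≤-trans b<U (ℤ.drop‿+≤+ (ℤ.0≤i-j⇒j≤i 0≤b-U)))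

    -- Both squares lie within 1 of D·U², whereas squares of distinct positive integers differ by at
    -- least 3.
    same-U : ∀ a → 0 < a → IsUnit (norm D (+ a) (+ U)) → a ≡ T
    same-U a a>0 unit = ≤-antisym
      (≮⇒≥ λ T<a → apart T>0 T<a (upper {D} {a} {U} unit) (lower {D} {T} {U} unitε))
      (≮⇒≥ λ a<T → apart a>0 a<T (upper {D} {T} {U} unitε) (lower {D} {a} {U} unit))
      where
      apart : ∀ {x y c} → 0 < x → x < y → y * y ≤ c + 1 → c ≤ x * x + 1 → ⊥
      apart {x} {y} {c} 0<x x<y y² c≤ = <-irrefl refl (begin-strict
        x * x + 2            <⟨ +-monoʳ-< (x * x) (s≤s (+-mono-≤ 0<x 0<x)) ⟩
        x * x + suc (x + x)  ≡⟨ expand x ⟩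
        suc x * suc x        ≤⟨ *-mono-≤ x<y x<y ⟩
        y * y                ≤⟨ y² ⟩
        c + 1                ≤⟨ +-monoˡ-≤ 1 c≤ ⟩
        x * x + 1 + 1        ≡⟨ +-assoc (x * x) 1 1 ⟩
        x * x + 2            ∎)
        where
        open ≤-Reasoning
        expand : ∀ x → x * x + (1 + (x + x)) ≡ (1 + x) * (1 + x)
        expand = solve-∀

    Quotient : ℕ → ℕ → Set
    Quotient a b = ∃[ a′ ] ∃[ b′ ] 0 < a′ × b′ < b × IsUnit (norm D (+ a′) (+ b′))
        × + a ≡ + a′ ℤ.* + T ℤ.+ + D ℤ.* (+ b′ ℤ.* + U) × + b ≡ + a′ ℤ.* + U ℤ.+ + b′ ℤ.* + T

    -- Division by ε: up to the sign of its norm the quotient has coordinates aT - DbU and bT - aU.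
    -- U < b makes the signed values positive, so the truncated subtractions are exact.
    descent : ∀ a b → 0 < a → U < b → IsUnit (norm D (+ a) (+ b)) → Quotient a b
    descent a b a>0 U<b unit = [ case₊ , case₋ ]′ unitε
      where
      open ≤-Reasoning
      UU<bb : U * U < b * b
      UU<bb = *-mono-< U<b U<b
      DUU : D * (U * U) + 4 ≤ D * (b * b)
      DUU = square-grows 1<D U>0 U<b
      b′<b : ∀ a′ b′ → 0 < a′ → + b ≡ + a′ ℤ.* + U ℤ.+ + b′ ℤ.* + T → b′ < b
      b′<b a′ b′ a′>0 eq = begin
        1 + b′            ≤⟨ +-mono-≤ (*-mono-≤ {1} {a′} a′>0 U>0) (m≤m*n b′ T {{>-nonZero T>0}}) ⟩
        a′ * U + b′ * T   ≡⟨ uncastEq (` a′ :* ` U :+ ` b′ :* ` T) (` b) (sym eq) ⟩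
        b                 ∎
      -- ν is the norm of ε and its own inverse, so one computation covers both signs.
      finish : ∀ a′ b′ ν → 0 < a′ → IsUnit ν → norm D (+ T) (+ U) ≡ ν →
        + a′ ≡ ν ℤ.* (+ a ℤ.* + T ℤ.- + D ℤ.* (+ b ℤ.* + U)) → + b′ ≡ ν ℤ.* (+ b ℤ.* + T ℤ.- + a ℤ.* + U) →
        ν ℤ.* ν ≡ + 1 → Quotient a b
      finish a′ b′ ν a′>0 unitν norm≡ a-eq b-eq ν²≡1 =
        a′ , b′ , a′>0 , b′<b a′ b′ a′>0 b-back ,
        subst IsUnit (sym norm-eq) (unit-* unit unitν) , a-back , b-back
        where
        a-back : + a ≡ + a′ ℤ.* + T ℤ.+ + D ℤ.* (+ b′ ℤ.* + U)
        a-back = sym (trans (cong₂ (λ x y → x ℤ.* + T ℤ.+ + D ℤ.* (y ℤ.* + U)) a-eq b-eq)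
          (trans (identity (+ a) (+ b) (+ T) (+ U) (+ D) ν) (trans (cong (λ n → ν ℤ.* + a ℤ.* n) norm≡) (trans (swap ν (+ a)) (trans (cong (ℤ._* + a) ν²≡1) (ℤ.*-identityˡ (+ a)))))))
          where
          identity : ∀ a b T U D ν → ν ℤ.* (a ℤ.* T ℤ.- D ℤ.* (b ℤ.* U)) ℤ.* T ℤ.+ D ℤ.* (ν ℤ.* (b ℤ.* T ℤ.- a ℤ.* U) ℤ.* U)
            ≡ ν ℤ.* a ℤ.* (T ℤ.* T ℤ.- D ℤ.* (U ℤ.* U))
          identity = solveℤ-∀
          swap : ∀ ν a → ν ℤ.* a ℤ.* ν ≡ ν ℤ.* ν ℤ.* a
          swap = solveℤ-∀
        b-back : + b ≡ + a′ ℤ.* + U ℤ.+ + b′ ℤ.* + T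
        b-back = sym (trans (cong₂ (λ x y → x ℤ.* + U ℤ.+ y ℤ.* + T) a-eq b-eq)
          (trans (identity (+ a) (+ b) (+ T) (+ U) (+ D) ν) (trans (cong (λ n → ν ℤ.* + b ℤ.* n) norm≡) (trans (swap ν (+ b)) (trans (cong (ℤ._* + b) ν²≡1) (ℤ.*-identityˡ (+ b)))))))
          where
          identity : ∀ a b T U D ν → ν ℤ.* (a ℤ.* T ℤ.- D ℤ.* (b ℤ.* U)) ℤ.* U ℤ.+ ν ℤ.* (b ℤ.* T ℤ.- a ℤ.* U) ℤ.* T
            ≡ ν ℤ.* b ℤ.* (T ℤ.* T ℤ.- D ℤ.* (U ℤ.* U))
          identity = solveℤ-∀
          swap : ∀ ν a → ν ℤ.* a ℤ.* ν ≡ ν ℤ.* ν ℤ.* a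
          swap = solveℤ-∀
        norm-eq : norm D (+ a′) (+ b′) ≡ norm D (+ a) (+ b) ℤ.* ν
        norm-eq = trans (cong₂ (norm D) a-eq b-eq)
          (trans (identity (+ a) (+ b) (+ T) (+ U) (+ D) ν)
            (trans (cong₂ (λ x y → x ℤ.* (norm D (+ a) (+ b) ℤ.* y)) ν²≡1 norm≡) (ℤ.*-identityˡ _)))
          where
          identity : ∀ a b T U D ν →
            ν ℤ.* (a ℤ.* T ℤ.- D ℤ.* (b ℤ.* U)) ℤ.* (ν ℤ.* (a ℤ.* T ℤ.- D ℤ.* (b ℤ.* U))) ℤ.- D ℤ.* (ν ℤ.* (b ℤ.* T ℤ.- a ℤ.* U) ℤ.* (ν ℤ.* (b ℤ.* T ℤ.- a ℤ.* U)))
            ≡ ν ℤ.* ν ℤ.* ((a ℤ.* a ℤ.- D ℤ.* (b ℤ.* b)) ℤ.* (T ℤ.* T ℤ.- D ℤ.* (U ℤ.* U)))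
          identity = solveℤ-∀
      case₊ : norm D (+ T) (+ U) ≡ + 1 → Quotient a b
      case₊ p = finish (a * T ∸ D * (b * U)) (b * T ∸ a * U) (+ 1) (m<n⇒0<n∸m first) (inj₁ refl) p
        (trans (pos-∸ (<⇒≤ first)) (trans (cong₂ ℤ._-_ (ℤ.pos-* a T) (cast (` D :* (` b :* ` U)))) (sym (ℤ.*-identityˡ _))))
        (trans (pos-∸ (<⇒≤ second)) (trans (cong₂ ℤ._-_ (ℤ.pos-* b T) (ℤ.pos-* a U)) (sym (ℤ.*-identityˡ _)))) refl
        where
        TT : T * T ≡ D * (U * U) + 1
        TT = norm⇒≡ {D} {T} {U} p
        first : D * (b * U) < a * T
        first = square-<⁻¹ (+-cancelʳ-< (T * T) _ _ (begin-strict
          D * (b * U) * (D * (b * U)) + T * T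
            <⟨ +-monoʳ-< (D * (b * U) * (D * (b * U))) (≤-trans (s≤s (≤-reflexive TT)) (≤-trans (≤-trans (m≤m+n _ 2) (≤-reflexive (shift (D * (U * U))))) DUU)) ⟩
          D * (b * U) * (D * (b * U)) + D * (b * b)
            ≡⟨ identity D b U ⟩
          D * (b * b) * (D * (U * U) + 1)
            ≡⟨ cong (D * (b * b) *_) TT ⟨
          D * (b * b) * (T * T)
            ≤⟨ *-monoˡ-≤ (T * T) (lower {D} {a} {b} unit) ⟩
          (a * a + 1) * (T * T)
            ≡⟨ identity₂ a T ⟩
          a * T * (a * T) + T * T ∎))
          where
          shift : ∀ x → suc (x + 1) + 2 ≡ x + 4
          shift = solve-∀
          identity : ∀ D b U → D * (b * U) * (D * (b * U)) + D * (b * b) ≡ D * (b * b) * (D * (U * U) + 1)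
          identity = solve-∀
          identity₂ : ∀ a T → (a * a + 1) * (T * T) ≡ a * T * (a * T) + T * T
          identity₂ = solve-∀
        second : a * U < b * T
        second = square-<⁻¹ (begin-strict
          a * U * (a * U)                ≡⟨ identity a U ⟩
          a * a * (U * U)                ≤⟨ *-monoˡ-≤ (U * U) (upper {D} {a} {b} unit) ⟩
          (D * (b * b) + 1) * (U * U)    ≡⟨ expand D b U ⟩
          b * b * (D * (U * U)) + U * U  <⟨ +-monoʳ-< (b * b * (D * (U * U))) UU<bb ⟩
          b * b * (D * (U * U)) + b * b  ≡⟨ collect (b * b) (D * (U * U)) ⟩
          b * b * (D * (U * U) + 1)      ≡⟨ cong (b * b *_) TT ⟨
          b * b * (T * T)                ≡⟨ identity b T ⟨
          b * T * (b * T) ∎)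
          where
          identity : ∀ a U → a * U * (a * U) ≡ a * a * (U * U)
          identity = solve-∀
          expand : ∀ D b U → (D * (b * b) + 1) * (U * U) ≡ b * b * (D * (U * U)) + U * U
          expand = solve-∀
          collect : ∀ x y → x * y + x ≡ x * (y + 1)
          collect = solve-∀
      case₋ : norm D (+ T) (+ U) ≡ - + 1 → Quotient a b
      case₋ p = finish (D * (b * U) ∸ a * T) (a * U ∸ b * T) (- + 1) (m<n⇒0<n∸m first) (inj₂ refl) p
        (trans (pos-∸ (<⇒≤ first)) (trans (cong₂ ℤ._-_ (cast (` D :* (` b :* ` U))) (ℤ.pos-* a T)) (flip (+ D ℤ.* (+ b ℤ.* + U)) (+ a ℤ.* + T))))
        (trans (pos-∸ (<⇒≤ second)) (trans (cong₂ ℤ._-_ (ℤ.pos-* a U) (ℤ.pos-* b T)) (flip (+ a ℤ.* + U) (+ b ℤ.* + T)))) refl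
        where
        flip : ∀ x y → x ℤ.- y ≡ - + 1 ℤ.* (y ℤ.- x)
        flip = solveℤ-∀
        TT : T * T + 1 ≡ D * (U * U)
        TT = norm⇒≡⁻ {D} {T} {U} p
        first : a * T < D * (b * U)
        first = square-<⁻¹ (+-cancelʳ-< (a * a) _ _ (begin-strict
          a * T * (a * T) + a * a                        ≡⟨ collect a T ⟩
          a * a * (T * T + 1)                            ≡⟨ cong (a * a *_) TT ⟩
          a * a * (D * (U * U))                          ≤⟨ *-monoˡ-≤ (D * (U * U)) (upper {D} {a} {b} unit) ⟩
          (D * (b * b) + 1) * (D * (U * U))              ≡⟨ expand D b U ⟩
          D * (b * U) * (D * (b * U)) + D * (U * U)      <⟨ +-monoʳ-< (D * (b * U) * (D * (b * U))) DUU<aa ⟩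
          D * (b * U) * (D * (b * U)) + a * a            ∎))
          where
          collect : ∀ a T → a * T * (a * T) + a * a ≡ a * a * (T * T + 1)
          collect = solve-∀
          expand : ∀ D b U → (D * (b * b) + 1) * (D * (U * U)) ≡ D * (b * U) * (D * (b * U)) + D * (U * U)
          expand = solve-∀
          DUU<aa : D * (U * U) < a * a
          DUU<aa = +-cancelʳ-≤ 1 _ _ (≤-trans (≤-trans (≤-trans (m≤m+n _ 2) (≤-reflexive (shift (D * (U * U))))) DUU) (lower {D} {a} {b} unit))
            where
            shift : ∀ x → suc x + 1 + 2 ≡ x + 4
            shift = solve-∀
        second : b * T < a * U
        second = square-<⁻¹ (+-cancelʳ-< (b * b) _ _ (begin-strict
          b * T * (b * T) + b * b           ≡⟨ collect b T ⟩
          b * b * (T * T + 1)               ≡⟨ cong (b * b *_) TT ⟩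
          b * b * (D * (U * U))             ≡⟨ swap D b U ⟩
          D * (b * b) * (U * U)             ≤⟨ *-monoˡ-≤ (U * U) (lower {D} {a} {b} unit) ⟩
          (a * a + 1) * (U * U)             ≡⟨ expand a U ⟩
          a * U * (a * U) + U * U           <⟨ +-monoʳ-< (a * U * (a * U)) UU<bb ⟩
          a * U * (a * U) + b * b           ∎))
          where
          collect : ∀ a T → a * T * (a * T) + a * a ≡ a * a * (T * T + 1)
          collect = solve-∀
          swap : ∀ D b U → b * b * (D * (U * U)) ≡ D * (b * b) * (U * U)
          swap = solve-∀
          expand : ∀ a U → (a * a + 1) * (U * U) ≡ a * U * (a * U) + U * U
          expand = solve-∀

    -- With η = s + t√D, the alternatives say that a + b√D is η² or ε·η².
    SquareClass : ℤ → ℤ → Set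
    SquareClass a b = ∃[ s ] ∃[ t ] IsUnit (norm D s t) ×
      ((a ≡ s ℤ.* s ℤ.+ + D ℤ.* (t ℤ.* t) × b ≡ + 2 ℤ.* (s ℤ.* t))
       ⊎ (a ≡ + T ℤ.* (s ℤ.* s ℤ.+ + D ℤ.* (t ℤ.* t)) ℤ.+ + D ℤ.* (+ U ℤ.* (+ 2 ℤ.* (s ℤ.* t)))
          × b ≡ + U ℤ.* (s ℤ.* s ℤ.+ + D ℤ.* (t ℤ.* t)) ℤ.+ + T ℤ.* (+ 2 ℤ.* (s ℤ.* t))))

    -- The two alternatives are exchanged, since ε·(ε·η²) = (ε·η)².
    multiply-by-ε : ∀ {a b a′ b′} → a ≡ a′ ℤ.* + T ℤ.+ + D ℤ.* (b′ ℤ.* + U) → b ≡ a′ ℤ.* + U ℤ.+ b′ ℤ.* + T →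
      SquareClass a′ b′ → SquareClass a b
    multiply-by-ε a-eq b-eq (s , t , unit-st , inj₁ (a′-eq , b′-eq)) = s , t , unit-st , inj₂
      ( trans a-eq (trans (cong₂ (λ x y → x ℤ.* + T ℤ.+ + D ℤ.* (y ℤ.* + U)) a′-eq b′-eq) (re (+ T) (+ U) (+ D) _ _))
      , trans b-eq (trans (cong₂ (λ x y → x ℤ.* + U ℤ.+ y ℤ.* + T) a′-eq b′-eq) (im (+ T) (+ U) _ _)))
      where
      re : ∀ T U D x y → x ℤ.* T ℤ.+ D ℤ.* (y ℤ.* U) ≡ T ℤ.* x ℤ.+ D ℤ.* (U ℤ.* y)
      re = solveℤ-∀
      im : ∀ T U x y → x ℤ.* U ℤ.+ y ℤ.* T ≡ U ℤ.* x ℤ.+ T ℤ.* y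
      im = solveℤ-∀
    multiply-by-ε a-eq b-eq (s , t , unit-st , inj₂ (a′-eq , b′-eq)) =
      + T ℤ.* s ℤ.+ + D ℤ.* (+ U ℤ.* t) , + U ℤ.* s ℤ.+ + T ℤ.* t ,
      subst IsUnit (multiplicative (+ T) (+ U) s t (+ D)) (unit-* unitε unit-st) , inj₁
      ( trans a-eq (trans (cong₂ (λ x y → x ℤ.* + T ℤ.+ + D ℤ.* (y ℤ.* + U)) a′-eq b′-eq) (re (+ T) (+ U) s t (+ D)))
      , trans b-eq (trans (cong₂ (λ x y → x ℤ.* + U ℤ.+ y ℤ.* + T) a′-eq b′-eq) (im (+ T) (+ U) s t (+ D))))
      where
      multiplicative : ∀ T U s t D → (T ℤ.* T ℤ.- D ℤ.* (U ℤ.* U)) ℤ.* (s ℤ.* s ℤ.- D ℤ.* (t ℤ.* t))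
        ≡ (T ℤ.* s ℤ.+ D ℤ.* (U ℤ.* t)) ℤ.* (T ℤ.* s ℤ.+ D ℤ.* (U ℤ.* t)) ℤ.- D ℤ.* ((U ℤ.* s ℤ.+ T ℤ.* t) ℤ.* (U ℤ.* s ℤ.+ T ℤ.* t))
      multiplicative = solveℤ-∀
      re : ∀ T U s t D →
        (T ℤ.* (s ℤ.* s ℤ.+ D ℤ.* (t ℤ.* t)) ℤ.+ D ℤ.* (U ℤ.* (+ 2 ℤ.* (s ℤ.* t)))) ℤ.* T
          ℤ.+ D ℤ.* ((U ℤ.* (s ℤ.* s ℤ.+ D ℤ.* (t ℤ.* t)) ℤ.+ T ℤ.* (+ 2 ℤ.* (s ℤ.* t))) ℤ.* U)
        ≡ (T ℤ.* s ℤ.+ D ℤ.* (U ℤ.* t)) ℤ.* (T ℤ.* s ℤ.+ D ℤ.* (U ℤ.* t)) ℤ.+ D ℤ.* ((U ℤ.* s ℤ.+ T ℤ.* t) ℤ.* (U ℤ.* s ℤ.+ T ℤ.* t))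
      re = solveℤ-∀
      im : ∀ T U s t D →
        (T ℤ.* (s ℤ.* s ℤ.+ D ℤ.* (t ℤ.* t)) ℤ.+ D ℤ.* (U ℤ.* (+ 2 ℤ.* (s ℤ.* t)))) ℤ.* U
          ℤ.+ (U ℤ.* (s ℤ.* s ℤ.+ D ℤ.* (t ℤ.* t)) ℤ.+ T ℤ.* (+ 2 ℤ.* (s ℤ.* t))) ℤ.* T
        ≡ + 2 ℤ.* ((T ℤ.* s ℤ.+ D ℤ.* (U ℤ.* t)) ℤ.* (U ℤ.* s ℤ.+ T ℤ.* t))
      im = solveℤ-∀

    -- n only bounds the recursion: divisions by ε lower b until it is 0 or U, where the unit is 1
    -- or ε.
    squareClass : ∀ n a b → b < n → 0 < a → IsUnit (norm D (+ a) (+ b)) → SquareClass (+ a) (+ b)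
    squareClass (suc n) a zero _ a>0 unit = + 1 , + 0 , inj₁ (norm-1 (+ D)) , inj₁ (trans (cong +_ a≡1) (sym (one (+ D))) , refl)
      where
      norm-1 : ∀ D → + 1 ℤ.* + 1 ℤ.- D ℤ.* (+ 0 ℤ.* + 0) ≡ + 1
      norm-1 = solveℤ-∀
      one : ∀ D → + 1 ℤ.* + 1 ℤ.+ D ℤ.* (+ 0 ℤ.* + 0) ≡ + 1
      one = solveℤ-∀
      a≡1 : a ≡ 1
      a≡1 = ≤-antisym (square-≤⁻¹ (≤-trans (upper {D} {a} {0} unit) (≤-reflexive (cong (_+ 1) (*-zeroʳ D))))) a>0
    squareClass (suc n) a b@(suc _) b<n a>0 unit = [ strict , same ]′ (m≤n⇒m<n∨m≡n (U≤b a b a>0 (s≤s z≤n) unit))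
      where
      same : U ≡ b → SquareClass (+ a) (+ b)
      same U≡b = + 1 , + 0 , inj₁ (norm-1 (+ D)) , inj₂
        ( trans (cong +_ (same-U a a>0 (subst (λ z → IsUnit (norm D (+ a) (+ z))) (sym U≡b) unit))) (re (+ T) (+ U) (+ D))
        , trans (cong +_ (sym U≡b)) (im (+ T) (+ U) (+ D)))
        where
        norm-1 : ∀ D → + 1 ℤ.* + 1 ℤ.- D ℤ.* (+ 0 ℤ.* + 0) ≡ + 1
        norm-1 = solveℤ-∀
        re : ∀ T U D → T ≡ T ℤ.* (+ 1 ℤ.* + 1 ℤ.+ D ℤ.* (+ 0 ℤ.* + 0)) ℤ.+ D ℤ.* (U ℤ.* (+ 2 ℤ.* (+ 1 ℤ.* + 0)))
        re = solveℤ-∀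
        im : ∀ T U D → U ≡ U ℤ.* (+ 1 ℤ.* + 1 ℤ.+ D ℤ.* (+ 0 ℤ.* + 0)) ℤ.+ T ℤ.* (+ 2 ℤ.* (+ 1 ℤ.* + 0))
        im = solveℤ-∀
      strict : U < b → SquareClass (+ a) (+ b)
      strict U<b = conclude (descent a b a>0 U<b unit)
        where
        conclude : Quotient a b → SquareClass (+ a) (+ b)
        conclude (a′ , b′ , a′>0 , b′<b , unit′ , a-eq , b-eq) =
          multiply-by-ε a-eq b-eq (squareClass n a′ b′ (≤-trans b′<b (s≤s⁻¹ b<n)) a′>0 unit′)

-- From two related solutions to an approximation.

module PellPair where
  open Prelude
  import Data.Sum.Base as Sum
  open import Data.Nat.Divisibility
  open import Data.Nat.GCD using (gcd; gcd[m,n]∣m; gcd[m,n]∣n; gcd-greatest)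
  open import Data.Nat.Coprimality using (Coprime; coprime-divisor)
  open Cast
  open Units using (norm; IsUnit; norm⇒≡; norm⇒≡⁻; square-≤⁻¹)
  open Evaluation using (quartic)

  lowestTerms : ∀ a b → 0 < b → ∃[ e ] ∃[ P ] ∃[ Q ] a ≡ e * P × b ≡ e * Q × Coprime P Q
  lowestTerms a b b>0 = e , P , Q , a≡ , b≡ , λ {d} (d∣P , d∣Q) → ∣1⇒≡1
      (*-cancelˡ-∣ e {{>-nonZero e>0}} (subst ((e * d) ∣_) (sym (*-identityʳ e)) (gcd-greatest (subst ((e * d) ∣_) (sym a≡) (*-monoʳ-∣ e d∣P)) (subst ((e * d) ∣_) (sym b≡) (*-monoʳ-∣ e d∣Q)))))
    where
    e P Q : ℕ
    e = gcd a b
    P = quotient (gcd[m,n]∣m a b)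
    Q = quotient (gcd[m,n]∣n a b)
    a≡ : a ≡ e * P
    a≡ = trans (_∣_.equality (gcd[m,n]∣m a b)) (*-comm P e)
    b≡ : b ≡ e * Q
    b≡ = trans (_∣_.equality (gcd[m,n]∣n a b)) (*-comm Q e)
    e>0 : 0 < e
    e>0 = n≢0⇒n>0 λ e≡0 → <⇒≢ b>0 (sym (trans b≡ (cong (_* Q) e≡0)))

  coprime-of-unit : ∀ {D s t} → IsUnit (norm D (+ s) (+ t)) → Coprime t s
  coprime-of-unit {D} {s} {t} (inj₁ p) {d} (d∣t , d∣s) = ∣1⇒≡1 (∣m+n∣m⇒∣n
    (subst (d ∣_) (norm⇒≡ {D} {s} {t} p) (∣m⇒∣m*n s d∣s)) (∣n⇒∣m*n D (∣m⇒∣m*n t d∣t)))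
  coprime-of-unit {D} {s} {t} (inj₂ p) {d} (d∣t , d∣s) = ∣1⇒≡1 (∣m+n∣m⇒∣n
    (subst (d ∣_) (sym (norm⇒≡⁻ {D} {s} {t} p)) (∣n⇒∣m*n D (∣m⇒∣m*n t d∣t))) (∣m⇒∣m*n s d∣s))

  record Approximation (X m Y₁ Y₂ : ℕ) : Set where
    field
      G Q g  : ℕ
      Q>0    : 0 < Q
      g>0    : 0 < g
      normEq : G * G + m * (Q * Q) ≡ g * (Y₁ * Y₂)
      g≤2m   : g ≤ 2 * m
      2XQ≤G  : 2 * X * Q ≤ G
      small  : abs (quartic (+ X) (+ m) (+ G) (+ Q)) ≤ g * g * (Y₁ * Y₁ * (Y₁ * Y₁))

  module _ (D X m Y₁ Y₂ s t : ℕ) (X>0 : 0 < X) (m>0 : 0 < m) (t>0 : 0 < t)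
           (sol : X * X + m ≡ D * (Y₁ * Y₁ * (Y₁ * Y₁)))
           (unit : IsUnit (norm D (+ s) (+ t)))
           (related : Y₂ * Y₂ ≡ Y₁ * Y₁ * (s * s + D * (t * t)) + 2 * X * (s * t)) where

    -- w + t √(-m) has norm (Y₁Y₂)²; adding Y₁Y₂ to it gives N + t √(-m), whose square is 2N (w + t √(-m)).
    w A N : ℕ
    w = Y₁ * Y₁ * s + X * t
    A = Y₁ * Y₂
    N = A + w

    -- In Y₁²·Y₂² the square is completed in s; the coefficient of t² that remains is D·Y₁⁴ - X² =
    -- m.
    norm-w : w * w + m * (t * t) ≡ A * A
    norm-w = trans (expand X m Y₁ s t) (trans (cong (λ z → Y₁ * Y₁ * (Y₁ * Y₁) * (s * s) + 2 * X * (Y₁ * Y₁) * (s * t) + z * (t * t)) sol)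
      (trans (collect D X Y₁ s t) (trans (cong (Y₁ * Y₁ *_) (sym related)) (square Y₁ Y₂))))
      where
      expand : ∀ X m Y s t → let w = Y * Y * s + X * t in
        w * w + m * (t * t) ≡ Y * Y * (Y * Y) * (s * s) + 2 * X * (Y * Y) * (s * t) + (X * X + m) * (t * t)
      expand = solve-∀
      collect : ∀ D X Y s t → Y * Y * (Y * Y) * (s * s) + 2 * X * (Y * Y) * (s * t) + D * (Y * Y * (Y * Y)) * (t * t)
        ≡ Y * Y * (Y * Y * (s * s + D * (t * t)) + 2 * X * (s * t))
      collect = solve-∀
      square : ∀ Y Z → Y * Y * (Z * Z) ≡ Y * Z * (Y * Z)
      square = solve-∀

    norm-N : N * N + m * (t * t) ≡ 2 * A * N
    norm-N = trans (expand A w m t) (trans (cong (λ z → A * A + 2 * A * w + z) norm-w) (collect A w))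
      where
      expand : ∀ A w m t → (A + w) * (A + w) + m * (t * t) ≡ A * A + 2 * A * w + (w * w + m * (t * t))
      expand = solve-∀
      collect : ∀ A w → A * A + 2 * A * w + A * A ≡ 2 * A * (A + w)
      collect = solve-∀

    -- (N + t√(-m))⁴ is 4N²(w + t√(-m))². Multiplied by X - √(-m), the last square has
    -- √(-m)-coefficient (X² + m)t² - (w - Xt)², which is -Y₁⁴(s² - Dt²); the unit norm leaves only
    -- Y₁⁴ in absolute value.
    abs-quartic-N : abs (quartic (+ X) (+ m) (+ N) (+ t)) ≡ 4 * (N * N) * (Y₁ * Y₁ * (Y₁ * Y₁))
    abs-quartic-N = trans (cong abs (trans value (cong (ℤ._* norm D (+ s) (+ t)) negative))) (trans (ℤ.abs-* (- + (4 * (N * N) * (Y₁ * Y₁ * (Y₁ * Y₁)))) (norm D (+ s) (+ t)))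
      (trans (cong₂ _*_ (ℤ.∣-i∣≡∣i∣ (+ (4 * (N * N) * (Y₁ * Y₁ * (Y₁ * Y₁))))) (abs-unit unit)) (*-identityʳ _)))
      where
      abs-unit : ∀ {n} → IsUnit n → abs n ≡ 1
      abs-unit (inj₁ refl) = refl
      abs-unit (inj₂ refl) = refl
      negative : - (+ 4 ℤ.* (+ N ℤ.* + N) ℤ.* (+ Y₁ ℤ.* + Y₁ ℤ.* (+ Y₁ ℤ.* + Y₁))) ≡ - + (4 * (N * N) * (Y₁ * Y₁ * (Y₁ * Y₁)))
      negative = cong -_ (sym (cast (` 4 :* (` N :* ` N) :* (` Y₁ :* ` Y₁ :* (` Y₁ :* ` Y₁)))))
      wℤ : + w ≡ + Y₁ ℤ.* + Y₁ ℤ.* + s ℤ.+ + X ℤ.* + t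
      wℤ = cast (` Y₁ :* ` Y₁ :* ` s :+ ` X :* ` t)
      solℤ : + X ℤ.* + X ℤ.+ + m ≡ + D ℤ.* (+ Y₁ ℤ.* + Y₁ ℤ.* (+ Y₁ ℤ.* + Y₁))
      solℤ = castEq (` X :* ` X :+ ` m) (` D :* (` Y₁ :* ` Y₁ :* (` Y₁ :* ` Y₁))) sol
      cℤ : + N ℤ.* + N ℤ.- + m ℤ.* (+ t ℤ.* + t) ≡ + 2 ℤ.* + N ℤ.* + w
      cℤ = trans (expand (+ A) (+ w) (+ m) (+ t)) (trans (cong (λ z → + 2 ℤ.* (+ A ℤ.+ + w) ℤ.* + w ℤ.+ (+ A ℤ.* + A ℤ.- z))
        (castEq (` w :* ` w :+ ` m :* (` t :* ` t)) (` A :* ` A) norm-w)) (collapse (+ 2 ℤ.* (+ A ℤ.+ + w) ℤ.* + w) (+ A ℤ.* + A)))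
        where
        expand : ∀ A w m t → (A ℤ.+ w) ℤ.* (A ℤ.+ w) ℤ.- m ℤ.* (t ℤ.* t) ≡ + 2 ℤ.* (A ℤ.+ w) ℤ.* w ℤ.+ (A ℤ.* A ℤ.- (w ℤ.* w ℤ.+ m ℤ.* (t ℤ.* t)))
        expand = solveℤ-∀
        collapse : ∀ u v → u ℤ.+ (v ℤ.- v) ≡ u
        collapse = solveℤ-∀
      value : quartic (+ X) (+ m) (+ N) (+ t) ≡ - (+ 4 ℤ.* (+ N ℤ.* + N) ℤ.* (+ Y₁ ℤ.* + Y₁ ℤ.* (+ Y₁ ℤ.* + Y₁))) ℤ.* norm D (+ s) (+ t)
      value = trans (cong (λ c → + 2 ℤ.* + X ℤ.* (c ℤ.* (+ 2 ℤ.* (+ N ℤ.* + t))) ℤ.- (c ℤ.* c ℤ.- + m ℤ.* ((+ 2 ℤ.* (+ N ℤ.* + t)) ℤ.* (+ 2 ℤ.* (+ N ℤ.* + t))))) cℤ)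
        (trans (cong (λ w → + 2 ℤ.* + X ℤ.* (+ 2 ℤ.* + N ℤ.* w ℤ.* (+ 2 ℤ.* (+ N ℤ.* + t))) ℤ.- (+ 2 ℤ.* + N ℤ.* w ℤ.* (+ 2 ℤ.* + N ℤ.* w) ℤ.- + m ℤ.* ((+ 2 ℤ.* (+ N ℤ.* + t)) ℤ.* (+ 2 ℤ.* (+ N ℤ.* + t))))) wℤ)
        (trans (identity (+ X) (+ m) (+ N) (+ Y₁) (+ s) (+ t) (+ D))
        (trans (cong (λ z → - (+ 4 ℤ.* (+ N ℤ.* + N) ℤ.* (+ Y₁ ℤ.* + Y₁ ℤ.* (+ Y₁ ℤ.* + Y₁))) ℤ.* norm D (+ s) (+ t) ℤ.+ + 4 ℤ.* (+ N ℤ.* + N) ℤ.* (+ t ℤ.* + t) ℤ.* (z ℤ.- + D ℤ.* (+ Y₁ ℤ.* + Y₁ ℤ.* (+ Y₁ ℤ.* + Y₁)))) solℤ)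
          (collapse (- (+ 4 ℤ.* (+ N ℤ.* + N) ℤ.* (+ Y₁ ℤ.* + Y₁ ℤ.* (+ Y₁ ℤ.* + Y₁))) ℤ.* norm D (+ s) (+ t)) (+ 4 ℤ.* (+ N ℤ.* + N) ℤ.* (+ t ℤ.* + t)) (+ D ℤ.* (+ Y₁ ℤ.* + Y₁ ℤ.* (+ Y₁ ℤ.* + Y₁)))))))
        where
        collapse : ∀ u v w → u ℤ.+ v ℤ.* (w ℤ.- w) ≡ u
        collapse = solveℤ-∀
        identity : ∀ X m N Y s t D → let w = Y ℤ.* Y ℤ.* s ℤ.+ X ℤ.* t ; Y⁴ = Y ℤ.* Y ℤ.* (Y ℤ.* Y) in
          + 2 ℤ.* X ℤ.* (+ 2 ℤ.* N ℤ.* w ℤ.* (+ 2 ℤ.* (N ℤ.* t))) ℤ.- (+ 2 ℤ.* N ℤ.* w ℤ.* (+ 2 ℤ.* N ℤ.* w) ℤ.- m ℤ.* ((+ 2 ℤ.* (N ℤ.* t)) ℤ.* (+ 2 ℤ.* (N ℤ.* t))))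
          ≡ - (+ 4 ℤ.* (N ℤ.* N) ℤ.* Y⁴) ℤ.* (s ℤ.* s ℤ.- D ℤ.* (t ℤ.* t)) ℤ.+ + 4 ℤ.* (N ℤ.* N) ℤ.* (t ℤ.* t) ℤ.* (X ℤ.* X ℤ.+ m ℤ.- D ℤ.* Y⁴)
        identity = solveℤ-∀

    -- (s : t) is the point of parameter P/Q = (Y₂ + Y₁s)/t on the conic, and G + Q √(-m) = (N + t √(-m))/e.
    approximation : Approximation X m Y₁ Y₂
    approximation = build (lowestTerms (Y₂ + Y₁ * s) t t>0)
      where
      build : ∃[ e ] ∃[ P ] ∃[ Q ] Y₂ + Y₁ * s ≡ e * P × t ≡ e * Q × Coprime P Q → Approximation X m Y₁ Y₂
      build (e , P , Q , eP , eQ , P⊥Q) = record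
        { G = G ; Q = Q ; g = g ; Q>0 = Q>0 ; g>0 = g>0 ; normEq = normEq
        ; g≤2m = ∣⇒≤ {{>-nonZero (*-mono-≤ {1} {2} (s≤s z≤n) m>0)}} g∣2m ; 2XQ≤G = 2XQ≤G ; small = ≤-reflexive small }
        where
        G : ℕ
        G = Y₁ * P + X * Q
        Q>0 : 0 < Q
        Q>0 = n≢0⇒n>0 λ Q≡0 → <⇒≢ t>0 (sym (trans eQ (trans (cong (e *_) Q≡0) (*-zeroʳ e))))
        e>0 : 0 < e
        e>0 = n≢0⇒n>0 λ e≡0 → <⇒≢ t>0 (sym (trans eQ (cong (_* Q) e≡0)))
        G>0 : 0 < G
        G>0 = ≤-trans (*-mono-≤ {1} {X} X>0 Q>0) (m≤n+m (X * Q) (Y₁ * P))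
        eG : e * G ≡ N
        eG = trans (expand e Y₁ P X Q) (trans (cong₂ (λ a b → Y₁ * a + X * b) (sym eP) (sym eQ)) (collect Y₁ Y₂ s X t))
          where
          expand : ∀ e Y P X Q → e * (Y * P + X * Q) ≡ Y * (e * P) + X * (e * Q)
          expand = solve-∀
          collect : ∀ Y Z s X t → Y * (Z + Y * s) + X * t ≡ Y * Z + (Y * Y * s + X * t)
          collect = solve-∀
        -- By `related`, (Y₂ + Y₁s)² = 2Ns + D·Y₁²·t²; one factor e is cancelled.
        eq₁ : 2 * G * s + e * (D * (Y₁ * Y₁) * (Q * Q)) ≡ e * (P * P)
        eq₁ = *-cancelˡ-≡ _ _ e {{>-nonZero e>0}} (begin
          e * (2 * G * s + e * (D * (Y₁ * Y₁) * (Q * Q)))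
            ≡⟨ expand e G s (D * (Y₁ * Y₁)) Q ⟩
          2 * (e * G) * s + D * (Y₁ * Y₁) * (e * Q * (e * Q))
            ≡⟨ cong₂ (λ a b → 2 * a * s + D * (Y₁ * Y₁) * (b * b)) eG (sym eQ) ⟩
          2 * N * s + D * (Y₁ * Y₁) * (t * t)
            ≡⟨ identity₁ D X Y₁ Y₂ s t ⟩
          Y₁ * Y₁ * (s * s + D * (t * t)) + 2 * X * (s * t) + (2 * (Y₁ * Y₂ * s) + Y₁ * Y₁ * (s * s))
            ≡⟨ cong (_+ (2 * (Y₁ * Y₂ * s) + Y₁ * Y₁ * (s * s))) related ⟨
          Y₂ * Y₂ + (2 * (Y₁ * Y₂ * s) + Y₁ * Y₁ * (s * s))
            ≡⟨ identity₂ Y₁ Y₂ s ⟩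
          (Y₂ + Y₁ * s) * (Y₂ + Y₁ * s)
            ≡⟨ cong (λ z → z * z) eP ⟩
          e * P * (e * P)
            ≡⟨ identity₃ e P ⟩
          e * (e * (P * P)) ∎)
          where
          open ≡-Reasoning
          expand : ∀ e G s d Q → e * (2 * G * s + e * (d * (Q * Q))) ≡ 2 * (e * G) * s + d * (e * Q * (e * Q))
          expand = solve-∀
          identity₁ : ∀ D X Y Z s t → 2 * (Y * Z + (Y * Y * s + X * t)) * s + D * (Y * Y) * (t * t)
            ≡ Y * Y * (s * s + D * (t * t)) + 2 * X * (s * t) + (2 * (Y * Z * s) + Y * Y * (s * s))
          identity₁ = solve-∀
          identity₂ : ∀ Y Z s → Z * Z + (2 * (Y * Z * s) + Y * Y * (s * s)) ≡ (Z + Y * s) * (Z + Y * s)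
          identity₂ = solve-∀
          identity₃ : ∀ e P → e * P * (e * P) ≡ e * (e * (P * P))
          identity₃ = solve-∀
        -- e divides t, and s is prime to t because s² - Dt² = ±1; so s cancels from e ∣ 2G·s.
        e∣2G : e ∣ 2 * G
        e∣2G = coprime-divisor {e} {s} e⊥s (subst (e ∣_) (*-comm (2 * G) s)
          (∣m+n∣m⇒∣n (subst (e ∣_) (trans (sym eq₁) (+-comm (2 * G * s) _)) (m∣m*n (P * P))) (m∣m*n (D * (Y₁ * Y₁) * (Q * Q)))))
          where
          e⊥s : Coprime e s
          e⊥s {d} (d∣e , d∣s) = coprime-of-unit {D} {s} {t} unit (subst (d ∣_) (sym eQ) (∣m⇒∣m*n Q d∣e) , d∣s)
        g : ℕ
        g = quotient e∣2G
        2G≡ : 2 * G ≡ g * e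
        2G≡ = _∣_.equality e∣2G
        g>0 : 0 < g
        g>0 = n≢0⇒n>0 λ g≡0 → <⇒≢ (*-mono-≤ {1} {2} (s≤s z≤n) G>0) (sym (trans 2G≡ (cong (_* e) g≡0)))
        eq₂ : g * s + D * (Y₁ * Y₁) * (Q * Q) ≡ P * P
        eq₂ = *-cancelˡ-≡ _ _ e {{>-nonZero e>0}} (trans (expand e g s (D * (Y₁ * Y₁) * (Q * Q)))
          (trans (cong (λ z → z * s + e * (D * (Y₁ * Y₁) * (Q * Q))) (sym 2G≡)) eq₁))
          where
          expand : ∀ e g s d → e * (g * s + d) ≡ g * e * s + e * d
          expand = solve-∀
        g⊥Q : Coprime g Q
        g⊥Q {d} (d∣g , d∣Q) = P⊥Q (coprime-divisor {d} {P} d⊥P d∣PP , d∣Q)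
          where
          d∣PP : d ∣ P * P
          d∣PP = subst (d ∣_) eq₂ (∣m∣n⇒∣m+n (∣m⇒∣m*n s d∣g) (∣n⇒∣m*n (D * (Y₁ * Y₁)) (∣m⇒∣m*n Q d∣Q)))
          d⊥P : Coprime d P
          d⊥P (c∣d , c∣P) = P⊥Q (c∣P , ∣-trans c∣d d∣Q)
        -- Substituting `eq₂` for P² in 2G·Y₁P and using D·Y₁⁴ = X² + m shows g ∣ 2m·Q²; then Q is
        -- cancelled twice.
        g∣2m : g ∣ 2 * m
        g∣2m = coprime-divisor g⊥Q (coprime-divisor g⊥Q (subst (g ∣_) (rearrange m Q)
          (∣m+n∣m⇒∣n (subst (g ∣_) identity (∣m⇒∣m*n (Y₁ * P) g∣2G))
            (∣m∣n⇒∣m+n (∣n⇒∣m*n (2 * (Y₁ * Y₁)) (m∣m*n s)) (∣m⇒∣m*n (X * Q) g∣2G)))))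
          where
          g∣2G : g ∣ 2 * G
          g∣2G = subst (g ∣_) (sym 2G≡) (m∣m*n e)
          rearrange : ∀ m Q → 2 * m * (Q * Q) ≡ Q * (Q * (2 * m))
          rearrange = solve-∀
          identity : 2 * G * (Y₁ * P) ≡ 2 * (Y₁ * Y₁) * (g * s) + 2 * G * (X * Q) + 2 * m * (Q * Q)
          identity = trans (expand Y₁ P X Q) (trans (cong (λ z → 2 * (Y₁ * Y₁) * z + 2 * (X * Q * (Y₁ * P))) (sym eq₂))
            (trans (regroup (Y₁ * Y₁) (g * s) D Q (X * Q * (Y₁ * P)))
            (trans (cong (λ z → 2 * (Y₁ * Y₁) * (g * s) + 2 * z * (Q * Q) + 2 * (X * Q * (Y₁ * P))) (sym sol)) (collect Y₁ P X Q m (g * s)))))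
            where
            expand : ∀ Y P X Q → 2 * (Y * P + X * Q) * (Y * P) ≡ 2 * (Y * Y) * (P * P) + 2 * (X * Q * (Y * P))
            expand = solve-∀
            regroup : ∀ y a D Q u → 2 * y * (a + D * y * (Q * Q)) + 2 * u ≡ 2 * y * a + 2 * (D * (y * y)) * (Q * Q) + 2 * u
            regroup = solve-∀
            collect : ∀ Y P X Q m a → 2 * (Y * Y) * a + 2 * (X * X + m) * (Q * Q) + 2 * (X * Q * (Y * P))
              ≡ 2 * (Y * Y) * a + 2 * (Y * P + X * Q) * (X * Q) + 2 * m * (Q * Q)
            collect = solve-∀
        normEq : G * G + m * (Q * Q) ≡ g * (Y₁ * Y₂)
        normEq = *-cancelˡ-≡ _ _ (e * e) {{>-nonZero (*-mono-≤ {1} {e} e>0 e>0)}} (begin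
          e * e * (G * G + m * (Q * Q))             ≡⟨ expand e G m Q ⟩
          e * G * (e * G) + m * (e * Q * (e * Q))   ≡⟨ cong₂ (λ a b → a * a + m * (b * b)) eG (sym eQ) ⟩
          N * N + m * (t * t)                       ≡⟨ norm-N ⟩
          2 * A * N                                 ≡⟨ cong (2 * A *_) eG ⟨
          2 * A * (e * G)                           ≡⟨ regroup A e G ⟩
          e * (2 * G) * A                           ≡⟨ cong (λ z → e * z * A) 2G≡ ⟩
          e * (g * e) * A                           ≡⟨ collect e g A ⟩
          e * e * (g * (Y₁ * Y₂)) ∎)
          where
          open ≡-Reasoning
          expand : ∀ e G m Q → e * e * (G * G + m * (Q * Q)) ≡ e * G * (e * G) + m * (e * Q * (e * Q))
          expand = solve-∀
          regroup : ∀ A e G → 2 * A * (e * G) ≡ e * (2 * G) * A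
          regroup = solve-∀
          collect : ∀ e g A → e * (g * e) * A ≡ e * e * (g * A)
          collect = solve-∀
        small : abs (quartic (+ X) (+ m) (+ G) (+ Q)) ≡ g * g * (Y₁ * Y₁ * (Y₁ * Y₁))
        small = *-cancelˡ-≡ _ _ (e * e * (e * e)) {{>-nonZero (*-mono-≤ {1} {e * e} (*-mono-≤ {1} {e} e>0 e>0) (*-mono-≤ {1} {e} e>0 e>0))}} (begin
          e * e * (e * e) * abs (quartic (+ X) (+ m) (+ G) (+ Q))   ≡⟨ quartic-homogeneous G Q e ⟨
          abs (quartic (+ X) (+ m) (+ (e * G)) (+ (e * Q)))         ≡⟨ cong₂ (λ a b → abs (quartic (+ X) (+ m) (+ a) (+ b))) eG (sym eQ) ⟩
          abs (quartic (+ X) (+ m) (+ N) (+ t))                     ≡⟨ abs-quartic-N ⟩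
          4 * (N * N) * (Y₁ * Y₁ * (Y₁ * Y₁))                       ≡⟨ cong (λ z → 4 * (z * z) * (Y₁ * Y₁ * (Y₁ * Y₁))) eG ⟨
          4 * (e * G * (e * G)) * (Y₁ * Y₁ * (Y₁ * Y₁))             ≡⟨ regroup e G (Y₁ * Y₁ * (Y₁ * Y₁)) ⟩
          e * e * (2 * G * (2 * G)) * (Y₁ * Y₁ * (Y₁ * Y₁))         ≡⟨ cong (λ z → e * e * (z * z) * (Y₁ * Y₁ * (Y₁ * Y₁))) 2G≡ ⟩
          e * e * (g * e * (g * e)) * (Y₁ * Y₁ * (Y₁ * Y₁))         ≡⟨ collect e g (Y₁ * Y₁ * (Y₁ * Y₁)) ⟩
          e * e * (e * e) * (g * g * (Y₁ * Y₁ * (Y₁ * Y₁))) ∎)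
          where
          open ≡-Reasoning
          open PadéEstimates X m using (quartic-homogeneous)
          regroup : ∀ e G y → 4 * (e * G * (e * G)) * y ≡ e * e * (2 * G * (2 * G)) * y
          regroup = solve-∀
          collect : ∀ e g y → e * e * (g * e * (g * e)) * y ≡ e * e * (e * e) * (g * g * y)
          collect = solve-∀
        -- By `eq₂`, P² ≥ D·Y₁²·Q², so (Y₁P)² ≥ D·Y₁⁴·Q² ≥ (XQ)²: both summands of G are at least
        -- XQ.
        2XQ≤G : 2 * X * Q ≤ G
        2XQ≤G = ≤-trans (≤-reflexive (double X Q)) (+-monoˡ-≤ (X * Q) (square-≤⁻¹ (begin
          X * Q * (X * Q)                                     ≡⟨ swap X Q ⟩
          X * X * (Q * Q)                                     ≤⟨ *-monoˡ-≤ (Q * Q) (≤-trans (m≤m+n (X * X) m) (≤-reflexive sol)) ⟩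
          D * (Y₁ * Y₁ * (Y₁ * Y₁)) * (Q * Q)                 ≤⟨ m≤n+m _ (Y₁ * Y₁ * (g * s)) ⟩
          Y₁ * Y₁ * (g * s) + D * (Y₁ * Y₁ * (Y₁ * Y₁)) * (Q * Q)   ≡⟨ factor (Y₁ * Y₁) (g * s) D Q ⟩
          Y₁ * Y₁ * (g * s + D * (Y₁ * Y₁) * (Q * Q))         ≡⟨ cong (Y₁ * Y₁ *_) eq₂ ⟩
          Y₁ * Y₁ * (P * P)                                   ≡⟨ swap Y₁ P ⟨
          Y₁ * P * (Y₁ * P) ∎)))
          where
          open ≤-Reasoning
          double : ∀ X Q → 2 * X * Q ≡ X * Q + X * Q
          double = solve-∀
          swap : ∀ a b → a * b * (a * b) ≡ a * a * (b * b)
          swap = solve-∀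
          factor : ∀ y a D Q → y * a + D * (y * y) * (Q * Q) ≡ y * (a + D * y * (Q * Q))
          factor = solve-∀

-- Orbits under squares of units, and gaps within an orbit.

module Orbits where
  open Prelude
  import Data.Sum.Base as Sum
  open Cast
  open Units using (norm; IsUnit; unit-*; square-≤⁻¹; square-<⁻¹; SquareClass; squareClass)
  open PellPair using (Approximation; module Approximation; approximation)

  module _ (D : ℕ) where

    square₁ square₂ : ℤ → ℤ → ℤ
    square₁ s t = s ℤ.* s ℤ.+ + D ℤ.* (t ℤ.* t)
    square₂ s t = + 2 ℤ.* (s ℤ.* t)

    -- X + Y²√D = (x + z√D)(s + t√D)² for a unit s + t√D.
    Orbit : ℤ → ℤ → ℕ × ℕ → Set
    Orbit x z (X , Y) = ∃[ s ] ∃[ t ] IsUnit (norm D s t)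
      × + X ≡ x ℤ.* square₁ s t ℤ.+ + D ℤ.* (z ℤ.* square₂ s t)
      × + Y ℤ.* + Y ≡ z ℤ.* square₁ s t ℤ.+ x ℤ.* square₂ s t

    Linked : ℕ × ℕ → ℕ × ℕ → Set
    Linked (X₁ , Y₁) (X₂ , Y₂) = ∃[ s ] ∃[ t ] IsUnit (norm D (+ s) (+ t)) × 0 < t
      × Y₂ * Y₂ ≡ Y₁ * Y₁ * (s * s + D * (t * t)) + 2 * X₁ * (s * t)

    unit-square : ∀ {n} → IsUnit n → n ℤ.* n ≡ + 1
    unit-square (inj₁ refl) = refl
    unit-square (inj₂ refl) = refl

    -- s + t√D = (s₂ + t₂√D)(s₁ - t₁√D) is the ratio of the two units up to the sign of a norm, and
    -- that sign disappears in the square.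
    ratio-identity : ∀ {x z X₁ Z₁ Z₂} s₁ t₁ s₂ t₂ → IsUnit (norm D s₁ t₁) →
      X₁ ≡ x ℤ.* square₁ s₁ t₁ ℤ.+ + D ℤ.* (z ℤ.* square₂ s₁ t₁) →
      Z₁ ≡ z ℤ.* square₁ s₁ t₁ ℤ.+ x ℤ.* square₂ s₁ t₁ →
      Z₂ ≡ z ℤ.* square₁ s₂ t₂ ℤ.+ x ℤ.* square₂ s₂ t₂ →
      let s = s₂ ℤ.* s₁ ℤ.- + D ℤ.* (t₂ ℤ.* t₁) ; t = t₂ ℤ.* s₁ ℤ.- s₂ ℤ.* t₁ in
      Z₂ ≡ Z₁ ℤ.* square₁ s t ℤ.+ X₁ ℤ.* square₂ s t
    ratio-identity {x} {z} s₁ t₁ s₂ t₂ unit refl refl refl = sym (trans (identity x z s₁ t₁ s₂ t₂ (+ D))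
      (trans (cong ((z ℤ.* square₁ s₂ t₂ ℤ.+ x ℤ.* square₂ s₂ t₂) ℤ.*_) (unit-square unit)) (ℤ.*-identityʳ _)))
      where
      identity : ∀ x z s₁ t₁ s₂ t₂ D →
        let A = λ s t → s ℤ.* s ℤ.+ D ℤ.* (t ℤ.* t)
            B = λ s t → + 2 ℤ.* (s ℤ.* t)
            n = s₁ ℤ.* s₁ ℤ.- D ℤ.* (t₁ ℤ.* t₁)
            s = s₂ ℤ.* s₁ ℤ.- D ℤ.* (t₂ ℤ.* t₁)
            t = t₂ ℤ.* s₁ ℤ.- s₂ ℤ.* t₁ in
        (z ℤ.* A s₁ t₁ ℤ.+ x ℤ.* B s₁ t₁) ℤ.* A s t ℤ.+ (x ℤ.* A s₁ t₁ ℤ.+ D ℤ.* (z ℤ.* B s₁ t₁)) ℤ.* B s t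
        ≡ (z ℤ.* A s₂ t₂ ℤ.+ x ℤ.* B s₂ t₂) ℤ.* (n ℤ.* n)
      identity = solveℤ-∀

    norm-ratio : ∀ s₁ t₁ s₂ t₂ → norm D (s₂ ℤ.* s₁ ℤ.- + D ℤ.* (t₂ ℤ.* t₁)) (t₂ ℤ.* s₁ ℤ.- s₂ ℤ.* t₁) ≡ norm D s₁ t₁ ℤ.* norm D s₂ t₂
    norm-ratio s₁ t₁ s₂ t₂ = identity s₁ t₁ s₂ t₂ (+ D)
      where
      identity : ∀ s₁ t₁ s₂ t₂ D →
        let s = s₂ ℤ.* s₁ ℤ.- D ℤ.* (t₂ ℤ.* t₁)
            t = t₂ ℤ.* s₁ ℤ.- s₂ ℤ.* t₁ in
        s ℤ.* s ℤ.- D ℤ.* (t ℤ.* t) ≡ (s₁ ℤ.* s₁ ℤ.- D ℤ.* (t₁ ℤ.* t₁)) ℤ.* (s₂ ℤ.* s₂ ℤ.- D ℤ.* (t₂ ℤ.* t₂))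
      identity = solveℤ-∀

    square-abs : ∀ i → i ℤ.* i ≡ + abs i ℤ.* + abs i
    square-abs (+ n)    = refl
    square-abs -[1+ n ] = refl

    norm-abs : ∀ s t → norm D s t ≡ norm D (+ abs s) (+ abs t)
    norm-abs s t = cong₂ (λ a b → a ℤ.- + D ℤ.* b) (square-abs s) (square-abs t)

    square₁-abs : ∀ s t → square₁ s t ≡ + (abs s * abs s + D * (abs t * abs t))
    square₁-abs s t = trans (cong₂ (λ a b → a ℤ.+ + D ℤ.* b) (square-abs s) (square-abs t))
      (sym (cast (` abs s :* ` abs s :+ ` D :* (` abs t :* ` abs t))))

    square₁>0 : ∀ s t → IsUnit (norm D (+ s) (+ t)) → 0 < s * s + D * (t * t)
    square₁>0 s t unit = n≢0⇒n>0 λ p → nonzero (m+n≡0⇒m≡0 (s * s) p) (m+n≡0⇒n≡0 (s * s) p) unit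
      where
      nonzero : s * s ≡ 0 → D * (t * t) ≡ 0 → IsUnit (norm D (+ s) (+ t)) → ⊥
      nonzero ss≡0 Dtt≡0 unit = [ (λ ()) , (λ ()) ]′ (subst IsUnit
        (cong₂ ℤ._-_ (castEq (` s :* ` s) (` 0) ss≡0) (castEq (` D :* (` t :* ` t)) (` 0) Dtt≡0)) unit)

    -- The ratio of the units relates the solutions both ways, st entering with opposite signs. If
    -- st ≤ 0, the relation from the second to the first would give Y₁² ≥ Y₂²; so st > 0 and
    -- absolute values may be taken.
    link : ∀ {x z X₁ Y₁ X₂ Y₂} → Y₁ < Y₂ → Orbit x z (X₁ , Y₁) → Orbit x z (X₂ , Y₂) → Linked (X₁ , Y₁) (X₂ , Y₂)
    link {x} {z} {X₁} {Y₁} {X₂} {Y₂} Y₁<Y₂ (s₁ , t₁ , unit₁ , X₁≡ , Y₁≡) (s₂ , t₂ , unit₂ , X₂≡ , Y₂≡) =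
      abs s , abs t , unit-abs , n≢0⇒n>0 t≢0 ,
      uncastEq (` Y₂ :* ` Y₂) (` Y₁ :* ` Y₁ :* (` abs s :* ` abs s :+ ` D :* (` abs t :* ` abs t)) :+ ` 2 :* ` X₁ :* (` abs s :* ` abs t))
        (trans forward (trans (cong₂ (λ a b → + Y₁ ℤ.* + Y₁ ℤ.* a ℤ.+ + X₁ ℤ.* (+ 2 ℤ.* b))
          (trans (square₁-abs s t) (cast (` abs s :* ` abs s :+ ` D :* (` abs t :* ` abs t))))
          (trans st-abs (ℤ.pos-* (abs s) (abs t))))
          (swap (+ Y₁ ℤ.* + Y₁ ℤ.* (+ abs s ℤ.* + abs s ℤ.+ + D ℤ.* (+ abs t ℤ.* + abs t))) (+ X₁) (+ abs s ℤ.* + abs t))))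
      where
      s t : ℤ
      s = s₂ ℤ.* s₁ ℤ.- + D ℤ.* (t₂ ℤ.* t₁)
      t = t₂ ℤ.* s₁ ℤ.- s₂ ℤ.* t₁
      swap : ∀ a X b → a ℤ.+ X ℤ.* (+ 2 ℤ.* b) ≡ a ℤ.+ + 2 ℤ.* X ℤ.* b
      swap = solveℤ-∀
      unit-abs : IsUnit (norm D (+ abs s) (+ abs t))
      unit-abs = subst IsUnit (norm-abs s t) (subst IsUnit (sym (norm-ratio s₁ t₁ s₂ t₂)) (unit-* unit₁ unit₂))
      forward : + Y₂ ℤ.* + Y₂ ≡ + Y₁ ℤ.* + Y₁ ℤ.* square₁ s t ℤ.+ + X₁ ℤ.* square₂ s t
      forward = ratio-identity {x} {z} s₁ t₁ s₂ t₂ unit₁ X₁≡ Y₁≡ Y₂≡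
      backward : + Y₁ ℤ.* + Y₁ ≡ + Y₂ ℤ.* + Y₂ ℤ.* square₁ s t ℤ.- + 2 ℤ.* + X₂ ℤ.* (s ℤ.* t)
      backward = trans (ratio-identity {x} {z} s₂ t₂ s₁ t₁ unit₂ X₂≡ Y₂≡ Y₁≡) (identity s₁ t₁ s₂ t₂ (+ D) (+ X₂) (+ Y₂ ℤ.* + Y₂))
        where
        identity : ∀ s₁ t₁ s₂ t₂ D X Z →
          let A = λ s t → s ℤ.* s ℤ.+ D ℤ.* (t ℤ.* t)
              s = s₂ ℤ.* s₁ ℤ.- D ℤ.* (t₂ ℤ.* t₁)
              t = t₂ ℤ.* s₁ ℤ.- s₂ ℤ.* t₁
              s′ = s₁ ℤ.* s₂ ℤ.- D ℤ.* (t₁ ℤ.* t₂)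
              t′ = t₁ ℤ.* s₂ ℤ.- s₁ ℤ.* t₂ in
          Z ℤ.* A s′ t′ ℤ.+ X ℤ.* (+ 2 ℤ.* (s′ ℤ.* t′)) ≡ Z ℤ.* A s t ℤ.- + 2 ℤ.* X ℤ.* (s ℤ.* t)
        identity = solveℤ-∀
      nonpositive : ∀ n → s ℤ.* t ≡ - + n → ⊥
      nonpositive n st≡ = <-irrefl refl (begin-strict
        Y₁ * Y₁                                      <⟨ *-mono-< Y₁<Y₂ Y₁<Y₂ ⟩
        Y₂ * Y₂                                      ≤⟨ m≤m*n (Y₂ * Y₂) A {{>-nonZero (square₁>0 (abs s) (abs t) unit-abs)}} ⟩
        Y₂ * Y₂ * A                                  ≤⟨ m≤m+n _ (2 * X₂ * n) ⟩
        Y₂ * Y₂ * A + 2 * X₂ * n                     ≡⟨ uncastEq (` Y₁ :* ` Y₁) (` Y₂ :* ` Y₂ :* ` A :+ ` 2 :* ` X₂ :* ` n)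
          (trans backward (trans (cong₂ (λ a b → + Y₂ ℤ.* + Y₂ ℤ.* a ℤ.- + 2 ℤ.* + X₂ ℤ.* b) (square₁-abs s t) st≡)
            (minus (+ Y₂ ℤ.* + Y₂ ℤ.* + A) (+ X₂) (+ n)))) ⟨
        Y₁ * Y₁ ∎)
        where
        open ≤-Reasoning
        A : ℕ
        A = abs s * abs s + D * (abs t * abs t)
        minus : ∀ a X n → a ℤ.- + 2 ℤ.* X ℤ.* (- n) ≡ a ℤ.+ + 2 ℤ.* X ℤ.* n
        minus = solveℤ-∀
      st-abs : s ℤ.* t ≡ + (abs s * abs t)
      st-abs = trans (nonneg (s ℤ.* t) nonpositive) (cong +_ (ℤ.abs-* s t))
        where
        nonneg : ∀ i → (∀ n → i ≡ - + n → ⊥) → i ≡ + abs i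
        nonneg (+ n)    h = refl
        nonneg -[1+ n ] h = ⊥-elim (h (suc n) refl)
      t≢0 : abs t ≡ 0 → ⊥
      t≢0 p = nonpositive 0 (trans st-abs (cong +_ (trans (cong (abs s *_) p) (*-zeroʳ (abs s)))))

  module _ (D m : ℕ) (1<D : 1 < D) (m>0 : 0 < m) where

    Solution : ℕ × ℕ → Set
    Solution (X , Y) = 0 < X × 0 < Y × X * X + m ≡ D * (Y * Y * (Y * Y))

    approximate : ∀ {X₁ Y₁ X₂ Y₂} → Solution (X₁ , Y₁) → Linked D (X₁ , Y₁) (X₂ , Y₂) → Approximation X₁ m Y₁ Y₂
    approximate {X₁} {Y₁} {X₂} {Y₂} (X>0 , Y>0 , sol) (s , t , unit , t>0 , related) =
      approximation D X₁ m Y₁ Y₂ s t X>0 m>0 t>0 sol unit related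

    -- D ≥ 2 leaves a whole Y⁴ in X² = D·Y⁴ - m to outweigh m.
    YY≤X : ∀ {X Y} → Solution (X , Y) → m ≤ Y * Y → Y * Y ≤ X
    YY≤X {X} {Y} (X>0 , Y>0 , sol) m≤YY = square-≤⁻¹ (+-cancelʳ-≤ m _ _ (begin
      Y * Y * (Y * Y) + m                   ≤⟨ +-monoʳ-≤ (Y * Y * (Y * Y)) (≤-trans m≤YY (m≤m*n (Y * Y) (Y * Y) {{>-nonZero (*-mono-≤ {1} {Y} Y>0 Y>0)}})) ⟩
      Y * Y * (Y * Y) + Y * Y * (Y * Y)     ≡⟨ cong (λ z → Y * Y * (Y * Y) + z) (+-identityʳ (Y * Y * (Y * Y))) ⟨
      2 * (Y * Y * (Y * Y))                 ≤⟨ *-monoˡ-≤ (Y * Y * (Y * Y)) 1<D ⟩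
      D * (Y * Y * (Y * Y))                 ≡⟨ sol ⟨
      X * X + m                             ∎))
      where open ≤-Reasoning

    -- G ≥ 2X₁Q ≥ 2Y₁² on one side, G² ≤ g·Y₁Y₂ ≤ 2m·Y₁Y₂ on the other.
    gap : ∀ {X₁ Y₁ X₂ Y₂} → Solution (X₁ , Y₁) → m ≤ Y₁ * Y₁ → Linked D (X₁ , Y₁) (X₂ , Y₂) → 2 * (Y₁ * Y₁ * Y₁) ≤ m * Y₂
    gap {X₁} {Y₁} {X₂} {Y₂} solution@(X>0 , Y>0 , sol) m≤YY linked =
      *-cancelˡ-≤ (2 * Y₁) {{>-nonZero (*-mono-≤ {1} {2} (s≤s z≤n) Y>0)}} (begin
        2 * Y₁ * (2 * (Y₁ * Y₁ * Y₁))         ≡⟨ regroup₁ Y₁ ⟩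
        2 * (Y₁ * Y₁) * (2 * (Y₁ * Y₁))       ≤⟨ *-mono-≤ 2YY≤G 2YY≤G ⟩
        G * G                                 ≤⟨ m≤m+n (G * G) (m * (Q * Q)) ⟩
        G * G + m * (Q * Q)                   ≡⟨ normEq ⟩
        g * (Y₁ * Y₂)                         ≤⟨ *-monoˡ-≤ (Y₁ * Y₂) g≤2m ⟩
        2 * m * (Y₁ * Y₂)                     ≡⟨ regroup₂ m Y₁ Y₂ ⟩
        2 * Y₁ * (m * Y₂)                     ∎)
      where
      open ≤-Reasoning
      open Approximation (approximate {X₁} {Y₁} {X₂} {Y₂} solution linked)
      2YY≤G : 2 * (Y₁ * Y₁) ≤ G
      2YY≤G = ≤-trans (*-monoʳ-≤ 2 (YY≤X solution m≤YY)) (≤-trans (m≤m*n (2 * X₁) Q {{>-nonZero Q>0}}) 2XQ≤G)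
      regroup₁ : ∀ Y → 2 * Y * (2 * (Y * Y * Y)) ≡ 2 * (Y * Y) * (2 * (Y * Y))
      regroup₁ = solve-∀
      regroup₂ : ∀ m Y Z → 2 * m * (Y * Z) ≡ 2 * Y * (m * Z)
      regroup₂ = solve-∀

    geometricGap : ∀ b {X₁ Y₁ X₂ Y₂} → Solution (X₁ , Y₁) → b * m ≤ 2 * (Y₁ * Y₁) → m ≤ Y₁ * Y₁ → Linked D (X₁ , Y₁) (X₂ , Y₂) → b * Y₁ ≤ Y₂
    geometricGap b {X₁} {Y₁} {X₂} {Y₂} solution bm≤ m≤YY linked = *-cancelˡ-≤ m {{>-nonZero m>0}} (begin
      m * (b * Y₁)              ≡⟨ regroup₁ m b Y₁ ⟩
      b * m * Y₁                ≤⟨ *-monoˡ-≤ Y₁ bm≤ ⟩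
      2 * (Y₁ * Y₁) * Y₁        ≡⟨ *-assoc 2 (Y₁ * Y₁) Y₁ ⟩
      2 * (Y₁ * Y₁ * Y₁)        ≤⟨ gap {X₁} {Y₁} {X₂} {Y₂} solution m≤YY linked ⟩
      m * Y₂ ∎)
      where
      open ≤-Reasoning
      regroup₁ : ∀ m b Y → m * (b * Y) ≡ b * m * Y
      regroup₁ = solve-∀

    -- The growth ratio in `geometricGap` may be Y₁ itself once Y₁ ≥ m.
    squareGap : ∀ {X₁ Y₁ X₂ Y₂} → Solution (X₁ , Y₁) → m ≤ Y₁ → Linked D (X₁ , Y₁) (X₂ , Y₂) → Y₁ * Y₁ ≤ Y₂
    squareGap {X₁} {Y₁} {X₂} {Y₂} solution@(X>0 , Y>0 , sol) m≤Y linked = geometricGap Y₁ {X₁} {Y₁} {X₂} {Y₂} solution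
      (≤-trans (*-monoʳ-≤ Y₁ m≤Y) (m≤n*m (Y₁ * Y₁) 2))
      (≤-trans m≤Y (m≤m*n Y₁ Y₁ {{>-nonZero Y>0}})) linked

    -- `squareGap` twice yields Y₃ ≥ Y₂² ≥ Y₁⁴. So `thue` is applied to the first and third
    -- solutions, the middle one only creating the distance; X₁ is large since X₁ ≥ Y₁².
    noThree : ∀ {X₁ Y₁ X₂ Y₂ X₃ Y₃} → Solution (X₁ , Y₁) → Solution (X₂ , Y₂) → (Thue.c * m) ^ 4 ≤ Y₁ → Y₁ < Y₂ →
      Linked D (X₁ , Y₁) (X₂ , Y₂) → Linked D (X₂ , Y₂) (X₃ , Y₃) → Linked D (X₁ , Y₁) (X₃ , Y₃) → ⊥
    noThree {X₁} {Y₁} {X₂} {Y₂} {X₃} {Y₃} solution₁@(X>0 , Y>0 , sol) solution₂ large Y₁<Y₂ linked₁₂ linked₂₃ linked₁₃ =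
      Thue.thue X₁ m G Q g Y₁ Y₃ m>0 Y>0 g>0 Q>0 normEq g≤2m 2XQ≤G small
        (≤-trans large (≤-trans (m≤m*n Y₁ Y₁ {{>-nonZero Y>0}}) (YY≤X solution₁ (≤-trans m≤Y₁ (m≤m*n Y₁ Y₁ {{>-nonZero Y>0}})))))
        (≤-trans (≤-reflexive (regroup Y₁)) (≤-trans (*-mono-≤ Y₁Y₁≤Y₂ Y₁Y₁≤Y₂) (squareGap {X₂} {Y₂} {X₃} {Y₃} solution₂ (≤-trans m≤Y₁ (<⇒≤ Y₁<Y₂)) linked₂₃)))
      where
      open Approximation (approximate {X₁} {Y₁} {X₃} {Y₃} solution₁ linked₁₃)
      cm>0 : 0 < Thue.c * m
      cm>0 = *-mono-≤ {1} {Thue.c} (Thue.2^≤c 0 z≤n) m>0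
      m≤Y₁ : m ≤ Y₁
      m≤Y₁ = ≤-trans (m≤n*m m Thue.c {{>-nonZero (Thue.2^≤c 0 z≤n)}})
        (≤-trans (≤-trans (≤-reflexive (sym (*-identityʳ _))) (*-monoʳ-≤ (Thue.c * m) (m^n>0 (Thue.c * m) {{>-nonZero cm>0}} 3))) large)
      Y₁Y₁≤Y₂ : Y₁ * Y₁ ≤ Y₂
      Y₁Y₁≤Y₂ = squareGap {X₁} {Y₁} {X₂} {Y₂} solution₁ m≤Y₁ linked₁₂
      regroup : ∀ Y → Y * (Y * (Y * (Y * 1))) ≡ Y * Y * (Y * Y)
      regroup = solve-∀

    -- a + b√D is the quotient of X + Y²√D by X₀ + Y₀²√D, the denominator -m coming from the norm.
    -- The witnesses are natural because `squareClass` works with coordinates in ℕ.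
    Congruent : ℕ × ℕ → ℕ × ℕ → Set
    Congruent (X₀ , Y₀) (X , Y) = (∃[ a ] X₀ * X + m * a ≡ D * (Y₀ * Y₀ * (Y * Y)))
      × (∃[ b ] X₀ * (Y * Y) + m * b ≡ X * (Y₀ * Y₀))

    module _ (T U : ℕ) (fundamental : IsFundamentalUnit D T U) where

      -- Both numbers have norm -m, so the quotient has norm 1 and is η² or ε·η²; in the second case
      -- ε is moved into the base point.
      orbits : ∀ {X₀ Y₀ X Y} → Solution (X₀ , Y₀) → Solution (X , Y) → Congruent (X₀ , Y₀) (X , Y) →
        Orbit D (+ X₀) (+ (Y₀ * Y₀)) (X , Y)
        ⊎ Orbit D (+ T ℤ.* + X₀ ℤ.+ + D ℤ.* (+ U ℤ.* + (Y₀ * Y₀))) (+ U ℤ.* + X₀ ℤ.+ + T ℤ.* + (Y₀ * Y₀)) (X , Y)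
      orbits {X₀} {Y₀} {X} {Y} (X₀>0 , Y₀>0 , sol₀) (X>0 , Y>0 , sol) ((a , a-eq) , (b , b-eq)) =
        conclude (squareClass D T U 1<D fundamental (suc b) a b ≤-refl a>0 (inj₁ norm-ab))
        where
        Z₀ Z : ℕ
        Z₀ = Y₀ * Y₀
        Z  = Y * Y
        ma : + m ℤ.* + a ≡ + D ℤ.* (+ Z₀ ℤ.* + Z) ℤ.- + X₀ ℤ.* + X
        ma = trans (sym (move (+ X₀ ℤ.* + X) (+ m ℤ.* + a))) (cong (ℤ._- + X₀ ℤ.* + X) (castEq (` X₀ :* ` X :+ ` m :* ` a) (` D :* (` Z₀ :* ` Z)) a-eq))
          where
          move : ∀ u v → u ℤ.+ v ℤ.- u ≡ v
          move = solveℤ-∀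
        mb : + m ℤ.* + b ≡ + X ℤ.* + Z₀ ℤ.- + X₀ ℤ.* + Z
        mb = trans (sym (move (+ X₀ ℤ.* + Z) (+ m ℤ.* + b))) (cong (ℤ._- + X₀ ℤ.* + Z) (castEq (` X₀ :* ` Z :+ ` m :* ` b) (` X :* ` Z₀) b-eq))
          where
          move : ∀ u v → u ℤ.+ v ℤ.- u ≡ v
          move = solveℤ-∀
        m₀ℤ : + X₀ ℤ.* + X₀ ℤ.+ + m ≡ + D ℤ.* (+ Z₀ ℤ.* + Z₀)
        m₀ℤ = castEq (` X₀ :* ` X₀ :+ ` m) (` D :* (` Z₀ :* ` Z₀)) sol₀
        mℤ : + X ℤ.* + X ℤ.+ + m ≡ + D ℤ.* (+ Z ℤ.* + Z)
        mℤ = castEq (` X :* ` X :+ ` m) (` D :* (` Z :* ` Z)) sol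
        m≡₀ : + m ≡ + D ℤ.* (+ Z₀ ℤ.* + Z₀) ℤ.- + X₀ ℤ.* + X₀
        m≡₀ = trans (sym (move (+ X₀ ℤ.* + X₀) (+ m))) (cong (ℤ._- + X₀ ℤ.* + X₀) m₀ℤ)
          where
          move : ∀ u v → u ℤ.+ v ℤ.- u ≡ v
          move = solveℤ-∀
        m≡ : + m ≡ + D ℤ.* (+ Z ℤ.* + Z) ℤ.- + X ℤ.* + X
        m≡ = trans (sym (move (+ X ℤ.* + X) (+ m))) (cong (ℤ._- + X ℤ.* + X) mℤ)
          where
          move : ∀ u v → u ℤ.+ v ℤ.- u ≡ v
          move = solveℤ-∀
        cancel-m : ∀ i j → + m ℤ.* i ≡ + m ℤ.* j → i ≡ j
        cancel-m i j = ℤ.*-cancelˡ-≡ (+ m) i j {{ℕ-nonZero}}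
          where
          ℕ-nonZero : ℤ.NonZero (+ m)
          ℕ-nonZero = >-nonZero m>0
        norm-ab : norm D (+ a) (+ b) ≡ + 1
        norm-ab = cancel-m _ _ (cancel-m _ _ (trans (expand (+ m) (+ a) (+ b) (+ D))
          (trans (cong₂ (λ u v → u ℤ.* u ℤ.- + D ℤ.* (v ℤ.* v)) ma mb)
          (trans (identity (+ D) (+ Z₀) (+ Z) (+ X₀) (+ X))
          (trans (cong₂ ℤ._*_ (sym m≡₀) (sym m≡)) (cong (+ m ℤ.*_) (sym (ℤ.*-identityʳ (+ m)))))))))
          where
          expand : ∀ m a b D → m ℤ.* (m ℤ.* (a ℤ.* a ℤ.- D ℤ.* (b ℤ.* b))) ≡ m ℤ.* a ℤ.* (m ℤ.* a) ℤ.- D ℤ.* (m ℤ.* b ℤ.* (m ℤ.* b))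
          expand = solveℤ-∀
          identity : ∀ D Z₀ Z X₀ X →
            (D ℤ.* (Z₀ ℤ.* Z) ℤ.- X₀ ℤ.* X) ℤ.* (D ℤ.* (Z₀ ℤ.* Z) ℤ.- X₀ ℤ.* X) ℤ.- D ℤ.* ((X ℤ.* Z₀ ℤ.- X₀ ℤ.* Z) ℤ.* (X ℤ.* Z₀ ℤ.- X₀ ℤ.* Z))
            ≡ (D ℤ.* (Z₀ ℤ.* Z₀) ℤ.- X₀ ℤ.* X₀) ℤ.* (D ℤ.* (Z ℤ.* Z) ℤ.- X ℤ.* X)
          identity = solveℤ-∀
        X-eq : + X ≡ + X₀ ℤ.* + a ℤ.+ + D ℤ.* (+ Z₀ ℤ.* + b)
        X-eq = cancel-m _ _ (sym (trans (expand (+ m) (+ X₀) (+ a) (+ D) (+ Z₀) (+ b))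
          (trans (cong₂ (λ u v → + X₀ ℤ.* u ℤ.+ + D ℤ.* (+ Z₀ ℤ.* v)) ma mb)
          (trans (identity (+ D) (+ Z₀) (+ Z) (+ X₀) (+ X)) (cong (ℤ._* + X) (sym m≡₀))))))
          where
          expand : ∀ m X₀ a D Z₀ b → m ℤ.* (X₀ ℤ.* a ℤ.+ D ℤ.* (Z₀ ℤ.* b)) ≡ X₀ ℤ.* (m ℤ.* a) ℤ.+ D ℤ.* (Z₀ ℤ.* (m ℤ.* b))
          expand = solveℤ-∀
          identity : ∀ D Z₀ Z X₀ X → X₀ ℤ.* (D ℤ.* (Z₀ ℤ.* Z) ℤ.- X₀ ℤ.* X) ℤ.+ D ℤ.* (Z₀ ℤ.* (X ℤ.* Z₀ ℤ.- X₀ ℤ.* Z)) ≡ (D ℤ.* (Z₀ ℤ.* Z₀) ℤ.- X₀ ℤ.* X₀) ℤ.* X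
          identity = solveℤ-∀
        Z-eq : + Z ≡ + Z₀ ℤ.* + a ℤ.+ + X₀ ℤ.* + b
        Z-eq = cancel-m _ _ (sym (trans (expand (+ m) (+ X₀) (+ a) (+ Z₀) (+ b))
          (trans (cong₂ (λ u v → + Z₀ ℤ.* u ℤ.+ + X₀ ℤ.* v) ma mb)
          (trans (identity (+ D) (+ Z₀) (+ Z) (+ X₀) (+ X)) (cong (ℤ._* + Z) (sym m≡₀))))))
          where
          expand : ∀ m X₀ a Z₀ b → m ℤ.* (Z₀ ℤ.* a ℤ.+ X₀ ℤ.* b) ≡ Z₀ ℤ.* (m ℤ.* a) ℤ.+ X₀ ℤ.* (m ℤ.* b)
          expand = solveℤ-∀
          identity : ∀ D Z₀ Z X₀ X → Z₀ ℤ.* (D ℤ.* (Z₀ ℤ.* Z) ℤ.- X₀ ℤ.* X) ℤ.+ X₀ ℤ.* (X ℤ.* Z₀ ℤ.- X₀ ℤ.* Z) ≡ (D ℤ.* (Z₀ ℤ.* Z₀) ℤ.- X₀ ℤ.* X₀) ℤ.* Z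
          identity = solveℤ-∀
        a>0 : 0 < a
        a>0 = n≢0⇒n>0 λ a≡0 → <⇒≢ X₀X<DZZ (trans (sym (trans (cong (λ z → X₀ * X + m * z) a≡0) (trans (cong (λ z → X₀ * X + z) (*-zeroʳ m)) (+-identityʳ (X₀ * X))))) a-eq)
          where
          X₀X<DZZ : X₀ * X < D * (Z₀ * Z)
          X₀X<DZZ = square-<⁻¹ (begin-strict
            X₀ * X * (X₀ * X)                  ≡⟨ swap X₀ X ⟩
            X₀ * X₀ * (X * X)                  <⟨ *-mono-< (m<m+n (X₀ * X₀) m>0) (m<m+n (X * X) m>0) ⟩
            (X₀ * X₀ + m) * (X * X + m)        ≡⟨ cong₂ _*_ sol₀ sol ⟩
            D * (Z₀ * Z₀) * (D * (Z * Z))      ≡⟨ swap₂ D Z₀ Z ⟩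
            D * (Z₀ * Z) * (D * (Z₀ * Z))      ∎)
            where
            open ≤-Reasoning
            swap : ∀ a b → a * b * (a * b) ≡ a * a * (b * b)
            swap = solve-∀
            swap₂ : ∀ D a b → D * (a * a) * (D * (b * b)) ≡ D * (a * b) * (D * (a * b))
            swap₂ = solve-∀
        YY : + Y ℤ.* + Y ≡ + Z
        YY = sym (ℤ.pos-* Y Y)
        conclude : SquareClass D T U 1<D fundamental (+ a) (+ b) →
          Orbit D (+ X₀) (+ Z₀) (X , Y) ⊎ Orbit D (+ T ℤ.* + X₀ ℤ.+ + D ℤ.* (+ U ℤ.* + Z₀)) (+ U ℤ.* + X₀ ℤ.+ + T ℤ.* + Z₀) (X , Y)
        conclude (s , t , unit , inj₁ (a≡ , b≡)) = inj₁ (s , t , unit ,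
          trans X-eq (cong₂ (λ u v → + X₀ ℤ.* u ℤ.+ + D ℤ.* (+ Z₀ ℤ.* v)) a≡ b≡) ,
          trans YY (trans Z-eq (cong₂ (λ u v → + Z₀ ℤ.* u ℤ.+ + X₀ ℤ.* v) a≡ b≡)))
        conclude (s , t , unit , inj₂ (a≡ , b≡)) = inj₂ (s , t , unit ,
          trans X-eq (trans (cong₂ (λ u v → + X₀ ℤ.* u ℤ.+ + D ℤ.* (+ Z₀ ℤ.* v)) a≡ b≡) (re (+ X₀) (+ Z₀) (+ D) (+ T) (+ U) (square₁ D s t) (square₂ D s t))) ,
          trans YY (trans Z-eq (trans (cong₂ (λ u v → + Z₀ ℤ.* u ℤ.+ + X₀ ℤ.* v) a≡ b≡) (im (+ X₀) (+ Z₀) (+ D) (+ T) (+ U) (square₁ D s t) (square₂ D s t)))))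
          where
          re : ∀ X Z D T U A B → X ℤ.* (T ℤ.* A ℤ.+ D ℤ.* (U ℤ.* B)) ℤ.+ D ℤ.* (Z ℤ.* (U ℤ.* A ℤ.+ T ℤ.* B))
            ≡ (T ℤ.* X ℤ.+ D ℤ.* (U ℤ.* Z)) ℤ.* A ℤ.+ D ℤ.* ((U ℤ.* X ℤ.+ T ℤ.* Z) ℤ.* B)
          re = solveℤ-∀
          im : ∀ X Z D T U A B → Z ℤ.* (T ℤ.* A ℤ.+ D ℤ.* (U ℤ.* B)) ℤ.+ X ℤ.* (U ℤ.* A ℤ.+ T ℤ.* B)
            ≡ (U ℤ.* X ℤ.+ T ℤ.* Z) ℤ.* A ℤ.+ (T ℤ.* X ℤ.+ D ℤ.* (U ℤ.* Z)) ℤ.* B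
          im = solveℤ-∀

-- Square roots of D modulo M, told apart by finitely many tests.

module Roots where
  open Prelude
  import Data.Sum.Base as Sum
  import Data.Nat.Divisibility as ℕ∣
  open import Data.Nat.Coprimality using (Coprime)
  open import Data.Nat.GCD using (gcd; gcd[m,n]∣m; gcd[m,n]∣n; gcd-greatest; gcd[m,n]≡0⇒m≡0)
  open import Data.Nat.Primality using (Prime; euclidsLemma; prime[2]; prime⇒nonTrivial)
  open import Data.Nat.Primality.Factorisation using (factorise; PrimeFactorisation)
  open import Data.Nat.ListAction using (product)
  open import Data.List.Base using ([]; _∷_)
  open import Data.List.Relation.Unary.All using (All; []; _∷_)
  open import Data.Integer.DivMod using (_%ℕ_; _/ℕ_; a≡a%ℕn+[a/ℕn]*n; n%ℕd<d)
  import Data.Integer.Coprimality as ℤ-Coprimality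
  open import Data.Integer.Divisibility.Signed

  primeDivisor : ∀ d → 0 < d → d ≢ 1 → ∃[ p ] Prime p × p ℕ∣.∣ d
  primeDivisor d d>0 d≢1 = first (PrimeFactorisation.factors f) (PrimeFactorisation.isFactorisation f) (PrimeFactorisation.factorsPrime f)
    where
    f : PrimeFactorisation d
    f = factorise d {{>-nonZero d>0}}
    first : ∀ ps → d ≡ product ps → All Prime ps → ∃[ p ] Prime p × p ℕ∣.∣ d
    first []       d≡1 []       = ⊥-elim (d≢1 d≡1)
    first (p ∷ ps) d≡  (pp ∷ _) = p , pp , subst (p ℕ∣.∣_) (sym d≡) (ℕ∣.m∣m*n (product ps))

  coprimeByPrimes : ∀ {a b} → 0 < a → (∀ p → Prime p → p ℕ∣.∣ a → p ℕ∣.∣ b → ⊥) → Coprime a b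
  coprimeByPrimes {a} {b} a>0 no-prime {d} (d∣a , d∣b) with d ≟ 1
  ... | yes d≡1 = d≡1
  ... | no  d≢1 with primeDivisor d (n≢0⇒n>0 λ { refl → <⇒≢ a>0 (sym (ℕ∣.0∣⇒≡0 d∣a)) }) d≢1
  ...   | p , pp , p∣d = ⊥-elim (no-prime p pp (ℕ∣.∣-trans p∣d d∣a) (ℕ∣.∣-trans p∣d d∣b))

  prime-≢1 : ∀ {p} → Prime p → p ≢ 1
  prime-≢1 pp refl with prime⇒nonTrivial pp
  ... | ()

  twoPart : ∀ n k → n ≤ k → 0 < n → ∃[ e ] ∃[ N ] n ≡ 2 ^ e * N × ¬ 2 ℕ∣.∣ N
  twoPart zero k _ ()
  twoPart n@(suc _) (suc k) n≤k n>0 with 2 ℕ∣.∣? n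
  ... | no  2∤n = 0 , n , sym (+-identityʳ n) , 2∤n
  ... | yes (ℕ∣.divides q eq) with twoPart q k (≤-pred (≤-trans q<n n≤k)) q>0
    where
    q>0 : 0 < q
    q>0 = n≢0⇒n>0 λ { refl → <⇒≢ n>0 (sym eq) }
    q<n : q < n
    q<n = subst (q <_) (sym eq) (m<m*n q 2 {{>-nonZero q>0}} (s≤s (s≤s z≤n)))
  ...   | e , N , q≡ , 2∤N = suc e , N , trans eq (trans (*-comm q 2) (trans (cong (2 *_) q≡) (sym (*-assoc 2 (2 ^ e) N)))) , 2∤N

  evenOrOdd : ∀ i → + 2 ∣ i ⊎ ∃[ j ] i ≡ + 1 ℤ.+ + 2 ℤ.* j
  evenOrOdd i with i %ℕ 2 | a≡a%ℕn+[a/ℕn]*n i 2 | n%ℕd<d i 2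
  ... | 0 | eq | _ = inj₁ (divides (i /ℕ 2) (trans eq (ℤ.+-identityˡ _)))
  ... | 1 | eq | _ = inj₂ (i /ℕ 2 , trans eq (cong (λ z → + 1 ℤ.+ z) (ℤ.*-comm (i /ℕ 2) (+ 2))))
  ... | suc (suc _) | _ | s≤s (s≤s ())

  divisor : ∀ {M u} v → Coprime M (abs u) → + M ∣ u ℤ.* v → + M ∣ v
  divisor {M} {u} v c h = ∣ᵤ⇒∣ (ℤ-Coprimality.coprime-divisor (+ M) u v c (∣⇒∣ᵤ h))

  product-∣ : ∀ {a b} v → Coprime a b → + a ∣ v → + b ∣ v → + (a * b) ∣ v
  product-∣ {a} {b} v c (divides q eq) b∣v with divisor {b} {+ a} q (λ (x , y) → c (y , x)) (subst (+ b ∣_) (trans eq (ℤ.*-comm q (+ a))) b∣v)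
  ... | divides r q≡ = divides r (trans eq (trans (cong (ℤ._* + a) q≡) (trans (ℤ.*-assoc r (+ b) (+ a)) (cong (r ℤ.*_) (trans (ℤ.*-comm (+ b) (+ a)) (sym (ℤ.pos-* a b)))))))

  euclid : ∀ {p} → Prime p → ∀ u v → + p ∣ u ℤ.* v → + p ∣ u ⊎ + p ∣ v
  euclid {p} pp u v h = [ (λ x → inj₁ (∣ᵤ⇒∣ x)) , (λ x → inj₂ (∣ᵤ⇒∣ x)) ]′
    (euclidsLemma (abs u) (abs v) pp (subst (p ℕ∣.∣_) (ℤ.abs-* u v) (∣⇒∣ᵤ h)))

  -- If 2u₁ and 2u₂ are the same multiple of q up to parity, then the odd multiples cancel modulo q.
  halves : ∀ q → 0 < q → ∀ u₁ u₂ z₁ z₂ → + q ∣ + 2 ℤ.* u₁ → + q ∣ + 2 ℤ.* u₂ →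
    (+ q ∣ u₁ × + q ∣ u₂) ⊎ (¬ + q ∣ u₁ × ¬ + q ∣ u₂) → ¬ + 2 ∣ z₁ → ¬ + 2 ∣ z₂ → + q ∣ u₁ ℤ.* z₂ ℤ.- u₂ ℤ.* z₁
  halves q q>0 u₁ u₂ z₁ z₂ _ _ (inj₁ (h₁ , h₂)) _ _ = ∣m∣n⇒∣m-n (∣m⇒∣m*n z₂ h₁) (∣m⇒∣m*n z₁ h₂)
  halves q q>0 u₁ u₂ z₁ z₂ (divides k₁ e₁) (divides k₂ e₂) (inj₂ (n₁ , n₂)) o₁ o₂ = conclude (odd k₁ u₁ e₁ n₁) (odd k₂ u₂ e₂ n₂) ([ (λ e → ⊥-elim (o₁ e)) , (λ o → o) ]′ (evenOrOdd z₁)) ([ (λ e → ⊥-elim (o₂ e)) , (λ o → o) ]′ (evenOrOdd z₂))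
    where
    odd : ∀ k u → + 2 ℤ.* u ≡ k ℤ.* + q → ¬ + q ∣ u → ∃[ j ] k ≡ + 1 ℤ.+ + 2 ℤ.* j
    odd k u eq ¬q∣u = [ (λ { (divides j k≡) → ⊥-elim (¬q∣u (divides j (ℤ.*-cancelˡ-≡ (+ 2) _ _ (trans eq (trans (cong (ℤ._* + q) k≡) (swap j (+ q)))))))  }) , (λ o → o) ]′ (evenOrOdd k)
      where
      swap : ∀ j q → j ℤ.* + 2 ℤ.* q ≡ + 2 ℤ.* (j ℤ.* q)
      swap = solveℤ-∀
    conclude : ∃[ j ] k₁ ≡ + 1 ℤ.+ + 2 ℤ.* j → ∃[ j ] k₂ ≡ + 1 ℤ.+ + 2 ℤ.* j → ∃[ j ] z₁ ≡ + 1 ℤ.+ + 2 ℤ.* j → ∃[ j ] z₂ ≡ + 1 ℤ.+ + 2 ℤ.* j → _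
    conclude (a , refl) (b , refl) (c , refl) (d , refl) = divides (a ℤ.+ d ℤ.+ + 2 ℤ.* (a ℤ.* d) ℤ.- (b ℤ.+ c ℤ.+ + 2 ℤ.* (b ℤ.* c)))
      (ℤ.*-cancelˡ-≡ (+ 2) _ _ (trans (expand u₁ u₂ c d) (trans (cong₂ (λ s t → s ℤ.* (+ 1 ℤ.+ + 2 ℤ.* d) ℤ.- t ℤ.* (+ 1 ℤ.+ + 2 ℤ.* c)) e₁ e₂) (identity a b c d (+ q)))))
      where
      expand : ∀ u₁ u₂ c d → + 2 ℤ.* (u₁ ℤ.* (+ 1 ℤ.+ + 2 ℤ.* d) ℤ.- u₂ ℤ.* (+ 1 ℤ.+ + 2 ℤ.* c)) ≡ + 2 ℤ.* u₁ ℤ.* (+ 1 ℤ.+ + 2 ℤ.* d) ℤ.- + 2 ℤ.* u₂ ℤ.* (+ 1 ℤ.+ + 2 ℤ.* c)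
      expand = solveℤ-∀
      identity : ∀ a b c d q → (+ 1 ℤ.+ + 2 ℤ.* a) ℤ.* q ℤ.* (+ 1 ℤ.+ + 2 ℤ.* d) ℤ.- (+ 1 ℤ.+ + 2 ℤ.* b) ℤ.* q ℤ.* (+ 1 ℤ.+ + 2 ℤ.* c)
        ≡ + 2 ℤ.* ((a ℤ.+ d ℤ.+ + 2 ℤ.* (a ℤ.* d) ℤ.- (b ℤ.+ c ℤ.+ + 2 ℤ.* (b ℤ.* c))) ℤ.* q)
      identity = solveℤ-∀

  prime-∣-2 : ∀ {p} → Prime p → p ℕ∣.∣ 2 → p ≡ 2
  prime-∣-2 {0} pp p∣2 = ⊥-elim (0≢1+n (sym (ℕ∣.0∣⇒≡0 p∣2)))
  prime-∣-2 {1} pp p∣2 = ⊥-elim (prime-≢1 pp refl)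
  prime-∣-2 {2} pp p∣2 = refl
  prime-∣-2 {suc (suc (suc p))} pp p∣2 = ⊥-elim (<⇒≱ (s≤s (s≤s (s≤s z≤n))) (ℕ∣.∣⇒≤ p∣2))

  prime-∣-2^ : ∀ {p} → Prime p → ∀ e → p ℕ∣.∣ 2 ^ e → p ≡ 2
  prime-∣-2^ pp zero    h = ⊥-elim (prime-≢1 pp (ℕ∣.∣1⇒≡1 h))
  prime-∣-2^ pp (suc e) h = [ prime-∣-2 pp , prime-∣-2^ pp e ]′ (euclidsLemma 2 (2 ^ e) pp h)

  SameTruth : Set → Set → Set
  SameTruth P Q = (P × Q) ⊎ (¬ P × ¬ Q)

  module _ (M : ℕ) (M>0 : 0 < M) (x₀ z₀ x₁ z₁ x₂ z₂ : ℤ)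
           (x₀⊥M : Coprime M (abs x₀)) (z₀⊥M : Coprime M (abs z₀))
           (x₁⊥M : Coprime M (abs x₁)) (z₁⊥M : Coprime M (abs z₁))
           (x₂⊥M : Coprime M (abs x₂)) (z₂⊥M : Coprime M (abs z₂)) where

    -- A measures the difference of x/z from the base root x₀/z₀, B its sum with it. When both
    -- square to D modulo M, the product A·B is divisible by M.
    A₁ B₁ A₂ B₂ : ℤ
    A₁ = x₁ ℤ.* z₀ ℤ.- x₀ ℤ.* z₁
    B₁ = x₁ ℤ.* z₀ ℤ.+ x₀ ℤ.* z₁
    A₂ = x₂ ℤ.* z₀ ℤ.- x₀ ℤ.* z₂
    B₂ = x₂ ℤ.* z₀ ℤ.+ x₀ ℤ.* z₂

    cross : ℤ
    cross = x₁ ℤ.* z₂ ℤ.- x₂ ℤ.* z₁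

    A-cross : A₁ ℤ.* z₂ ℤ.- A₂ ℤ.* z₁ ≡ z₀ ℤ.* cross
    A-cross = identity x₀ z₀ x₁ z₁ x₂ z₂
      where
      identity : ∀ x₀ z₀ x₁ z₁ x₂ z₂ → (x₁ ℤ.* z₀ ℤ.- x₀ ℤ.* z₁) ℤ.* z₂ ℤ.- (x₂ ℤ.* z₀ ℤ.- x₀ ℤ.* z₂) ℤ.* z₁ ≡ z₀ ℤ.* (x₁ ℤ.* z₂ ℤ.- x₂ ℤ.* z₁)
      identity = solveℤ-∀

    B-cross : B₁ ℤ.* z₂ ℤ.- B₂ ℤ.* z₁ ≡ z₀ ℤ.* cross
    B-cross = identity x₀ z₀ x₁ z₁ x₂ z₂
      where
      identity : ∀ x₀ z₀ x₁ z₁ x₂ z₂ → (x₁ ℤ.* z₀ ℤ.+ x₀ ℤ.* z₁) ℤ.* z₂ ℤ.- (x₂ ℤ.* z₀ ℤ.+ x₀ ℤ.* z₂) ℤ.* z₁ ≡ z₀ ℤ.* (x₁ ℤ.* z₂ ℤ.- x₂ ℤ.* z₁)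
      identity = solveℤ-∀

    sum : ∀ x z → (x ℤ.* z₀ ℤ.- x₀ ℤ.* z) ℤ.+ (x ℤ.* z₀ ℤ.+ x₀ ℤ.* z) ≡ + 2 ℤ.* (x ℤ.* z₀)
    sum x z = identity x z₀ (x₀ ℤ.* z)
      where
      identity : ∀ x z₀ u → (x ℤ.* z₀ ℤ.- u) ℤ.+ (x ℤ.* z₀ ℤ.+ u) ≡ + 2 ℤ.* (x ℤ.* z₀)
      identity = solveℤ-∀

    coprime-∣ : ∀ {N u p} → N ℕ∣.∣ M → Coprime M (abs u) → Prime p → p ℕ∣.∣ N → ¬ + p ∣ u
    coprime-∣ N∣M u⊥M pp p∣N p∣u = prime-≢1 pp (u⊥M (ℕ∣.∣-trans p∣N N∣M , ∣⇒∣ᵤ p∣u))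

    restrict : ∀ {N u} → N ℕ∣.∣ M → Coprime M (abs u) → Coprime N (abs u)
    restrict N∣M u⊥M (d∣N , d∣u) = u⊥M (ℕ∣.∣-trans d∣N N∣M , d∣u)

    -- The sum of the two numbers is 2xz₀, which an odd prime divisor of M cannot divide.
    not-both : ∀ {N p} → N ℕ∣.∣ M → ¬ 2 ℕ∣.∣ N → Prime p → p ℕ∣.∣ N → ∀ x z → Coprime M (abs x) →
      + p ∣ x ℤ.* z₀ ℤ.- x₀ ℤ.* z → + p ∣ x ℤ.* z₀ ℤ.+ x₀ ℤ.* z → ⊥
    not-both {N} {p} N∣M odd pp p∣N x z x⊥M p∣A p∣B =
      [ (λ p∣2 → odd (subst (ℕ∣._∣ N) (prime-∣-2 pp (∣⇒∣ᵤ p∣2)) p∣N))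
      , (λ p∣xz₀ → [ coprime-∣ N∣M x⊥M pp p∣N , coprime-∣ N∣M z₀⊥M pp p∣N ]′ (euclid pp x z₀ p∣xz₀)) ]′
      (euclid pp (+ 2) (x ℤ.* z₀) (subst (+ p ∣_) (sum x z) (∣m∣n⇒∣m+n p∣A p∣B)))

    -- d is the part of N at which the roots x₁/z₁ and x₀/z₀ agree, d′ the part at which they are opposite.
    oddPart : ∀ N → N ℕ∣.∣ M → ¬ 2 ℕ∣.∣ N → + N ∣ A₁ ℤ.* B₁ → + N ∣ A₂ ℤ.* B₂ →
      (∀ p → Prime p → p ℕ∣.∣ N → SameTruth (+ p ∣ A₁) (+ p ∣ A₂)) → + N ∣ cross
    oddPart N N∣M odd AB₁ AB₂ same = subst (λ n → + n ∣ cross) (sym N≡) (product-∣ {d} {d′} cross d⊥d′ d∣cross d′∣cross)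
      where
      N>0 : 0 < N
      N>0 = n≢0⇒n>0 λ { refl → odd (2 ℕ∣.∣0) }
      d d′ : ℕ
      d = gcd N (abs A₁)
      d∣N : d ℕ∣.∣ N
      d∣N = gcd[m,n]∣m N (abs A₁)
      d∣A₁ : d ℕ∣.∣ abs A₁
      d∣A₁ = gcd[m,n]∣n N (abs A₁)
      d>0 : 0 < d
      d>0 = n≢0⇒n>0 λ p → <⇒≢ N>0 (sym (gcd[m,n]≡0⇒m≡0 p))
      d′ = ℕ∣.quotient d∣N
      N≡ : N ≡ d * d′
      N≡ = trans (ℕ∣._∣_.equality d∣N) (*-comm d′ d)
      d′∣N : d′ ℕ∣.∣ N
      d′∣N = subst (d′ ℕ∣.∣_) (sym N≡) (ℕ∣.n∣m*n d)
      d′>0 : 0 < d′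
      d′>0 = n≢0⇒n>0 λ p → <⇒≢ N>0 (sym (trans N≡ (trans (cong (d *_) p) (*-zeroʳ d))))
      transfer₁₂ : ∀ {p} → Prime p → p ℕ∣.∣ N → + p ∣ A₁ → + p ∣ A₂
      transfer₁₂ {p} pp p∣N h = [ proj₂ , (λ (n , _) → ⊥-elim (n h)) ]′ (same p pp p∣N)
      transfer₂₁ : ∀ {p} → Prime p → p ℕ∣.∣ N → + p ∣ A₂ → + p ∣ A₁
      transfer₂₁ {p} pp p∣N h = [ proj₁ , (λ (_ , n) → ⊥-elim (n h)) ]′ (same p pp p∣N)
      d′∣B₁ : + d′ ∣ B₁
      d′∣B₁ = divide (∣ᵤ⇒∣ {+ d} {A₁} d∣A₁)
        where
        divide : + d ∣ A₁ → + d′ ∣ B₁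
        divide (divides a A₁≡) = divisor {d′} {a} B₁ d′⊥a (*-cancelˡ-∣ (+ d) {+ d′} {a ℤ.* B₁} {{>-nonZero d>0}}
          (subst₂ _∣_ (trans (cong +_ N≡) (ℤ.pos-* d d′)) (trans (cong (ℤ._* B₁) A₁≡) (swap a (+ d) B₁)) AB₁))
          where
          swap : ∀ a d b → a ℤ.* d ℤ.* b ≡ d ℤ.* (a ℤ.* b)
          swap = solveℤ-∀
          d′⊥a : Coprime d′ (abs a)
          d′⊥a {c} (c∣d′ , c∣a) = ℕ∣.∣1⇒≡1 (ℕ∣.*-cancelˡ-∣ d {{>-nonZero d>0}} (subst ((d * c) ℕ∣.∣_) (sym (*-identityʳ d))
            (gcd-greatest (subst ((d * c) ℕ∣.∣_) (sym N≡) (ℕ∣.*-monoʳ-∣ d c∣d′))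
              (subst ((d * c) ℕ∣.∣_) (sym (trans (cong abs A₁≡) (trans (ℤ.abs-* a (+ d)) (*-comm (abs a) d)))) (ℕ∣.*-monoʳ-∣ d c∣a)))))
      p∣d⇒A₁ : ∀ {p} → p ℕ∣.∣ d → + p ∣ A₁
      p∣d⇒A₁ p∣d = ∣ᵤ⇒∣ (ℕ∣.∣-trans p∣d d∣A₁)
      p∣d′⇒B₁ : ∀ {p} → p ℕ∣.∣ d′ → + p ∣ B₁
      p∣d′⇒B₁ p∣d′ = ∣-trans (∣ᵤ⇒∣ p∣d′) d′∣B₁
      d∣cross : + d ∣ cross
      d∣cross = divisor {d} {z₀} cross (restrict {d} {z₀} (ℕ∣.∣-trans d∣N N∣M) z₀⊥M) (subst (+ d ∣_) A-cross
        (∣m∣n⇒∣m-n (∣m⇒∣m*n z₂ (∣ᵤ⇒∣ {+ d} {A₁} d∣A₁)) (∣m⇒∣m*n z₁ d∣A₂)))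
        where
        d∣A₂ : + d ∣ A₂
        d∣A₂ = divisor {d} {B₂} A₂ (coprimeByPrimes d>0 λ p pp p∣d p∣B₂ →
            not-both N∣M odd pp (ℕ∣.∣-trans p∣d d∣N) x₂ z₂ x₂⊥M (transfer₁₂ pp (ℕ∣.∣-trans p∣d d∣N) (p∣d⇒A₁ p∣d)) (∣ᵤ⇒∣ p∣B₂))
          (subst (+ d ∣_) (ℤ.*-comm A₂ B₂) (∣-trans (∣ᵤ⇒∣ d∣N) AB₂))
      d′∣cross : + d′ ∣ cross
      d′∣cross = divisor {d′} {z₀} cross (restrict {d′} {z₀} (ℕ∣.∣-trans d′∣N N∣M) z₀⊥M) (subst (+ d′ ∣_) B-cross
        (∣m∣n⇒∣m-n (∣m⇒∣m*n z₂ d′∣B₁) (∣m⇒∣m*n z₁ d′∣B₂)))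
        where
        d′∣B₂ : + d′ ∣ B₂
        d′∣B₂ = divisor {d′} {A₂} B₂ (coprimeByPrimes d′>0 λ p pp p∣d′ p∣A₂ →
            not-both N∣M odd pp (ℕ∣.∣-trans p∣d′ d′∣N) x₁ z₁ x₁⊥M (transfer₂₁ pp (ℕ∣.∣-trans p∣d′ d′∣N) (∣ᵤ⇒∣ p∣A₂)) (p∣d′⇒B₁ p∣d′))
          (∣-trans (∣ᵤ⇒∣ d′∣N) AB₂)
      d⊥d′ : Coprime d d′
      d⊥d′ = coprimeByPrimes d>0 λ p pp p∣d p∣d′ → not-both N∣M odd pp (ℕ∣.∣-trans p∣d d∣N) x₁ z₁ x₁⊥M (p∣d⇒A₁ p∣d) (p∣d′⇒B₁ p∣d′)

    -- A = 2a and B = 2b with a + b = xz₀ odd. So one of a and b is odd, and cancels from the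
    -- divisibility of AB by a power of 2.
    halfDivides : ∀ e → 2 ^ suc e ℕ∣.∣ M → ∀ x z → Coprime M (abs x) →
      let A = x ℤ.* z₀ ℤ.- x₀ ℤ.* z ; B = x ℤ.* z₀ ℤ.+ x₀ ℤ.* z in
      + (2 ^ suc e) ∣ A ℤ.* B → + (2 ^ suc e) ∣ + 2 ℤ.* A ⊎ + (2 ^ suc e) ∣ + 2 ℤ.* B
    halfDivides e q∣M x z x⊥M q∣AB = conclude (evenA (evenOrOdd A))
      where
      q : ℕ
      q = 2 ^ suc e
      A B : ℤ
      A = x ℤ.* z₀ ℤ.- x₀ ℤ.* z
      B = x ℤ.* z₀ ℤ.+ x₀ ℤ.* z
      2∣q : 2 ℕ∣.∣ q
      2∣q = ℕ∣.m∣m*n (2 ^ e)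
      ¬2∣xz₀ : ¬ + 2 ∣ x ℤ.* z₀
      ¬2∣xz₀ h = [ coprime-∣ {q} {x} q∣M x⊥M prime[2] 2∣q , coprime-∣ {q} {z₀} q∣M z₀⊥M prime[2] 2∣q ]′ (euclid prime[2] x z₀ h)
      2∣A+B : + 2 ∣ A ℤ.+ B
      2∣A+B = subst (+ 2 ∣_) (sym (sum x z)) (∣m⇒∣m*n (x ℤ.* z₀) ∣-refl)
      evenA : + 2 ∣ A ⊎ ∃[ j ] A ≡ + 1 ℤ.+ + 2 ℤ.* j → + 2 ∣ A
      evenA (inj₁ h) = h
      evenA (inj₂ _) = [ (λ h → h) , (λ 2∣B → ∣m+n∣n⇒∣m 2∣A+B 2∣B) ]′ (euclid prime[2] A B (∣-trans (∣ᵤ⇒∣ 2∣q) q∣AB))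
      coprime-q : ∀ u → ¬ + 2 ∣ u → Coprime q (abs u)
      coprime-q u ¬2∣u = coprimeByPrimes (m^n>0 2 (suc e)) λ p pp p∣q p∣u →
        ¬2∣u (∣ᵤ⇒∣ (subst (ℕ∣._∣ abs u) (prime-∣-2^ pp (suc e) p∣q) p∣u))
      conclude : + 2 ∣ A → + q ∣ + 2 ℤ.* A ⊎ + q ∣ + 2 ℤ.* B
      conclude 2∣A = halve 2∣A (∣m+n∣m⇒∣n 2∣A+B 2∣A)
        where
        halve : + 2 ∣ A → + 2 ∣ B → + q ∣ + 2 ℤ.* A ⊎ + q ∣ + 2 ℤ.* B
        halve (divides a A≡) (divides b B≡) = [ (λ 2∣b → inj₂ (divisor {q} {a} (+ 2 ℤ.* B) (coprime-q a (λ 2∣a → ¬2∣xz₀ (subst (+ 2 ∣_) a+b (∣m∣n⇒∣m+n 2∣a 2∣b))))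
              (subst (+ q ∣_) (trans (cong (ℤ._* B) A≡) (ℤ.*-assoc a (+ 2) B)) q∣AB)))
          , (λ odd-b → inj₁ (divisor {q} {b} (+ 2 ℤ.* A) (coprime-q b (not-even odd-b))
              (subst (+ q ∣_) (trans (cong (A ℤ.*_) B≡) (swap A b)) q∣AB))) ]′ (evenOrOdd b)
          where
          swap : ∀ A b → A ℤ.* (b ℤ.* + 2) ≡ b ℤ.* (+ 2 ℤ.* A)
          swap = solveℤ-∀
          a+b : a ℤ.+ b ≡ x ℤ.* z₀
          a+b = ℤ.*-cancelˡ-≡ (+ 2) _ _ (trans (trans (spread a b) (sym (cong₂ ℤ._+_ A≡ B≡))) (sum x z))
            where
            spread : ∀ a b → + 2 ℤ.* (a ℤ.+ b) ≡ a ℤ.* + 2 ℤ.+ b ℤ.* + 2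
            spread = solveℤ-∀
          not-even : ∀ {u} → ∃[ j ] u ≡ + 1 ℤ.+ + 2 ℤ.* j → ¬ + 2 ∣ u
          not-even (j , refl) h = <⇒≱ (s≤s (s≤s z≤n)) (ℕ∣.∣⇒≤ (∣⇒∣ᵤ (∣m+n∣n⇒∣m {+ 2} {+ 1} h (∣m⇒∣m*n j ∣-refl))))

    -- Modulo q = 2^e the base root and its negative are not the only roots: q/2 may be added. The
    -- test on 2A decides between the two up to q/2, the test on A or B then settles the summand.
    twoAdicPart : ∀ e → 2 ^ e ℕ∣.∣ M → + (2 ^ e) ∣ A₁ ℤ.* B₁ → + (2 ^ e) ∣ A₂ ℤ.* B₂ →
      SameTruth (+ (2 ^ e) ∣ + 2 ℤ.* A₁) (+ (2 ^ e) ∣ + 2 ℤ.* A₂) →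
      SameTruth (+ (2 ^ e) ∣ A₁) (+ (2 ^ e) ∣ A₂) → SameTruth (+ (2 ^ e) ∣ B₁) (+ (2 ^ e) ∣ B₂) → + (2 ^ e) ∣ cross
    twoAdicPart zero _ _ _ _ _ _ = divides cross (sym (ℤ.*-identityʳ cross))
    twoAdicPart (suc e) q∣M AB₁ AB₂ same₂ sameA sameB = divisor {q} {z₀} cross (restrict {q} {z₀} q∣M z₀⊥M) ([ viaA , viaB ]′ same₂)
      where
      q : ℕ
      q = 2 ^ suc e
      q>0 : 0 < q
      q>0 = m^n>0 2 (suc e)
      odd : ∀ z → Coprime M (abs z) → ¬ + 2 ∣ z
      odd z z⊥M = coprime-∣ {q} {z} q∣M z⊥M prime[2] (ℕ∣.m∣m*n (2 ^ e))
      viaA : + q ∣ + 2 ℤ.* A₁ × + q ∣ + 2 ℤ.* A₂ → + q ∣ z₀ ℤ.* cross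
      viaA (h₁ , h₂) = subst (+ q ∣_) A-cross (halves q q>0 A₁ A₂ z₁ z₂ h₁ h₂ sameA (odd z₁ z₁⊥M) (odd z₂ z₂⊥M))
      viaB : ¬ + q ∣ + 2 ℤ.* A₁ × ¬ + q ∣ + 2 ℤ.* A₂ → + q ∣ z₀ ℤ.* cross
      viaB (n₁ , n₂) = subst (+ q ∣_) B-cross (halves q q>0 B₁ B₂ z₁ z₂
        ([ (λ h → ⊥-elim (n₁ h)) , (λ h → h) ]′ (halfDivides e q∣M x₁ z₁ x₁⊥M AB₁))
        ([ (λ h → ⊥-elim (n₂ h)) , (λ h → h) ]′ (halfDivides e q∣M x₂ z₂ x₂⊥M AB₂))
        sameB (odd z₁ z₁⊥M) (odd z₂ z₂⊥M))

    sameRoot : ∀ e N → M ≡ 2 ^ e * N → ¬ 2 ℕ∣.∣ N → + M ∣ A₁ ℤ.* B₁ → + M ∣ A₂ ℤ.* B₂ →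
      (∀ p → Prime p → p ℕ∣.∣ M → SameTruth (+ p ∣ A₁) (+ p ∣ A₂)) →
      SameTruth (+ (2 ^ e) ∣ + 2 ℤ.* A₁) (+ (2 ^ e) ∣ + 2 ℤ.* A₂) →
      SameTruth (+ (2 ^ e) ∣ A₁) (+ (2 ^ e) ∣ A₂) → SameTruth (+ (2 ^ e) ∣ B₁) (+ (2 ^ e) ∣ B₂) → + M ∣ cross
    sameRoot e N M≡ odd AB₁ AB₂ same same₂ sameA sameB = subst (λ n → + n ∣ cross) (sym M≡)
      (product-∣ {2 ^ e} {N} cross 2^e⊥N
        (twoAdicPart e q∣M (∣-trans (∣ᵤ⇒∣ q∣M) AB₁) (∣-trans (∣ᵤ⇒∣ q∣M) AB₂) same₂ sameA sameB)
        (oddPart N N∣M odd (∣-trans (∣ᵤ⇒∣ N∣M) AB₁) (∣-trans (∣ᵤ⇒∣ N∣M) AB₂) (λ p pp p∣N → same p pp (ℕ∣.∣-trans p∣N N∣M))))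
      where
      q∣M : 2 ^ e ℕ∣.∣ M
      q∣M = subst (2 ^ e ℕ∣.∣_) (sym M≡) (ℕ∣.m∣m*n N)
      N∣M : N ℕ∣.∣ M
      N∣M = subst (N ℕ∣.∣_) (sym M≡) (ℕ∣.n∣m*n (2 ^ e))
      2^e⊥N : Coprime (2 ^ e) N
      2^e⊥N = coprimeByPrimes (m^n>0 2 e) λ p pp p∣q p∣N → odd (subst (ℕ∣._∣ N) (prime-∣-2^ pp e p∣q) p∣N)

-- Reduction by the gcd of X and Y².

module GcdClasses where
  open Prelude
  open import Data.Nat.Divisibility
  open import Data.Nat.GCD using (gcd)
  open import Data.Nat.Coprimality using (Coprime; coprime-divisor)
  import Data.Integer.Divisibility.Signed as ℤ∣
  open Cast
  open Units using (square-≤⁻¹)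
  open PellPair using (lowestTerms)
  open Orbits using (Solution; Congruent)
  open Roots using (divisor)

  nonneg-quotient : ∀ {c d m} q → 0 < m → d ≤ c → + c ≡ + d ℤ.+ + m ℤ.* q → ∃[ b ] d + m * b ≡ c
  nonneg-quotient {c} {d} {m} (+ b) m>0 d≤c eq = b , uncastEq (` d :+ ` m :* ` b) (` c) (sym eq)
  nonneg-quotient {c} {d} {m} -[1+ n ] m>0 d≤c eq = ⊥-elim (<-irrefl refl (begin-strict
    d                 ≤⟨ d≤c ⟩
    c                 <⟨ m<m+n c (*-mono-≤ {1} {m} {1} {suc n} m>0 (s≤s z≤n)) ⟩
    c + m * suc n     ≡⟨ uncastEq (` c :+ ` m :* ` (suc n)) (` d)
                          (trans (cong (ℤ._+ + m ℤ.* + suc n) eq) (cancel (+ d) (+ m) (+ suc n))) ⟩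
    d                 ∎))
    where
    open ≤-Reasoning
    cancel : ∀ d m s → d ℤ.+ m ℤ.* (- s) ℤ.+ m ℤ.* s ≡ d
    cancel = solveℤ-∀

  coprime-square : ∀ {a b} → Coprime a b → Coprime a (b * b)
  coprime-square {a} {b} c {d} (d∣a , d∣bb) = c (d∣a , coprime-divisor {d} {b} (λ (e∣d , e∣b) → c (∣-trans e∣d d∣a , e∣b)) d∣bb)

  module _ (D m : ℕ) (1<D : 1 < D) (m>0 : 0 < m) (D⊥m : Coprime D m) where

    -- g and M are parameters, so that all members of a gcd class visibly share the modulus for
    -- which x/z is a square root of D.
    record Reduced (g M : ℕ) (P : ℕ × ℕ) : Set where
      field
        x z    : ℕ
        X≡     : proj₁ P ≡ g * x
        YY≡    : proj₂ P * proj₂ P ≡ g * z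
        m≡     : m ≡ g * g * M
        normEq : x * x + M ≡ D * (z * z)
        M⊥x    : Coprime M x
        M⊥z    : Coprime M z

    reduce : ∀ {X Y} → Solution D m 1<D m>0 (X , Y) → ∃[ M ] Reduced (gcd X (Y * Y)) M (X , Y)
    reduce {X} {Y} (X>0 , Y>0 , sol) = M , record
      { x = x ; z = z ; X≡ = X≡ ; YY≡ = YY≡ ; m≡ = m≡ ; normEq = normEq ; M⊥x = M⊥x ; M⊥z = M⊥z }
      where
      terms = lowestTerms X (Y * Y) (*-mono-≤ {1} {Y} Y>0 Y>0)
      g x z : ℕ
      g = proj₁ terms
      x = proj₁ (proj₂ terms)
      z = proj₁ (proj₂ (proj₂ terms))
      X≡ : X ≡ g * x
      X≡ = proj₁ (proj₂ (proj₂ (proj₂ terms)))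
      YY≡ : Y * Y ≡ g * z
      YY≡ = proj₁ (proj₂ (proj₂ (proj₂ (proj₂ terms))))
      x⊥z : Coprime x z
      x⊥z = proj₂ (proj₂ (proj₂ (proj₂ (proj₂ terms))))
      g>0 : 0 < g
      g>0 = n≢0⇒n>0 λ p → <⇒≢ X>0 (sym (trans X≡ (cong (_* x) p)))
      gg>0 : 0 < g * g
      gg>0 = *-mono-≤ {1} {g} g>0 g>0
      M : ℕ
      M = D * (z * z) ∸ x * x
      sol-reduced : g * g * (x * x) + m ≡ g * g * (D * (z * z))
      sol-reduced = trans (cong (_+ m) (trans (square g x) (cong (λ u → u * u) (sym X≡)))) (trans sol
        (trans (cong (λ u → D * (u * u)) YY≡) (expand D g z)))
        where
        square : ∀ g x → g * g * (x * x) ≡ g * x * (g * x)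
        square = solve-∀
        expand : ∀ D g z → D * (g * z * (g * z)) ≡ g * g * (D * (z * z))
        expand = solve-∀
      normEq : x * x + M ≡ D * (z * z)
      normEq = m+[n∸m]≡n (*-cancelˡ-≤ (g * g) {{>-nonZero gg>0}} (≤-trans (m≤m+n _ m) (≤-reflexive sol-reduced)))
      m≡ : m ≡ g * g * M
      m≡ = +-cancelˡ-≡ (g * g * (x * x)) _ _ (trans sol-reduced (trans (cong (g * g *_) (sym normEq)) (*-distribˡ-+ (g * g) (x * x) M)))
      M∣m : M ∣ m
      M∣m = subst (M ∣_) (sym m≡) (n∣m*n (g * g))
      M⊥z : Coprime M z
      M⊥z {d} (d∣M , d∣z) = x⊥z (coprime-divisor {d} {x} (λ (c∣d , c∣x) → x⊥z (c∣x , ∣-trans c∣d d∣z)) d∣xx , d∣z)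
        where
        d∣xx : d ∣ x * x
        d∣xx = ∣m+n∣m⇒∣n (subst (d ∣_) (trans (sym normEq) (+-comm (x * x) M)) (∣n⇒∣m*n D (∣m⇒∣m*n z d∣z))) d∣M
      -- A common divisor of M and x divides D·z². It is prime to D because it divides m, hence it
      -- divides z.
      M⊥x : Coprime M x
      M⊥x {d} (d∣M , d∣x) = x⊥z (d∣x , coprime-divisor {d} {z} (λ (c∣d , c∣z) → x⊥z (∣-trans c∣d d∣x , c∣z))
        (coprime-divisor {d} {D} (λ (c∣d , c∣D) → D⊥m (c∣D , ∣-trans c∣d (∣-trans d∣M M∣m))) d∣Dzz))
        where
        d∣Dzz : d ∣ D * (z * z)
        d∣Dzz = subst (d ∣_) normEq (∣m∣n⇒∣m+n (∣m⇒∣m*n x d∣x) d∣M)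

    -- The hypothesis equates two roots of D modulo M, so M also divides z₁(Dz₁z₂ - x₁x₂), and z₁
    -- cancels. Multiplied by g² both divisibilities become congruences modulo m.
    congruent : ∀ {g M X₁ Y₁ X₂ Y₂} → Solution D m 1<D m>0 (X₁ , Y₁) → Solution D m 1<D m>0 (X₂ , Y₂) →
      (r₁ : Reduced g M (X₁ , Y₁)) (r₂ : Reduced g M (X₂ , Y₂)) → Y₁ ≤ Y₂ →
      (+ M ℤ∣.∣ + Reduced.x r₁ ℤ.* + Reduced.z r₂ ℤ.- + Reduced.x r₂ ℤ.* + Reduced.z r₁) →
      Congruent D m 1<D m>0 (X₁ , Y₁) (X₂ , Y₂)
    congruent {g} {M} {X₁} {Y₁} {X₂} {Y₂} (X₁>0 , Y₁>0 , sol₁) (X₂>0 , Y₂>0 , sol₂) r₁ r₂ Y₁≤Y₂ (ℤ∣.divides q cross≡) =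
      first (divisor {M} {+ z₁} _ M⊥z₁ (ℤ∣.divides (+ z₂ ℤ.+ + x₁ ℤ.* q) first-divides))
      , nonneg-quotient (- q) m>0 order₂ second-eq
      where
      open Reduced r₁ using () renaming (x to x₁; z to z₁; X≡ to X₁≡; YY≡ to YY₁≡; m≡ to m≡; normEq to normEq₁; M⊥z to M⊥z₁)
      open Reduced r₂ using () renaming (x to x₂; z to z₂; X≡ to X₂≡; YY≡ to YY₂≡)
      Z₁ Z₂ : ℕ
      Z₁ = Y₁ * Y₁
      Z₂ = Y₂ * Y₂
      gxgz : ∀ {u v x z} → u ≡ g * x → v ≡ g * z → + (u * v) ≡ + g ℤ.* + g ℤ.* (+ x ℤ.* + z)
      gxgz {x = x} {z} refl refl = trans (cast (` g :* ` x :* (` g :* ` z))) (swap (+ g) (+ x) (+ z))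
        where
        swap : ∀ g x z → g ℤ.* x ℤ.* (g ℤ.* z) ≡ g ℤ.* g ℤ.* (x ℤ.* z)
        swap = solveℤ-∀
      mℤ : + m ≡ + g ℤ.* + g ℤ.* + M
      mℤ = trans (cong +_ m≡) (cast (` g :* ` g :* ` M))
      second-eq : + (X₂ * Z₁) ≡ + (X₁ * Z₂) ℤ.+ + m ℤ.* (- q)
      second-eq = trans (gxgz X₂≡ YY₁≡) (trans (identity (+ g) (+ x₁) (+ x₂) (+ z₁) (+ z₂))
        (trans (cong (λ u → + g ℤ.* + g ℤ.* (+ x₁ ℤ.* + z₂) ℤ.- + g ℤ.* + g ℤ.* u) cross≡)
        (trans (regroup (+ g ℤ.* + g) (+ x₁ ℤ.* + z₂) q (+ M)) (sym (cong₂ (λ u v → u ℤ.+ v ℤ.* (- q)) (gxgz X₁≡ YY₂≡) mℤ)))))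
        where
        identity : ∀ g x₁ x₂ z₁ z₂ → g ℤ.* g ℤ.* (x₂ ℤ.* z₁) ≡ g ℤ.* g ℤ.* (x₁ ℤ.* z₂) ℤ.- g ℤ.* g ℤ.* (x₁ ℤ.* z₂ ℤ.- x₂ ℤ.* z₁)
        identity = solveℤ-∀
        regroup : ∀ h u q M → h ℤ.* u ℤ.- h ℤ.* (q ℤ.* M) ≡ h ℤ.* u ℤ.+ h ℤ.* M ℤ.* (- q)
        regroup = solveℤ-∀
      first-divides : + z₁ ℤ.* (+ D ℤ.* (+ z₁ ℤ.* + z₂) ℤ.- + x₁ ℤ.* + x₂) ≡ (+ z₂ ℤ.+ + x₁ ℤ.* q) ℤ.* + M
      first-divides = trans (identity (+ D) (+ x₁) (+ x₂) (+ z₁) (+ z₂))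
        (trans (cong₂ (λ u v → + z₂ ℤ.* u ℤ.- + x₁ ℤ.* + x₁ ℤ.* + z₂ ℤ.+ + x₁ ℤ.* v)
            (sym (castEq (` x₁ :* ` x₁ :+ ` M) (` D :* (` z₁ :* ` z₁)) normEq₁)) cross≡)
          (collect (+ x₁) (+ z₂) (+ M) q))
        where
        identity : ∀ D x₁ x₂ z₁ z₂ → z₁ ℤ.* (D ℤ.* (z₁ ℤ.* z₂) ℤ.- x₁ ℤ.* x₂)
          ≡ z₂ ℤ.* (D ℤ.* (z₁ ℤ.* z₁)) ℤ.- x₁ ℤ.* x₁ ℤ.* z₂ ℤ.+ x₁ ℤ.* (x₁ ℤ.* z₂ ℤ.- x₂ ℤ.* z₁)
        identity = solveℤ-∀
        collect : ∀ x z M q → z ℤ.* (x ℤ.* x ℤ.+ M) ℤ.- x ℤ.* x ℤ.* z ℤ.+ x ℤ.* (q ℤ.* M) ≡ (z ℤ.+ x ℤ.* q) ℤ.* M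
        collect = solveℤ-∀
      order₁ : X₁ * X₂ ≤ D * (Z₁ * Z₂)
      order₁ = square-≤⁻¹ (begin
        X₁ * X₂ * (X₁ * X₂)              ≡⟨ swap X₁ X₂ ⟩
        X₁ * X₁ * (X₂ * X₂)              ≤⟨ *-mono-≤ (m≤m+n (X₁ * X₁) m) (m≤m+n (X₂ * X₂) m) ⟩
        (X₁ * X₁ + m) * (X₂ * X₂ + m)    ≡⟨ cong₂ _*_ sol₁ sol₂ ⟩
        D * (Z₁ * Z₁) * (D * (Z₂ * Z₂))  ≡⟨ swap₂ D Z₁ Z₂ ⟩
        D * (Z₁ * Z₂) * (D * (Z₁ * Z₂))  ∎)
        where
        open ≤-Reasoning
        swap : ∀ a b → a * b * (a * b) ≡ a * a * (b * b)
        swap = solve-∀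
        swap₂ : ∀ D a b → D * (a * a) * (D * (b * b)) ≡ D * (a * b) * (D * (a * b))
        swap₂ = solve-∀
      -- The base solution has to be the smaller one: X²/Z² = D - m/Z² increases with Y.
      order₂ : X₁ * Z₂ ≤ X₂ * Z₁
      order₂ = square-≤⁻¹ (+-cancelʳ-≤ (m * (Z₂ * Z₂)) _ _ (begin
        X₁ * Z₂ * (X₁ * Z₂) + m * (Z₂ * Z₂)   ≡⟨ expand X₁ Z₂ m ⟩
        (X₁ * X₁ + m) * (Z₂ * Z₂)             ≡⟨ cong (_* (Z₂ * Z₂)) sol₁ ⟩
        D * (Z₁ * Z₁) * (Z₂ * Z₂)             ≡⟨ swap D (Z₁ * Z₁) (Z₂ * Z₂) ⟩
        D * (Z₂ * Z₂) * (Z₁ * Z₁)             ≡⟨ cong (_* (Z₁ * Z₁)) sol₂ ⟨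
        (X₂ * X₂ + m) * (Z₁ * Z₁)             ≡⟨ expand X₂ Z₁ m ⟨
        X₂ * Z₁ * (X₂ * Z₁) + m * (Z₁ * Z₁)   ≤⟨ +-monoʳ-≤ (X₂ * Z₁ * (X₂ * Z₁)) (*-monoʳ-≤ m (*-mono-≤ Z₁≤Z₂ Z₁≤Z₂)) ⟩
        X₂ * Z₁ * (X₂ * Z₁) + m * (Z₂ * Z₂)   ∎))
        where
        open ≤-Reasoning
        Z₁≤Z₂ : Z₁ ≤ Z₂
        Z₁≤Z₂ = *-mono-≤ Y₁≤Y₂ Y₁≤Y₂
        expand : ∀ X Z m → X * Z * (X * Z) + m * (Z * Z) ≡ (X * X + m) * (Z * Z)
        expand = solve-∀
        swap : ∀ D a b → D * a * b ≡ D * b * a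
        swap = solve-∀
      first : (+ M ℤ∣.∣ + D ℤ.* (+ z₁ ℤ.* + z₂) ℤ.- + x₁ ℤ.* + x₂) → ∃[ a ] X₁ * X₂ + m * a ≡ D * (Z₁ * Z₂)
      first (ℤ∣.divides r eq) = nonneg-quotient r m>0 order₁
        (trans (ℤ.pos-* D (Z₁ * Z₂)) (trans (cong (+ D ℤ.*_) (gxgz YY₁≡ YY₂≡)) (trans (identity (+ g) (+ D) (+ z₁ ℤ.* + z₂) (+ x₁ ℤ.* + x₂))
          (trans (cong (λ u → + g ℤ.* + g ℤ.* (+ x₁ ℤ.* + x₂) ℤ.+ + g ℤ.* + g ℤ.* u) eq)
          (trans (regroup (+ g ℤ.* + g) (+ x₁ ℤ.* + x₂) r (+ M)) (sym (cong₂ (λ u v → u ℤ.+ v ℤ.* r) (gxgz X₁≡ X₂≡) mℤ)))))))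
        where
        identity : ∀ g D u v → D ℤ.* (g ℤ.* g ℤ.* u) ≡ g ℤ.* g ℤ.* v ℤ.+ g ℤ.* g ℤ.* (D ℤ.* u ℤ.- v)
        identity = solveℤ-∀
        regroup : ∀ h u r M → h ℤ.* u ℤ.+ h ℤ.* (r ℤ.* M) ≡ h ℤ.* u ℤ.+ h ℤ.* M ℤ.* r
        regroup = solveℤ-∀

-- Cardinality bounds by duplicate-free lists.

module Counting where
  open Prelude
  open Roots using (SameTruth)
  import Data.Sum.Base as Sum
  open import Data.List.Base using (List; []; _∷_; length)
  open import Data.List.Relation.Unary.All as All using (All; []; _∷_)
  open import Data.List.Relation.Unary.AllPairs using ([]; _∷_)
  open import Data.List.Relation.Unary.Unique.Propositional using (Unique)
  open import Relation.Binary.Definitions using (tri<; tri≈; tri>)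

  module _ {A : Set} where

    -- Requires neither an enumeration nor decidability of P; only given lists are measured, as in
    -- the theorem.
    Bounded : (A → Set) → ℕ → Set
    Bounded P n = ∀ xs → Unique xs → All P xs → length xs ≤ n

    bounded-map : ∀ {P Q : A → Set} {n} → (∀ a → P a → Q a) → Bounded Q n → Bounded P n
    bounded-map f b xs u ps = b xs u (All.map (λ {a} → f a) ps)

    bounded-mono : ∀ {P : A → Set} {m n} → m ≤ n → Bounded P m → Bounded P n
    bounded-mono m≤n b xs u ps = ≤-trans (b xs u ps) m≤n

    bounded-⊎ : ∀ {P Q : A → Set} {m n} → Bounded P m → Bounded Q n → Bounded (λ a → P a ⊎ Q a) (m + n)
    bounded-⊎ {P} {Q} bP bQ xs u pqs with split xs u pqs
      where
      split : ∀ xs → Unique xs → All (λ a → P a ⊎ Q a) xs → ∃[ ys ] ∃[ zs ]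
        Unique ys × All P ys × Unique zs × All Q zs × length xs ≤ length ys + length zs
        × (∀ {a} → All (a ≢_) xs → All (a ≢_) ys × All (a ≢_) zs)
      split []       []       []         = [] , [] , [] , [] , [] , [] , z≤n , λ _ → [] , []
      split (x ∷ xs) (x∉ ∷ u) (pq ∷ pqs) with split xs u pqs | pq
      ... | ys , zs , uy , py , uz , qz , len , fresh | inj₁ p =
        x ∷ ys , zs , proj₁ (fresh x∉) ∷ uy , p ∷ py , uz , qz , s≤s len ,
        λ { (a≢x ∷ f) → a≢x ∷ proj₁ (fresh f) , proj₂ (fresh f) }
      ... | ys , zs , uy , py , uz , qz , len , fresh | inj₂ q =
        ys , x ∷ zs , uy , py , proj₂ (fresh x∉) ∷ uz , q ∷ qz ,
        ≤-trans (s≤s len) (≤-reflexive (sym (+-suc (length ys) (length zs)))) ,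
        λ { (a≢x ∷ f) → proj₁ (fresh f) , a≢x ∷ proj₂ (fresh f) }
    ... | ys , zs , uy , py , uz , qz , len , _ = ≤-trans len (+-mono-≤ (bP ys uy py) (bQ zs uz qz))

    bounded-0 : ∀ {P : A → Set} → (∀ a → ¬ P a) → Bounded P 0
    bounded-0 h []       _ _       = z≤n
    bounded-0 h (x ∷ xs) _ (p ∷ _) = ⊥-elim (h x p)

    bounded-1 : ∀ {P : A → Set} → (∀ a b → P a → P b → a ≡ b) → Bounded P 1
    bounded-1 h []           _                 _            = z≤n
    bounded-1 h (x ∷ [])     _                 _            = s≤s z≤n
    bounded-1 h (x ∷ y ∷ xs) ((x≢y ∷ _) ∷ _) (px ∷ py ∷ _) = ⊥-elim (x≢y (h x y px py))

    -- A list is empty or exhibits a member, so one may be assumed while bounding.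
    bounded-inhabited : ∀ {P : A → Set} {n} → (∀ a → P a → Bounded P n) → Bounded P n
    bounded-inhabited h []       _ _            = z≤n
    bounded-inhabited h (x ∷ xs) u ps@(p ∷ _) = h x p (x ∷ xs) u ps

    -- A minimum over all of P is never computed; each list supplies its own.
    bounded-minimal : ∀ {P : A → Set} {n} (Y : A → ℕ) → (∀ a → P a → Bounded (λ b → P b × Y a ≤ Y b) n) → Bounded P n
    bounded-minimal Y h [] _ _ = z≤n
    bounded-minimal {P} Y h (x ∷ xs) u ps with minimal x xs ps
      where
      minimal : ∀ x xs → All P (x ∷ xs) → ∃[ a ] P a × All (λ b → P b × Y a ≤ Y b) (x ∷ xs)
      minimal x [] (p ∷ []) = x , p , (p , ≤-refl) ∷ []
      minimal x (y ∷ ys) (p ∷ ps) with minimal y ys ps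
      ... | a , pa , all with ≤-total (Y a) (Y x)
      ...   | inj₁ a≤x = a , pa , (p , a≤x) ∷ all
      ...   | inj₂ x≤a = x , p , (p , ≤-refl) ∷ All.map (λ (q , a≤b) → q , ≤-trans x≤a a≤b) all
    ... | a , pa , all = h a pa (x ∷ xs) u all

    bounded-labels : ∀ {P : A → Set} {k} (f : A → ℕ) →
      (∀ a → P a → Bounded (λ b → P b × f b ≡ f a) k) → ∀ N → Bounded (λ a → P a × f a < N) (N * k)
    bounded-labels f h zero = bounded-0 λ { a (_ , ()) }
    bounded-labels {P} {k} f h (suc N) = bounded-map
      (λ a (p , fa<) → Sum.map (λ fa≡ → p , fa≡) (λ fa<N → p , fa<N) (Sum.swap (m≤n⇒m<n∨m≡n (≤-pred fa<))))
      (bounded-⊎ {λ a → P a × f a ≡ N}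
        (bounded-inhabited λ a (p , fa≡N) → bounded-map (λ b (q , fb≡N) → q , trans fb≡N (sym fa≡N)) (h a p))
        (bounded-labels f h N))

    -- Each test splits P in two and doubles the bound. The final classes are described by agreement
    -- with a member, which serves as reference point.
    bounded-bits : ∀ {I : Set} (Q : I → A → Set) → (∀ i a → Dec (Q i a)) → ∀ {k} (is : List I) {P : A → Set} →
      (∀ a → P a → Bounded (λ b → P b × All (λ i → SameTruth (Q i a) (Q i b)) is) k) → Bounded P (2 ^ length is * k)
    bounded-bits Q Q? {k} [] h = bounded-mono (≤-reflexive (sym (+-identityʳ k)))
      (bounded-inhabited λ a p → bounded-map (λ b q → q , []) (h a p))
    bounded-bits Q Q? {k} (i ∷ is) {P} h = bounded-mono (≤-reflexive (double (2 ^ length is) k)) (bounded-map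
      (λ a p → decide a p (Q? i a))
      (bounded-⊎ {λ a → P a × Q i a} {λ a → P a × ¬ Q i a}
        (bounded-bits Q Q? is λ a (p , q) → bounded-map (λ b ((p′ , q′) , all) → p′ , inj₁ (q , q′) ∷ all) (h a p))
        (bounded-bits Q Q? is λ a (p , q) → bounded-map (λ b ((p′ , q′) , all) → p′ , inj₂ (q , q′) ∷ all) (h a p))))
      where
      decide : ∀ a → P a → Dec (Q i a) → (P a × Q i a) ⊎ (P a × ¬ Q i a)
      decide a p (yes q) = inj₁ (p , q)
      decide a p (no ¬q) = inj₂ (p , ¬q)
      double : ∀ c k → c * k + c * k ≡ 2 * c * k
      double c k = trans (sym (*-distribʳ-+ k c c)) (cong (λ z → (c + z) * k) (sym (+-identityʳ c)))

    -- No two values of Y lie between consecutive powers of b, since the larger would be at least b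
    -- times the smaller.
    bounded-geometric : ∀ {P : A → Set} (Y : A → ℕ) b →
      (∀ a → P a → 0 < Y a) → (∀ a a′ → P a → P a′ → Y a ≡ Y a′ → a ≡ a′) →
      (∀ a a′ → P a → P a′ → Y a < Y a′ → b * Y a ≤ Y a′) →
      ∀ J → Bounded (λ a → P a × Y a < b ^ J) J
    bounded-geometric Y b pos inj grow zero = bounded-0 λ a (p , Y<1) → <⇒≱ (pos a p) (≤-pred Y<1)
    bounded-geometric {P} Y b pos inj grow (suc J) = bounded-mono (≤-reflexive (+-comm J 1)) (bounded-map
      (λ a (p , Y<) → [ (λ lt → inj₁ (p , lt)) , (λ ge → inj₂ (p , ge , Y<)) ]′ (<-≤-connex (Y a) (b ^ J)))
      (bounded-⊎ {Q = λ a → P a × b ^ J ≤ Y a × Y a < b ^ suc J} (bounded-geometric Y b pos inj grow J) (bounded-1 single)))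
      where
      apart : ∀ a a′ → P a × b ^ J ≤ Y a × Y a < b ^ suc J → P a′ × b ^ J ≤ Y a′ × Y a′ < b ^ suc J → ¬ Y a < Y a′
      apart a a′ (p , low , _) (p′ , _ , high) a<a′ = <-irrefl refl (<-≤-trans high (≤-trans (*-monoʳ-≤ b low) (grow a a′ p p′ a<a′)))
      single : ∀ a a′ → P a × b ^ J ≤ Y a × Y a < b ^ suc J → P a′ × b ^ J ≤ Y a′ × Y a′ < b ^ suc J → a ≡ a′
      single a a′ h h′ = inj a a′ (proj₁ h) (proj₁ h′) (≤-antisym (≮⇒≥ (apart a′ a h′ h)) (≮⇒≥ (apart a a′ h h′)))

    bounded-2 : ∀ {P : A → Set} (Y : A → ℕ) → (∀ a a′ → P a → P a′ → Y a ≡ Y a′ → a ≡ a′) →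
      (∀ a b c → P a → P b → P c → Y a < Y b → Y b < Y c → ⊥) → Bounded P 2
    bounded-2 Y inj chain []           _ _ = z≤n
    bounded-2 Y inj chain (x ∷ [])     _ _ = s≤s z≤n
    bounded-2 Y inj chain (x ∷ y ∷ []) _ _ = s≤s (s≤s z≤n)
    bounded-2 {P} Y inj chain (x ∷ y ∷ z ∷ xs) ((x≢y ∷ x≢z ∷ _) ∷ (y≢z ∷ _) ∷ _) (px ∷ py ∷ pz ∷ _) =
      ⊥-elim (sorted (order x y px py x≢y) (order y z py pz y≢z) (order x z px pz x≢z))
      where
      order : ∀ a b → P a → P b → a ≢ b → Y a < Y b ⊎ Y b < Y a
      order a b pa pb a≢b with <-cmp (Y a) (Y b)
      ... | tri< lt _ _ = inj₁ lt
      ... | tri≈ _ eq _ = ⊥-elim (a≢b (inj a b pa pb eq))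
      ... | tri> _ _ gt = inj₂ gt
      sorted : Y x < Y y ⊎ Y y < Y x → Y y < Y z ⊎ Y z < Y y → Y x < Y z ⊎ Y z < Y x → ⊥
      sorted (inj₁ xy) (inj₁ yz) _         = chain x y z px py pz xy yz
      sorted (inj₁ xy) (inj₂ zy) (inj₁ xz) = chain x z y px pz py xz zy
      sorted (inj₁ xy) (inj₂ zy) (inj₂ zx) = chain z x y pz px py zx xy
      sorted (inj₂ yx) (inj₁ yz) (inj₁ xz) = chain y x z py px pz yx xz
      sorted (inj₂ yx) (inj₁ yz) (inj₂ zx) = chain y z x py pz px yz zx
      sorted (inj₂ yx) (inj₂ zy) _         = chain z y x pz py px zy yx

-- The count of solutions: gcd classes, roots, orbits.

module Classes where
  open Prelude
  import Data.Sum.Base as Sum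
  open import Data.Nat.Divisibility using (_∣_; divides; quotient; ∣⇒≤; m∣m*n; n∣m*n; ∣-trans)
  open import Data.Nat.DivMod using (m*n/n≡m)
  open import Data.Nat.GCD using (gcd; gcd[m,n]≡0⇒m≡0)
  open import Data.Nat.Coprimality using (Coprime; coprime-divisor)
  open import Data.Nat.Primality using (prime?)
  open import Data.List.Base using (List; _∷_; length; filter; upTo; map)
  open import Data.List.Properties using (length-map)
  open import Data.List.Relation.Unary.All as All using (All; _∷_)
  import Data.List.Relation.Unary.All.Properties as All
  open import Data.List.Membership.Propositional.Properties using (∈-filter⁺; ∈-upTo⁺)
  import Data.Integer.Divisibility.Signed as ℤ∣
  open import Relation.Nullary.Decidable using (_×-dec_)
  import Data.Nat.Divisibility as ℕ∣
  open Cast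
  open Arith using (*-^)
  open Units using (square-≤⁻¹)
  open PellPair using (lowestTerms)
  open Orbits
  open GcdClasses using (Reduced; module Reduced; reduce; congruent; coprime-square)
  open Counting
  open Roots using (SameTruth)

  pred-cancel : ∀ {a b} → 0 < a → 0 < b → pred a ≡ pred b → a ≡ b
  pred-cancel {suc a} {suc b} _ _ = cong suc

  pred-< : ∀ {n k} → 0 < n → n ≤ k → pred n < k
  pred-< {suc n} _ h = h

  squareRoot : ∀ n → ∃[ s ] s * s ≤ n × n < suc s * suc s
  squareRoot zero = 0 , z≤n , s≤s z≤n
  squareRoot (suc n) with squareRoot n
  ... | s , ss≤n , n<ss with m≤n⇒m<n∨m≡n n<ss
  ...   | inj₁ lt = s , ≤-trans ss≤n (n≤1+n n) , lt
  ...   | inj₂ eq = suc s , ≤-reflexive (sym eq) , subst (_< suc (suc s) * suc (suc s)) (sym eq) (*-mono-< (n<1+n (suc s)) (n<1+n (suc s)))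

  -- G is built as a least common multiple of all g with g² ∣ m. Its square still divides m, since
  -- coprime cofactors have coprime squares.
  squareDivisor : ∀ m → 0 < m → ∃[ G ] G * G ∣ m × (∀ g → g * g ∣ m → g ∣ G)
  squareDivisor m m>0 = weaken (upTo′ m)
    where
    lcm-square : ∀ {a b} → 0 < b → a * a ∣ m → b * b ∣ m → ∃[ L ] L * L ∣ m × a ∣ L × b ∣ L
    lcm-square {a} {b} b>0 aa∣m bb∣m with lowestTerms a b b>0
    ... | e , P , Q , refl , refl , P⊥Q = e * P * Q , subst (_∣ m) (square e P Q) ee·PPQQ∣m , m∣m*n Q , divides P (swap e P Q)
      where
      square : ∀ e P Q → e * P * (e * P) * (Q * Q) ≡ e * P * Q * (e * P * Q)
      square = solve-∀
      swap : ∀ e P Q → e * P * Q ≡ P * (e * Q)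
      swap = solve-∀
      e>0 : 0 < e
      e>0 = n≢0⇒n>0 λ { refl → <⇒≢ b>0 refl }
      u : ℕ
      u = quotient aa∣m
      m≡ : m ≡ e * e * (P * P * u)
      m≡ = trans (ℕ∣._∣_.equality aa∣m) (regroup u e P)
        where
        regroup : ∀ u e P → u * (e * P * (e * P)) ≡ e * e * (P * P * u)
        regroup = solve-∀
      QQ∣PPu : Q * Q ∣ P * P * u
      QQ∣PPu = ℕ∣.*-cancelˡ-∣ (e * e) {{>-nonZero (*-mono-≤ {1} {e} e>0 e>0)}} (subst₂ _∣_ (regroup e Q) m≡ bb∣m)
        where
        regroup : ∀ e Q → e * Q * (e * Q) ≡ e * e * (Q * Q)
        regroup = solve-∀
      QQ⊥PP : Coprime (Q * Q) (P * P)
      QQ⊥PP (d∣QQ , d∣PP) = coprime-square (λ (x , y) → coprime-square P⊥Q (y , x)) (d∣QQ , d∣PP)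
      ee·PPQQ∣m : e * P * (e * P) * (Q * Q) ∣ m
      ee·PPQQ∣m = subst (e * P * (e * P) * (Q * Q) ∣_) (sym (trans (ℕ∣._∣_.equality aa∣m) (*-comm u _)))
        (ℕ∣.*-monoʳ-∣ (e * P * (e * P)) (coprime-divisor QQ⊥PP QQ∣PPu))
    upTo′ : ∀ n → ∃[ G ] G * G ∣ m × (∀ g → 0 < g → g ≤ n → g * g ∣ m → g ∣ G)
    upTo′ zero = 1 , ℕ∣.1∣ m , λ g g>0 g≤0 _ → ⊥-elim (<⇒≱ g>0 g≤0)
    upTo′ (suc n) with upTo′ n | suc n * suc n ℕ∣.∣? m
    ... | G , GG∣m , all | no ¬h = G , GG∣m , λ g g>0 g≤ gg∣m →
      [ (λ g<  → all g g>0 (≤-pred g<) gg∣m) , (λ { refl → ⊥-elim (¬h gg∣m) }) ]′ (m≤n⇒m<n∨m≡n g≤)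
    ... | G , GG∣m , all | yes h with lcm-square {G} {suc n} (s≤s z≤n) GG∣m h
    ...   | L , LL∣m , G∣L , sn∣L = L , LL∣m , λ g g>0 g≤ gg∣m →
      [ (λ g<  → ∣-trans (all g g>0 (≤-pred g<) gg∣m) G∣L) , (λ { refl → sn∣L }) ]′ (m≤n⇒m<n∨m≡n g≤)
    weaken : ∃[ G ] G * G ∣ m × (∀ g → 0 < g → g ≤ m → g * g ∣ m → g ∣ G) → ∃[ G ] G * G ∣ m × (∀ g → g * g ∣ m → g ∣ G)
    weaken (G , GG∣m , all) = G , GG∣m , λ g gg∣m → all g (g>0 g gg∣m) (≤-trans (g≤gg g) (∣⇒≤ {{>-nonZero m>0}} gg∣m)) gg∣m
      where
      g≤gg : ∀ g → g ≤ g * g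
      g≤gg zero    = z≤n
      g≤gg (suc g) = m≤m*n (suc g) (suc g)
      g>0 : ∀ g → g * g ∣ m → 0 < g
      g>0 g gg∣m = n≢0⇒n>0 λ { refl → <⇒≢ m>0 (sym (ℕ∣.0∣⇒≡0 gg∣m)) }

  -- Kept abstract because unfolding b * m would be unary.
  abstract
    b : ℕ
    b = 2 ^ 11

    b≡2^11 : b ≡ 2 ^ 11
    b≡2^11 = refl

    b-expand : ∀ s → b * (4 * (s * s)) ≡ 2 * (64 * s * (64 * s))
    b-expand s = trans (sym (*-assoc b 4 (s * s))) (trans (cong (_* (s * s)) {b * 4} {2 * (64 * 64)} refl) (regroup 64 s))
      where
      regroup : ∀ u s → 2 * (u * u) * (s * s) ≡ 2 * (u * s * (u * s))
      regroup = solve-∀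

  module _ (D m : ℕ) (1<D : 1 < D) (m>0 : 0 < m) (D⊥m : Coprime D m) (T U : ℕ) (fundamental : IsFundamentalUnit D T U)
           (s q : ℕ) (ss≤m : s * s ≤ m) (m<ss : m < suc s * suc s) (qq≤s : q * q ≤ s) (s<qq : s < suc q * suc q) where

    Sol : ℕ × ℕ → Set
    Sol = Solution D m 1<D m>0

    Large : ℕ × ℕ → Set
    Large a = Sol a × 64 * s < proj₂ a

    s>0 : 0 < s
    s>0 = n≢0⇒n>0 λ s≡0 → <⇒≱ (subst (λ z → m < suc z * suc z) s≡0 m<ss) m>0

    q>0 : 0 < q
    q>0 = n≢0⇒n>0 λ q≡0 → <⇒≱ (subst (λ z → s < suc z * suc z) q≡0 s<qq) s>0

    Y-injective : ∀ a a′ → Sol a → Sol a′ → proj₂ a ≡ proj₂ a′ → a ≡ a′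
    Y-injective (X , Y) (X′ , .Y) (_ , _ , sol) (_ , _ , sol′) refl = cong (_, Y) (≤-antisym (square-≤⁻¹ (≤-reflexive XX≡)) (square-≤⁻¹ (≤-reflexive (sym XX≡))))
      where
      XX≡ : X * X ≡ X′ * X′
      XX≡ = +-cancelʳ-≡ m _ _ (trans sol (sym sol′))

    -- m ≤ 4s² and Y > 64s, so 2Y² ≥ 2·64²·s² = 2^11·4s²; this determines b.
    bm≤ : ∀ a → Large a → b * m ≤ 2 * (proj₂ a * proj₂ a)
    bm≤ (X , Y) (_ , Y>) = begin
      b * m                  ≤⟨ *-monoʳ-≤ b (≤-trans (<⇒≤ m<ss) (*-mono-≤ s+1≤ s+1≤)) ⟩
      b * (2 * s * (2 * s))  ≡⟨ cong (b *_) (regroup s) ⟩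
      b * (4 * (s * s))      ≡⟨ b-expand s ⟩
      2 * (64 * s * (64 * s)) ≤⟨ *-monoʳ-≤ 2 (*-mono-≤ (<⇒≤ Y>) (<⇒≤ Y>)) ⟩
      2 * (Y * Y)            ∎
      where
      open ≤-Reasoning
      s+1≤ : suc s ≤ 2 * s
      s+1≤ = ≤-trans (+-monoˡ-≤ s s>0) (≤-reflexive (cong (λ z → s + z) (sym (+-identityʳ s))))
      regroup : ∀ s → 2 * s * (2 * s) ≡ 4 * (s * s)
      regroup = solve-∀

    m≤YY : ∀ a → Large a → m ≤ proj₂ a * proj₂ a
    m≤YY a l = *-cancelˡ-≤ 2 (≤-trans (*-monoˡ-≤ m 2≤b) (bm≤ a l))
      where
      2≤b : 2 ≤ b
      2≤b = ≤-trans (^-monoʳ-≤ 2 {1} {11} (s≤s z≤n)) (≤-reflexive (sym b≡2^11))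

    -- m < (q + 1)⁴ ≤ 2^(4q) puts the left side below 2^(72 + 16q), and 72 + 16q ≤ 88q = 11·8q since
    -- q ≥ 1. This is where the exponent 8q comes from.
    threshold : (Thue.c * m) ^ 4 ≤ b ^ (8 * q)
    threshold = powers 18 11 Thue.c≡2^18 b≡2^11 exponent
      where
      open ≤-Reasoning
      exponent : (18 + 4 * q) * 4 ≤ 11 * (8 * q)
      exponent = begin
        (18 + 4 * q) * 4        ≡⟨ expand q ⟩
        72 * 1 + 16 * q         ≤⟨ +-monoˡ-≤ (16 * q) (*-monoʳ-≤ 72 q>0) ⟩
        72 * q + 16 * q         ≡⟨ collect q ⟩
        11 * (8 * q)            ∎
        where
        expand : ∀ q → (18 + 4 * q) * 4 ≡ 72 + 16 * q
        expand = solve-∀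
        collect : ∀ q → 72 * q + 16 * q ≡ 11 * (8 * q)
        collect = solve-∀
      m≤2^4q : m ≤ 2 ^ (4 * q)
      m≤2^4q = begin
        m                                               ≤⟨ <⇒≤ m<ss ⟩
        suc s * suc s                                   ≤⟨ *-mono-≤ s<qq s<qq ⟩
        suc q * suc q * (suc q * suc q)                 ≡⟨ fourth (suc q) ⟩
        suc q ^ 4                                       ≤⟨ ^-monoˡ-≤ 4 (Thue.n<2^n q) ⟩
        (2 ^ q) ^ 4                                     ≡⟨ ^-*-assoc 2 q 4 ⟩
        2 ^ (q * 4)                                     ≡⟨ cong (2 ^_) (*-comm q 4) ⟩
        2 ^ (4 * q)                                     ∎
        where
        fourth : ∀ x → x * x * (x * x) ≡ x * (x * (x * (x * 1)))
        fourth = solve-∀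
      -- The two constants enter as variables equal to powers of 2, so that only exponents are
      -- computed.
      powers : ∀ i j {c b} → c ≡ 2 ^ i → b ≡ 2 ^ j → (i + 4 * q) * 4 ≤ j * (8 * q) → (c * m) ^ 4 ≤ b ^ (8 * q)
      powers i j refl refl h = begin
        (2 ^ i * m) ^ 4                ≤⟨ ^-monoˡ-≤ 4 (*-monoʳ-≤ (2 ^ i) m≤2^4q) ⟩
        (2 ^ i * 2 ^ (4 * q)) ^ 4      ≡⟨ cong (_^ 4) (^-distribˡ-+-* 2 i (4 * q)) ⟨
        (2 ^ (i + 4 * q)) ^ 4          ≡⟨ ^-*-assoc 2 (i + 4 * q) 4 ⟩
        2 ^ ((i + 4 * q) * 4)          ≤⟨ ^-monoʳ-≤ 2 h ⟩
        2 ^ (j * (8 * q))              ≡⟨ ^-*-assoc 2 j (8 * q) ⟨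
        (2 ^ j) ^ (8 * q)              ∎

    -- Below b^(8q) growth by the factor b leaves at most 8q members, above it `noThree` leaves two,
    -- and 2 ≤ 2q.
    orbit-bounded : ∀ x z → Bounded (λ a → Large a × Orbit D x z a) (10 * q)
    orbit-bounded x z = bounded-mono size (bounded-map
      (λ a p → [ (λ lt → inj₁ (p , lt)) , (λ ge → inj₂ (p , ge)) ]′ (Sum.swap (≤-<-connex (b ^ (8 * q)) (proj₂ a))))
      (bounded-⊎ {Q = λ a → P a × b ^ (8 * q) ≤ proj₂ a}
        (bounded-geometric proj₂ b (λ a p → proj₁ (proj₂ (proj₁ (proj₁ p)))) inj grow (8 * q))
        (bounded-2 proj₂ (λ a a′ p p′ → inj a a′ (proj₁ p) (proj₁ p′)) noChain)))
      where
      P : ℕ × ℕ → Set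
      P a = Large a × Orbit D x z a
      size : 8 * q + 2 ≤ 10 * q
      size = ≤-trans (+-monoʳ-≤ (8 * q) (*-monoʳ-≤ 2 q>0)) (≤-reflexive (collect q))
        where
        collect : ∀ q → 8 * q + 2 * q ≡ 10 * q
        collect = solve-∀
      inj : ∀ a a′ → P a → P a′ → proj₂ a ≡ proj₂ a′ → a ≡ a′
      inj a a′ p p′ = Y-injective a a′ (proj₁ (proj₁ p)) (proj₁ (proj₁ p′))
      linked : ∀ a a′ → P a → P a′ → proj₂ a < proj₂ a′ → Linked D a a′
      linked a a′ p p′ lt = link D {x} {z} lt (proj₂ p) (proj₂ p′)
      grow : ∀ a a′ → P a → P a′ → proj₂ a < proj₂ a′ → b * proj₂ a ≤ proj₂ a′
      grow a a′ p p′ lt = geometricGap D m 1<D m>0 b {proj₁ a} {proj₂ a} {proj₁ a′} {proj₂ a′} (proj₁ (proj₁ p)) (bm≤ a (proj₁ p)) (m≤YY a (proj₁ p)) (linked a a′ p p′ lt)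
      noChain : ∀ a a′ a″ → P a × b ^ (8 * q) ≤ proj₂ a → P a′ × b ^ (8 * q) ≤ proj₂ a′ → P a″ × b ^ (8 * q) ≤ proj₂ a″ →
        proj₂ a < proj₂ a′ → proj₂ a′ < proj₂ a″ → ⊥
      noChain a a′ a″ (p , big) (p′ , _) (p″ , _) lt lt′ =
        noThree D m 1<D m>0 {proj₁ a} {proj₂ a} {proj₁ a′} {proj₂ a′} {proj₁ a″} {proj₂ a″} (proj₁ (proj₁ p)) (proj₁ (proj₁ p′)) (≤-trans threshold big) lt
          (linked a a′ p p′ lt) (linked a′ a″ p′ p″ lt′) (linked a a″ p p″ (<-trans lt lt′))

    -- One sign test for each prime of m and three tests for the power of 2, at a cost of 2^(3 + ω
    -- m).
    data Bit : Set where
      prime              : ℕ → Bit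
      twice diff total   : Bit

    bits : List Bit
    bits = twice ∷ diff ∷ total ∷ map prime (filter (λ p → prime? p ×-dec (p ℕ∣.∣? m)) (upTo (suc m)))

    length-bits : length bits ≡ 3 + ω m
    length-bits = cong (λ l → 3 + l) (length-map prime (filter (λ p → prime? p ×-dec (p ℕ∣.∣? m)) (upTo (suc m))))

    module _ (g M : ℕ) (g>0 : 0 < g) where

      Member : ℕ × ℕ → Set
      Member a = Large a × Reduced D m 1<D m>0 D⊥m g M a

      gg>0 : 0 < g * g
      gg>0 = *-mono-≤ {1} {g} g>0 g>0

      module Bits (a₀ : ℕ × ℕ) (r₀ : Reduced D m 1<D m>0 D⊥m g M a₀) (e N : ℕ) where
        open Reduced r₀ using () renaming (x to x₀; z to z₀; X≡ to X₀≡; YY≡ to YY₀≡; M⊥x to M⊥x₀; M⊥z to M⊥z₀; normEq to normEq₀)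

        -- Formed from X and Y² rather than from x and z: the latter belong to a witness, while a
        -- test must be a predicate of the solution alone. The price is a factor g².
        Δ Σ : ℕ × ℕ → ℤ
        Δ (X , Y) = + X ℤ.* + (proj₂ a₀ * proj₂ a₀) ℤ.- + proj₁ a₀ ℤ.* + (Y * Y)
        Σ (X , Y) = + X ℤ.* + (proj₂ a₀ * proj₂ a₀) ℤ.+ + proj₁ a₀ ℤ.* + (Y * Y)

        -- In terms of x = X/g and z = Y²/g, these are the divisibility conditions of Roots.sameRoot.
        Holds : Bit → ℕ × ℕ → Set
        Holds (prime p) a = + (g * g * p) ℤ∣.∣ Δ a
        Holds twice     a = + (g * g * 2 ^ e) ℤ∣.∣ + 2 ℤ.* Δ a
        Holds diff      a = + (g * g * 2 ^ e) ℤ∣.∣ Δ a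
        Holds total     a = + (g * g * 2 ^ e) ℤ∣.∣ Σ a

        holds? : ∀ i a → Dec (Holds i a)
        holds? (prime p) a = _ ℤ∣.∣? _
        holds? twice     a = _ ℤ∣.∣? _
        holds? diff      a = _ ℤ∣.∣? _
        holds? total     a = _ ℤ∣.∣? _

        scale : ∀ {n u v} → u ≡ + (g * g) ℤ.* v → (+ (g * g * n) ℤ∣.∣ u → + n ℤ∣.∣ v) × (+ n ℤ∣.∣ v → + (g * g * n) ℤ∣.∣ u)
        scale {n} {u} {v} refl =
          (λ h → ℤ∣.*-cancelˡ-∣ (+ (g * g)) {+ n} {v} {{>-nonZero gg>0}} (subst (ℤ∣._∣ u) (ℤ.pos-* (g * g) n) h)) ,
          (λ h → subst (ℤ∣._∣ u) (sym (ℤ.pos-* (g * g) n)) (ℤ∣.*-monoʳ-∣ (+ (g * g)) h))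

        sameTruth-scale : ∀ {n u v u′ v′} → u ≡ + (g * g) ℤ.* v → u′ ≡ + (g * g) ℤ.* v′ →
          SameTruth (+ (g * g * n) ℤ∣.∣ u) (+ (g * g * n) ℤ∣.∣ u′) → SameTruth (+ n ℤ∣.∣ v) (+ n ℤ∣.∣ v′)
        sameTruth-scale {n} {u} {v} {u′} {v′} p p′ = Sum.map
          (λ (h , h′) → proj₁ (scale {n} {u} {v} p) h , proj₁ (scale {n} {u′} {v′} p′) h′)
          (λ (h , h′) → (λ k → h (proj₂ (scale {n} {u} {v} p) k)) , (λ k → h′ (proj₂ (scale {n} {u′} {v′} p′) k)))

        sameTruth-trans : ∀ {P Q R : Set} → SameTruth P Q → SameTruth P R → SameTruth Q R
        sameTruth-trans (inj₁ (p , q))  (inj₁ (_ , r))   = inj₁ (q , r)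
        sameTruth-trans (inj₁ (p , _))  (inj₂ (¬p , _))  = ⊥-elim (¬p p)
        sameTruth-trans (inj₂ (¬p , _)) (inj₁ (p , _))   = ⊥-elim (¬p p)
        sameTruth-trans (inj₂ (_ , ¬q)) (inj₂ (_ , ¬r))  = inj₂ (¬q , ¬r)

        module _ (a : ℕ × ℕ) (r : Reduced D m 1<D m>0 D⊥m g M a) where
          open Reduced r using (x; z; X≡; YY≡; normEq)

          δ σ : ℤ
          δ = + x ℤ.* + z₀ ℤ.- + x₀ ℤ.* + z
          σ = + x ℤ.* + z₀ ℤ.+ + x₀ ℤ.* + z

          gxgz : ∀ {u v x z} → u ≡ g * x → v ≡ g * z → + u ℤ.* + v ≡ + (g * g) ℤ.* (+ x ℤ.* + z)
          gxgz {x = x} {z} refl refl = trans (cong₂ ℤ._*_ (ℤ.pos-* g x) (ℤ.pos-* g z)) (trans (swap (+ g) (+ x) (+ z)) (cong (ℤ._* (+ x ℤ.* + z)) (sym (ℤ.pos-* g g))))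
            where
            swap : ∀ g x z → g ℤ.* x ℤ.* (g ℤ.* z) ≡ g ℤ.* g ℤ.* (x ℤ.* z)
            swap = solveℤ-∀

          Δ≡ : Δ a ≡ + (g * g) ℤ.* δ
          Δ≡ = trans (cong₂ ℤ._-_ (gxgz X≡ YY₀≡) (gxgz X₀≡ YY≡)) (factor (+ (g * g)) (+ x ℤ.* + z₀) (+ x₀ ℤ.* + z))
            where
            factor : ∀ h u v → h ℤ.* u ℤ.- h ℤ.* v ≡ h ℤ.* (u ℤ.- v)
            factor = solveℤ-∀

          Σ≡ : Σ a ≡ + (g * g) ℤ.* σ
          Σ≡ = trans (cong₂ ℤ._+_ (gxgz X≡ YY₀≡) (gxgz X₀≡ YY≡)) (sym (ℤ.*-distribˡ-+ (+ (g * g)) (+ x ℤ.* + z₀) (+ x₀ ℤ.* + z)))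

          2Δ≡ : + 2 ℤ.* Δ a ≡ + (g * g) ℤ.* (+ 2 ℤ.* δ)
          2Δ≡ = trans (cong (+ 2 ℤ.*_) Δ≡) (swap (+ (g * g)) δ)
            where
            swap : ∀ h u → + 2 ℤ.* (h ℤ.* u) ≡ h ℤ.* (+ 2 ℤ.* u)
            swap = solveℤ-∀

          M∣δσ : + M ℤ∣.∣ δ ℤ.* σ
          M∣δσ = ℤ∣.divides (+ z ℤ.* + z ℤ.- + z₀ ℤ.* + z₀) (trans (identity (+ x) (+ z) (+ x₀) (+ z₀) (+ D) (+ M))
            (trans (cong₂ (λ u v → (u ℤ.- + D ℤ.* (+ z ℤ.* + z)) ℤ.* (+ z₀ ℤ.* + z₀) ℤ.- (v ℤ.- + D ℤ.* (+ z₀ ℤ.* + z₀)) ℤ.* (+ z ℤ.* + z) ℤ.+ (+ z ℤ.* + z ℤ.- + z₀ ℤ.* + z₀) ℤ.* + M)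
              (castEq (` x :* ` x :+ ` M) (` D :* (` z :* ` z)) normEq) (castEq (` x₀ :* ` x₀ :+ ` M) (` D :* (` z₀ :* ` z₀)) normEq₀))
            (collapse (+ D ℤ.* (+ z ℤ.* + z)) (+ D ℤ.* (+ z₀ ℤ.* + z₀)) (+ z₀ ℤ.* + z₀) (+ z ℤ.* + z) _)))
            where
            identity : ∀ x z x₀ z₀ D M → (x ℤ.* z₀ ℤ.- x₀ ℤ.* z) ℤ.* (x ℤ.* z₀ ℤ.+ x₀ ℤ.* z)
              ≡ (x ℤ.* x ℤ.+ M ℤ.- D ℤ.* (z ℤ.* z)) ℤ.* (z₀ ℤ.* z₀) ℤ.- (x₀ ℤ.* x₀ ℤ.+ M ℤ.- D ℤ.* (z₀ ℤ.* z₀)) ℤ.* (z ℤ.* z) ℤ.+ (z ℤ.* z ℤ.- z₀ ℤ.* z₀) ℤ.* M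
            identity = solveℤ-∀
            collapse : ∀ u v s t w → (u ℤ.- u) ℤ.* s ℤ.- (v ℤ.- v) ℤ.* t ℤ.+ w ≡ w
            collapse = solveℤ-∀

        cross-∣ : 0 < M → M ≡ 2 ^ e * N → ¬ 2 ∣ N → M ∣ m → ∀ a b (r : Reduced D m 1<D m>0 D⊥m g M a) (r′ : Reduced D m 1<D m>0 D⊥m g M b) →
          All (λ i → SameTruth (Holds i a) (Holds i b)) bits →
          + M ℤ∣.∣ + Reduced.x r ℤ.* + Reduced.z r′ ℤ.- + Reduced.x r′ ℤ.* + Reduced.z r
        cross-∣ M>0 M≡ odd M∣m a b r r′ (h₂ ∷ h₋ ∷ h₊ ∷ hs) =
          Roots.sameRoot M M>0 (+ x₀) (+ z₀) (+ Reduced.x r) (+ Reduced.z r) (+ Reduced.x r′) (+ Reduced.z r′)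
            M⊥x₀ M⊥z₀ (Reduced.M⊥x r) (Reduced.M⊥z r) (Reduced.M⊥x r′) (Reduced.M⊥z r′)
            e N M≡ odd (M∣δσ a r) (M∣δσ b r′)
            (λ p pp p∣M → sameTruth-scale {p} (Δ≡ a r) (Δ≡ b r′)
              (All.lookup (All.map⁻ hs) (∈-filter⁺ (λ p → prime? p ×-dec (p ℕ∣.∣? m)) (∈-upTo⁺ (s≤s (∣⇒≤ {{>-nonZero m>0}} (∣-trans p∣M M∣m)))) (pp , ∣-trans p∣M M∣m))))
            (sameTruth-scale {2 ^ e} (2Δ≡ a r) (2Δ≡ b r′) h₂)
            (sameTruth-scale {2 ^ e} (Δ≡ a r) (Δ≡ b r′) h₋)
            (sameTruth-scale {2 ^ e} (Σ≡ a r) (Σ≡ b r′) h₊)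

      -- With all tests fixed, the solution of least Y becomes the base point, and the others lie in
      -- two orbits of at most 10q members each.
      member-bounded : Bounded Member (2 ^ (3 + ω m) * (20 * q))
      member-bounded = bounded-inhabited λ a₀ (_ , r₀) → bounded-mono (≤-reflexive (cong (λ l → 2 ^ l * (20 * q)) length-bits)) (withBase a₀ r₀)
        where
        withBase : ∀ a₀ → Reduced D m 1<D m>0 D⊥m g M a₀ → Bounded Member (2 ^ length bits * (20 * q))
        withBase a₀ r₀ = bounded-bits Holds holds? bits λ a₁ _ → bounded-minimal proj₂ λ { a₂ ((l₂ , r₂) , agree₂) →
            bounded-mono (≤-reflexive (sym (*-distribʳ-+ q 10 10))) (bounded-map (classify a₁ a₂ l₂ r₂ agree₂)
              (bounded-⊎ (orbit-bounded (x₁ a₂) (z₁ a₂)) (orbit-bounded (x₂ a₂) (z₂ a₂)))) }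
          where
          M>0 : 0 < M
          M>0 = n≢0⇒n>0 λ M≡0 → <⇒≢ m>0 (sym (trans (Reduced.m≡ r₀) (trans (cong (g * g *_) M≡0) (*-zeroʳ (g * g)))))
          M∣m : M ∣ m
          M∣m = subst (M ∣_) (sym (Reduced.m≡ r₀)) (n∣m*n (g * g))
          parts : ∃[ e ] ∃[ N ] M ≡ 2 ^ e * N × ¬ 2 ∣ N
          parts = Roots.twoPart M M ≤-refl M>0
          open Bits a₀ r₀ (proj₁ parts) (proj₁ (proj₂ parts))
          x₁ z₁ x₂ z₂ : ℕ × ℕ → ℤ
          x₁ (X , Y) = + X
          z₁ (X , Y) = + (Y * Y)
          x₂ (X , Y) = + T ℤ.* + X ℤ.+ + D ℤ.* (+ U ℤ.* + (Y * Y))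
          z₂ (X , Y) = + U ℤ.* + X ℤ.+ + T ℤ.* + (Y * Y)
          classify : ∀ a₁ a₂ → Large a₂ → (r₂ : Reduced D m 1<D m>0 D⊥m g M a₂) → All (λ i → SameTruth (Holds i a₁) (Holds i a₂)) bits → ∀ a →
            (Member a × All (λ i → SameTruth (Holds i a₁) (Holds i a)) bits) × proj₂ a₂ ≤ proj₂ a →
            (Large a × Orbit D (x₁ a₂) (z₁ a₂) a) ⊎ (Large a × Orbit D (x₂ a₂) (z₂ a₂) a)
          classify a₁ a₂ l₂ r₂ agree₂ a (((l , r) , agree) , Y₂≤Y) = Sum.map (l ,_) (l ,_)
            (orbits D m 1<D m>0 T U fundamental {proj₁ a₂} {proj₂ a₂} {proj₁ a} {proj₂ a} (proj₁ l₂) (proj₁ l)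
              (congruent D m 1<D m>0 D⊥m {g} {M} {proj₁ a₂} {proj₂ a₂} {proj₁ a} {proj₂ a} (proj₁ l₂) (proj₁ l) r₂ r Y₂≤Y
                (cross-∣ M>0 (proj₁ (proj₂ (proj₂ parts))) (proj₂ (proj₂ (proj₂ parts))) M∣m a₂ a r₂ r
                  (All.zipWith (λ (h , h′) → sameTruth-trans h h′) (agree₂ , agree)))))

    gcdOf : ℕ × ℕ → ℕ
    gcdOf (X , Y) = gcd X (Y * Y)

    gcd>0 : ∀ a → Sol a → 0 < gcdOf a
    gcd>0 (X , Y) (X>0 , _) = n≢0⇒n>0 λ p → <⇒≢ X>0 (sym (gcd[m,n]≡0⇒m≡0 p))

    gcdClass : ℕ
    gcdClass = 2 ^ (3 + ω m) * (20 * q)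

    -- Equal gcds imply equal M, because m = g²·M.
    gcd-bounded : ∀ a → Large a → Bounded (λ a′ → Large a′ × gcdOf a′ ≡ gcdOf a) gcdClass
    gcd-bounded a (sol , _) = conclude (reduce D m 1<D m>0 D⊥m {proj₁ a} {proj₂ a} sol)
      where
      conclude : ∃[ M ] Reduced D m 1<D m>0 D⊥m (gcdOf a) M a → Bounded (λ a′ → Large a′ × gcdOf a′ ≡ gcdOf a) gcdClass
      conclude (M , r) = bounded-map (λ a′ (l′ , eq) → l′ , same a′ eq (reduce D m 1<D m>0 D⊥m {proj₁ a′} {proj₂ a′} (proj₁ l′)))
        (member-bounded (gcdOf a) M (gcd>0 a sol))
        where
        same : ∀ a′ → gcdOf a′ ≡ gcdOf a → ∃[ M′ ] Reduced D m 1<D m>0 D⊥m (gcdOf a′) M′ a′ → Reduced D m 1<D m>0 D⊥m (gcdOf a) M a′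
        same a′ eq (M′ , r′) = subst₂ (λ g n → Reduced D m 1<D m>0 D⊥m g n a′) eq
          (*-cancelˡ-≡ M′ M (gcdOf a * gcdOf a) {{>-nonZero (*-mono-≤ {1} {gcdOf a} (gcd>0 a sol) (gcd>0 a sol))}}
            (trans (cong (λ g → g * g * M′) (sym eq)) (trans (sym (Reduced.m≡ r′)) (Reduced.m≡ r)))) r′

    -- Either gcd X Y² or its codivisor in G is at most q.
    large-bounded : Bounded Large (q * gcdClass + q * gcdClass)
    large-bounded = withRoot (squareDivisor m m>0)
      where
      withRoot : ∃[ G ] G * G ∣ m × (∀ g → g * g ∣ m → g ∣ G) → Bounded Large (q * gcdClass + q * gcdClass)
      withRoot (G , GG∣m , all) = bounded-map (λ a l → Sum.map (l ,_) (l ,_) (classify a l))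
        (bounded-⊎ (bounded-labels small-label small-class q) (bounded-labels large-label large-class q))
        where
        small-label codivisor large-label : ℕ × ℕ → ℕ
        small-label a = pred (gcdOf a)
        -- `suc (pred _)` makes the divisor visibly nonzero; the gcd being positive, it is the gcd
        -- itself.
        codivisor a = G / suc (pred (gcdOf a))
        large-label a = pred (codivisor a)
        G≤s : G ≤ s
        G≤s = ≮⇒≥ λ s<G → <⇒≱ m<ss (≤-trans (*-mono-≤ s<G s<G) (∣⇒≤ {{>-nonZero m>0}} GG∣m))
        G>0 : 0 < G
        G>0 = n≢0⇒n>0 λ G≡0 → <⇒≢ m>0 (sym (ℕ∣.0∣⇒≡0 (subst (λ z → z * z ∣ m) G≡0 GG∣m)))
        gcd∣G : ∀ a → Large a → gcdOf a ∣ G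
        gcd∣G a (sol , _) = from (reduce D m 1<D m>0 D⊥m {proj₁ a} {proj₂ a} sol)
          where
          from : ∃[ M ] Reduced D m 1<D m>0 D⊥m (gcdOf a) M a → gcdOf a ∣ G
          from (M , r) = all (gcdOf a) (subst (gcdOf a * gcdOf a ∣_) (sym (Reduced.m≡ r)) (m∣m*n M))
        codivisor≡ : ∀ a → Large a → codivisor a * gcdOf a ≡ G
        codivisor≡ a l = go (gcdOf a) (gcd>0 a (proj₁ l)) (gcd∣G a l)
          where
          go : ∀ g → 0 < g → g ∣ G → G / suc (pred g) * g ≡ G
          go (suc g) _ (divides h refl) = cong (_* suc g) (m*n/n≡m h (suc g))
        codivisor>0 : ∀ a → Large a → 0 < codivisor a
        codivisor>0 a l = n≢0⇒n>0 λ p → <⇒≢ G>0 (trans (sym (cong (_* gcdOf a) p)) (codivisor≡ a l))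
        classify : ∀ a → Large a → small-label a < q ⊎ large-label a < q
        classify a l = [ (λ g≤q → inj₁ (pred-< (gcd>0 a (proj₁ l)) g≤q)) , (λ q<g → inj₂ (pred-< (codivisor>0 a l) (≮⇒≥ (λ q<h →
          <⇒≱ s<qq (≤-trans (*-mono-≤ q<h q<g) (≤-trans (≤-reflexive (codivisor≡ a l)) G≤s)))))) ]′ (≤-<-connex (gcdOf a) q)
        small-class : ∀ a → Large a → Bounded (λ a′ → Large a′ × small-label a′ ≡ small-label a) gcdClass
        small-class a l = bounded-map (λ a′ (l′ , eq) → l′ , pred-cancel (gcd>0 a′ (proj₁ l′)) (gcd>0 a (proj₁ l)) eq) (gcd-bounded a l)
        large-class : ∀ a → Large a → Bounded (λ a′ → Large a′ × large-label a′ ≡ large-label a) gcdClass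
        large-class a l = bounded-map (λ a′ (l′ , eq) → l′ , *-cancelˡ-≡ (gcdOf a′) (gcdOf a) (codivisor a) {{>-nonZero (codivisor>0 a l)}}
            (trans (cong (_* gcdOf a′) (sym (pred-cancel (codivisor>0 a′ l′) (codivisor>0 a l) eq))) (trans (codivisor≡ a′ l′) (sym (codivisor≡ a l)))))
          (gcd-bounded a l)

    -- Y determines X, so each value of Y up to 64s accounts for at most one solution.
    small-bounded : Bounded (λ a → Sol a × proj₂ a ≤ 64 * s) (64 * s)
    small-bounded = bounded-mono (≤-reflexive (*-identityʳ (64 * s))) (bounded-map
      (λ { a ((X>0 , Y>0 , sol) , Y≤) → (X>0 , Y>0 , sol) , pred-< Y>0 Y≤ })
      (bounded-labels (λ a → pred (proj₂ a)) (λ a sol → bounded-1 λ a′ a″ (sol′ , eq′) (sol″ , eq″) →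
        Y-injective a′ a″ sol′ sol″ (pred-cancel (proj₁ (proj₂ sol′)) (proj₁ (proj₂ sol″)) (trans eq′ (sym eq″)))) (64 * s)))

    solutions-bounded : Bounded Sol (384 * (2 ^ ω m * s))
    solutions-bounded = bounded-mono (total≤ (2 ^ ω m) (m^n>0 2 (ω m))) (bounded-map
      (λ a sol → Sum.map (sol ,_) (sol ,_) (≤-<-connex (proj₂ a) (64 * s)))
      (bounded-⊎ small-bounded large-bounded))
      where
      -- Here 384 = 64 + 320 arises: 64s small solutions, and 2q labels of the gcd times 8·2^ω·20q,
      -- that is 320·2^ω·q² with q² ≤ s.
      total≤ : ∀ w → 0 < w → 64 * s + (q * (2 * (2 * (2 * w)) * (20 * q)) + q * (2 * (2 * (2 * w)) * (20 * q))) ≤ 384 * (w * s)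
      total≤ w w>0 = begin
        64 * s + (q * (2 * (2 * (2 * w)) * (20 * q)) + q * (2 * (2 * (2 * w)) * (20 * q)))  ≡⟨ cong (λ z → 64 * s + z) (expand w q) ⟩
        64 * s + 320 * (w * (q * q))      ≤⟨ +-mono-≤ (*-monoʳ-≤ 64 (m≤n*m s w {{>-nonZero w>0}})) (*-monoʳ-≤ 320 (*-monoʳ-≤ w qq≤s)) ⟩
        64 * (w * s) + 320 * (w * s)      ≡⟨ *-distribʳ-+ (w * s) 64 320 ⟨
        384 * (w * s)                     ∎
        where
        open ≤-Reasoning
        expand : ∀ w q → q * (2 * (2 * (2 * w)) * (20 * q)) + q * (2 * (2 * (2 * w)) * (20 * q)) ≡ 320 * (w * (q * q))
        expand = solve-∀

-- From the count to the stated inequality.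

module Conclusion where
  open Prelude
  import Data.Sum.Base as Sum
  open import Data.Nat.Coprimality using (Coprime)
  open import Data.List.Base using (List; length)
  open import Data.List.Relation.Unary.All as All using (All)
  open import Data.List.Relation.Unary.Unique.Propositional using (Unique)
  open Cast
  open Arith using (*-^)
  open Orbits using (Solution)
  open Classes using (squareRoot; solutions-bounded)

  isSol⇒solution : ∀ {D n} (1<D : 1 < D) a → IsSol D -[1+ n ] a → Solution D (suc n) 1<D (s≤s z≤n) a
  isSol⇒solution {D} {n} 1<D (X , Y) (X>0 , Y>0 , eq) = X>0 , Y>0 ,
    uncastEq (` X :* ` X :+ ` (suc n)) (` D :* (` Y :* ` Y :* (` Y :* ` Y)))
      (trans (cong (λ k → + X ℤ.* + X ℤ.- k) (sym eq)) (identity (+ X) (+ D) (+ Y)))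
    where
    identity : ∀ X D Y → X ℤ.* X ℤ.- (X ℤ.* X ℤ.- D ℤ.* (Y ℤ.* (Y ℤ.* (Y ℤ.* (Y ℤ.* + 1))))) ≡ D ℤ.* (Y ℤ.* Y ℤ.* (Y ℤ.* Y))
    identity = solveℤ-∀

  -- The summand 3TU²D of the rational part of ε³ is already large enough.
  2D≤cubeA : ∀ D T U → 0 < T → 0 < U → 2 * D ≤ cubeA D T U
  2D≤cubeA D T U T>0 U>0 = begin
    2 * D                           ≤⟨ *-monoˡ-≤ D {2} {3} (s≤s (s≤s z≤n)) ⟩
    3 * D                           ≤⟨ *-monoˡ-≤ D (*-mono-≤ {3} {3 * T * U} {1} {U} (*-mono-≤ {3} {3 * T} {1} {U} (*-monoʳ-≤ 3 T>0) U>0) U>0) ⟩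
    3 * T * U * U * D               ≤⟨ m≤n+m (3 * T * U * U * D) (T * T * T) ⟩
    T * T * T + 3 * T * U * U * D   ∎
    where open ≤-Reasoning

  square-bound : ∀ c w v s m A d N → w * w ≡ v → s * s ≤ m → d ≤ A → N ≤ c * (w * s) → d * (N * N) ≤ c * c * v * m * A
  square-bound c w v s m A d N refl ss≤m d≤A N≤ = begin
    d * (N * N)                          ≤⟨ *-mono-≤ d≤A (*-mono-≤ N≤ N≤) ⟩
    A * (c * (w * s) * (c * (w * s)))    ≡⟨ regroup A c w s ⟩
    c * c * (w * w) * (s * s) * A        ≤⟨ *-monoˡ-≤ A (*-monoʳ-≤ (c * c * (w * w)) ss≤m) ⟩
    c * c * (w * w) * m * A              ∎
    where
    open ≤-Reasoning
    regroup : ∀ A c w s → A * (c * (w * s) * (c * (w * s))) ≡ c * c * (w * w) * (s * s) * A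
    regroup = solve-∀

  -- BoundHolds with its numerical constants replaced by variables, so that they are never unfolded.
  Bound : (D T U N c v m : ℕ) → Set
  Bound D T U N c v m = LeSqrt D (+ (2 * D * (N * N)) ℤ.- + (c * c * v * m * cubeA D T U)) (+ (c * c * v * m * cubeB D T U))

  -- The rational part A of ε³ alone gives 2D·N² ≤ C·A. The left side of `LeSqrt` is then at most 0
  -- and the right side at least 0, so its first alternative applies without any squaring.
  bound : ∀ D T U N c w v s m → 0 < T → 0 < U → w * w ≡ v → s * s ≤ m → N ≤ c * (w * s) → Bound D T U N c v m
  bound D T U N c w v s m T>0 U>0 ww≡v ss≤m N≤ =
    inj₁ (ℤ.i≤j⇒i-j≤0 (ℤ.+≤+ (square-bound c w v s m (cubeA D T U) (2 * D) N ww≡v ss≤m (2D≤cubeA D T U T>0 U>0) N≤)) , inj₁ (ℤ.+≤+ z≤n))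

  boundHolds : ∀ D k T U N → Bound D T U N 384 (4 ^ ωℤ k) (abs k) → BoundHolds D k T U N
  boundHolds D k T U N h = h

  boundForNegative : ∀ D n → 1 < D → Coprime D (suc n) → ∀ T U → IsFundamentalUnit D T U →
    ∀ sols → Unique sols → All (IsSol D -[1+ n ]) sols → BoundHolds D -[1+ n ] T U (length sols)
  boundForNegative D n 1<D D⊥m T U fundamental sols unique all = boundHolds D -[1+ n ] T U (length sols) (conclude (squareRoot (suc n)))
    where
    conclude : ∃[ s ] s * s ≤ suc n × suc n < suc s * suc s → Bound D T U (length sols) 384 (4 ^ ωℤ -[1+ n ]) (abs -[1+ n ])
    conclude (s , ss≤m , m<ss) = conclude′ (squareRoot s)
      where
      conclude′ : ∃[ q ] q * q ≤ s × s < suc q * suc q → Bound D T U (length sols) 384 (4 ^ ωℤ -[1+ n ]) (abs -[1+ n ])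
      conclude′ (q , qq≤s , s<qq) = bound D T U (length sols) 384 (2 ^ ωℤ -[1+ n ]) (4 ^ ωℤ -[1+ n ]) s (suc n)
        (proj₁ (proj₁ fundamental)) (proj₁ (proj₂ (proj₁ fundamental)))
        (sym (*-^ 2 2 (ωℤ -[1+ n ]))) ss≤m
        (solutions-bounded D (suc n) 1<D (s≤s z≤n) D⊥m T U fundamental s q ss≤m m<ss qq≤s s<qq
          sols unique (All.map (λ {a} → isSol⇒solution 1<D a) all))

open import Data.Nat using (ℕ; _<_)
open import Data.Nat.Coprimality using (Coprime)
open import Data.Integer using (ℤ; +_; ∣_∣) renaming (_<_ to _<ℤ_)
open import Data.List using (List; length)
open import Data.List.Relation.Unary.All using (All)
open import Data.List.Relation.Unary.Unique.Propositional using (Unique)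
open import Data.Product using (_×_)

theorem1p1 : (D : ℕ) → 1 < D → SquareFree D →
    (k : ℤ) → k <ℤ + 0 → Coprime D ∣ k ∣ →
    (T U : ℕ) → IsFundamentalUnit D T U →
    (sols : List (ℕ × ℕ)) → Unique sols → All (IsSol D k) sols →
    BoundHolds D k T U (length sols)
theorem1p1 D 1<D _ (+ n) (ℤ.+<+ ())
theorem1p1 D 1<D _ ℤ.-[1+ n ] _ D⊥k T U fundamental sols unique all = boundForNegative D n 1<D D⊥k T U fundamental sols unique all
  where open Conclusion using (boundForNegative)
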